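{- Let $(\vartheta_0,D)$ be one of the pairs $(0.729,2)$, $(0.616,6)$, $(0.554,8)$, $(0.515,12)$, and suppose some $\vartheta>\vartheta_0$ satisfies both conditions (A) and (B) below. Then there exists a positive even integer $d\le D+2$ such that $\lambda(p+d)=-1$ for infinitely many primes $p$.
   Context: $\Omega(n)$ is the number of prime factors of $n$ counted with multiplicity and $\lambda(n)=(-1)^{\Omega(n)}$. Condition (A): for every $\varepsilon>0$, $A>0$, $\sum_{q\le N^{\vartheta-\varepsilon}}\max_{a:(a,q)=1}\bigl|\sum_{p\le N,\,p\equiv a\ (\mathrm{mod}\ q)}\log p-\frac{N}{\varphi(q)}\bigr|\ll_{\varepsilon,A}\frac{N}{(\log N)^A}$ ($p$ over primes). Condition (B): for every $\varepsilon>0$, $A>0$, $\sum_{q\le N^{\vartheta-\varepsilon}}\max_{y\le N}\max_a\bigl|\sum_{n\le y,\,n\equiv a\ (\mathrm{mod}\ q)}\lambda(n)\bigr|\ll_{\varepsilon,A}\frac{N}{(\log N)^A}$. -}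

module Defs where

open import Algebra.Definitions.RawSemiring using () renaming (_^_ to pow)
open import Axiom.ExcludedMiddle using (ExcludedMiddle)
open import Data.Integer.Base as ℤ using (ℤ; +_; -1ℤ; 0ℤ)
open import Data.List.Base using (List; []; _∷_; map; foldr; filter; upTo; length)
open import Data.Nat.Base as ℕ using (ℕ; zero; suc; _!)
open import Data.Nat.Divisibility using (_∣_; _∣?_)
open import Data.Nat.GCD using (gcd)
open import Data.Nat.Primality using (prime?)
open import Data.Nat.Primality.Factorisation using (factorise; factors)
import Data.Nat.Properties as ℕ
open import Data.Product.Base using (_×_; _,_; ∃-syntax)
open import Data.Rational.Base as ℚ using (ℚ; 0ℚ; 1ℚ)
import Data.Rational.Properties as ℚ
open import Level using (0ℓ)
open import Relation.Binary.PropositionalEquality.Core using (cong)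
open import Relation.Nullary.Decidable using (Dec; yes; no; _×-dec_)

-- The value at 0 is never used.
Ω : ℕ → ℕ
Ω zero        = 0
Ω n@(suc _)   = length (factors (factorise n))

λ′ : ℕ → ℤ
λ′ n = -1ℤ ℤ.^ Ω n

φ : ℕ → ℕ
φ q = length (filter (λ a → gcd a q ℕ.≟ 1) (upTo q))

infix 4 _≡_[mod_] _≡?_[mod_]

_≡_[mod_] : ℕ → ℕ → ℕ → Set
m ≡ n [mod q ] = q ∣ ℕ.∣ m - n ∣

_≡?_[mod_] : ∀ m n q → Dec (m ≡ n [mod q ])
m ≡? n [mod q ] = q ∣? ℕ.∣ m - n ∣

[1⋯_] : ℕ → List ℕ
[1⋯ n ] = map suc (upTo n)

sumℤ : List ℤ → ℤ
sumℤ = foldr ℤ._+_ 0ℤ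

maxℕ : List ℕ → ℕ
maxℕ = foldr ℕ._⊔_ 0

_^ℚ_ : ℚ → ℕ → ℚ
_^ℚ_ = pow ℚ.+-*-rawSemiring

ℕ→ℚ : ℕ → ℚ
ℕ→ℚ n = + n ℚ./ 1

-- Total inverse, with invℚ 0 = 0.
invℚ : ℚ → ℚ
invℚ p with p ℚ.≟ 0ℚ
... | yes _   = 0ℚ
... | no  p≢0 = ℚ.1/_ p {{ℚ.≢-nonZero p≢0}}

sumℚ : List ℚ → ℚ
sumℚ = foldr ℚ._+_ 0ℚ

-- ∑_{k ≤ n} x^k / k!
expPartial : ℕ → ℚ → ℚ
expPartial n x = sumℚ (map (λ k → (x ^ℚ k) ℚ.* invℚ (ℕ→ℚ (k !))) (upTo (suc n)))

-- 2 ∑_{k ≤ n} z^(2k+1) / (2k+1)  with  z = (x - 1) / (x + 1);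
-- these converge to log x, locally uniformly in x > 0.
logPartial : ℕ → ℚ → ℚ
logPartial n x =
  ℕ→ℚ 2 ℚ.* sumℚ (map (λ k → (z ^ℚ odd k) ℚ.* invℚ (ℕ→ℚ (odd k))) (upTo (suc n)))
  where
  z : ℚ
  z = (x ℚ.- 1ℚ) ℚ.* invℚ (x ℚ.+ 1ℚ)
  odd : ℕ → ℕ
  odd k = suc (2 ℕ.* k)

IsCauchy : (ℕ → ℚ) → Set
IsCauchy s = ∀ (ε : ℚ) → 0ℚ ℚ.< ε →
  ∃[ k ] (∀ m n → k ℕ.≤ m → k ℕ.≤ n → ℚ.∣ s m ℚ.- s n ∣ ℚ.≤ ε)

record ℝ : Set where
  constructor mkℝ
  field
    seq    : ℕ → ℚ
    cauchy : IsCauchy seq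

open ℝ public

-- Distinct sequences may represent the same real number; order is the order
-- of the represented numbers, so x and y are equal reals iff x ≤ℝ y and y ≤ℝ x.

infix 4 _≤ℝ_ _<ℝ_

_≤ℝ_ : ℝ → ℝ → Set
x ≤ℝ y = ∀ (ε : ℚ) → 0ℚ ℚ.< ε →
  ∃[ k ] (∀ n → k ℕ.≤ n → seq x n ℚ.≤ seq y n ℚ.+ ε)

_<ℝ_ : ℝ → ℝ → Set
x <ℝ y = ∃[ ε ] (0ℚ ℚ.< ε ×
  ∃[ k ] (∀ n → k ℕ.≤ n → seq x n ℚ.+ ε ℚ.≤ seq y n))

ℚ→ℝ : ℚ → ℝ
ℚ→ℝ p = mkℝ (λ _ → p) λ ε 0<ε → 0 , λ _ _ _ _ →
  ℚ.≤-trans (ℚ.≤-reflexive (cong ℚ.∣_∣ (ℚ.+-inverseʳ p))) (ℚ.<⇒≤ 0<ε)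

ℕ→ℝ : ℕ → ℝ
ℕ→ℝ n = ℚ→ℝ (ℕ→ℚ n)

0ℝ : ℝ
0ℝ = ℚ→ℝ 0ℚ

IsFloor : ℝ → ℕ → Set
IsFloor x n = (ℕ→ℝ n ≤ℝ x) × (x <ℝ ℕ→ℝ (suc n))

module Classical (em : ExcludedMiddle 0ℓ) where

  -- The real number represented by a sequence of rationals if that sequence is
  -- Cauchy, and 0 otherwise.  Below, the sequences for _+ℝ_, _-ℝ_, _*ℝ_, ∣_∣ℝ,
  -- _⊔ℝ_ and exp are always Cauchy, the one for x /ℝ y is Cauchy when y ≠ 0,
  -- and the one for log x is Cauchy when x > 0.
  limit : (ℕ → ℚ) → ℝ
  limit s with em {IsCauchy s}
  ... | yes c = mkℝ s c
  ... | no  _ = 0ℝ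

  infixl 6 _+ℝ_ _-ℝ_ _⊔ℝ_
  infixl 7 _*ℝ_ _/ℝ_
  infixr 9 _^ℝ_

  _+ℝ_ _-ℝ_ _*ℝ_ _/ℝ_ _⊔ℝ_ : ℝ → ℝ → ℝ
  x +ℝ y = limit (λ n → seq x n ℚ.+ seq y n)
  x -ℝ y = limit (λ n → seq x n ℚ.- seq y n)
  x *ℝ y = limit (λ n → seq x n ℚ.* seq y n)
  x /ℝ y = limit (λ n → seq x n ℚ.* invℚ (seq y n))
  x ⊔ℝ y = limit (λ n → seq x n ℚ.⊔ seq y n)

  ∣_∣ℝ exp log : ℝ → ℝ
  ∣ x ∣ℝ = limit (λ n → ℚ.∣ seq x n ∣)
  exp x  = limit (λ n → expPartial n (seq x n))
  log x  = limit (λ n → logPartial n (seq x n))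

  _^ℝ_ : ℝ → ℝ → ℝ
  x ^ℝ a = exp (a *ℝ log x)

  -- maxℝ is only applied to lists of non-negative numbers.
  sumℝ maxℝ : List ℝ → ℝ
  sumℝ = foldr _+ℝ_ 0ℝ
  maxℝ = foldr _⊔ℝ_ 0ℝ

  -- ∑_{p ≤ N, p ≡ a (mod q)} log p
  ϑ-sum : (N q a : ℕ) → ℝ
  ϑ-sum N q a =
    sumℝ (map (λ p → log (ℕ→ℝ p))
      (filter (λ p → prime? p ×-dec (p ≡? a [mod q ])) [1⋯ N ]))

  errorA : (N q : ℕ) → ℝ
  errorA N q =
    maxℝ (map (λ a → ∣ ϑ-sum N q a -ℝ ℕ→ℝ N /ℝ ℕ→ℝ (φ q) ∣ℝ)
      (filter (λ a → gcd a q ℕ.≟ 1) (upTo q)))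

  -- ∑_{n ≤ y, n ≡ a (mod q)} λ(n)
  λ-sum : (y q a : ℕ) → ℤ
  λ-sum y q a = sumℤ (map λ′ (filter (λ n → n ≡? a [mod q ]) [1⋯ y ]))

  errorB : (N q : ℕ) → ℝ
  errorB N q = ℕ→ℝ
    (maxℕ (map (λ y → maxℕ (map (λ a → ℤ.∣ λ-sum y q a ∣) (upTo q))) [1⋯ N ]))

  -- For every ε, A > 0:  ∑_{q ≤ N^(ϑ-ε)} E N q  ≪_{ε,A}  N / (log N)^A.
  HasLevel : (E : ℕ → ℕ → ℝ) → ℝ → Set
  HasLevel E ϑ = ∀ (ε A : ℝ) → 0ℝ <ℝ ε → 0ℝ <ℝ A →
    ∃[ C ] (∀ (N Q : ℕ) → 2 ℕ.≤ N → IsFloor (ℕ→ℝ N ^ℝ (ϑ -ℝ ε)) Q →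
      sumℝ (map (E N) [1⋯ Q ]) ≤ℝ C *ℝ (ℕ→ℝ N /ℝ (log (ℕ→ℝ N) ^ℝ A)))

  ConditionA ConditionB : ℝ → Set
  ConditionA = HasLevel errorA
  ConditionB = HasLevel errorB

admissiblePairs : List (ℚ × ℕ)
admissiblePairs =
    (+ 729 ℚ./ 1000 , 2)
  ∷ (+ 616 ℚ./ 1000 , 6)
  ∷ (+ 554 ℚ./ 1000 , 8)
  ∷ (+ 515 ℚ./ 1000 , 12)
  ∷ []

InfinitelyMany : (ℕ → Set) → Set
InfinitelyMany P = ∀ m → ∃[ n ] (m ℕ.< n × P n)

{-# OPTIONS --safe #-}

-- Suppose that λ(p + d) = 1 for all even 0 < d ≤ D + 2 and all large primes p.  Let hs be the admissible
-- tuple formed by the first k of 0, 2, 6, 8, 12, whose largest element is D.  Then for large n at most one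
-- n + h with h in hs is prime, since a prime p has λ(p) = -1, and if one is, then λ(n + D + 2) = 1.  Hence
--
--   2 ∑_h 1_prime(n + h) log (n + h) ≤ (1 + λ(n + D + 2)) log N.
--
-- Sum this over n ≤ N in a residue class modulo W, where W is divisible by all small primes, against the
-- square of a Selberg sieve weight of level R.  Condition (A) evaluates the left side, and by (B) the values
-- of λ contribute nothing, provided that W R² ≤ N^ϑ₀.  The diagonalised quadratic forms become iterated
-- sums of a step function over powers of T, where R = T^J and N = T^b, and for suitable steps the resulting
-- inequality between integers is false by a finite computation.
--
-- Throughout, the harmonic number H N plays the role of log N, W is fixed (the loss is a factor close to 1),
-- and the weight Y of the sieve is the one after diagonalisation.

module Submission where

open import Axiom.ExcludedMiddle using (ExcludedMiddle)
open import Data.Bool.Base as Bool using (true; if_then_else_)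
open import Data.Empty using (⊥; ⊥-elim)
open import Data.Integer.Base as ℤ using (ℤ; -[1+_]; 1ℤ; -1ℤ)
import Data.Integer.Properties as ℤ
open import Data.List.Base using (List; []; _∷_; length; map; filter; _++_; upTo; applyUpTo; drop)
open import Data.List.Membership.Propositional using (_∈_; find)
open import Data.List.Membership.Propositional.Properties using (∈-filter⁺; ∈-filter⁻; ∈-map⁺; ∈-map⁻; ∈-upTo⁺)
import Data.List.Properties as List
open import Data.List.Relation.Binary.Permutation.Propositional.Properties using (↭-length)
open import Data.List.Relation.Binary.Sublist.Propositional using (_⊆_; []; _∷_; _∷ʳ_)
open import Data.List.Relation.Binary.Sublist.Propositional.Properties using (All-resp-⊆)
open import Data.List.Relation.Unary.All as All using (All; []; _∷_)
import Data.List.Relation.Unary.All.Properties as All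
open import Data.List.Relation.Unary.AllPairs using ([]; _∷_)
open import Data.List.Relation.Unary.Any as Any using (Any; here; there; any?)
open import Data.List.Relation.Unary.Unique.Propositional using (Unique)
import Data.List.Relation.Unary.Unique.Propositional.Properties as Unique
open import Data.Nat.Base as ℕ using (ℕ; zero; suc; _+_; _*_; _≤_; _<_; _!; z≤n; s≤s)
open import Data.Nat.Coprimality as Coprimality using (Coprime; coprime-Bézout; coprime-divisor; gcd≡1⇒coprime; coprime⇒gcd≡1)
open import Data.Nat.Divisibility
open import Data.Nat.DivMod using (_/_; _%_; m≡m%n+[m/n]*n; m%n<n)
open import Data.Nat.GCD using (gcd; module Bézout)
open import Data.Nat.ListAction using (product)
open import Data.Nat.Primality using (Prime; prime?; euclidsLemma; prime⇒irreducible; ¬prime[1]; ¬prime[0])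
open import Data.Nat.Primality.Factorisation using (factorise; factorisationUnique; primeFactorisation[p])
import Data.Nat.Properties as ℕ
open import Data.Nat.Solver using () renaming (module +-*-Solver to ℕ-Solver)
open import Data.Product.Base using (_×_; _,_; ∃-syntax; proj₁; proj₂)
open import Data.Rational.Base as ℚ using (ℚ; 0ℚ; 1ℚ) renaming (_+_ to _⊕_; _*_ to _⊗_; _-_ to _⊖_; -_ to ⊝_; _≤_ to _⩽_; _<_ to _≺_; ∣_∣ to ∥_∥)
import Data.Rational.Properties as ℚ
open import Data.Rational.Solver using (module +-*-Solver)
import Data.Rational.Unnormalised.Base as ℚᵘ
import Data.Rational.Unnormalised.Properties as ℚᵘ
open import Data.Sum.Base as Sum using (_⊎_; inj₁; inj₂)
open import Data.Unit.Base using (⊤; tt)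
open import Level using (0ℓ)
open import Relation.Binary.PropositionalEquality using (_≡_; _≢_; refl; sym; trans; cong; cong₂; subst; module ≡-Reasoning)
open import Relation.Nullary.Decidable using (Dec; yes; no; does; _×-dec_; ¬?; True; toWitness)
open import Relation.Nullary.Negation using (¬_)
open import Data.List.Relation.Unary.Unique.DecPropositional ℕ._≟_ using (unique?)
open import Defs

open +-*-Solver using (solve; _:+_; _:*_; _:-_; :-_; _:=_; con)
open ℕ-Solver using () renaming (solve to solveℕ; _:+_ to _⟨+⟩_; _:*_ to _⟨*⟩_; _:=_ to _⟨=⟩_; con to conℕ)

-- Rational numbers

-- The sieve weight is the square of `𝕊 (χ h (e n)) ps Y`, where `e n p` indicates that p divides
-- some n + h and `χ` is h p - (1 + h p) e n p. If the `e n p` were independent with density k/p,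
-- each `χ` would have mean 0 and variance h p = k/(p - k), so the form is diagonal in Y. When n +
-- hᵢ is required to be prime, the density is (k - 1)/(p - 1), the mean becomes 1/(p - 1), and the
-- form is only bounded below, by completing squares one prime at a time. The true moments deviate
-- from the independent ones by the errors of (A) and (B), with weights exponential in the number of
-- primes; an average over moduli cannot absorb these alone, so it is traded against a trivial bound
-- in `𝕃-split`. Reals are Cauchy sequences, so the sieve runs on rational data taken at one large
-- index, where the logarithm of N is a partial sum between H N - 2 and H N. Of the available level
-- N^ϑ₀, one factor T pays for W and a second for the gap between H and the logarithm; hence b ϑ₀ =
-- 2 + 2 J.

⩽-refl : ∀ {x} → x ⩽ x
⩽-refl = ℚ.≤-refl

⩽-trans : ∀ {x y z} → x ⩽ y → y ⩽ z → x ⩽ z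
⩽-trans = ℚ.≤-trans

≡⇒⩽ : ∀ {x y} → x ≡ y → x ⩽ y
≡⇒⩽ = ℚ.≤-reflexive

⊕-mono : ∀ {a b c d} → a ⩽ b → c ⩽ d → a ⊕ c ⩽ b ⊕ d
⊕-mono = ℚ.+-mono-≤

⊕-monoʳ : ∀ {a b} c → a ⩽ b → c ⊕ a ⩽ c ⊕ b
⊕-monoʳ c = ℚ.+-monoʳ-≤ c

⊕-monoˡ : ∀ {a b} c → a ⩽ b → a ⊕ c ⩽ b ⊕ c
⊕-monoˡ c = ℚ.+-monoˡ-≤ c

⊗-monoˡ : ∀ {a b} c → 0ℚ ⩽ c → a ⩽ b → c ⊗ a ⩽ c ⊗ b
⊗-monoˡ c 0≤c = ℚ.*-monoˡ-≤-nonNeg c {{ℚ.nonNegative 0≤c}}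

⊗-monoʳ : ∀ {a b} c → 0ℚ ⩽ c → a ⩽ b → a ⊗ c ⩽ b ⊗ c
⊗-monoʳ c 0≤c = ℚ.*-monoʳ-≤-nonNeg c {{ℚ.nonNegative 0≤c}}

⊗-mono : ∀ {a b c d} → 0ℚ ⩽ a → a ⩽ b → 0ℚ ⩽ c → c ⩽ d → a ⊗ c ⩽ b ⊗ d
⊗-mono {a} {b} {c} 0≤a a≤b 0≤c c≤d =
  ⩽-trans (⊗-monoʳ c 0≤c a≤b) (⊗-monoˡ b (⩽-trans 0≤a a≤b) c≤d)

⊗-nonneg : ∀ {a b} → 0ℚ ⩽ a → 0ℚ ⩽ b → 0ℚ ⩽ a ⊗ b
⊗-nonneg {a} {b} 0≤a 0≤b =
  subst (_⩽ a ⊗ b) (ℚ.*-zeroʳ a) (⊗-monoˡ a 0≤a 0≤b)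

⊕-nonneg : ∀ {a b} → 0ℚ ⩽ a → 0ℚ ⩽ b → 0ℚ ⩽ a ⊕ b
⊕-nonneg {a} {b} 0≤a 0≤b = subst (_⩽ a ⊕ b) (ℚ.+-identityˡ 0ℚ) (⊕-mono 0≤a 0≤b)

⊗-pos : ∀ {a b} → 0ℚ ≺ a → 0ℚ ≺ b → 0ℚ ≺ a ⊗ b
⊗-pos {a} {b} 0<a 0<b =
  subst (_≺ a ⊗ b) (ℚ.*-zeroʳ a) (ℚ.*-monoʳ-<-pos a {{ℚ.positive 0<a}} 0<b)

≺⇒⩽ : ∀ {x y} → x ≺ y → x ⩽ y
≺⇒⩽ = ℚ.<⇒≤

≺⇒⋡ : ∀ {x y} → x ≺ y → y ⩽ x → ⊥
≺⇒⋡ x<y y≤x = ℚ.<-irrefl refl (ℚ.<-≤-trans x<y y≤x)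

0≤1 : 0ℚ ⩽ 1ℚ
0≤1 = ℚ.*≤* (ℤ.+≤+ z≤n)

0<1 : 0ℚ ≺ 1ℚ
0<1 = ℚ.*<* (ℤ.+<+ (s≤s z≤n))

⊕-identityˡ : ∀ x → 0ℚ ⊕ x ≡ x
⊕-identityˡ = ℚ.+-identityˡ

⊕-identityʳ : ∀ x → x ⊕ 0ℚ ≡ x
⊕-identityʳ = ℚ.+-identityʳ

0≤y-x⇒x≤y : ∀ {x y} → 0ℚ ⩽ y ⊖ x → x ⩽ y
0≤y-x⇒x≤y {x} {y} p =
  subst₂⩽ (⊕-identityʳ x) (solve 2 (λ x y → x :+ (y :- x) := y) refl x y) (⊕-mono (⩽-refl {x}) p)
  where
  subst₂⩽ : ∀ {a b c d} → a ≡ b → c ≡ d → a ⩽ c → b ⩽ d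
  subst₂⩽ refl refl p = p

x≤y⇒0≤y-x : ∀ {x y} → x ⩽ y → 0ℚ ⩽ y ⊖ x
x≤y⇒0≤y-x {x} {y} p = ⩽-trans (≡⇒⩽ (sym (ℚ.+-inverseʳ x))) (⊕-mono p (⩽-refl {⊝ x}))

by-excess : ∀ {x y} e → 0ℚ ⩽ e → x ⊕ e ≡ y → x ⩽ y
by-excess {x} e 0≤e refl = ⩽-trans (≡⇒⩽ (sym (⊕-identityʳ x))) (⊕-mono (⩽-refl {x}) 0≤e)

≤⊕ʳ : ∀ {x y} → 0ℚ ⩽ y → x ⩽ x ⊕ y
≤⊕ʳ {x} {y} 0≤y = by-excess y 0≤y refl

≤⊕ˡ : ∀ {x y} → 0ℚ ⩽ x → y ⩽ x ⊕ y
≤⊕ˡ {x} {y} 0≤x = by-excess x 0≤x (ℚ.+-comm y x)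

square-nonneg : ∀ x → 0ℚ ⩽ x ⊗ x
square-nonneg x with ℚ.≤-total 0ℚ x
... | inj₁ p = ⊗-nonneg p p
... | inj₂ p = ⩽-trans (⊗-nonneg q q) (≡⇒⩽ (solve 1 (λ x → (:- x) :* (:- x) := x :* x) refl x))
  where
  q : 0ℚ ⩽ ⊝ x
  q = ℚ.neg-antimono-≤ p

^ℚ-nonneg : ∀ {x} → 0ℚ ⩽ x → ∀ n → 0ℚ ⩽ x ^ℚ n
^ℚ-nonneg 0≤x zero    = 0≤1
^ℚ-nonneg 0≤x (suc n) = ⊗-nonneg 0≤x (^ℚ-nonneg 0≤x n)

∥∥-nonneg : ∀ x → 0ℚ ⩽ ∥ x ∥
∥∥-nonneg = ℚ.0≤∣p∣

∥∥-intro : ∀ {x y} → x ⩽ y → ⊝ x ⩽ y → ∥ x ∥ ⩽ y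
∥∥-intro {x} p q with ℚ.∣p∣≡p∨∣p∣≡-p x
... | inj₁ e = ⩽-trans (≡⇒⩽ e) p
... | inj₂ e = ⩽-trans (≡⇒⩽ e) q

x≤∥x∥ : ∀ x → x ⩽ ∥ x ∥
x≤∥x∥ x with ℚ.≤-total 0ℚ x
... | inj₁ p = ≡⇒⩽ (sym (ℚ.0≤p⇒∣p∣≡p p))
... | inj₂ p = ⩽-trans p (∥∥-nonneg x)

-x≤∥x∥ : ∀ x → ⊝ x ⩽ ∥ x ∥
-x≤∥x∥ x = ⩽-trans (x≤∥x∥ (⊝ x)) (≡⇒⩽ (ℚ.∣-p∣≡∣p∣ x))

∥∥-⊕ : ∀ x y → ∥ x ⊕ y ∥ ⩽ ∥ x ∥ ⊕ ∥ y ∥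
∥∥-⊕ = ℚ.∣p+q∣≤∣p∣+∣q∣

∥∥-⊗ : ∀ x y → ∥ x ⊗ y ∥ ≡ ∥ x ∥ ⊗ ∥ y ∥
∥∥-⊗ = ℚ.∣p*q∣≡∣p∣*∣q∣

⊗-cancelˡ : ∀ {a b} c → 0ℚ ≺ c → c ⊗ a ⩽ c ⊗ b → a ⩽ b
⊗-cancelˡ c 0<c = ℚ.*-cancelˡ-≤-pos c {{ℚ.positive 0<c}}

invℚ-inverseʳ : ∀ {x} → 0ℚ ≺ x → x ⊗ invℚ x ≡ 1ℚ
invℚ-inverseʳ {x} 0<x with x ℚ.≟ 0ℚ
... | yes x≡0 = ⊥-elim (ℚ.<-irrefl (sym x≡0) 0<x)
... | no  x≢0 = ℚ.*-inverseʳ x {{ℚ.≢-nonZero x≢0}}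

invℚ-pos : ∀ {x} → 0ℚ ≺ x → 0ℚ ≺ invℚ x
invℚ-pos {x} 0<x = ℚ.≰⇒> λ p → ℚ.<⇒≢ 0<1
  (ℚ.≤-antisym 0≤1
    (⩽-trans (≡⇒⩽ (sym (invℚ-inverseʳ 0<x)))
      (⩽-trans (⊗-monoˡ x (≺⇒⩽ 0<x) p) (≡⇒⩽ (ℚ.*-zeroʳ x)))))

invℚ-nonneg : ∀ {x} → 0ℚ ⩽ x → 0ℚ ⩽ invℚ x
invℚ-nonneg {x} 0≤x with x ℚ.≟ 0ℚ in eq
... | yes x≡0 = ⩽-refl
... | no  x≢0 = subst (0ℚ ⩽_) lem (≺⇒⩽ (invℚ-pos 0<x))
  where
  0<x : 0ℚ ≺ x
  0<x = ℚ.≰⇒> λ p → x≢0 (ℚ.≤-antisym p 0≤x)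
  lem : invℚ x ≡ ℚ.1/_ x {{ℚ.≢-nonZero x≢0}}
  lem with x ℚ.≟ 0ℚ
  ... | yes x≡0 = ⊥-elim (x≢0 x≡0)
  ... | no  _   = refl

≤-div : ∀ {a b x} → 0ℚ ≺ b → b ⊗ x ⩽ a → x ⩽ a ⊗ invℚ b
≤-div {a} {b} {x} 0<b p = ⊗-cancelˡ b 0<b (⩽-trans p (≡⇒⩽ (sym (trans
  (solve 3 (λ a b c → b :* (a :* c) := a :* (b :* c)) refl a b (invℚ b))
  (trans (cong (a ⊗_) (invℚ-inverseʳ 0<b)) (ℚ.*-identityʳ a))))))

div-≤ : ∀ {a b x} → 0ℚ ≺ b → a ⩽ b ⊗ x → a ⊗ invℚ b ⩽ x
div-≤ {a} {b} {x} 0<b p = ⊗-cancelˡ b 0<b (⩽-trans (≡⇒⩽ (trans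
  (solve 3 (λ a b c → b :* (a :* c) := a :* (b :* c)) refl a b (invℚ b))
  (trans (cong (a ⊗_) (invℚ-inverseʳ 0<b)) (ℚ.*-identityʳ a)))) p)

invℚ-anti : ∀ {x y} → 0ℚ ≺ x → x ⩽ y → invℚ y ⩽ invℚ x
invℚ-anti {x} {y} 0<x x≤y = ⩽-trans (≡⇒⩽ (sym (ℚ.*-identityˡ (invℚ y))))
  (div-≤ (ℚ.<-≤-trans 0<x x≤y) (⩽-trans (≡⇒⩽ (sym (invℚ-inverseʳ 0<x)))
    (⊗-monoʳ (invℚ x) (≺⇒⩽ (invℚ-pos 0<x)) x≤y)))

infix 9 #_ ⅟_

-- Opaque, so that conversion does not normalise the rational numbers behind large literals. Outside
-- this block only the two unfold lemmas expose the definitions.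
opaque
  #_ : ℕ → ℚ
  # n = ℕ→ℚ n

  #-unfold : ∀ n → # n ≡ ℕ→ℚ n
  #-unfold n = refl

  #0 : # 0 ≡ 0ℚ
  #0 = refl

  #1 : # 1 ≡ 1ℚ
  #1 = refl

  private
    toℚᵘ-# : ∀ n → ℚ.toℚᵘ (ℕ→ℚ n) ℚᵘ.≃ ℚᵘ.mkℚᵘ (ℤ.+ n) 0
    toℚᵘ-# n = ℚ.toℚᵘ-fromℚᵘ (ℚᵘ.mkℚᵘ (ℤ.+ n) 0)

  #-+ : ∀ m n → # (m + n) ≡ # m ⊕ # n
  #-+ m n = ℚ.toℚᵘ-injective (ℚᵘ.≃-trans (toℚᵘ-# (m + n)) (ℚᵘ.≃-trans
    (ℚᵘ.*≡* (cong (ℤ._* ℤ.+ 1) (trans (ℤ.pos-+ m n) (cong₂ ℤ._+_ (sym (ℤ.*-identityʳ (ℤ.+ m))) (sym (ℤ.*-identityʳ (ℤ.+ n)))))))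
    (ℚᵘ.≃-sym (ℚᵘ.≃-trans (ℚ.toℚᵘ-homo-+ (ℕ→ℚ m) (ℕ→ℚ n)) (ℚᵘ.+-cong (toℚᵘ-# m) (toℚᵘ-# n))))))

  #-* : ∀ m n → # (m * n) ≡ # m ⊗ # n
  #-* m n = ℚ.toℚᵘ-injective (ℚᵘ.≃-trans (toℚᵘ-# (m * n)) (ℚᵘ.≃-trans
    (ℚᵘ.*≡* (cong (ℤ._* ℤ.+ 1) (ℤ.pos-* m n)))
    (ℚᵘ.≃-sym (ℚᵘ.≃-trans (ℚ.toℚᵘ-homo-* (ℕ→ℚ m) (ℕ→ℚ n)) (ℚᵘ.*-cong (toℚᵘ-# m) (toℚᵘ-# n))))))

  #-mono : ∀ {m n} → m ≤ n → # m ⩽ # n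
  #-mono {m} {n} m≤n = ℚ.toℚᵘ-cancel-≤ (ℚᵘ.≤-respˡ-≃ (ℚᵘ.≃-sym (toℚᵘ-# m)) (ℚᵘ.≤-respʳ-≃ (ℚᵘ.≃-sym (toℚᵘ-# n))
    (ℚᵘ.*≤* (ℤ.*-monoʳ-≤-nonNeg (ℤ.+ 1) (ℤ.+≤+ m≤n)))))

  #-cancel : ∀ {m n} → # m ⩽ # n → m ≤ n
  #-cancel {m} {n} p with ℚᵘ.≤-respˡ-≃ (toℚᵘ-# m) (ℚᵘ.≤-respʳ-≃ (toℚᵘ-# n) (ℚ.toℚᵘ-mono-≤ p))
  ... | ℚᵘ.*≤* q = ℤ.drop‿+≤+ (ℤ.*-cancelʳ-≤-pos (ℤ.+ m) (ℤ.+ n) (ℤ.+ 1) q)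

  -- The junk value is ⅟ 0 = 0.
  ⅟_ : ℕ → ℚ
  ⅟ n = invℚ (# n)

  ⅟-unfold : ∀ n → ⅟ n ≡ invℚ (# n)
  ⅟-unfold n = refl

#-nonneg : ∀ n → 0ℚ ⩽ # n
#-nonneg n = subst (_⩽ # n) #0 (#-mono z≤n)

#-suc : ∀ n → # (suc n) ≡ 1ℚ ⊕ # n
#-suc n = trans (#-+ 1 n) (cong (_⊕ # n) #1)

#-pos : ∀ {n} → 0 < n → 0ℚ ≺ # n
#-pos {n} 0<n = ℚ.<-≤-trans 0<1 (subst (_⩽ # n) #1 (#-mono 0<n))

#-≺ : ∀ {m n} → m < n → # m ≺ # n
#-≺ {m} {n} m<n = ℚ.≰⇒> λ p → ℕ.<⇒≱ m<n (#-cancel p)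

1≤# : ∀ {n} → 0 < n → 1ℚ ⩽ # n
1≤# {n} 0<n = subst (_⩽ # n) #1 (#-mono 0<n)

#-∸ : ∀ {m n} → n ≤ m → # (m ℕ.∸ n) ≡ # m ⊖ # n
#-∸ {m} {n} n≤m = trans (solve 2 (λ a b → a := (b :+ a) :- b) refl (# (m ℕ.∸ n)) (# n))
  (cong (_⊖ # n) (trans (sym (#-+ n (m ℕ.∸ n))) (cong #_ (ℕ.m+[n∸m]≡n n≤m))))

⅟-inverse : ∀ {n} → 0 < n → # n ⊗ ⅟ n ≡ 1ℚ
⅟-inverse {n} 0<n = trans (cong (# n ⊗_) (⅟-unfold n)) (invℚ-inverseʳ (#-pos 0<n))

⅟-nonneg : ∀ n → 0ℚ ⩽ ⅟ n
⅟-nonneg n = subst (0ℚ ⩽_) (sym (⅟-unfold n)) (invℚ-nonneg (#-nonneg n))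

⅟-pos : ∀ {n} → 0 < n → 0ℚ ≺ ⅟ n
⅟-pos {n} 0<n = subst (0ℚ ≺_) (sym (⅟-unfold n)) (invℚ-pos (#-pos 0<n))

⅟-anti : ∀ {m n} → 0 < m → m ≤ n → ⅟ n ⩽ ⅟ m
⅟-anti {m} {n} 0<m m≤n = subst (λ z → z ⩽ ⅟ m) (sym (⅟-unfold n)) (subst (invℚ (# n) ⩽_) (sym (⅟-unfold m)) (invℚ-anti (#-pos 0<m) (#-mono m≤n)))

⅟-unique : ∀ {n} → 0 < n → ∀ {x} → # n ⊗ x ≡ 1ℚ → x ≡ ⅟ n
⅟-unique {n} 0<n {x} e = begin
  x                   ≡⟨ ℚ.*-identityʳ x ⟨
  x ⊗ 1ℚ              ≡⟨ cong (x ⊗_) (⅟-inverse 0<n) ⟨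
  x ⊗ (# n ⊗ ⅟ n)     ≡⟨ solve 3 (λ x n r → x :* (n :* r) := (n :* x) :* r) refl x (# n) (⅟ n) ⟩
  (# n ⊗ x) ⊗ ⅟ n     ≡⟨ cong (_⊗ ⅟ n) e ⟩
  1ℚ ⊗ ⅟ n            ≡⟨ ℚ.*-identityˡ (⅟ n) ⟩
  ⅟ n                 ∎
  where open ≡-Reasoning

⅟-* : ∀ {m n} → 0 < m → 0 < n → ⅟ (m * n) ≡ ⅟ m ⊗ ⅟ n
⅟-* {m} {n} 0<m 0<n = sym (⅟-unique {m * n} (ℕ.*-mono-< {0} {m} {0} {n} 0<m 0<n) (begin
  # (m * n) ⊗ (⅟ m ⊗ ⅟ n)        ≡⟨ cong (_⊗ (⅟ m ⊗ ⅟ n)) (#-* m n) ⟩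
  # m ⊗ # n ⊗ (⅟ m ⊗ ⅟ n)        ≡⟨ solve 4 (λ a b c d → a :* b :* (c :* d) := (a :* c) :* (b :* d)) refl (# m) (# n) (⅟ m) (⅟ n) ⟩
  (# m ⊗ ⅟ m) ⊗ (# n ⊗ ⅟ n)      ≡⟨ cong₂ _⊗_ (⅟-inverse 0<m) (⅟-inverse 0<n) ⟩
  1ℚ ⊗ 1ℚ                        ≡⟨⟩
  1ℚ                             ∎))
  where open ≡-Reasoning

⅟1 : ⅟ 1 ≡ 1ℚ
⅟1 = sym (⅟-unique {1} (s≤s z≤n) (trans (ℚ.*-identityʳ (# 1)) #1))

archimedes : ∀ x → ∃[ n ] x ⩽ # n
archimedes x@(ℚ.mkℚ (ℤ.+ m) d c) = m , subst (x ⩽_) (sym (#-unfold m)) (ℚ.toℚᵘ-cancel-≤ (ℚᵘ.≤-respʳ-≃ {ℚᵘ.mkℚᵘ (ℤ.+ m) d} {ℚᵘ.mkℚᵘ (ℤ.+ m) 0} {ℚ.toℚᵘ (ℕ→ℚ m)} (ℚᵘ.≃-sym (ℚ.toℚᵘ-fromℚᵘ (ℚᵘ.mkℚᵘ (ℤ.+ m) 0)))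
  (ℚᵘ.*≤* (ℤ.≤-trans (ℤ.≤-reflexive (ℤ.*-identityʳ (ℤ.+ m))) (ℤ.≤-trans (ℤ.+≤+ (ℕ.m≤m*n m (suc d))) (ℤ.≤-reflexive (ℤ.pos-* m (suc d))))))))
archimedes x@(ℚ.mkℚ (ℤ.-[1+ m ]) d c) = 0 , ≺⇒⩽ (ℚ.≤-<-trans (≡⇒⩽ refl) (subst (x ≺_) (sym #0) (ℚ.negative⁻¹ x)))

-- Finite sums

𝟙 : ∀ {P : Set} → Dec P → ℚ
𝟙 d = if does d then 1ℚ else 0ℚ

𝟙-yes : ∀ {P : Set} (d : Dec P) → P → 𝟙 d ≡ 1ℚ
𝟙-yes (yes _) _ = refl
𝟙-yes (no ¬p) p = ⊥-elim (¬p p)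

𝟙-no : ∀ {P : Set} (d : Dec P) → ¬ P → 𝟙 d ≡ 0ℚ
𝟙-no (yes p) ¬p = ⊥-elim (¬p p)
𝟙-no (no _)  _  = refl

𝟙-nonneg : ∀ {P : Set} (d : Dec P) → 0ℚ ⩽ 𝟙 d
𝟙-nonneg (yes _) = 0≤1
𝟙-nonneg (no _)  = ⩽-refl

𝟙≤1 : ∀ {P : Set} (d : Dec P) → 𝟙 d ⩽ 1ℚ
𝟙≤1 (yes _) = ⩽-refl
𝟙≤1 (no _)  = 0≤1

𝟙-mono : ∀ {P Q : Set} (d : Dec P) (e : Dec Q) → (P → Q) → 𝟙 d ⩽ 𝟙 e
𝟙-mono (yes p) e f = ≡⇒⩽ (sym (𝟙-yes e (f p)))
𝟙-mono (no _)  e f = 𝟙-nonneg e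

𝟙-cong : ∀ {P Q : Set} (d : Dec P) (e : Dec Q) → (P → Q) → (Q → P) → 𝟙 d ≡ 𝟙 e
𝟙-cong d e f g = ℚ.≤-antisym (𝟙-mono d e f) (𝟙-mono e d g)

𝟙-× : ∀ {P Q : Set} (d : Dec P) (e : Dec Q) → 𝟙 (d ×-dec e) ≡ 𝟙 d ⊗ 𝟙 e
𝟙-× (yes _) (yes _) = refl
𝟙-× (yes _) (no _)  = refl
𝟙-× (no _)  (yes _) = refl
𝟙-× (no _)  (no _)  = refl

𝟙-¬ : ∀ {P : Set} (d : Dec P) → 𝟙 (¬? d) ⊕ 𝟙 d ≡ 1ℚ
𝟙-¬ (yes _) = refl
𝟙-¬ (no _)  = refl

∑ : ℕ → (ℕ → ℚ) → ℚ
∑ zero    f = 0ℚ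
∑ (suc n) f = ∑ n f ⊕ f (suc n)

∑-cong : ∀ n {f g : ℕ → ℚ} → (∀ i → 0 < i → i ≤ n → f i ≡ g i) → ∑ n f ≡ ∑ n g
∑-cong zero    e = refl
∑-cong (suc n) e = cong₂ _⊕_ (∑-cong n λ i 0<i i≤n → e i 0<i (ℕ.m≤n⇒m≤1+n i≤n)) (e (suc n) (s≤s z≤n) ℕ.≤-refl)

∑-mono : ∀ n {f g : ℕ → ℚ} → (∀ i → 0 < i → i ≤ n → f i ⩽ g i) → ∑ n f ⩽ ∑ n g
∑-mono zero    e = ⩽-refl
∑-mono (suc n) e = ⊕-mono (∑-mono n λ i 0<i i≤n → e i 0<i (ℕ.m≤n⇒m≤1+n i≤n)) (e (suc n) (s≤s z≤n) ℕ.≤-refl)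

∑-0 : ∀ n → ∑ n (λ _ → 0ℚ) ≡ 0ℚ
∑-0 zero    = refl
∑-0 (suc n) = trans (⊕-identityʳ (∑ n (λ _ → 0ℚ))) (∑-0 n)

∑-zero : ∀ n {f : ℕ → ℚ} → (∀ i → 0 < i → i ≤ n → f i ≡ 0ℚ) → ∑ n f ≡ 0ℚ
∑-zero n e = trans (∑-cong n e) (∑-0 n)

∑-nonneg : ∀ n {f : ℕ → ℚ} → (∀ i → 0 < i → i ≤ n → 0ℚ ⩽ f i) → 0ℚ ⩽ ∑ n f
∑-nonneg n {f} e = subst (_⩽ ∑ n f) (∑-0 n) (∑-mono n e)

∑-⊕ : ∀ n (f g : ℕ → ℚ) → ∑ n (λ i → f i ⊕ g i) ≡ ∑ n f ⊕ ∑ n g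
∑-⊕ zero    f g = refl
∑-⊕ (suc n) f g = trans (cong (_⊕ (f (suc n) ⊕ g (suc n))) (∑-⊕ n f g))
  (solve 4 (λ a b c d → (a :+ b) :+ (c :+ d) := (a :+ c) :+ (b :+ d)) refl (∑ n f) (∑ n g) (f (suc n)) (g (suc n)))

∑-⊗ : ∀ n c (f : ℕ → ℚ) → ∑ n (λ i → c ⊗ f i) ≡ c ⊗ ∑ n f
∑-⊗ zero    c f = sym (ℚ.*-zeroʳ c)
∑-⊗ (suc n) c f = trans (cong (_⊕ c ⊗ f (suc n)) (∑-⊗ n c f)) (sym (ℚ.*-distribˡ-+ c (∑ n f) (f (suc n))))

∑-const : ∀ n c → ∑ n (λ _ → c) ≡ # n ⊗ c
∑-const zero    c = trans (sym (ℚ.*-zeroˡ c)) (cong (_⊗ c) (sym #0))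
∑-const (suc n) c = trans (cong (_⊕ c) (∑-const n c)) (trans
  (solve 2 (λ n c → n :* c :+ c := (con 1ℚ :+ n) :* c) refl (# n) c) (cong (_⊗ c) (sym (#-suc n))))

∑-∥∥ : ∀ n (f : ℕ → ℚ) → ∥ ∑ n f ∥ ⩽ ∑ n (λ i → ∥ f i ∥)
∑-∥∥ zero    f = ⩽-refl
∑-∥∥ (suc n) f = ⩽-trans (∥∥-⊕ (∑ n f) (f (suc n))) (⊕-mono (∑-∥∥ n f) ⩽-refl)

∑-split : ∀ m n (f : ℕ → ℚ) → ∑ (m + n) f ≡ ∑ m f ⊕ ∑ n (λ i → f (m + i))
∑-split m zero    f = trans (cong (λ z → ∑ z f) (ℕ.+-identityʳ m)) (sym (⊕-identityʳ (∑ m f)))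
∑-split m (suc n) f = trans (cong (λ z → ∑ z f) (ℕ.+-suc m n)) (trans
  (cong₂ _⊕_ (∑-split m n f) (cong f (sym (ℕ.+-suc m n))))
  (ℚ.+-assoc (∑ m f) (∑ n (λ i → f (m + i))) (f (m + suc n))))

∑-ext : ∀ {m n} {f : ℕ → ℚ} → m ≤ n → (∀ i → m < i → i ≤ n → f i ≡ 0ℚ) → ∑ n f ≡ ∑ m f
∑-ext {m} {n} {f} m≤n e = begin
  ∑ n f                                        ≡⟨ cong (λ z → ∑ z f) (ℕ.m+[n∸m]≡n m≤n) ⟨
  ∑ (m + (n ℕ.∸ m)) f                          ≡⟨ ∑-split m (n ℕ.∸ m) f ⟩
  ∑ m f ⊕ ∑ (n ℕ.∸ m) (λ i → f (m + i))        ≡⟨ cong (∑ m f ⊕_) (∑-zero (n ℕ.∸ m) λ i 0<i i≤ → e (m + i) (ℕ.m<m+n m 0<i) (ℕ.≤-trans (ℕ.+-monoʳ-≤ m i≤) (ℕ.≤-reflexive (ℕ.m+[n∸m]≡n m≤n)))) ⟩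
  ∑ m f ⊕ 0ℚ                                   ≡⟨ ⊕-identityʳ (∑ m f) ⟩
  ∑ m f                                        ∎
  where open ≡-Reasoning

∑-≤-ext : ∀ {m n} {f : ℕ → ℚ} → m ≤ n → (∀ i → m < i → i ≤ n → 0ℚ ⩽ f i) → ∑ m f ⩽ ∑ n f
∑-≤-ext {m} {n} {f} m≤n e = ⩽-trans (≤⊕ʳ (∑-nonneg (n ℕ.∸ m) λ i 0<i i≤ → e (m + i) (ℕ.m<m+n m 0<i) (ℕ.≤-trans (ℕ.+-monoʳ-≤ m i≤) (ℕ.≤-reflexive (ℕ.m+[n∸m]≡n m≤n)))))
  (≡⇒⩽ (trans (sym (∑-split m (n ℕ.∸ m) f)) (cong (λ z → ∑ z f) (ℕ.m+[n∸m]≡n m≤n))))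

-- Among the p numbers following p m, only the last is a multiple of p.
∑-multiples-block : ∀ p m (F : ℕ → ℚ) → 0 < p → ∑ (p * m) (λ n → 𝟙 (p ∣? n) ⊗ F n) ≡ ∑ m (λ n → F (p * n))
∑-multiples-block p zero    F _ = cong (λ z → ∑ z (λ n → 𝟙 (p ∣? n) ⊗ F n)) (ℕ.*-zeroʳ p)
∑-multiples-block (suc p) (suc m) F 0<p = begin
  ∑ (suc p * suc m) G                                         ≡⟨ cong (λ z → ∑ z G) (trans (ℕ.*-suc (suc p) m) (ℕ.+-comm (suc p) (suc p * m))) ⟩
  ∑ (suc p * m + suc p) G                                     ≡⟨ ∑-split (suc p * m) (suc p) G ⟩
  ∑ (suc p * m) G ⊕ (∑ p G′ ⊕ G′ (suc p))                     ≡⟨ cong₂ _⊕_ (∑-multiples-block (suc p) m F 0<p) (cong₂ _⊕_ (∑-zero p zeros) last) ⟩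
  ∑ m (λ n → F (suc p * n)) ⊕ (0ℚ ⊕ F (suc p * suc m))        ≡⟨ cong (∑ m (λ n → F (suc p * n)) ⊕_) (⊕-identityˡ (F (suc p * suc m))) ⟩
  ∑ (suc m) (λ n → F (suc p * n))                             ∎
  where
  open ≡-Reasoning
  G G′ : ℕ → ℚ
  G n = 𝟙 (suc p ∣? n) ⊗ F n
  G′ i = G (suc p * m + i)
  zeros : ∀ i → 0 < i → i ≤ p → G′ i ≡ 0ℚ
  zeros (suc i) 0<i i≤p = trans (cong (_⊗ F (suc p * m + suc i)) (𝟙-no (suc p ∣? (suc p * m + suc i)) λ d →
    ℕ.<⇒≱ (s≤s i≤p) (∣⇒≤ (∣m+n∣m⇒∣n d (m∣m*n m))))) (ℚ.*-zeroˡ (F (suc p * m + suc i)))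
  last : G′ (suc p) ≡ F (suc p * suc m)
  last = trans (cong G (trans (ℕ.+-comm (suc p * m) (suc p)) (sym (ℕ.*-suc (suc p) m))))
    (trans (cong (_⊗ F (suc p * suc m)) (𝟙-yes (suc p ∣? (suc p * suc m)) (m∣m*n (suc m)))) (ℚ.*-identityˡ (F (suc p * suc m))))

-- As F vanishes beyond B, the left range can be extended to p B, where it splits into whole blocks
-- of length p.
∑-multiples : ∀ p B (F : ℕ → ℚ) → 0 < p → (∀ n → B < n → F n ≡ 0ℚ) → ∑ B (λ n → 𝟙 (p ∣? n) ⊗ F n) ≡ ∑ B (λ n → F (p * n))
∑-multiples p@(suc _) B F 0<p vanish = trans
  (sym (∑-ext (ℕ.m≤n*m B p) λ i B<i _ → trans (cong (𝟙 (p ∣? i) ⊗_) (vanish i B<i)) (ℚ.*-zeroʳ (𝟙 (p ∣? i)))))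
  (∑-multiples-block p B F 0<p)

-- Sums over squarefree numbers

-- ∑ over the squarefree d composed of primes in the list, weighted by ∏_{p ∣ d} g p.
𝕊 : (ℕ → ℚ) → List ℕ → (ℕ → ℚ) → ℚ
𝕊 g []       f = f 1
𝕊 g (p ∷ ps) f = 𝕊 g ps f ⊕ g p ⊗ 𝕊 g ps (λ d → f (p * d))

Positive : List ℕ → Set
Positive = All (0 <_)

Nonneg : {A : Set} → (A → ℚ) → Set
Nonneg f = ∀ n → 0ℚ ⩽ f n

*-pos : ∀ {m n} → 0 < m → 0 < n → 0 < m * n
*-pos {m} {n} 0<m 0<n = ℕ.*-mono-< {0} {m} {0} {n} 0<m 0<n

𝕊-cong : ∀ g {ps} → Positive ps → ∀ {f f′} → (∀ d → 0 < d → f d ≡ f′ d) → 𝕊 g ps f ≡ 𝕊 g ps f′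
𝕊-cong g []           e = e 1 (s≤s z≤n)
𝕊-cong g {p ∷ ps} (0<p ∷ pos) e = cong₂ (λ x y → x ⊕ g p ⊗ y) (𝕊-cong g pos e) (𝕊-cong g pos λ d 0<d → e (p * d) (*-pos 0<p 0<d))

𝕊-mono : ∀ {g} → Nonneg g → ∀ {ps} → Positive ps → ∀ {f f′} → (∀ d → 0 < d → f d ⩽ f′ d) → 𝕊 g ps f ⩽ 𝕊 g ps f′
𝕊-mono 0≤g []            e = e 1 (s≤s z≤n)
𝕊-mono {g} 0≤g {p ∷ ps} (0<p ∷ pos) e = ⊕-mono (𝕊-mono 0≤g pos e) (⊗-monoˡ (g p) (0≤g p) (𝕊-mono 0≤g pos λ d 0<d → e (p * d) (*-pos 0<p 0<d)))

𝕊-nonneg : ∀ {g} → Nonneg g → ∀ ps {f} → Nonneg f → 0ℚ ⩽ 𝕊 g ps f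
𝕊-nonneg 0≤g []       0≤f = 0≤f 1
𝕊-nonneg 0≤g (p ∷ ps) 0≤f = ⊕-nonneg (𝕊-nonneg 0≤g ps 0≤f) (⊗-nonneg (0≤g p) (𝕊-nonneg 0≤g ps λ d → 0≤f (p * d)))

𝕊-mono-weight : ∀ {g g′} → Nonneg g → ∀ {ps} → All (λ p → g p ⩽ g′ p) ps → ∀ {f} → Nonneg f → 𝕊 g ps f ⩽ 𝕊 g′ ps f
𝕊-mono-weight 0≤g []        0≤f = ⩽-refl
𝕊-mono-weight {g} 0≤g {p ∷ ps} (e ∷ es) 0≤f = ⊕-mono (𝕊-mono-weight 0≤g es 0≤f)
  (⊗-mono (0≤g p) e (𝕊-nonneg 0≤g ps λ d → 0≤f (p * d)) (𝕊-mono-weight 0≤g es λ d → 0≤f (p * d)))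

𝕊-⊕ : ∀ g ps f f′ → 𝕊 g ps (λ d → f d ⊕ f′ d) ≡ 𝕊 g ps f ⊕ 𝕊 g ps f′
𝕊-⊕ g []       f f′ = refl
𝕊-⊕ g (p ∷ ps) f f′ = trans (cong₂ (λ x y → x ⊕ g p ⊗ y) (𝕊-⊕ g ps f f′) (𝕊-⊕ g ps (λ d → f (p * d)) (λ d → f′ (p * d))))
  (solve 5 (λ a b c d e → (a :+ b) :+ c :* (d :+ e) := (a :+ c :* d) :+ (b :+ c :* e)) refl
    (𝕊 g ps f) (𝕊 g ps f′) (g p) (𝕊 g ps (λ d → f (p * d))) (𝕊 g ps (λ d → f′ (p * d))))

𝕊-⊗ : ∀ g ps c f → 𝕊 g ps (λ d → c ⊗ f d) ≡ c ⊗ 𝕊 g ps f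
𝕊-⊗ g []       c f = refl
𝕊-⊗ g (p ∷ ps) c f = trans (cong₂ (λ x y → x ⊕ g p ⊗ y) (𝕊-⊗ g ps c f) (𝕊-⊗ g ps c (λ d → f (p * d))))
  (solve 4 (λ a b c d → c :* a :+ d :* (c :* b) := c :* (a :+ d :* b)) refl
    (𝕊 g ps f) (𝕊 g ps (λ d → f (p * d))) c (g p))

-- Monotonicity is what makes repeated primes harmless: replacing f (p p d) by f (p d) only
-- increases a sum. The cut at R lets finite ranges of summation be complete.
record Decreasing (R : ℕ) (f : ℕ → ℚ) : Set where
  field
    nonneg : Nonneg f
    anti   : ∀ {m n} → m ≤ n → f n ⩽ f m
    vanish : ∀ n → R < n → f n ≡ 0ℚ

open Decreasing

m≤p*m : ∀ {p} m → 0 < p → m ≤ p * m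
m≤p*m {suc p} m _ = ℕ.m≤n*m m (suc p)

shift-decreasing : ∀ {R f p} → 0 < p → Decreasing R f → Decreasing R (λ d → f (p * d))
shift-decreasing {p = p} 0<p F .nonneg d      = nonneg F (p * d)
shift-decreasing {p = p} 0<p F .anti m≤n      = anti F (ℕ.*-monoʳ-≤ p m≤n)
shift-decreasing {p = p} 0<p F .vanish n R<n  = vanish F (p * n) (ℕ.<-≤-trans R<n (m≤p*m n 0<p))

private
  swap-* : ∀ x p d → x * (p * d) ≡ p * (x * d)
  swap-* x p d = trans (sym (ℕ.*-assoc x p d)) (trans (cong (_* d) (ℕ.*-comm x p)) (ℕ.*-assoc p x d))

-- The products with p² ∣ d arising on the left are at most those with p ∥ d, as f decreases.
𝕊-compose-≤ : ∀ {a b c} → Nonneg a → Nonneg b → ∀ {R ps} → Positive ps →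
  All (λ p → a p ⊕ b p ⊕ a p ⊗ b p ⩽ c p) ps → Nonneg c → ∀ {f} → Decreasing R f →
  𝕊 b ps (λ x → 𝕊 a ps (λ d → f (x * d))) ⩽ 𝕊 c ps f
𝕊-compose-≤ 0≤a 0≤b [] [] 0≤c F = ⩽-refl
𝕊-compose-≤ {a} {b} {c} 0≤a 0≤b {R} {p ∷ ps} (0<p ∷ pos) (e ∷ es) 0≤c {f} F = begin
  𝕊 b ps G ⊕ b p ⊗ 𝕊 b ps (λ x → G (p * x))                     ≤⟨ ⊕-mono first (⊗-monoˡ (b p) (0≤b p) second) ⟩
  (C₀ ⊕ a p ⊗ C₁) ⊕ b p ⊗ ((1ℚ ⊕ a p) ⊗ C₁)                     ≡⟨ solve 4 (λ x y a b → (x :+ a :* y) :+ b :* ((con 1ℚ :+ a) :* y) := x :+ (a :+ b :+ a :* b) :* y) refl C₀ C₁ (a p) (b p) ⟩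
  C₀ ⊕ (a p ⊕ b p ⊕ a p ⊗ b p) ⊗ C₁                             ≤⟨ ⊕-mono (⩽-refl {C₀}) (⊗-monoʳ C₁ (𝕊-nonneg 0≤c ps (λ d → nonneg F (p * d))) e) ⟩
  C₀ ⊕ c p ⊗ C₁                                                 ∎
  where
  open ℚ.≤-Reasoning
  fₚ : ℕ → ℚ
  fₚ d = f (p * d)
  C₀ C₁ : ℚ
  C₀ = 𝕊 c ps f
  C₁ = 𝕊 c ps fₚ
  Fₚ : Decreasing R fₚ
  Fₚ = shift-decreasing 0<p F
  G : ℕ → ℚ
  G x = 𝕊 a ps (λ d → f (x * d)) ⊕ a p ⊗ 𝕊 a ps (λ d → f (x * (p * d)))
  first : 𝕊 b ps G ⩽ C₀ ⊕ a p ⊗ C₁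
  first = begin
    𝕊 b ps G  ≡⟨ 𝕊-⊕ b ps (λ x → 𝕊 a ps (λ d → f (x * d))) (λ x → a p ⊗ 𝕊 a ps (λ d → f (x * (p * d)))) ⟩
    𝕊 b ps (λ x → 𝕊 a ps (λ d → f (x * d))) ⊕ 𝕊 b ps (λ x → a p ⊗ 𝕊 a ps (λ d → f (x * (p * d))))
      ≡⟨ cong (𝕊 b ps (λ x → 𝕊 a ps (λ d → f (x * d))) ⊕_) (trans (𝕊-⊗ b ps (a p) (λ x → 𝕊 a ps (λ d → f (x * (p * d)))))
           (cong (a p ⊗_) (𝕊-cong b pos λ x _ → 𝕊-cong a pos λ d _ → cong f (swap-* x p d)))) ⟩
    𝕊 b ps (λ x → 𝕊 a ps (λ d → f (x * d))) ⊕ a p ⊗ 𝕊 b ps (λ x → 𝕊 a ps (λ d → fₚ (x * d)))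
      ≤⟨ ⊕-mono (𝕊-compose-≤ 0≤a 0≤b pos es 0≤c F) (⊗-monoˡ (a p) (0≤a p) (𝕊-compose-≤ 0≤a 0≤b pos es 0≤c Fₚ)) ⟩
    C₀ ⊕ a p ⊗ C₁ ∎
  second : 𝕊 b ps (λ x → G (p * x)) ⩽ (1ℚ ⊕ a p) ⊗ C₁
  second = begin
    𝕊 b ps (λ x → G (p * x)) ≤⟨ 𝕊-mono 0≤b pos (λ x 0<x → begin
      𝕊 a ps (λ d → f (p * x * d)) ⊕ a p ⊗ 𝕊 a ps (λ d → f (p * x * (p * d)))
        ≤⟨ ⊕-mono (⩽-refl {𝕊 a ps (λ d → f (p * x * d))}) (⊗-monoˡ (a p) (0≤a p) (𝕊-mono 0≤a pos λ d 0<d → anti F (ℕ.*-monoʳ-≤ (p * x) (m≤p*m d 0<p)))) ⟩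
      𝕊 a ps (λ d → f (p * x * d)) ⊕ a p ⊗ 𝕊 a ps (λ d → f (p * x * d))
        ≡⟨ solve 2 (λ x a → x :+ a :* x := (con 1ℚ :+ a) :* x) refl (𝕊 a ps (λ d → f (p * x * d))) (a p) ⟩
      (1ℚ ⊕ a p) ⊗ 𝕊 a ps (λ d → f (p * x * d))
        ≡⟨ cong ((1ℚ ⊕ a p) ⊗_) (𝕊-cong a pos λ d _ → cong f (ℕ.*-assoc p x d)) ⟩
      (1ℚ ⊕ a p) ⊗ 𝕊 a ps (λ d → fₚ (x * d)) ∎) ⟩
    𝕊 b ps (λ x → (1ℚ ⊕ a p) ⊗ 𝕊 a ps (λ d → fₚ (x * d))) ≡⟨ 𝕊-⊗ b ps (1ℚ ⊕ a p) (λ x → 𝕊 a ps (λ d → fₚ (x * d))) ⟩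
    (1ℚ ⊕ a p) ⊗ 𝕊 b ps (λ x → 𝕊 a ps (λ d → fₚ (x * d))) ≤⟨ ⊗-monoˡ (1ℚ ⊕ a p) (⊕-nonneg 0≤1 (0≤a p)) (𝕊-compose-≤ 0≤a 0≤b pos es 0≤c Fₚ) ⟩
    (1ℚ ⊕ a p) ⊗ C₁ ∎

-- At each prime only the pairs are kept in which it divides exactly one of x and d, or neither.
-- They give the weight a p + b p, and the discarded terms are nonnegative.
𝕊-compose-≥ : ∀ {a b c} → Nonneg a → Nonneg b → ∀ {ps} → Positive ps →
  Nonneg c → (∀ p → c p ⩽ a p ⊕ b p) → ∀ {f} → Nonneg f →
  𝕊 c ps f ⩽ 𝕊 b ps (λ x → 𝕊 a ps (λ d → f (x * d)))
𝕊-compose-≥ 0≤a 0≤b [] 0≤c e 0≤f = ⩽-refl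
𝕊-compose-≥ {a} {b} {c} 0≤a 0≤b {p ∷ ps} (0<p ∷ pos) 0≤c e {f} 0≤f = begin
  𝕊 c ps f ⊕ c p ⊗ 𝕊 c ps fₚ
    ≤⟨ ⊕-mono (𝕊-compose-≥ 0≤a 0≤b pos 0≤c e 0≤f) (⩽-trans (⊗-monoˡ (c p) (0≤c p) (𝕊-compose-≥ 0≤a 0≤b pos 0≤c e 0≤fₚ)) (⊗-monoʳ B₁ 0≤B₁ (e p))) ⟩
  B₀ ⊕ (a p ⊕ b p) ⊗ B₁
    ≡⟨ solve 4 (λ x y a b → x :+ (a :+ b) :* y := (x :+ a :* y) :+ b :* y) refl B₀ B₁ (a p) (b p) ⟩
  (B₀ ⊕ a p ⊗ B₁) ⊕ b p ⊗ B₁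
    ≤⟨ ⊕-mono (≡⇒⩽ (sym first)) (⊗-monoˡ (b p) (0≤b p) second) ⟩
  𝕊 b ps G ⊕ b p ⊗ 𝕊 b ps (λ x → G (p * x)) ∎
  where
  open ℚ.≤-Reasoning
  fₚ : ℕ → ℚ
  fₚ d = f (p * d)
  0≤fₚ : Nonneg fₚ
  0≤fₚ d = 0≤f (p * d)
  B₀ B₁ : ℚ
  B₀ = 𝕊 b ps (λ x → 𝕊 a ps (λ d → f (x * d)))
  B₁ = 𝕊 b ps (λ x → 𝕊 a ps (λ d → fₚ (x * d)))
  0≤B₁ : 0ℚ ⩽ B₁
  0≤B₁ = 𝕊-nonneg 0≤b ps λ x → 𝕊-nonneg 0≤a ps λ d → 0≤fₚ (x * d)
  G : ℕ → ℚ
  G x = 𝕊 a ps (λ d → f (x * d)) ⊕ a p ⊗ 𝕊 a ps (λ d → f (x * (p * d)))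
  first : 𝕊 b ps G ≡ B₀ ⊕ a p ⊗ B₁
  first = trans (𝕊-⊕ b ps (λ x → 𝕊 a ps (λ d → f (x * d))) (λ x → a p ⊗ 𝕊 a ps (λ d → f (x * (p * d)))))
    (cong (B₀ ⊕_) (trans (𝕊-⊗ b ps (a p) (λ x → 𝕊 a ps (λ d → f (x * (p * d)))))
           (cong (a p ⊗_) (𝕊-cong b pos λ x _ → 𝕊-cong a pos λ d _ → cong f (swap-* x p d)))))
  second : B₁ ⩽ 𝕊 b ps (λ x → G (p * x))
  second = 𝕊-mono 0≤b pos λ x 0<x → ⩽-trans (≡⇒⩽ (𝕊-cong a pos λ d _ → cong f (sym (ℕ.*-assoc p x d))))
    (≤⊕ʳ (⊗-nonneg (0≤a p) (𝕊-nonneg 0≤a ps λ d → 0≤f (p * x * (p * d)))))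

-- Monotone operators and their iterates

Operator : Set
Operator = (ℕ → ℚ) → ℚ

record Monotone (O : Operator) : Set where
  field
    mono : ∀ {f f′} → (∀ d → 0 < d → f d ⩽ f′ d) → O f ⩽ O f′
    op-zero : O (λ _ → 0ℚ) ≡ 0ℚ

  op-cong : ∀ {f f′} → (∀ d → 0 < d → f d ≡ f′ d) → O f ≡ O f′
  op-cong e = ℚ.≤-antisym (mono λ d 0<d → ≡⇒⩽ (e d 0<d)) (mono λ d 0<d → ≡⇒⩽ (sym (e d 0<d)))

  op-nonneg : ∀ {f} → Nonneg f → 0ℚ ⩽ O f
  op-nonneg 0≤f = ⩽-trans (≡⇒⩽ (sym op-zero)) (mono λ d _ → 0≤f d)

  op-decreasing : ∀ {R f} → Decreasing R f → Decreasing R (λ x → O (λ d → f (x * d)))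
  op-decreasing F .nonneg x = op-nonneg λ d → nonneg F (x * d)
  op-decreasing F .anti x≤y = mono λ d _ → anti F (ℕ.*-monoˡ-≤ d x≤y)
  op-decreasing F .vanish x R<x = trans (op-cong λ { d@(suc _) 0<d → vanish F (x * d) (ℕ.<-≤-trans R<x (ℕ.m≤m*n x d)) }) op-zero

open Monotone

𝕊-0 : ∀ g ps → 𝕊 g ps (λ _ → 0ℚ) ≡ 0ℚ
𝕊-0 g []       = refl
𝕊-0 g (p ∷ ps) = trans (cong₂ (λ x y → x ⊕ g p ⊗ y) (𝕊-0 g ps) (𝕊-0 g ps)) (trans (⊕-identityˡ (g p ⊗ 0ℚ)) (ℚ.*-zeroʳ (g p)))

𝕊-monotone : ∀ {g} → Nonneg g → ∀ {ps} → Positive ps → Monotone (𝕊 g ps)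
𝕊-monotone 0≤g pos .mono = 𝕊-mono 0≤g pos
𝕊-monotone {g} 0≤g {ps} pos .op-zero = 𝕊-0 g ps

-- ∑ over j-tuples of f (product of the tuple).
iterate : Operator → ℕ → Operator
iterate O zero    f = f 1
iterate O (suc j) f = O (λ x → iterate O j (λ d → f (x * d)))

iterate-monotone : ∀ {O} → Monotone O → ∀ j → Monotone (iterate O j)
iterate-monotone M zero .mono e = e 1 (s≤s z≤n)
iterate-monotone M zero .op-zero = refl
iterate-monotone M (suc j) .mono e = mono M λ x 0<x → mono (iterate-monotone M j) λ d 0<d → e (x * d) (*-pos 0<x 0<d)
iterate-monotone M (suc j) .op-zero = trans (op-cong M λ _ _ → op-zero (iterate-monotone M j)) (op-zero M)

-- The operators are exchanged from the inside out. The inner iterate of `O′` is again decreasing in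
-- the outer variable, by `op-decreasing`, so the comparison on decreasing functions applies at
-- every stage.
iterate-≤ : ∀ {R O O′} → Monotone O → Monotone O′ → (∀ {f} → Decreasing R f → O f ⩽ O′ f) →
  ∀ j {f} → Decreasing R f → iterate O j f ⩽ iterate O′ j f
iterate-≤ M M′ e zero    F = ⩽-refl
iterate-≤ M M′ e (suc j) F = ⩽-trans
  (mono M λ x 0<x → iterate-≤ M M′ e j (shift-decreasing 0<x F))
  (e (op-decreasing (iterate-monotone M′ j) F))

module _ {μ : ℕ → ℚ} (0≤μ : Nonneg μ) where

  -- (1 + μ)^j - 1
  compound : ℕ → ℕ → ℚ
  compound zero    p = 0ℚ
  compound (suc j) p = compound j p ⊕ μ p ⊕ compound j p ⊗ μ p

  compound-nonneg : ∀ j → Nonneg (compound j)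
  compound-nonneg zero    p = ⩽-refl
  compound-nonneg (suc j) p = ⊕-nonneg (⊕-nonneg (compound-nonneg j p) (0≤μ p)) (⊗-nonneg (compound-nonneg j p) (0≤μ p))

  𝕊-zero-weight : ∀ ps f → 𝕊 (λ _ → 0ℚ) ps f ≡ f 1
  𝕊-zero-weight []       f = refl
  𝕊-zero-weight (p ∷ ps) f = trans (cong₂ _⊕_ (𝕊-zero-weight ps f) (ℚ.*-zeroˡ (𝕊 (λ _ → 0ℚ) ps (λ d → f (p * d))))) (⊕-identityʳ (f 1))

  -- A prime may occur in any nonempty set of the j positions, with total weight (1 + μ)^j - 1. Each
  -- such occurrence is bounded by a single factor p in the argument of f.
  iterate-𝕊-≤ : ∀ {R ps} → Positive ps → ∀ j {f} → Decreasing R f → iterate (𝕊 μ ps) j f ⩽ 𝕊 (compound j) ps f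
  iterate-𝕊-≤ {ps = ps} pos zero    {f} F = ≡⇒⩽ (sym (𝕊-zero-weight ps f))
  iterate-𝕊-≤ {ps = ps} pos (suc j) {f} F = ⩽-trans
    (𝕊-mono 0≤μ pos λ x 0<x → iterate-𝕊-≤ pos j (shift-decreasing 0<x F))
    (𝕊-compose-≤ (compound-nonneg j) 0≤μ pos (All.tabulate λ _ → ⩽-refl) (compound-nonneg (suc j)) F)

  -- Only the tuples with pairwise coprime entries are kept: each prime of d then chooses one of j
  -- positions.
  iterate-𝕊-≥ : ∀ {ps} → Positive ps → ∀ j {f} → Nonneg f → 𝕊 (λ p → # j ⊗ μ p) ps f ⩽ iterate (𝕊 μ ps) j f
  iterate-𝕊-≥ {ps} pos zero {f} 0≤f = ⩽-trans (𝕊-mono-weight (λ p → ⊗-nonneg (#-nonneg 0) (0≤μ p)) {ps} (All.tabulate λ {p} _ → ≡⇒⩽ (trans (cong (_⊗ μ p) #0) (ℚ.*-zeroˡ (μ p)))) 0≤f) (≡⇒⩽ (𝕊-zero-weight ps f))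
  iterate-𝕊-≥ {ps} pos (suc j) {f} 0≤f = ⩽-trans
    (𝕊-compose-≥ (λ p → ⊗-nonneg (#-nonneg j) (0≤μ p)) 0≤μ pos (λ p → ⊗-nonneg (#-nonneg (suc j)) (0≤μ p))
      (λ p → ≡⇒⩽ (trans (cong (_⊗ μ p) (#-suc j)) (solve 2 (λ a b → (con 1ℚ :+ a) :* b := a :* b :+ b) refl (# j) (μ p)))) 0≤f)
    (𝕊-mono 0≤μ pos λ x 0<x → iterate-𝕊-≥ pos j λ d → 0≤f (x * d))

∏₁ : (ℕ → ℚ) → List ℕ → ℚ
∏₁ δ []       = 1ℚ
∏₁ δ (p ∷ ps) = ∏₁ δ ps ⊗ (1ℚ ⊕ δ p)

∏₁-nonneg : ∀ {δ} → Nonneg δ → ∀ ps → 0ℚ ⩽ ∏₁ δ ps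
∏₁-nonneg 0≤δ []       = 0≤1
∏₁-nonneg 0≤δ (p ∷ ps) = ⊗-nonneg (∏₁-nonneg 0≤δ ps) (⊕-nonneg 0≤1 (0≤δ p))

-- A prime chosen with the excess weight δ p may be removed from d, since f decreases. What remains
-- is the sum with weight g, and the removed primes contribute the product of the 1 + δ p.
𝕊-perturb : ∀ {h g δ} → Nonneg h → Nonneg g → Nonneg δ → ∀ {R ps} → Positive ps → All (λ p → h p ⩽ g p ⊕ δ p) ps →
  ∀ {f} → Decreasing R f → 𝕊 h ps f ⩽ ∏₁ δ ps ⊗ 𝕊 g ps f
𝕊-perturb 0≤h 0≤g 0≤δ [] [] {f} F = ≡⇒⩽ (sym (ℚ.*-identityˡ (f 1)))
𝕊-perturb {h} {g} {δ} 0≤h 0≤g 0≤δ {R} {p ∷ ps} (0<p ∷ pos) (e ∷ es) {f} F = begin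
  𝕊 h ps f ⊕ h p ⊗ 𝕊 h ps fₚ        ≤⟨ ⊕-mono (𝕊-perturb 0≤h 0≤g 0≤δ pos es F)
      (⊗-mono (0≤h p) e (𝕊-nonneg 0≤h ps λ d → nonneg F (p * d)) (𝕊-perturb 0≤h 0≤g 0≤δ pos es (shift-decreasing 0<p F))) ⟩
  P ⊗ X ⊕ (g p ⊕ δ p) ⊗ (P ⊗ Xₚ)    ≡⟨ solve 5 (λ P X Y g d → P :* X :+ (g :+ d) :* (P :* Y) := (P :* X :+ P :* (g :* Y)) :+ P :* (d :* Y)) refl P X Xₚ (g p) (δ p) ⟩
  (P ⊗ X ⊕ P ⊗ (g p ⊗ Xₚ)) ⊕ P ⊗ (δ p ⊗ Xₚ)
    ≤⟨ ⊕-monoʳ (P ⊗ X ⊕ P ⊗ (g p ⊗ Xₚ)) (⊗-monoˡ P (∏₁-nonneg 0≤δ ps) (⊗-monoˡ (δ p) (0≤δ p) Xₚ≤)) ⟩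
  (P ⊗ X ⊕ P ⊗ (g p ⊗ Xₚ)) ⊕ P ⊗ (δ p ⊗ (X ⊕ g p ⊗ Xₚ))
    ≡⟨ solve 4 (λ P X Y d → (P :* X :+ P :* Y) :+ P :* (d :* (X :+ Y)) := P :* (con 1ℚ :+ d) :* (X :+ Y)) refl P X (g p ⊗ Xₚ) (δ p) ⟩
  P ⊗ (1ℚ ⊕ δ p) ⊗ (X ⊕ g p ⊗ Xₚ)   ∎
  where
  open ℚ.≤-Reasoning
  fₚ : ℕ → ℚ
  fₚ d = f (p * d)
  P X Xₚ : ℚ
  P = ∏₁ δ ps
  X = 𝕊 g ps f
  Xₚ = 𝕊 g ps fₚ
  Xₚ≤ : Xₚ ⩽ X ⊕ g p ⊗ Xₚ
  Xₚ≤ = ⩽-trans (𝕊-mono 0≤g pos λ d _ → anti F (m≤p*m d 0<p)) (≤⊕ʳ (⊗-nonneg (0≤g p) (𝕊-nonneg 0≤g ps λ d → nonneg F (p * d))))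

-- Comparison of sums over integers and over squarefree numbers

prime-pos : ∀ {p} → Prime p → 0 < p
prime-pos {zero}  pr = ⊥-elim (¬prime[0] pr)
prime-pos {suc p} pr = s≤s z≤n

prime-∣-prime : ∀ {p q} → Prime p → Prime q → p ∣ q → p ≡ q
prime-∣-prime pp pq p∣q with prime⇒irreducible pq p∣q
... | inj₁ refl = ⊥-elim (¬prime[1] pp)
... | inj₂ p≡q  = p≡q

-- The data that survive when the primes of the list are peeled off one at a time. `invariant` says
-- that z does not see the primes still in the list, and `exhausted` that for an empty list only n =
-- 1 is left below B. The intended z is the indicator of being coprime to W.
record SiftedBy (B : ℕ) (z : ℕ → ℚ) (ps : List ℕ) : Set where
  field
    primes    : All Prime ps
    unique    : Unique ps
    z-nonneg  : Nonneg z
    z-1       : z 1 ≡ 1ℚ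
    invariant : All (λ p → ∀ n → 0 < n → z (p * n) ≡ z n) ps
    exhausted : ∀ n → 1 < n → n ≤ B → z n ≡ 0ℚ ⊎ Any (_∣ n) ps

  positive : Positive ps
  positive = All.map prime-pos primes

open SiftedBy

sift : ℕ → (ℕ → ℚ) → ℕ → ℚ
sift p z n = z n ⊗ 𝟙 (¬? (p ∣? n))

sift-SiftedBy : ∀ {B z p ps} → SiftedBy B z (p ∷ ps) → SiftedBy B (sift p z) ps
sift-SiftedBy S .primes with primes S
... | _ ∷ pr = pr
sift-SiftedBy S .unique with unique S
... | _ ∷ u = u
sift-SiftedBy {z = z} {p} S .z-nonneg n = ⊗-nonneg (z-nonneg S n) (𝟙-nonneg (¬? (p ∣? n)))
sift-SiftedBy {z = z} {p} S .z-1 with primes S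
... | pp ∷ _ = trans (cong₂ _⊗_ (z-1 S) (𝟙-yes (¬? (p ∣? 1)) λ p∣1 → ¬prime[1] (subst Prime (∣1⇒≡1 p∣1) pp))) (ℚ.*-identityˡ 1ℚ)
sift-SiftedBy {z = z} {p} {ps} S .invariant with primes S | unique S | invariant S
... | pp ∷ pr | ≢s ∷ _ | _ ∷ inv = All.zipWith (λ { {q} (f , pq , p≢q) n 0<n → cong₂ _⊗_ (f n 0<n) (𝟙-cong (¬? (p ∣? (q * n))) (¬? (p ∣? n))
      (λ p∤qn p∣n → p∤qn (∣n⇒∣m*n q p∣n))
      (λ p∤n p∣qn → case-⊎ (euclidsLemma q n pp p∣qn) (λ p∣q → p≢q (prime-∣-prime pp pq p∣q)) p∤n)) })
    (inv , All.zip (pr , ≢s))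
  where
  case-⊎ : ∀ {A B C : Set} → A ⊎ B → (A → C) → (B → C) → C
  case-⊎ (inj₁ a) f g = f a
  case-⊎ (inj₂ b) f g = g b
sift-SiftedBy {z = z} {p} S .exhausted n 1<n n≤B with exhausted S n 1<n n≤B
... | inj₁ e = inj₁ (trans (cong (_⊗ 𝟙 (¬? (p ∣? n))) e) (ℚ.*-zeroˡ (𝟙 (¬? (p ∣? n)))))
... | inj₂ (here p∣n) = inj₁ (trans (cong (z n ⊗_) (𝟙-no (¬? (p ∣? n)) λ p∤n → p∤n p∣n)) (ℚ.*-zeroʳ (z n)))
... | inj₂ (there a) = inj₂ a

siftedSum : ℕ → (ℕ → ℚ) → (ℕ → ℚ) → ℚ
siftedSum B z F = ∑ B (λ n → z n ⊗ F n)

-- The range is split by whether p divides n. In the second sum z is not sifted by p, so all higher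
-- powers of p are still included there.
siftedSum-peel : ∀ {B z p ps F} → SiftedBy B z (p ∷ ps) → (∀ n → B < n → F n ≡ 0ℚ) →
  siftedSum B z F ≡ siftedSum B (sift p z) F ⊕ siftedSum B z (λ n → F (p * n))
siftedSum-peel {B} {z} {p} {ps} {F} S vF with primes S | invariant S
... | pp ∷ _ | inv ∷ _ = begin
  ∑ B (λ n → z n ⊗ F n)                      ≡⟨ ∑-cong B (λ n _ _ → split n) ⟩
  ∑ B (λ n → sift p z n ⊗ F n ⊕ 𝟙 (p ∣? n) ⊗ (z n ⊗ F n))   ≡⟨ ∑-⊕ B (λ n → sift p z n ⊗ F n) (λ n → 𝟙 (p ∣? n) ⊗ (z n ⊗ F n)) ⟩
  siftedSum B (sift p z) F ⊕ ∑ B (λ n → 𝟙 (p ∣? n) ⊗ (z n ⊗ F n))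
    ≡⟨ cong (siftedSum B (sift p z) F ⊕_) (∑-multiples p B (λ n → z n ⊗ F n) (prime-pos pp) λ n B<n → trans (cong (z n ⊗_) (vF n B<n)) (ℚ.*-zeroʳ (z n))) ⟩
  siftedSum B (sift p z) F ⊕ ∑ B (λ n → z (p * n) ⊗ F (p * n))
    ≡⟨ cong (siftedSum B (sift p z) F ⊕_) (∑-cong B λ n 0<n _ → cong (_⊗ F (p * n)) (inv n 0<n)) ⟩
  siftedSum B (sift p z) F ⊕ siftedSum B z (λ n → F (p * n)) ∎
  where
  open ≡-Reasoning
  split : ∀ n → z n ⊗ F n ≡ sift p z n ⊗ F n ⊕ 𝟙 (p ∣? n) ⊗ (z n ⊗ F n)
  split n = trans (sym (trans (cong (_⊗ (z n ⊗ F n)) (𝟙-¬ (p ∣? n))) (ℚ.*-identityˡ (z n ⊗ F n))))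
    (solve 4 (λ a b z f → (a :+ b) :* (z :* f) := z :* a :* f :+ b :* (z :* f)) refl (𝟙 (¬? (p ∣? n))) (𝟙 (p ∣? n)) (z n) (F n))

siftedSum-[] : ∀ {B z F} → 0 < B → SiftedBy B z [] → siftedSum B z F ≡ F 1
siftedSum-[] {B} {z} {F} 0<B S = begin
  ∑ B (λ n → z n ⊗ F n)  ≡⟨ ∑-ext 0<B (λ i 1<i i≤B → trans (cong (_⊗ F i) (z0 i 1<i i≤B)) (ℚ.*-zeroˡ (F i))) ⟩
  0ℚ ⊕ z 1 ⊗ F 1         ≡⟨ ⊕-identityˡ (z 1 ⊗ F 1) ⟩
  z 1 ⊗ F 1              ≡⟨ cong (_⊗ F 1) (z-1 S) ⟩
  1ℚ ⊗ F 1               ≡⟨ ℚ.*-identityˡ (F 1) ⟩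
  F 1                    ∎
  where
  open ≡-Reasoning
  z0 : ∀ i → 1 < i → i ≤ B → z i ≡ 0ℚ
  z0 i 1<i i≤B with exhausted S i 1<i i≤B
  ... | inj₁ e = e
  ... | inj₂ ()

sift-≤ : ∀ {z : ℕ → ℚ} → Nonneg z → ∀ p B {F} → Nonneg F → siftedSum B (sift p z) F ⩽ siftedSum B z F
sift-≤ {z} 0≤z p B {F} 0≤F = ∑-mono B λ n _ _ → ⊗-monoʳ (F n) (0≤F n)
  (⩽-trans (⊗-monoˡ (z n) (0≤z n) (𝟙≤1 (¬? (p ∣? n)))) (≡⇒⩽ (ℚ.*-identityʳ (z n))))

-- After peeling p, the multiples p m may contain p again. Sifting m by p as well discards exactly
-- such terms, which are nonnegative, and leaves the squarefree numbers.
𝕊-≤-siftedSum : ∀ {B z} → 0 < B → ∀ {ps} → SiftedBy B z ps → ∀ {F} → Nonneg F → (∀ n → B < n → F n ≡ 0ℚ) →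
  𝕊 (λ _ → 1ℚ) ps F ⩽ siftedSum B z F
𝕊-≤-siftedSum 0<B {[]} S 0≤F vF = ≡⇒⩽ (sym (siftedSum-[] 0<B S))
𝕊-≤-siftedSum {B} {z} 0<B {p ∷ ps} S {F} 0≤F vF = begin
  𝕊 (λ _ → 1ℚ) ps F ⊕ 1ℚ ⊗ 𝕊 (λ _ → 1ℚ) ps Fₚ      ≡⟨ cong (𝕊 (λ _ → 1ℚ) ps F ⊕_) (ℚ.*-identityˡ (𝕊 (λ _ → 1ℚ) ps Fₚ)) ⟩
  𝕊 (λ _ → 1ℚ) ps F ⊕ 𝕊 (λ _ → 1ℚ) ps Fₚ           ≤⟨ ⊕-mono (𝕊-≤-siftedSum 0<B S′ 0≤F vF) (𝕊-≤-siftedSum 0<B S′ (λ n → 0≤F (p * n)) vFₚ) ⟩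
  siftedSum B (sift p z) F ⊕ siftedSum B (sift p z) Fₚ  ≤⟨ ⊕-monoʳ (siftedSum B (sift p z) F) (sift-≤ (z-nonneg S) p B (λ n → 0≤F (p * n))) ⟩
  siftedSum B (sift p z) F ⊕ siftedSum B z Fₚ           ≡⟨ siftedSum-peel S vF ⟨
  siftedSum B z F ∎
  where
  open ℚ.≤-Reasoning
  S′ = sift-SiftedBy S
  Fₚ : ℕ → ℚ
  Fₚ n = F (p * n)
  vFₚ : ∀ n → B < n → Fₚ n ≡ 0ℚ
  vFₚ n B<n = vF (p * n) (ℕ.<-≤-trans B<n (m≤p*m n (All.head (positive S))))

harmonicSum : ℕ → (ℕ → ℚ) → Operator
harmonicSum B z f = siftedSum B z (λ n → ⅟ n ⊗ f n)

harmonicSum-monotone : ∀ B {z} → Nonneg z → Monotone (harmonicSum B z)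
harmonicSum-monotone B {z} 0≤z .mono e = ∑-mono B λ n 0<n _ → ⊗-monoˡ (z n) (0≤z n) (⊗-monoˡ (⅟ n) (⅟-nonneg n) (e n 0<n))
harmonicSum-monotone B {z} 0≤z .op-zero = ∑-zero B λ n _ _ → trans (cong (z n ⊗_) (ℚ.*-zeroʳ (⅟ n))) (ℚ.*-zeroʳ (z n))

harmonicSum-peel : ∀ {B z p ps f} → SiftedBy B z (p ∷ ps) → (∀ n → B < n → f n ≡ 0ℚ) →
  harmonicSum B z f ≡ harmonicSum B (sift p z) f ⊕ ⅟ p ⊗ harmonicSum B z (λ n → f (p * n))
harmonicSum-peel {B} {z} {p} {ps} {f} S vf = trans
  (siftedSum-peel S λ n B<n → trans (cong (⅟ n ⊗_) (vf n B<n)) (ℚ.*-zeroʳ (⅟ n)))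
  (cong (harmonicSum B (sift p z) f ⊕_) (trans
    (∑-cong B λ n 0<n _ → trans (cong (λ t → z n ⊗ (t ⊗ f (p * n))) (⅟-* (All.head (positive S)) 0<n))
      (solve 4 (λ z a b f → z :* (a :* b :* f) := a :* (z :* (b :* f))) refl (z n) (⅟ p) (⅟ n) (f (p * n))))
    (∑-⊗ B (⅟ p) (λ n → z n ⊗ (⅟ n ⊗ f (p * n))))))

𝕊-⅟-weight : ∀ {ps} → Positive ps → ∀ f → 𝕊 ⅟_ ps f ≡ 𝕊 (λ _ → 1ℚ) ps (λ n → ⅟ n ⊗ f n)
𝕊-⅟-weight [] f = sym (trans (cong (_⊗ f 1) ⅟1) (ℚ.*-identityˡ (f 1)))
𝕊-⅟-weight {p ∷ ps} (0<p ∷ pos) f = cong₂ _⊕_ (𝕊-⅟-weight pos f) (begin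
  ⅟ p ⊗ 𝕊 ⅟_ ps fₚ                                        ≡⟨ cong (⅟ p ⊗_) (𝕊-⅟-weight pos fₚ) ⟩
  ⅟ p ⊗ 𝕊 (λ _ → 1ℚ) ps (λ n → ⅟ n ⊗ fₚ n)                ≡⟨ 𝕊-⊗ (λ _ → 1ℚ) ps (⅟ p) (λ n → ⅟ n ⊗ fₚ n) ⟨
  𝕊 (λ _ → 1ℚ) ps (λ n → ⅟ p ⊗ (⅟ n ⊗ fₚ n))              ≡⟨ 𝕊-cong (λ _ → 1ℚ) pos (λ n 0<n → trans (sym (ℚ.*-assoc (⅟ p) (⅟ n) (fₚ n))) (cong (_⊗ fₚ n) (sym (⅟-* 0<p 0<n)))) ⟩
  𝕊 (λ _ → 1ℚ) ps (λ n → ⅟ (p * n) ⊗ f (p * n))           ≡⟨ ℚ.*-identityˡ (𝕊 (λ _ → 1ℚ) ps (λ n → ⅟ (p * n) ⊗ f (p * n))) ⟨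
  1ℚ ⊗ 𝕊 (λ _ → 1ℚ) ps (λ n → ⅟ (p * n) ⊗ f (p * n))      ∎)
  where
  open ≡-Reasoning
  fₚ : ℕ → ℚ
  fₚ d = f (p * d)

𝕊-≤-harmonicSum : ∀ {B z} → 0 < B → ∀ {ps} → SiftedBy B z ps → ∀ {f} → Nonneg f → (∀ n → B < n → f n ≡ 0ℚ) →
  𝕊 ⅟_ ps f ⩽ harmonicSum B z f
𝕊-≤-harmonicSum 0<B S {f} 0≤f vf = ⩽-trans (≡⇒⩽ (𝕊-⅟-weight (positive S) f))
  (𝕊-≤-siftedSum 0<B S (λ n → ⊗-nonneg (⅟-nonneg n) (0≤f n)) λ n B<n → trans (cong (⅟ n ⊗_) (vf n B<n)) (ℚ.*-zeroʳ (⅟ n)))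

μ : ℕ → ℚ
μ p = ⅟ (p ℕ.∸ 1)

μ-nonneg : Nonneg μ
μ-nonneg p = ⅟-nonneg (p ℕ.∸ 1)

prime>1 : ∀ {p} → Prime p → 1 < p
prime>1 {zero}        pr = ⊥-elim (¬prime[0] pr)
prime>1 {suc zero}    pr = ⊥-elim (¬prime[1] pr)
prime>1 {suc (suc p)} pr = s≤s (s≤s z≤n)

#pred : ∀ {p} → 1 < p → # p ≡ 1ℚ ⊕ # (p ℕ.∸ 1)
#pred {suc p} _ = #-suc p

-- μ p is the geometric series 1/p + 1/p² + ⋯, so it accounts for all prime powers.
harmonicSum-≤-𝕊 : ∀ {B z} → 0 < B → ∀ {ps} → SiftedBy B z ps → ∀ {f} → Decreasing B f →
  harmonicSum B z f ⩽ 𝕊 μ ps f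
harmonicSum-≤-𝕊 {B} {z} 0<B {[]} S {f} F = ≡⇒⩽ (trans (siftedSum-[] 0<B S) (trans (cong (_⊗ f 1) ⅟1) (ℚ.*-identityˡ (f 1))))
harmonicSum-≤-𝕊 {B} {z} 0<B {p ∷ ps} S {f} F = begin
  harmonicSum B z f                        ≡⟨ harmonicSum-peel S (vanish F) ⟩
  A′ f ⊕ ⅟ p ⊗ A fₚ                        ≤⟨ ⊕-mono (harmonicSum-≤-𝕊 0<B S′ F) step ⟩
  𝕊 μ ps f ⊕ μ p ⊗ 𝕊 μ ps fₚ               ∎
  where
  open ℚ.≤-Reasoning
  S′ = sift-SiftedBy S
  fₚ : ℕ → ℚ
  fₚ d = f (p * d)
  0<p = All.head (positive S)
  Fₚ = shift-decreasing 0<p F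
  1<p = prime>1 (All.head (primes S))
  A A′ : Operator
  A = harmonicSum B z
  A′ = harmonicSum B (sift p z)
  MA = harmonicSum-monotone B (z-nonneg S)
  -- The recursion is closed up by fₚ (p n) ≤ fₚ n. Solving for `A fₚ` gives (p - 1) A fₚ ≤ p A′ fₚ,
  -- which is the sum of the geometric series without an infinite sum.
  self : A fₚ ⩽ A′ fₚ ⊕ ⅟ p ⊗ A fₚ
  self = ⩽-trans (≡⇒⩽ (harmonicSum-peel S (vanish Fₚ)))
    (⊕-monoʳ (A′ fₚ) (⊗-monoˡ (⅟ p) (⅟-nonneg p) (mono MA λ d _ → anti Fₚ (m≤p*m d 0<p))))
  q : ℚ
  q = # (p ℕ.∸ 1)
  scaled : q ⊗ A fₚ ⩽ # p ⊗ A′ fₚ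
  scaled = 0≤y-x⇒x≤y (⩽-trans (x≤y⇒0≤y-x (⊗-monoˡ (# p) (#-nonneg p) self)) (≡⇒⩽ (begin-equality
    # p ⊗ (A′ fₚ ⊕ ⅟ p ⊗ A fₚ) ⊖ # p ⊗ A fₚ       ≡⟨ solve 4 (λ p r a b → p :* (b :+ r :* a) :- p :* a := (p :* b :+ (p :* r) :* a) :- p :* a) refl (# p) (⅟ p) (A fₚ) (A′ fₚ) ⟩
    (# p ⊗ A′ fₚ ⊕ (# p ⊗ ⅟ p) ⊗ A fₚ) ⊖ # p ⊗ A fₚ   ≡⟨ cong₂ (λ u v → (# p ⊗ A′ fₚ ⊕ u ⊗ A fₚ) ⊖ v ⊗ A fₚ) (⅟-inverse 0<p) (#pred 1<p) ⟩
    (# p ⊗ A′ fₚ ⊕ 1ℚ ⊗ A fₚ) ⊖ (1ℚ ⊕ q) ⊗ A fₚ   ≡⟨ solve 3 (λ x a q → (x :+ con 1ℚ :* a) :- (con 1ℚ :+ q) :* a := x :- q :* a) refl (# p ⊗ A′ fₚ) (A fₚ) q ⟩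
    # p ⊗ A′ fₚ ⊖ q ⊗ A fₚ                        ∎)))
  0<q : 0 < p ℕ.∸ 1
  0<q = ℕ.m<n⇒0<n∸m 1<p
  step : ⅟ p ⊗ A fₚ ⩽ μ p ⊗ 𝕊 μ ps fₚ
  step = ⊗-cancelˡ q (#-pos 0<q) (begin
    q ⊗ (⅟ p ⊗ A fₚ)          ≡⟨ solve 3 (λ q r a → q :* (r :* a) := r :* (q :* a)) refl q (⅟ p) (A fₚ) ⟩
    ⅟ p ⊗ (q ⊗ A fₚ)          ≤⟨ ⊗-monoˡ (⅟ p) (⅟-nonneg p) scaled ⟩
    ⅟ p ⊗ (# p ⊗ A′ fₚ)       ≡⟨ solve 3 (λ r p a → r :* (p :* a) := (p :* r) :* a) refl (⅟ p) (# p) (A′ fₚ) ⟩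
    (# p ⊗ ⅟ p) ⊗ A′ fₚ       ≡⟨ cong (_⊗ A′ fₚ) (trans (⅟-inverse 0<p) (sym (⅟-inverse 0<q))) ⟩
    (q ⊗ μ p) ⊗ A′ fₚ         ≤⟨ ⊗-monoˡ (q ⊗ μ p) (⊗-nonneg (#-nonneg (p ℕ.∸ 1)) (μ-nonneg p)) (harmonicSum-≤-𝕊 0<B S′ Fₚ) ⟩
    (q ⊗ μ p) ⊗ 𝕊 μ ps fₚ     ≡⟨ ℚ.*-assoc q (μ p) (𝕊 μ ps fₚ) ⟩
    q ⊗ (μ p ⊗ 𝕊 μ ps fₚ)     ∎)

-- The quadratic form of the sieve

-- The quadratic form of independent random variables with means a p and
-- variances v p: the expectation of the product of 𝕊 χ ps Y and 𝕊 χ ps Y′.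
module _ (a v : ℕ → ℚ) where

  covariance : List ℕ → (ℕ → ℚ) → (ℕ → ℚ) → ℚ
  covariance []       Y Y′ = Y 1 ⊗ Y′ 1
  covariance (p ∷ ps) Y Y′ =
    covariance ps Y Y′ ⊕ a p ⊗ covariance ps (λ d → Y (p * d)) Y′
    ⊕ a p ⊗ covariance ps Y (λ d → Y′ (p * d))
    ⊕ (a p ⊗ a p ⊕ v p) ⊗ covariance ps (λ d → Y (p * d)) (λ d → Y′ (p * d))

  covariance-linearˡ : ∀ ps c Y Z Y′ →
    covariance ps (λ d → Y d ⊕ c ⊗ Z d) Y′ ≡ covariance ps Y Y′ ⊕ c ⊗ covariance ps Z Y′
  covariance-linearˡ [] c Y Z Y′ = solve 4 (λ y c z w → (y :+ c :* z) :* w := y :* w :+ c :* (z :* w)) refl (Y 1) c (Z 1) (Y′ 1)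
  covariance-linearˡ (p ∷ ps) c Y Z Y′ =
    trans (four _ _ _ _ _ _ _ _ (covariance-linearˡ ps c Y Z Y′) (covariance-linearˡ ps c Yₚ Zₚ Y′) (covariance-linearˡ ps c Y Z Y′ₚ) (covariance-linearˡ ps c Yₚ Zₚ Y′ₚ))
      (solve 11 (λ x₁ x₂ x₃ x₄ y₁ y₂ y₃ y₄ c a q →
        (x₁ :+ c :* y₁) :+ a :* (x₂ :+ c :* y₂) :+ a :* (x₃ :+ c :* y₃) :+ q :* (x₄ :+ c :* y₄)
        := (x₁ :+ a :* x₂ :+ a :* x₃ :+ q :* x₄) :+ c :* (y₁ :+ a :* y₂ :+ a :* y₃ :+ q :* y₄)) refl
        (covariance ps Y Y′) (covariance ps Yₚ Y′) (covariance ps Y Y′ₚ) (covariance ps Yₚ Y′ₚ)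
        (covariance ps Z Y′) (covariance ps Zₚ Y′) (covariance ps Z Y′ₚ) (covariance ps Zₚ Y′ₚ) c (a p) (a p ⊗ a p ⊕ v p))
    where
    Yₚ Zₚ Y′ₚ : ℕ → ℚ
    Yₚ d = Y (p * d)
    Zₚ d = Z (p * d)
    Y′ₚ d = Y′ (p * d)
    four : ∀ x₁ x₂ x₃ x₄ y₁ y₂ y₃ y₄ → x₁ ≡ y₁ → x₂ ≡ y₂ → x₃ ≡ y₃ → x₄ ≡ y₄ →
      x₁ ⊕ a p ⊗ x₂ ⊕ a p ⊗ x₃ ⊕ (a p ⊗ a p ⊕ v p) ⊗ x₄ ≡ y₁ ⊕ a p ⊗ y₂ ⊕ a p ⊗ y₃ ⊕ (a p ⊗ a p ⊕ v p) ⊗ y₄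
    four _ _ _ _ _ _ _ _ refl refl refl refl = refl

  covariance-sym : ∀ ps Y Y′ → covariance ps Y Y′ ≡ covariance ps Y′ Y
  covariance-sym [] Y Y′ = ℚ.*-comm (Y 1) (Y′ 1)
  covariance-sym (p ∷ ps) Y Y′ = trans
    (cong₂ (λ x y → x ⊕ a p ⊗ covariance ps (λ d → Y (p * d)) Y′ ⊕ a p ⊗ covariance ps Y (λ d → Y′ (p * d)) ⊕ (a p ⊗ a p ⊕ v p) ⊗ y)
      (covariance-sym ps Y Y′) (covariance-sym ps (λ d → Y (p * d)) (λ d → Y′ (p * d))))
    (trans (cong₂ (λ x y → covariance ps Y′ Y ⊕ a p ⊗ x ⊕ a p ⊗ y ⊕ (a p ⊗ a p ⊕ v p) ⊗ covariance ps (λ d → Y′ (p * d)) (λ d → Y (p * d)))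
      (covariance-sym ps (λ d → Y (p * d)) Y′) (covariance-sym ps Y (λ d → Y′ (p * d))))
      (solve 4 (λ w x y z → w :+ x :+ y :+ z := w :+ y :+ x :+ z) refl
        (covariance ps Y′ Y) (a p ⊗ covariance ps Y′ (λ d → Y (p * d))) (a p ⊗ covariance ps (λ d → Y′ (p * d)) Y)
        ((a p ⊗ a p ⊕ v p) ⊗ covariance ps (λ d → Y′ (p * d)) (λ d → Y (p * d)))))

  covariance-linearʳ : ∀ ps c Y Y′ Z → covariance ps Y (λ d → Y′ d ⊕ c ⊗ Z d) ≡ covariance ps Y Y′ ⊕ c ⊗ covariance ps Y Z
  covariance-linearʳ ps c Y Y′ Z = trans (covariance-sym ps Y (λ d → Y′ d ⊕ c ⊗ Z d)) (trans (covariance-linearˡ ps c Y′ Z Y)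
    (cong₂ (λ x y → x ⊕ c ⊗ y) (covariance-sym ps Y′ Y) (covariance-sym ps Z Y)))

  -- The law of total variance at the prime p: the conditional mean contributes the form of Y + a p
  -- Yₚ, and the fluctuation of the variable at p contributes v p times the form of Yₚ.
  covariance-complete-square : ∀ p ps Y →
    let Ŷ = λ d → Y d ⊕ a p ⊗ Y (p * d) in
    covariance (p ∷ ps) Y Y ≡ covariance ps Ŷ Ŷ ⊕ v p ⊗ covariance ps (λ d → Y (p * d)) (λ d → Y (p * d))
  covariance-complete-square p ps Y = sym (begin
    C Ŷ Ŷ ⊕ v p ⊗ C Yₚ Yₚ
      ≡⟨ cong (_⊕ v p ⊗ C Yₚ Yₚ) (trans (covariance-linearˡ ps (a p) Y Yₚ Ŷ)
           (cong₂ (λ x y → x ⊕ a p ⊗ y) (covariance-linearʳ ps (a p) Y Y Yₚ) (covariance-linearʳ ps (a p) Yₚ Y Yₚ))) ⟩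
    (C Y Y ⊕ a p ⊗ C Y Yₚ) ⊕ a p ⊗ (C Yₚ Y ⊕ a p ⊗ C Yₚ Yₚ) ⊕ v p ⊗ C Yₚ Yₚ
      ≡⟨ solve 6 (λ x y z w a v → (x :+ a :* y) :+ a :* (z :+ a :* w) :+ v :* w := x :+ a :* z :+ a :* y :+ (a :* a :+ v) :* w) refl
           (C Y Y) (C Y Yₚ) (C Yₚ Y) (C Yₚ Yₚ) (a p) (v p) ⟩
    covariance (p ∷ ps) Y Y ∎)
    where
    open ≡-Reasoning
    C : (ℕ → ℚ) → (ℕ → ℚ) → ℚ
    C = covariance ps
    Yₚ Ŷ : ℕ → ℚ
    Yₚ d = Y (p * d)
    Ŷ d = Y d ⊕ a p ⊗ Y (p * d)

  covariance-mono : Nonneg a → Nonneg v → ∀ {ps} → Positive ps → ∀ {Y Z Y′ Z′} →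
    Nonneg Y → (∀ d → 0 < d → Y d ⩽ Z d) → Nonneg Y′ → (∀ d → 0 < d → Y′ d ⩽ Z′ d) →
    covariance ps Y Y′ ⩽ covariance ps Z Z′
  covariance-mono 0≤a 0≤v [] 0≤Y e 0≤Y′ e′ = ⊗-mono (0≤Y 1) (e 1 (s≤s z≤n)) (0≤Y′ 1) (e′ 1 (s≤s z≤n))
  covariance-mono 0≤a 0≤v {p ∷ ps} (0<p ∷ pos) {Y} {Z} {Y′} {Z′} 0≤Y e 0≤Y′ e′ =
    ⊕-mono (⊕-mono (⊕-mono (ih 0≤Y e 0≤Y′ e′) (⊗-monoˡ (a p) (0≤a p) (ih 0≤Yₚ eₚ 0≤Y′ e′)))
      (⊗-monoˡ (a p) (0≤a p) (ih 0≤Y e 0≤Y′ₚ e′ₚ)))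
      (⊗-monoˡ (a p ⊗ a p ⊕ v p) (⊕-nonneg (square-nonneg (a p)) (0≤v p)) (ih 0≤Yₚ eₚ 0≤Y′ₚ e′ₚ))
    where
    ih : ∀ {Y Z Y′ Z′} → Nonneg Y → (∀ d → 0 < d → Y d ⩽ Z d) → Nonneg Y′ → (∀ d → 0 < d → Y′ d ⩽ Z′ d) →
      covariance ps Y Y′ ⩽ covariance ps Z Z′
    ih = covariance-mono 0≤a 0≤v pos
    0≤Yₚ = λ d → 0≤Y (p * d)
    0≤Y′ₚ = λ d → 0≤Y′ (p * d)
    eₚ = λ d (0<d : 0 < d) → e (p * d) (*-pos 0<p 0<d)
    e′ₚ = λ d (0<d : 0 < d) → e′ (p * d) (*-pos 0<p 0<d)

-- Products of centred independent variables over different squarefree numbers are orthogonal. This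
-- is the diagonalisation of the form.
covariance-centred : ∀ v ps Y Y′ → covariance (λ _ → 0ℚ) v ps Y Y′ ≡ 𝕊 v ps (λ d → Y d ⊗ Y′ d)
covariance-centred v []       Y Y′ = refl
covariance-centred v (p ∷ ps) Y Y′ = trans
  (solve 5 (λ w x y z v → w :+ con 0ℚ :* x :+ con 0ℚ :* y :+ (con 0ℚ :* con 0ℚ :+ v) :* z := w :+ v :* z) refl
    (C Y Y′) (C Yₚ Y′) (C Y Y′ₚ) (C Yₚ Y′ₚ) (v p))
  (cong₂ (λ x y → x ⊕ v p ⊗ y) (covariance-centred v ps Y Y′) (covariance-centred v ps Yₚ Y′ₚ))
  where
  C = covariance (λ _ → 0ℚ) v ps
  Yₚ Y′ₚ : ℕ → ℚ
  Yₚ d = Y (p * d)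
  Y′ₚ d = Y′ (p * d)

⊕-decreasing : ∀ {R c Y Z} → 0ℚ ⩽ c → Decreasing R Y → Decreasing R Z → Decreasing R (λ d → Y d ⊕ c ⊗ Z d)
⊕-decreasing 0≤c DY DZ .nonneg d = ⊕-nonneg (nonneg DY d) (⊗-nonneg 0≤c (nonneg DZ d))
⊕-decreasing {c = c} 0≤c DY DZ .anti m≤n = ⊕-mono (anti DY m≤n) (⊗-monoˡ c 0≤c (anti DZ m≤n))
⊕-decreasing {c = c} 0≤c DY DZ .vanish n R<n = trans (cong₂ (λ x y → x ⊕ c ⊗ y) (vanish DY n R<n) (vanish DZ n R<n)) (trans (⊕-identityˡ (c ⊗ 0ℚ)) (ℚ.*-zeroʳ c))

-- The factor (1 + a)² in the variance pays for dropping the coprimality of s and d.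
covariance-≥ : ∀ {a h v} → Nonneg a → Nonneg h → Nonneg v → ∀ {R ps} → Positive ps →
  All (λ p → v p ≡ h p ⊗ ((1ℚ ⊕ a p) ⊗ (1ℚ ⊕ a p))) ps → ∀ {Y} → Decreasing R Y →
  𝕊 h ps (λ s → 𝕊 a ps (λ d → Y (s * d)) ⊗ 𝕊 a ps (λ d → Y (s * d))) ⩽ covariance a v ps Y Y
covariance-≥ 0≤a 0≤h 0≤v [] [] {Y} D = ⩽-refl
covariance-≥ {a} {h} {v} 0≤a 0≤h 0≤v {R} {p ∷ ps} (0<p ∷ pos) (e ∷ es) {Y} D = begin
  𝕊 h ps (λ s → K s ⊗ K s) ⊕ h p ⊗ 𝕊 h ps (λ s → K (p * s) ⊗ K (p * s))
    ≡⟨ cong₂ (λ x y → x ⊕ h p ⊗ y) (𝕊-cong h pos λ s _ → cong (λ t → t ⊗ t) (K≡ s))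
         (𝕊-cong h pos λ s _ → cong (λ t → t ⊗ t) (trans (K≡ (p * s)) (𝕊-cong a pos λ d _ → cong Ŷ (ℕ.*-assoc p s d)))) ⟩
  𝕊 h ps (λ s → 𝕊 a ps (λ d → Ŷ (s * d)) ⊗ 𝕊 a ps (λ d → Ŷ (s * d)))
    ⊕ h p ⊗ 𝕊 h ps (λ s → 𝕊 a ps (λ d → Ŷₚ (s * d)) ⊗ 𝕊 a ps (λ d → Ŷₚ (s * d)))
    ≤⟨ ⊕-mono (covariance-≥ 0≤a 0≤h 0≤v pos es DŶ) (⊗-monoˡ (h p) (0≤h p) (covariance-≥ 0≤a 0≤h 0≤v pos es (shift-decreasing 0<p DŶ))) ⟩
  -- `Ŷₚ d` contains the value Y (p p d). As Y decreases, this is at most Y (p d), so `Ŷₚ` is at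
  -- most (1 + a p) `Yₚ`, and the form at most (1 + a p)² times that of `Yₚ`.
  C Ŷ Ŷ ⊕ h p ⊗ C Ŷₚ Ŷₚ
    ≤⟨ ⊕-monoʳ (C Ŷ Ŷ) (⊗-monoˡ (h p) (0≤h p) (covariance-mono a v 0≤a 0≤v pos (λ d → nonneg DŶ (p * d)) Ŷₚ≤ (λ d → nonneg DŶ (p * d)) Ŷₚ≤)) ⟩
  C Ŷ Ŷ ⊕ h p ⊗ C Z Z
    ≡⟨ cong (λ x → C Ŷ Ŷ ⊕ h p ⊗ x) (trans (covariance-linearˡ a v ps (a p) Yₚ Yₚ Z)
         (cong (λ x → x ⊕ a p ⊗ x) (covariance-linearʳ a v ps (a p) Yₚ Yₚ Yₚ))) ⟩
  C Ŷ Ŷ ⊕ h p ⊗ ((C Yₚ Yₚ ⊕ a p ⊗ C Yₚ Yₚ) ⊕ a p ⊗ (C Yₚ Yₚ ⊕ a p ⊗ C Yₚ Yₚ))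
    ≡⟨ cong (C Ŷ Ŷ ⊕_) (trans (solve 3 (λ h a c → h :* ((c :+ a :* c) :+ a :* (c :+ a :* c)) := (h :* ((con 1ℚ :+ a) :* (con 1ℚ :+ a))) :* c) refl (h p) (a p) (C Yₚ Yₚ))
         (cong (_⊗ C Yₚ Yₚ) (sym e))) ⟩
  C Ŷ Ŷ ⊕ v p ⊗ C Yₚ Yₚ
    ≡⟨ covariance-complete-square a v p ps Y ⟨
  covariance a v (p ∷ ps) Y Y ∎
  where
  open ℚ.≤-Reasoning
  C = covariance a v ps
  Yₚ Ŷ Ŷₚ Z K : ℕ → ℚ
  Yₚ d = Y (p * d)
  Ŷ d = Y d ⊕ a p ⊗ Y (p * d)
  Ŷₚ d = Ŷ (p * d)
  Z d = Yₚ d ⊕ a p ⊗ Yₚ d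
  K s = 𝕊 a ps (λ d → Y (s * d)) ⊕ a p ⊗ 𝕊 a ps (λ d → Y (s * (p * d)))
  DŶ : Decreasing R Ŷ
  DŶ = ⊕-decreasing (0≤a p) D (shift-decreasing 0<p D)
  Ŷₚ≤ : ∀ d → 0 < d → Ŷₚ d ⩽ Z d
  Ŷₚ≤ d _ = ⊕-monoʳ (Yₚ d) (⊗-monoˡ (a p) (0≤a p) (anti D (m≤p*m (p * d) 0<p)))
  K≡ : ∀ s → K s ≡ 𝕊 a ps (λ d → Ŷ (s * d))
  K≡ s = sym (trans (𝕊-⊕ a ps (λ d → Y (s * d)) (λ d → a p ⊗ Y (p * (s * d))))
    (cong (𝕊 a ps (λ d → Y (s * d)) ⊕_) (trans (𝕊-⊗ a ps (a p) (λ d → Y (p * (s * d))))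
      (cong (a p ⊗_) (𝕊-cong a pos λ d _ → cong Y (sym (swap-* s p d)))))))

-- Moments of the sieve weight and their total deviation

Moment : Set
Moment = List ℕ → ℚ

_∷ᵐ_ : ℕ → Moment → Moment
(p ∷ᵐ m) T = m (p ∷ T)

∏ₑ : (ℕ → ℚ) → Moment
∏ₑ e []      = 1ℚ
∏ₑ e (p ∷ T) = e p ⊗ ∏ₑ e T

-- The expansion of (x + χ y)(x′ + χ y′) for χ = h - (1 + h) e with e idempotent, for which χ² = h²
-- + (1 - h²) e. The arguments x₃, x₅ and x₇ are the ones that carry a factor e.
combine : (h x₁ x₂ x₃ x₄ x₅ x₆ x₇ : ℚ) → ℚ
combine h x₁ x₂ x₃ x₄ x₅ x₆ x₇ = x₁ ⊕ (h ⊗ x₂ ⊖ (1ℚ ⊕ h) ⊗ x₃) ⊕ (h ⊗ x₄ ⊖ (1ℚ ⊕ h) ⊗ x₅) ⊕ (h ⊗ h ⊗ x₆ ⊕ (1ℚ ⊖ h ⊗ h) ⊗ x₇)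

combine-cong : ∀ h {x₁ x₂ x₃ x₄ x₅ x₆ x₇ y₁ y₂ y₃ y₄ y₅ y₆ y₇} → x₁ ≡ y₁ → x₂ ≡ y₂ → x₃ ≡ y₃ → x₄ ≡ y₄ → x₅ ≡ y₅ → x₆ ≡ y₆ → x₇ ≡ y₇ →
  combine h x₁ x₂ x₃ x₄ x₅ x₆ x₇ ≡ combine h y₁ y₂ y₃ y₄ y₅ y₆ y₇
combine-cong h refl refl refl refl refl refl refl = refl

module Moments (h : ℕ → ℚ) where

  -- The value on 𝕊 χ ps Y · 𝕊 χ ps Y′, where χ p = h p - (1 + h p) e p with
  -- e p idempotent, of the functional mapping ∏_{p ∈ T} e p to m T.
  eval : List ℕ → (ℕ → ℚ) → (ℕ → ℚ) → Moment → ℚ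
  eval []       Y Y′ m = Y 1 ⊗ Y′ 1 ⊗ m []
  eval (p ∷ ps) Y Y′ m =
    combine (h p) (eval ps Y Y′ m) (eval ps Yₚ Y′ m) (eval ps Yₚ Y′ (p ∷ᵐ m)) (eval ps Y Y′ₚ m)
      (eval ps Y Y′ₚ (p ∷ᵐ m)) (eval ps Yₚ Y′ₚ m) (eval ps Yₚ Y′ₚ (p ∷ᵐ m))
    where
    Yₚ Y′ₚ : ℕ → ℚ
    Yₚ d = Y (p * d)
    Y′ₚ d = Y′ (p * d)

  χ : (ℕ → ℚ) → ℕ → ℚ
  χ e p = h p ⊖ (1ℚ ⊕ h p) ⊗ e p

  eval-cong : ∀ ps Y Y′ {m m′} → (∀ T → m T ≡ m′ T) → eval ps Y Y′ m ≡ eval ps Y Y′ m′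
  eval-cong [] Y Y′ e = cong (Y 1 ⊗ Y′ 1 ⊗_) (e [])
  eval-cong (p ∷ ps) Y Y′ {m} {m′} e = combine-cong (h p) (ih Y Y′) (ih Yₚ Y′) (ihₚ Yₚ Y′) (ih Y Y′ₚ) (ihₚ Y Y′ₚ) (ih Yₚ Y′ₚ) (ihₚ Yₚ Y′ₚ)
    where
    Yₚ Y′ₚ : ℕ → ℚ
    Yₚ d = Y (p * d)
    Y′ₚ d = Y′ (p * d)
    ih : ∀ Y Y′ → eval ps Y Y′ m ≡ eval ps Y Y′ m′
    ih Y Y′ = eval-cong ps Y Y′ e
    ihₚ : ∀ Y Y′ → eval ps Y Y′ (p ∷ᵐ m) ≡ eval ps Y Y′ (p ∷ᵐ m′)
    ihₚ Y Y′ = eval-cong ps Y Y′ λ T → e (p ∷ T)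

  eval-⊗ : ∀ ps Y Y′ c m → eval ps Y Y′ (λ T → c ⊗ m T) ≡ c ⊗ eval ps Y Y′ m
  eval-⊗ [] Y Y′ c m = solve 3 (λ y c m → y :* (c :* m) := c :* (y :* m)) refl (Y 1 ⊗ Y′ 1) c (m [])
  eval-⊗ (p ∷ ps) Y Y′ c m = begin
    combine (h p) (eval-c Y Y′ m) (eval-c Yₚ Y′ m) (eval-c Yₚ Y′ mₚ) (eval-c Y Y′ₚ m) (eval-c Y Y′ₚ mₚ) (eval-c Yₚ Y′ₚ m) (eval-c Yₚ Y′ₚ mₚ)
      ≡⟨ combine-cong (h p) (eval-⊗ ps Y Y′ c m) (eval-⊗ ps Yₚ Y′ c m) (eval-⊗ ps Yₚ Y′ c mₚ) (eval-⊗ ps Y Y′ₚ c m) (eval-⊗ ps Y Y′ₚ c mₚ) (eval-⊗ ps Yₚ Y′ₚ c m) (eval-⊗ ps Yₚ Y′ₚ c mₚ) ⟩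
    combine (h p) (c ⊗ V Y Y′ m) (c ⊗ V Yₚ Y′ m) (c ⊗ V Yₚ Y′ mₚ) (c ⊗ V Y Y′ₚ m) (c ⊗ V Y Y′ₚ mₚ) (c ⊗ V Yₚ Y′ₚ m) (c ⊗ V Yₚ Y′ₚ mₚ)
      ≡⟨ solve 9 (λ h c x₁ x₂ x₃ x₄ x₅ x₆ x₇ →
           c :* x₁ :+ (h :* (c :* x₂) :- (con 1ℚ :+ h) :* (c :* x₃)) :+ (h :* (c :* x₄) :- (con 1ℚ :+ h) :* (c :* x₅)) :+ (h :* h :* (c :* x₆) :+ (con 1ℚ :- h :* h) :* (c :* x₇))
           := c :* (x₁ :+ (h :* x₂ :- (con 1ℚ :+ h) :* x₃) :+ (h :* x₄ :- (con 1ℚ :+ h) :* x₅) :+ (h :* h :* x₆ :+ (con 1ℚ :- h :* h) :* x₇))) refl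
           (h p) c (V Y Y′ m) (V Yₚ Y′ m) (V Yₚ Y′ mₚ) (V Y Y′ₚ m) (V Y Y′ₚ mₚ) (V Yₚ Y′ₚ m) (V Yₚ Y′ₚ mₚ) ⟩
    c ⊗ eval (p ∷ ps) Y Y′ m ∎
    where
    open ≡-Reasoning
    V = eval ps
    mₚ = p ∷ᵐ m
    eval-c : (ℕ → ℚ) → (ℕ → ℚ) → Moment → ℚ
    eval-c Y Y′ m = eval ps Y Y′ (λ T → c ⊗ m T)
    Yₚ Y′ₚ : ℕ → ℚ
    Yₚ d = Y (p * d)
    Y′ₚ d = Y′ (p * d)

  eval-⊕ : ∀ ps Y Y′ m m′ → eval ps Y Y′ (λ T → m T ⊕ m′ T) ≡ eval ps Y Y′ m ⊕ eval ps Y Y′ m′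
  eval-⊕ [] Y Y′ m m′ = ℚ.*-distribˡ-+ (Y 1 ⊗ Y′ 1) (m []) (m′ [])
  eval-⊕ (p ∷ ps) Y Y′ m m′ = trans
    (combine-cong (h p) (eval-⊕ ps Y Y′ m m′) (eval-⊕ ps Yₚ Y′ m m′) (eval-⊕ ps Yₚ Y′ mₚ m′ₚ) (eval-⊕ ps Y Y′ₚ m m′) (eval-⊕ ps Y Y′ₚ mₚ m′ₚ) (eval-⊕ ps Yₚ Y′ₚ m m′) (eval-⊕ ps Yₚ Y′ₚ mₚ m′ₚ))
    (solve 15 (λ h x₁ x₂ x₃ x₄ x₅ x₆ x₇ y₁ y₂ y₃ y₄ y₅ y₆ y₇ →
           (x₁ :+ y₁) :+ (h :* (x₂ :+ y₂) :- (con 1ℚ :+ h) :* (x₃ :+ y₃)) :+ (h :* (x₄ :+ y₄) :- (con 1ℚ :+ h) :* (x₅ :+ y₅)) :+ (h :* h :* (x₆ :+ y₆) :+ (con 1ℚ :- h :* h) :* (x₇ :+ y₇))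
           := (x₁ :+ (h :* x₂ :- (con 1ℚ :+ h) :* x₃) :+ (h :* x₄ :- (con 1ℚ :+ h) :* x₅) :+ (h :* h :* x₆ :+ (con 1ℚ :- h :* h) :* x₇))
           :+ (y₁ :+ (h :* y₂ :- (con 1ℚ :+ h) :* y₃) :+ (h :* y₄ :- (con 1ℚ :+ h) :* y₅) :+ (h :* h :* y₆ :+ (con 1ℚ :- h :* h) :* y₇))) refl
           (h p) (V Y Y′ m) (V Yₚ Y′ m) (V Yₚ Y′ mₚ) (V Y Y′ₚ m) (V Y Y′ₚ mₚ) (V Yₚ Y′ₚ m) (V Yₚ Y′ₚ mₚ)
           (V Y Y′ m′) (V Yₚ Y′ m′) (V Yₚ Y′ m′ₚ) (V Y Y′ₚ m′) (V Y Y′ₚ m′ₚ) (V Yₚ Y′ₚ m′) (V Yₚ Y′ₚ m′ₚ))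
    where
    V = eval ps
    mₚ = p ∷ᵐ m
    m′ₚ = p ∷ᵐ m′
    Yₚ Y′ₚ : ℕ → ℚ
    Yₚ d = Y (p * d)
    Y′ₚ d = Y′ (p * d)

  eval-∏ₑ : ∀ (e : ℕ → ℚ) → (∀ p → e p ⊗ e p ≡ e p) → ∀ ps Y Y′ →
    eval ps Y Y′ (∏ₑ e) ≡ 𝕊 (χ e) ps Y ⊗ 𝕊 (χ e) ps Y′
  eval-∏ₑ e idem [] Y Y′ = ℚ.*-identityʳ (Y 1 ⊗ Y′ 1)
  eval-∏ₑ e idem (p ∷ ps) Y Y′ = begin
    eval (p ∷ ps) Y Y′ (∏ₑ e)
      ≡⟨ combine-cong (h p) (eval-∏ₑ e idem ps Y Y′) (eval-∏ₑ e idem ps Yₚ Y′) (ihₚ Yₚ Y′) (eval-∏ₑ e idem ps Y Y′ₚ) (ihₚ Y Y′ₚ) (eval-∏ₑ e idem ps Yₚ Y′ₚ) (ihₚ Yₚ Y′ₚ) ⟩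
    (x ⊗ x′) ⊕ (h p ⊗ (y ⊗ x′) ⊖ (1ℚ ⊕ h p) ⊗ (e p ⊗ (y ⊗ x′))) ⊕ (h p ⊗ (x ⊗ y′) ⊖ (1ℚ ⊕ h p) ⊗ (e p ⊗ (x ⊗ y′)))
      ⊕ (h p ⊗ h p ⊗ (y ⊗ y′) ⊕ (1ℚ ⊖ h p ⊗ h p) ⊗ (e p ⊗ (y ⊗ y′)))
      ≡⟨ solve 6 (λ x x′ y y′ h e →
          (x :* x′) :+ (h :* (y :* x′) :- (con 1ℚ :+ h) :* (e :* (y :* x′))) :+ (h :* (x :* y′) :- (con 1ℚ :+ h) :* (e :* (x :* y′)))
            :+ (h :* h :* (y :* y′) :+ (con 1ℚ :- h :* h) :* (e :* (y :* y′)))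
          := (x :+ (h :- (con 1ℚ :+ h) :* e) :* y) :* (x′ :+ (h :- (con 1ℚ :+ h) :* e) :* y′) :- (con 1ℚ :+ h) :* (con 1ℚ :+ h) :* (y :* y′) :* (e :* e :- e)) refl x x′ y y′ (h p) (e p) ⟩
    𝕊 (χ e) (p ∷ ps) Y ⊗ 𝕊 (χ e) (p ∷ ps) Y′ ⊖ (1ℚ ⊕ h p) ⊗ (1ℚ ⊕ h p) ⊗ (y ⊗ y′) ⊗ (e p ⊗ e p ⊖ e p)
      ≡⟨ cong (λ t → 𝕊 (χ e) (p ∷ ps) Y ⊗ 𝕊 (χ e) (p ∷ ps) Y′ ⊖ (1ℚ ⊕ h p) ⊗ (1ℚ ⊕ h p) ⊗ (y ⊗ y′) ⊗ (t ⊖ e p)) (idem p) ⟩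
    𝕊 (χ e) (p ∷ ps) Y ⊗ 𝕊 (χ e) (p ∷ ps) Y′ ⊖ (1ℚ ⊕ h p) ⊗ (1ℚ ⊕ h p) ⊗ (y ⊗ y′) ⊗ (e p ⊖ e p)
      ≡⟨ solve 3 (λ a b e → a :- b :* (e :- e) := a) refl (𝕊 (χ e) (p ∷ ps) Y ⊗ 𝕊 (χ e) (p ∷ ps) Y′) ((1ℚ ⊕ h p) ⊗ (1ℚ ⊕ h p) ⊗ (y ⊗ y′)) (e p) ⟩
    𝕊 (χ e) (p ∷ ps) Y ⊗ 𝕊 (χ e) (p ∷ ps) Y′ ∎
    where
    open ≡-Reasoning
    Yₚ Y′ₚ : ℕ → ℚ
    Yₚ d = Y (p * d)
    Y′ₚ d = Y′ (p * d)
    x = 𝕊 (χ e) ps Y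
    x′ = 𝕊 (χ e) ps Y′
    y = 𝕊 (χ e) ps Yₚ
    y′ = 𝕊 (χ e) ps Y′ₚ
    ihₚ : ∀ Y Y′ → eval ps Y Y′ (p ∷ᵐ ∏ₑ e) ≡ e p ⊗ (𝕊 (χ e) ps Y ⊗ 𝕊 (χ e) ps Y′)
    ihₚ Y Y′ = trans (eval-⊗ ps Y Y′ (e p) (∏ₑ e)) (cong (e p ⊗_) (eval-∏ₑ e idem ps Y Y′))

  -- The weighted sum over n depends on f and e only through the moments, and linearly. Hence its
  -- deviation from the independent model is `eval` of the difference of the moments.
  eval-∑ : ∀ N (f : ℕ → ℚ) (e : ℕ → ℕ → ℚ) → (∀ n p → e n p ⊗ e n p ≡ e n p) → ∀ ps Y Y′ →
    ∑ N (λ n → f n ⊗ (𝕊 (χ (e n)) ps Y ⊗ 𝕊 (χ (e n)) ps Y′)) ≡ eval ps Y Y′ (λ T → ∑ N (λ n → f n ⊗ ∏ₑ (e n) T))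
  eval-∑ zero f e idem ps Y Y′ = sym (trans (eval-cong ps Y Y′ λ T → sym (ℚ.*-zeroˡ 1ℚ)) (trans (eval-⊗ ps Y Y′ 0ℚ (λ _ → 1ℚ)) (ℚ.*-zeroˡ (eval ps Y Y′ (λ _ → 1ℚ)))))
  eval-∑ (suc N) f e idem ps Y Y′ = sym (trans
    (eval-⊕ ps Y Y′ (λ T → ∑ N (λ n → f n ⊗ ∏ₑ (e n) T)) (λ T → f (suc N) ⊗ ∏ₑ (e (suc N)) T))
    (cong₂ _⊕_ (sym (eval-∑ N f e idem ps Y Y′))
      (trans (eval-⊗ ps Y Y′ (f (suc N)) (∏ₑ (e (suc N)))) (cong (f (suc N) ⊗_) (eval-∏ₑ (e (suc N)) (idem (suc N)) ps Y Y′)))))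

  -- Multiplicative moments describe independent indicators of density g p. The hypotheses compute
  -- the mean a p of χ and its second moment a p² + v p.
  eval-independent : ∀ {g a v} ps → All (λ p → h p ⊖ (1ℚ ⊕ h p) ⊗ g p ≡ a p) ps →
    All (λ p → h p ⊗ h p ⊕ (1ℚ ⊖ h p ⊗ h p) ⊗ g p ≡ a p ⊗ a p ⊕ v p) ps → ∀ Y Y′ →
    eval ps Y Y′ (∏ₑ g) ≡ covariance a v ps Y Y′
  eval-independent [] [] [] Y Y′ = ℚ.*-identityʳ (Y 1 ⊗ Y′ 1)
  eval-independent {g} {a} {v} (p ∷ ps) (e₁ ∷ es₁) (e₂ ∷ es₂) Y Y′ = begin
    eval (p ∷ ps) Y Y′ (∏ₑ g)
      ≡⟨ combine-cong (h p) (ih Y Y′) (ih Yₚ Y′) (ihₚ Yₚ Y′) (ih Y Y′ₚ) (ihₚ Y Y′ₚ) (ih Yₚ Y′ₚ) (ihₚ Yₚ Y′ₚ) ⟩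
    x₁ ⊕ (h p ⊗ x₂ ⊖ (1ℚ ⊕ h p) ⊗ (g p ⊗ x₂)) ⊕ (h p ⊗ x₃ ⊖ (1ℚ ⊕ h p) ⊗ (g p ⊗ x₃)) ⊕ (h p ⊗ h p ⊗ x₄ ⊕ (1ℚ ⊖ h p ⊗ h p) ⊗ (g p ⊗ x₄))
      ≡⟨ solve 6 (λ x₁ x₂ x₃ x₄ h g →
           x₁ :+ (h :* x₂ :- (con 1ℚ :+ h) :* (g :* x₂)) :+ (h :* x₃ :- (con 1ℚ :+ h) :* (g :* x₃)) :+ (h :* h :* x₄ :+ (con 1ℚ :- h :* h) :* (g :* x₄))
           := x₁ :+ (h :- (con 1ℚ :+ h) :* g) :* x₂ :+ (h :- (con 1ℚ :+ h) :* g) :* x₃ :+ (h :* h :+ (con 1ℚ :- h :* h) :* g) :* x₄) refl x₁ x₂ x₃ x₄ (h p) (g p) ⟩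
    x₁ ⊕ (h p ⊖ (1ℚ ⊕ h p) ⊗ g p) ⊗ x₂ ⊕ (h p ⊖ (1ℚ ⊕ h p) ⊗ g p) ⊗ x₃ ⊕ (h p ⊗ h p ⊕ (1ℚ ⊖ h p ⊗ h p) ⊗ g p) ⊗ x₄
      ≡⟨ cong₂ (λ s t → x₁ ⊕ s ⊗ x₂ ⊕ s ⊗ x₃ ⊕ t ⊗ x₄) e₁ e₂ ⟩
    covariance a v (p ∷ ps) Y Y′ ∎
    where
    open ≡-Reasoning
    Yₚ Y′ₚ : ℕ → ℚ
    Yₚ d = Y (p * d)
    Y′ₚ d = Y′ (p * d)
    x₁ = covariance a v ps Y Y′
    x₂ = covariance a v ps Yₚ Y′
    x₃ = covariance a v ps Y Y′ₚ
    x₄ = covariance a v ps Yₚ Y′ₚ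
    ih : ∀ Y Y′ → eval ps Y Y′ (∏ₑ g) ≡ covariance a v ps Y Y′
    ih = eval-independent ps es₁ es₂
    ihₚ : ∀ Y Y′ → eval ps Y Y′ (p ∷ᵐ ∏ₑ g) ≡ g p ⊗ covariance a v ps Y Y′
    ihₚ Y Y′ = trans (eval-⊗ ps Y Y′ (g p) (∏ₑ g)) (cong (g p ⊗_) (ih Y Y′))

open Moments

-- ∑ over all sublists T of ps, weighted by c^∣T∣.
𝕃 : ℚ → List ℕ → (List ℕ → ℚ) → ℚ
𝕃 c []       K = K []
𝕃 c (p ∷ ps) K = 𝕃 c ps K ⊕ c ⊗ 𝕃 c ps (λ T → K (p ∷ T))

𝕃-mono : ∀ {c} → 0ℚ ⩽ c → ∀ ps {K K′} → (∀ T → T ⊆ ps → K T ⩽ K′ T) → 𝕃 c ps K ⩽ 𝕃 c ps K′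
𝕃-mono 0≤c [] e = e [] []
𝕃-mono {c} 0≤c (p ∷ ps) e = ⊕-mono (𝕃-mono 0≤c ps λ T τ → e T (p ∷ʳ τ)) (⊗-monoˡ c 0≤c (𝕃-mono 0≤c ps λ T τ → e (p ∷ T) (refl ∷ τ)))

𝕃-cong : ∀ c ps {K K′} → (∀ T → K T ≡ K′ T) → 𝕃 c ps K ≡ 𝕃 c ps K′
𝕃-cong c [] e = e []
𝕃-cong c (p ∷ ps) e = cong₂ (λ x y → x ⊕ c ⊗ y) (𝕃-cong c ps e) (𝕃-cong c ps λ T → e (p ∷ T))

𝕃-nonneg : ∀ {c} → 0ℚ ⩽ c → ∀ ps {K} → Nonneg K → 0ℚ ⩽ 𝕃 c ps K
𝕃-nonneg 0≤c [] e = e []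
𝕃-nonneg {c} 0≤c (p ∷ ps) e = ⊕-nonneg (𝕃-nonneg 0≤c ps e) (⊗-nonneg 0≤c (𝕃-nonneg 0≤c ps λ T → e (p ∷ T)))

pow : ℚ → List ℕ → ℚ
pow c T = ∏ₑ (λ _ → c) T

∏ₑ-nonneg : ∀ {u} → Nonneg u → Nonneg (∏ₑ u)
∏ₑ-nonneg 0≤u []      = 0≤1
∏ₑ-nonneg 0≤u (p ∷ T) = ⊗-nonneg (0≤u p) (∏ₑ-nonneg 0≤u T)

-- The elementary inequality s ≤ t + s² / t decouples the weights from the errors.
𝕃-split : ∀ {c t} → 0ℚ ⩽ c → 0ℚ ≺ t → ∀ ps s → 0ℚ ⩽ s → ∀ {K e f : List ℕ → ℚ} →
  (∀ T → T ⊆ ps → 0ℚ ⩽ K T) → (∀ T → T ⊆ ps → K T ⩽ e T) → (∀ T → T ⊆ ps → K T ⩽ f T) →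
  s ⊗ 𝕃 c ps K ⩽ t ⊗ 𝕃 1ℚ ps e ⊕ s ⊗ s ⊗ invℚ t ⊗ 𝕃 (c ⊗ c) ps f
𝕃-split {c} {t} 0≤c 0<t [] s 0≤s {K} {e} {f} 0≤K K≤e K≤f = begin
  s ⊗ K []                                   ≤⟨ ⊗-monoʳ (K []) (0≤K [] []) s≤ ⟩
  (t ⊕ s ⊗ s ⊗ invℚ t) ⊗ K []                ≡⟨ ℚ.*-distribʳ-+ (K []) t (s ⊗ s ⊗ invℚ t) ⟩
  t ⊗ K [] ⊕ s ⊗ s ⊗ invℚ t ⊗ K []           ≤⟨ ⊕-mono (⊗-monoˡ t (≺⇒⩽ 0<t) (K≤e [] [])) (⊗-monoˡ (s ⊗ s ⊗ invℚ t) 0≤q (K≤f [] [])) ⟩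
  t ⊗ e [] ⊕ s ⊗ s ⊗ invℚ t ⊗ f []           ∎
  where
  open ℚ.≤-Reasoning
  0≤q : 0ℚ ⩽ s ⊗ s ⊗ invℚ t
  0≤q = ⊗-nonneg (⊗-nonneg 0≤s 0≤s) (≺⇒⩽ (invℚ-pos 0<t))
  s≤ : s ⩽ t ⊕ s ⊗ s ⊗ invℚ t
  s≤ with ℚ.≤-total s t
  ... | inj₁ s≤t = ⩽-trans s≤t (≤⊕ʳ 0≤q)
  ... | inj₂ t≤s = ⩽-trans (≤-div 0<t (⊗-monoʳ s 0≤s t≤s)) (≤⊕ˡ (≺⇒⩽ 0<t))
𝕃-split {c} {t} 0≤c 0<t (p ∷ ps) s 0≤s {K} {e} {f} 0≤K K≤e K≤f = begin
  s ⊗ (𝕃 c ps K ⊕ c ⊗ 𝕃 c ps Kₚ)                 ≡⟨ solve 4 (λ s c x y → s :* (x :+ c :* y) := s :* x :+ s :* c :* y) refl s c (𝕃 c ps K) (𝕃 c ps Kₚ) ⟩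
  s ⊗ 𝕃 c ps K ⊕ s ⊗ c ⊗ 𝕃 c ps Kₚ
    ≤⟨ ⊕-mono (𝕃-split 0≤c 0<t ps s 0≤s (λ T τ → 0≤K T (p ∷ʳ τ)) (λ T τ → K≤e T (p ∷ʳ τ)) (λ T τ → K≤f T (p ∷ʳ τ)))
         (𝕃-split 0≤c 0<t ps (s ⊗ c) (⊗-nonneg 0≤s 0≤c) (λ T τ → 0≤K (p ∷ T) (refl ∷ τ)) (λ T τ → K≤e (p ∷ T) (refl ∷ τ)) (λ T τ → K≤f (p ∷ T) (refl ∷ τ))) ⟩
  (t ⊗ E ⊕ s ⊗ s ⊗ invℚ t ⊗ F) ⊕ (t ⊗ Eₚ ⊕ s ⊗ c ⊗ (s ⊗ c) ⊗ invℚ t ⊗ Fₚ)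
    ≡⟨ solve 8 (λ t E Eₚ F Fₚ s c i → (t :* E :+ s :* s :* i :* F) :+ (t :* Eₚ :+ s :* c :* (s :* c) :* i :* Fₚ)
         := t :* (E :+ con 1ℚ :* Eₚ) :+ s :* s :* i :* (F :+ c :* c :* Fₚ)) refl t E Eₚ F Fₚ s c (invℚ t) ⟩
  t ⊗ (E ⊕ 1ℚ ⊗ Eₚ) ⊕ s ⊗ s ⊗ invℚ t ⊗ (F ⊕ c ⊗ c ⊗ Fₚ) ∎
  where
  open ℚ.≤-Reasoning
  Kₚ = λ T → K (p ∷ T)
  E = 𝕃 1ℚ ps e
  Eₚ = 𝕃 1ℚ ps (λ T → e (p ∷ T))
  F = 𝕃 (c ⊗ c) ps f
  Fₚ = 𝕃 (c ⊗ c) ps (λ T → f (p ∷ T))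

𝕃-⊗ : ∀ c ps a K → 𝕃 c ps (λ T → a ⊗ K T) ≡ a ⊗ 𝕃 c ps K
𝕃-⊗ c [] a K = refl
𝕃-⊗ c (p ∷ ps) a K = trans (cong₂ (λ x y → x ⊕ c ⊗ y) (𝕃-⊗ c ps a K) (𝕃-⊗ c ps a (λ T → K (p ∷ T))))
  (solve 4 (λ a c x y → a :* x :+ c :* (a :* y) := a :* (x :+ c :* y)) refl a c (𝕃 c ps K) (𝕃 c ps (λ T → K (p ∷ T))))

𝕃-pow : ∀ c k ps K → 𝕃 c ps (λ T → pow k T ⊗ K T) ≡ 𝕃 (c ⊗ k) ps K
𝕃-pow c k [] K = ℚ.*-identityˡ (K [])
𝕃-pow c k (p ∷ ps) K = cong₂ _⊕_ (𝕃-pow c k ps K) (begin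
  c ⊗ 𝕃 c ps (λ T → k ⊗ pow k T ⊗ K (p ∷ T))      ≡⟨ cong (c ⊗_) (𝕃-cong c ps λ T → ℚ.*-assoc k (pow k T) (K (p ∷ T))) ⟩
  c ⊗ 𝕃 c ps (λ T → k ⊗ (pow k T ⊗ K (p ∷ T)))    ≡⟨ cong (c ⊗_) (𝕃-⊗ c ps k (λ T → pow k T ⊗ K (p ∷ T))) ⟩
  c ⊗ (k ⊗ 𝕃 c ps (λ T → pow k T ⊗ K (p ∷ T)))    ≡⟨ ℚ.*-assoc c k (𝕃 c ps (λ T → pow k T ⊗ K (p ∷ T))) ⟨
  c ⊗ k ⊗ 𝕃 c ps (λ T → pow k T ⊗ K (p ∷ T))      ≡⟨ cong (c ⊗ k ⊗_) (𝕃-pow c k ps (λ T → K (p ∷ T))) ⟩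
  c ⊗ k ⊗ 𝕃 (c ⊗ k) ps (λ T → K (p ∷ T))          ∎)
  where
  open ≡-Reasoning

𝕃-𝕊 : ∀ c u ps (F : ℕ → ℚ) → 𝕃 c ps (λ T → ∏ₑ u T ⊗ F (product T)) ≡ 𝕊 (λ p → c ⊗ u p) ps F
𝕃-𝕊 c u [] F = ℚ.*-identityˡ (F 1)
𝕃-𝕊 c u (p ∷ ps) F = cong₂ _⊕_ (𝕃-𝕊 c u ps F) (begin
  c ⊗ 𝕃 c ps (λ T → u p ⊗ ∏ₑ u T ⊗ F (p * product T))      ≡⟨ cong (c ⊗_) (𝕃-cong c ps λ T → ℚ.*-assoc (u p) (∏ₑ u T) (F (p * product T))) ⟩
  c ⊗ 𝕃 c ps (λ T → u p ⊗ (∏ₑ u T ⊗ F (p * product T)))    ≡⟨ cong (c ⊗_) (𝕃-⊗ c ps (u p) (λ T → ∏ₑ u T ⊗ F (p * product T))) ⟩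
  c ⊗ (u p ⊗ 𝕃 c ps (λ T → ∏ₑ u T ⊗ F (p * product T)))    ≡⟨ ℚ.*-assoc c (u p) (𝕃 c ps (λ T → ∏ₑ u T ⊗ F (p * product T))) ⟨
  c ⊗ u p ⊗ 𝕃 c ps (λ T → ∏ₑ u T ⊗ F (p * product T))      ≡⟨ cong (c ⊗ u p ⊗_) (𝕃-𝕊 c u ps (λ d → F (p * d))) ⟩
  c ⊗ u p ⊗ 𝕊 (λ p → c ⊗ u p) ps (λ d → F (p * d))           ∎)
  where
  open ≡-Reasoning

module _ {h : ℕ → ℚ} (0≤h : Nonneg h) (R : ℕ) {y₀ : ℚ} (0≤y₀ : 0ℚ ⩽ y₀) where

  Mass : List ℕ → ℕ → ℚ
  Mass ps x = 𝕊 h ps (λ r → 𝟙 (x * r ℕ.≤? R))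

  -- Every prime of T divides one of two indices that are at most R, so only T with product at most
  -- R² matter. The number s is the product of the primes assigned so far.
  Level : ℕ → Moment → Moment
  Level s m T = 𝟙 (s * product T ℕ.≤? R * R) ⊗ ∥ m T ∥

  private
    Bounded : ℕ → ℕ → (ℕ → ℚ) → Set
    Bounded t x Y = ∀ r → 0 < r → ∥ Y r ∥ ⩽ y₀ ⊗ 𝟙 (t * x * r ℕ.≤? R)

    Mass-nonneg : ∀ ps x → 0ℚ ⩽ Mass ps x
    Mass-nonneg ps x = 𝕊-nonneg 0≤h ps λ r → 𝟙-nonneg (x * r ℕ.≤? R)

    Level-nonneg : ∀ s m → Nonneg (Level s m)
    Level-nonneg s m T = ⊗-nonneg (𝟙-nonneg (s * product T ℕ.≤? R * R)) (∥∥-nonneg (m T))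

    Total : List ℕ → ℕ → Moment → ℚ
    Total ps s m = 𝕃 (# 5) ps (Level s m)

    bound : ℚ → ℚ → ℚ → ℚ
    bound A A′ C = y₀ ⊗ y₀ ⊗ (A ⊗ A′ ⊗ C)

  -- In a pair (r , r′) write r = t x d and r′ = t′ x′ d′, where the primes of t
  -- and t′ have been assigned to T and those of x and x′ carry the weight h.
  eval-bounded : ∀ {ps} → Positive ps → All (λ p → h p ⩽ 1ℚ) ps → ∀ {t x t′ x′} → 0 < t → 0 < x → 0 < t′ → 0 < x′ →
    ∀ {Y Y′} → Bounded t x Y → Bounded t′ x′ Y′ → ∀ m →
    ∥ eval h ps Y Y′ m ∥ ⩽ y₀ ⊗ y₀ ⊗ (Mass ps x ⊗ Mass ps x′ ⊗ 𝕃 (# 5) ps (Level (t * t′) m))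
  eval-bounded [] [] {t} {x} {t′} {x′} 0<t 0<x 0<t′ 0<x′ {Y} {Y′} BY BY′ m = begin
    ∥ Y 1 ⊗ Y′ 1 ⊗ m [] ∥               ≡⟨ trans (∥∥-⊗ (Y 1 ⊗ Y′ 1) (m [])) (cong (_⊗ ∥ m [] ∥) (∥∥-⊗ (Y 1) (Y′ 1))) ⟩
    ∥ Y 1 ∥ ⊗ ∥ Y′ 1 ∥ ⊗ ∥ m [] ∥       ≤⟨ ⊗-monoʳ ∥ m [] ∥ (∥∥-nonneg (m [])) (⊗-mono (∥∥-nonneg (Y 1)) (BY 1 (s≤s z≤n)) (∥∥-nonneg (Y′ 1)) (BY′ 1 (s≤s z≤n))) ⟩
    y₀ ⊗ i ⊗ (y₀ ⊗ i′) ⊗ ∥ m [] ∥       ≡⟨ solve 4 (λ y i j m → y :* i :* (y :* j) :* m := y :* y :* (i :* j :* m)) refl y₀ i i′ ∥ m [] ∥ ⟩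
    y₀ ⊗ y₀ ⊗ (i ⊗ i′ ⊗ ∥ m [] ∥)       ≤⟨ ⊗-monoˡ (y₀ ⊗ y₀) (⊗-nonneg 0≤y₀ 0≤y₀) (⊗-monoʳ ∥ m [] ∥ (∥∥-nonneg (m [])) (three (t * x * 1 ℕ.≤? R) (t′ * x′ * 1 ℕ.≤? R) (x * 1 ℕ.≤? R) (x′ * 1 ℕ.≤? R) (t * t′ * 1 ℕ.≤? R * R)
        (ℕ.≤-trans (ℕ.*-monoˡ-≤ 1 (m≤p*m x 0<t))) (ℕ.≤-trans (ℕ.*-monoˡ-≤ 1 (m≤p*m x′ 0<t′))) λ p q → ℕ.≤-trans (ℕ.≤-reflexive (ℕ.*-identityʳ (t * t′)))
          (ℕ.*-mono-≤ (ℕ.≤-trans (t≤ t x 0<x) p) (ℕ.≤-trans (t≤ t′ x′ 0<x′) q)))) ⟩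
    y₀ ⊗ y₀ ⊗ (j ⊗ j′ ⊗ l ⊗ ∥ m [] ∥)   ≡⟨ cong (y₀ ⊗ y₀ ⊗_) (ℚ.*-assoc (j ⊗ j′) l ∥ m [] ∥) ⟩
    y₀ ⊗ y₀ ⊗ (j ⊗ j′ ⊗ (l ⊗ ∥ m [] ∥)) ∎
    where
    open ℚ.≤-Reasoning
    i = 𝟙 (t * x * 1 ℕ.≤? R)
    i′ = 𝟙 (t′ * x′ * 1 ℕ.≤? R)
    j = 𝟙 (x * 1 ℕ.≤? R)
    j′ = 𝟙 (x′ * 1 ℕ.≤? R)
    l = 𝟙 (t * t′ * 1 ℕ.≤? R * R)
    t≤ : ∀ t x → 0 < x → t ≤ t * x * 1
    t≤ t x@(suc _) _ = ℕ.≤-trans (ℕ.m≤m*n t x) (ℕ.≤-reflexive (sym (ℕ.*-identityʳ (t * x))))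
    three : ∀ {P P′ Q Q′ L : Set} (p : Dec P) (p′ : Dec P′) (q : Dec Q) (q′ : Dec Q′) (l : Dec L) → (P → Q) → (P′ → Q′) → (P → P′ → L) →
      𝟙 p ⊗ 𝟙 p′ ⩽ 𝟙 q ⊗ 𝟙 q′ ⊗ 𝟙 l
    three (yes p) (yes p′) q q′ l f g k rewrite 𝟙-yes q (f p) | 𝟙-yes q′ (g p′) | 𝟙-yes l (k p p′) = ⩽-refl
    three (no _) p′ q q′ l f g k = ⩽-trans (≡⇒⩽ (ℚ.*-zeroˡ (𝟙 p′))) (⊗-nonneg (⊗-nonneg (𝟙-nonneg q) (𝟙-nonneg q′)) (𝟙-nonneg l))
    three (yes _) (no _) q q′ l f g k = ⊗-nonneg (⊗-nonneg (𝟙-nonneg q) (𝟙-nonneg q′)) (𝟙-nonneg l)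
  eval-bounded {p ∷ ps} (0<p ∷ pos) (h≤1 ∷ hs) {t} {x} {t′} {x′} 0<t 0<x 0<t′ 0<x′ {Y} {Y′} BY BY′ m = begin
    ∥ v₁ ⊕ (h p ⊗ v₂ ⊖ (1ℚ ⊕ h p) ⊗ v₃) ⊕ (h p ⊗ v₄ ⊖ (1ℚ ⊕ h p) ⊗ v₅) ⊕ (h p ⊗ h p ⊗ v₆ ⊕ (1ℚ ⊖ h p ⊗ h p) ⊗ v₇) ∥
      ≤⟨ ⩽-trans (∥∥-⊕ (v₁ ⊕ w₂ ⊕ w₃) w₄) (⊕-mono (⩽-trans (∥∥-⊕ (v₁ ⊕ w₂) w₃) (⊕-mono (∥∥-⊕ v₁ w₂) ⩽-refl)) ⩽-refl) ⟩
    ∥ v₁ ∥ ⊕ ∥ w₂ ∥ ⊕ ∥ w₃ ∥ ⊕ ∥ w₄ ∥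
      ≤⟨ ⊕-mono (⊕-mono (⊕-mono b₁ (lin v₂ v₃ b₂ b₃)) (lin v₄ v₅ b₄ b₅)) quad ⟩
    -- The constant 5 of the bound arises here: e occurs with coefficient at most 1 + h ≤ 2 when p
    -- divides only r or only r′, and with 1 - h² ≤ 1 when p divides both.
    bound A A′ C ⊕ (h p ⊗ bound Aₚ A′ C ⊕ # 2 ⊗ bound A A′ Cₚ) ⊕ (h p ⊗ bound A A′ₚ C ⊕ # 2 ⊗ bound A A′ Cₚ) ⊕ (h p ⊗ h p ⊗ bound Aₚ A′ₚ C ⊕ bound A A′ Cₚ)
      ≡⟨ solve 9 (λ y A Aₚ A′ A′ₚ C Cₚ h w →
           y :* (A :* A′ :* C) :+ (h :* (y :* (Aₚ :* A′ :* C)) :+ w :* (y :* (A :* A′ :* Cₚ))) :+ (h :* (y :* (A :* A′ₚ :* C)) :+ w :* (y :* (A :* A′ :* Cₚ)))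
             :+ (h :* h :* (y :* (Aₚ :* A′ₚ :* C)) :+ y :* (A :* A′ :* Cₚ))
           := y :* ((A :+ h :* Aₚ) :* (A′ :+ h :* A′ₚ) :* C :+ (w :+ w :+ con 1ℚ) :* (A :* A′ :* Cₚ))) refl (y₀ ⊗ y₀) A Aₚ A′ A′ₚ C Cₚ (h p) (# 2) ⟩
    y₀ ⊗ y₀ ⊗ ((A ⊕ h p ⊗ Aₚ) ⊗ (A′ ⊕ h p ⊗ A′ₚ) ⊗ C ⊕ (# 2 ⊕ # 2 ⊕ 1ℚ) ⊗ (A ⊗ A′ ⊗ Cₚ))
      ≤⟨ ⊗-monoˡ (y₀ ⊗ y₀) (⊗-nonneg 0≤y₀ 0≤y₀) (⊕-monoʳ ((A ⊕ h p ⊗ Aₚ) ⊗ (A′ ⊕ h p ⊗ A′ₚ) ⊗ C) (⊗-mono (⊕-nonneg (⊕-nonneg (#-nonneg 2) (#-nonneg 2)) 0≤1) (≡⇒⩽ five) (⊗-nonneg (⊗-nonneg 0≤A 0≤A′) 0≤Cₚ)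
           (⊗-monoʳ Cₚ 0≤Cₚ (⊗-mono 0≤A (≤⊕ʳ (⊗-nonneg (0≤h p) 0≤Aₚ)) 0≤A′ (≤⊕ʳ (⊗-nonneg (0≤h p) 0≤A′ₚ)))))) ⟩
    y₀ ⊗ y₀ ⊗ ((A ⊕ h p ⊗ Aₚ) ⊗ (A′ ⊕ h p ⊗ A′ₚ) ⊗ C ⊕ # 5 ⊗ ((A ⊕ h p ⊗ Aₚ) ⊗ (A′ ⊕ h p ⊗ A′ₚ) ⊗ Cₚ))
      ≡⟨ solve 6 (λ y a b c d f → y :* (a :* b :* c :+ f :* (a :* b :* d)) := y :* (a :* b :* (c :+ f :* d))) refl (y₀ ⊗ y₀) (A ⊕ h p ⊗ Aₚ) (A′ ⊕ h p ⊗ A′ₚ) C Cₚ (# 5) ⟩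
    y₀ ⊗ y₀ ⊗ ((A ⊕ h p ⊗ Aₚ) ⊗ (A′ ⊕ h p ⊗ A′ₚ) ⊗ (C ⊕ # 5 ⊗ Cₚ)) ∎
    where
    open ℚ.≤-Reasoning
    Yₚ Y′ₚ : ℕ → ℚ
    Yₚ d = Y (p * d)
    Y′ₚ d = Y′ (p * d)
    mₚ : Moment
    mₚ T = m (p ∷ T)
    V = eval h ps
    v₁ = V Y Y′ m
    v₂ = V Yₚ Y′ m
    v₃ = V Yₚ Y′ mₚ
    v₄ = V Y Y′ₚ m
    v₅ = V Y Y′ₚ mₚ
    v₆ = V Yₚ Y′ₚ m
    v₇ = V Yₚ Y′ₚ mₚ
    w₂ = h p ⊗ v₂ ⊖ (1ℚ ⊕ h p) ⊗ v₃
    w₃ = h p ⊗ v₄ ⊖ (1ℚ ⊕ h p) ⊗ v₅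
    w₄ = h p ⊗ h p ⊗ v₆ ⊕ (1ℚ ⊖ h p ⊗ h p) ⊗ v₇
    A = Mass ps x
    A′ = Mass ps x′
    Aₚ = 𝕊 h ps (λ r → 𝟙 (x * (p * r) ℕ.≤? R))
    A′ₚ = 𝕊 h ps (λ r → 𝟙 (x′ * (p * r) ℕ.≤? R))
    C = Total ps (t * t′) m
    Cₚ = 𝕃 (# 5) ps (λ T → Level (t * t′) m (p ∷ T))
    0≤A = Mass-nonneg ps x
    0≤A′ = Mass-nonneg ps x′
    0≤Aₚ : 0ℚ ⩽ Aₚ
    0≤Aₚ = 𝕊-nonneg 0≤h ps λ r → 𝟙-nonneg (x * (p * r) ℕ.≤? R)
    0≤A′ₚ : 0ℚ ⩽ A′ₚ
    0≤A′ₚ = 𝕊-nonneg 0≤h ps λ r → 𝟙-nonneg (x′ * (p * r) ℕ.≤? R)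
    0≤Cₚ : 0ℚ ⩽ Cₚ
    0≤Cₚ = 𝕃-nonneg (#-nonneg 5) ps λ T → Level-nonneg (t * t′) m (p ∷ T)
    five : # 2 ⊕ # 2 ⊕ 1ℚ ≡ # 5
    five = sym (trans (#-+ 4 1) (cong₂ _⊕_ (#-+ 2 2) #1))
    Aₚ≡ : ∀ x → Mass ps (x * p) ≡ 𝕊 h ps (λ r → 𝟙 (x * (p * r) ℕ.≤? R))
    Aₚ≡ x = 𝕊-cong h pos λ r _ → cong (λ n → 𝟙 (n ℕ.≤? R)) (ℕ.*-assoc x p r)
    Cₚ≡ : ∀ {s} → s ≡ t * t′ * p → Total ps s mₚ ≡ Cₚ
    Cₚ≡ refl = 𝕃-cong (# 5) ps λ T → cong (λ n → 𝟙 (n ℕ.≤? R * R) ⊗ ∥ m (p ∷ T) ∥) (ℕ.*-assoc (t * t′) p (product T))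
    toX : ∀ {t x Y} → Bounded t x Y → Bounded t (x * p) (λ d → Y (p * d))
    toX {t} {x} B r 0<r = ⩽-trans (B (p * r) (*-pos 0<p 0<r)) (≡⇒⩽ (cong (λ n → y₀ ⊗ 𝟙 (n ℕ.≤? R)) (trans (sym (ℕ.*-assoc (t * x) p r)) (cong (_* r) (ℕ.*-assoc t x p)))))
    toT : ∀ {t x Y} → Bounded t x Y → Bounded (t * p) x (λ d → Y (p * d))
    toT {t} {x} B r 0<r = ⩽-trans (B (p * r) (*-pos 0<p 0<r)) (≡⇒⩽ (cong (λ n → y₀ ⊗ 𝟙 (n ℕ.≤? R)) (trans (sym (ℕ.*-assoc (t * x) p r)) (cong (_* r)
      (trans (ℕ.*-assoc t x p) (trans (cong (t *_) (ℕ.*-comm x p)) (sym (ℕ.*-assoc t p x))))))))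
    -- When p divides both indices and is placed in T, it is charged to t alone, because T contains
    -- p only once. The other index just forgets its factor p.
    forget : ∀ {t x Y} → Bounded t x Y → Bounded t x (λ d → Y (p * d))
    forget {t} {x} B r 0<r = ⩽-trans (B (p * r) (*-pos 0<p 0<r)) (⊗-monoˡ y₀ 0≤y₀ (𝟙-mono (t * x * (p * r) ℕ.≤? R) (t * x * r ℕ.≤? R) (ℕ.≤-trans (ℕ.*-monoʳ-≤ (t * x) (m≤p*m r 0<p)))))
    bd : ∀ {v a a′ c b b′ d} → ∥ v ∥ ⩽ bound a a′ c → a ≡ b → a′ ≡ b′ → c ≡ d → ∥ v ∥ ⩽ bound b b′ d
    bd q refl refl refl = q
    tp = *-pos 0<t 0<p
    t′p = *-pos 0<t′ 0<p
    xp = *-pos 0<x 0<p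
    x′p = *-pos 0<x′ 0<p
    arr : t * p * t′ ≡ t * t′ * p
    arr = trans (ℕ.*-assoc t p t′) (trans (cong (t *_) (ℕ.*-comm p t′)) (sym (ℕ.*-assoc t t′ p)))
    b₁ : ∥ v₁ ∥ ⩽ bound A A′ C
    b₁ = eval-bounded pos hs 0<t 0<x 0<t′ 0<x′ BY BY′ m
    b₂ : ∥ v₂ ∥ ⩽ bound Aₚ A′ C
    b₂ = bd (eval-bounded pos hs 0<t xp 0<t′ 0<x′ (toX {t} {x} BY) BY′ m) (Aₚ≡ x) (refl {x = A′}) (refl {x = C})
    b₃ : ∥ v₃ ∥ ⩽ bound A A′ Cₚ
    b₃ = bd (eval-bounded pos hs tp 0<x 0<t′ 0<x′ (toT {t} {x} BY) BY′ mₚ) (refl {x = A}) (refl {x = A′}) (Cₚ≡ arr)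
    b₄ : ∥ v₄ ∥ ⩽ bound A A′ₚ C
    b₄ = bd (eval-bounded pos hs 0<t 0<x 0<t′ x′p BY (toX {t′} {x′} BY′) m) (refl {x = A}) (Aₚ≡ x′) (refl {x = C})
    b₅ : ∥ v₅ ∥ ⩽ bound A A′ Cₚ
    b₅ = bd (eval-bounded pos hs 0<t 0<x t′p 0<x′ BY (toT {t′} {x′} BY′) mₚ) (refl {x = A}) (refl {x = A′}) (Cₚ≡ (sym (ℕ.*-assoc t t′ p)))
    b₆ : ∥ v₆ ∥ ⩽ bound Aₚ A′ₚ C
    b₆ = bd (eval-bounded pos hs 0<t xp 0<t′ x′p (toX {t} {x} BY) (toX {t′} {x′} BY′) m) (Aₚ≡ x) (Aₚ≡ x′) (refl {x = C})
    b₇ : ∥ v₇ ∥ ⩽ bound A A′ Cₚ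
    b₇ = bd (eval-bounded pos hs tp 0<x 0<t′ 0<x′ (toT {t} {x} BY) (forget {t′} {x′} BY′) mₚ) (refl {x = A}) (refl {x = A′}) (Cₚ≡ arr)
    lin : ∀ v v′ {b b′} → ∥ v ∥ ⩽ b → ∥ v′ ∥ ⩽ b′ → ∥ h p ⊗ v ⊖ (1ℚ ⊕ h p) ⊗ v′ ∥ ⩽ h p ⊗ b ⊕ # 2 ⊗ b′
    lin v v′ {b} {b′} q q′ = begin
      ∥ h p ⊗ v ⊖ (1ℚ ⊕ h p) ⊗ v′ ∥           ≤⟨ ℚ.∣p-q∣≤∣p∣+∣q∣ (h p ⊗ v) ((1ℚ ⊕ h p) ⊗ v′) ⟩
      ∥ h p ⊗ v ∥ ⊕ ∥ (1ℚ ⊕ h p) ⊗ v′ ∥       ≡⟨ cong₂ _⊕_ (trans (∥∥-⊗ (h p) v) (cong (_⊗ ∥ v ∥) (ℚ.0≤p⇒∣p∣≡p (0≤h p)))) (trans (∥∥-⊗ (1ℚ ⊕ h p) v′) (cong (_⊗ ∥ v′ ∥) (ℚ.0≤p⇒∣p∣≡p (⊕-nonneg 0≤1 (0≤h p))))) ⟩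
      h p ⊗ ∥ v ∥ ⊕ (1ℚ ⊕ h p) ⊗ ∥ v′ ∥       ≤⟨ ⊕-mono (⊗-monoˡ (h p) (0≤h p) q) (⊗-mono (⊕-nonneg 0≤1 (0≤h p)) (⩽-trans (⊕-monoʳ 1ℚ h≤1) (≡⇒⩽ (trans (cong (1ℚ ⊕_) (sym #1)) (sym (#-suc 1))))) (∥∥-nonneg v′) q′) ⟩
      h p ⊗ b ⊕ # 2 ⊗ b′                      ∎
    h²≤1 : h p ⊗ h p ⩽ 1ℚ
    h²≤1 = ⩽-trans (⊗-mono (0≤h p) h≤1 (0≤h p) h≤1) (≡⇒⩽ (ℚ.*-identityˡ 1ℚ))
    0≤1-h² : 0ℚ ⩽ 1ℚ ⊖ h p ⊗ h p
    0≤1-h² = x≤y⇒0≤y-x h²≤1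
    1-h²≤1 : 1ℚ ⊖ h p ⊗ h p ⩽ 1ℚ
    1-h²≤1 = by-excess (h p ⊗ h p) (square-nonneg (h p)) (solve 1 (λ x → con 1ℚ :- x :+ x := con 1ℚ) refl (h p ⊗ h p))
    quad : ∥ w₄ ∥ ⩽ h p ⊗ h p ⊗ bound Aₚ A′ₚ C ⊕ bound A A′ Cₚ
    quad = begin
      ∥ w₄ ∥                                                     ≤⟨ ∥∥-⊕ (h p ⊗ h p ⊗ v₆) ((1ℚ ⊖ h p ⊗ h p) ⊗ v₇) ⟩
      ∥ h p ⊗ h p ⊗ v₆ ∥ ⊕ ∥ (1ℚ ⊖ h p ⊗ h p) ⊗ v₇ ∥             ≡⟨ cong₂ _⊕_ (trans (∥∥-⊗ (h p ⊗ h p) v₆) (cong (_⊗ ∥ v₆ ∥) (ℚ.0≤p⇒∣p∣≡p (square-nonneg (h p))))) (trans (∥∥-⊗ (1ℚ ⊖ h p ⊗ h p) v₇) (cong (_⊗ ∥ v₇ ∥) (ℚ.0≤p⇒∣p∣≡p 0≤1-h²))) ⟩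
      h p ⊗ h p ⊗ ∥ v₆ ∥ ⊕ (1ℚ ⊖ h p ⊗ h p) ⊗ ∥ v₇ ∥             ≤⟨ ⊕-mono (⊗-monoˡ (h p ⊗ h p) (square-nonneg (h p)) b₆) (⩽-trans (⊗-mono 0≤1-h² 1-h²≤1 (∥∥-nonneg v₇) b₇) (≡⇒⩽ (ℚ.*-identityˡ (bound A A′ Cₚ)))) ⟩
      h p ⊗ h p ⊗ bound Aₚ A′ₚ C ⊕ bound A A′ Cₚ                 ∎

coprime-* : ∀ {m a b} → Coprime m a → Coprime m b → Coprime m (a * b)
coprime-* cₐ cᵦ (d∣m , d∣ab) = cᵦ (d∣m , coprime-divisor (λ (e∣d , e∣a) → cₐ (∣-trans e∣d d∣m , e∣a)) d∣ab)

coprime-∣ : ∀ {m a b} → Coprime m b → a ∣ b → Coprime m a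
coprime-∣ c a∣b (d∣m , d∣a) = c (d∣m , ∣-trans d∣a a∣b)

prime-coprime : ∀ {p n} → Prime p → ¬ p ∣ n → Coprime p n
prime-coprime {p} pp p∤n (d∣p , d∣n) with prime⇒irreducible pp d∣p
... | inj₁ d≡1 = d≡1
... | inj₂ refl = ⊥-elim (p∤n d∣n)

coprime-all : ∀ {q p T} → Prime p → All (p ≢_) T → All Prime T → All (Coprime q) T → All (Coprime (q * p)) T
coprime-all pp [] [] [] = []
coprime-all {q} {p} {t ∷ T} pp (p≢t ∷ ≢s) (pt ∷ pT) (c ∷ cs) = c′ ∷ coprime-all pp ≢s pT cs
  where
  c′ : Coprime (q * p) t
  c′ = Coprimality.sym (coprime-* (Coprimality.sym c) (prime-coprime pt λ t∣p → p≢t (sym (prime-∣-prime pt pp t∣p))))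

coprime-lcm : ∀ {q p n} → Coprime q p → q ∣ n → p ∣ n → q * p ∣ n
coprime-lcm {q} {p} c (divides k refl) p∣n with coprime-divisor (Coprimality.sym c) (subst (p ∣_) (ℕ.*-comm k q) p∣n)
... | divides l refl = divides l (trans (ℕ.*-assoc l p q) (cong (l *_) (ℕ.*-comm p q)))

-- Residue classes

-- Residue classes are written as {n : q ∣ n + r}.
crt : ∀ {q p} → 1 < p → Coprime q p → ∀ r h → ∃[ y ] ∃[ s ] r + q * y ≡ h + p * s
crt {p = suc zero} (s≤s ())
crt {q} {p@(suc (suc p-2))} _ c r h with coprime-Bézout c
... | Bézout.+- x y eq = x * k , r + y * k , (begin
    r + q * (x * k)          ≡⟨ solveℕ 4 (λ r q x k → r ⟨+⟩ q ⟨*⟩ (x ⟨*⟩ k) ⟨=⟩ r ⟨+⟩ (x ⟨*⟩ q) ⟨*⟩ k) refl r q x k ⟩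
    r + x * q * k            ≡⟨ cong (λ t → r + t * k) eq ⟨
    r + (1 + y * p) * k      ≡⟨ solveℕ 4 (λ r y p′ h → let p = conℕ 1 ⟨+⟩ p′; k = h ⟨+⟩ p′ ⟨*⟩ r in
                                  r ⟨+⟩ (conℕ 1 ⟨+⟩ y ⟨*⟩ p) ⟨*⟩ k ⟨=⟩ h ⟨+⟩ p ⟨*⟩ (r ⟨+⟩ y ⟨*⟩ k)) refl r y (suc p-2) h ⟩
    h + p * (r + y * k)      ∎)
  where
  open ≡-Reasoning
  -- This is h - r modulo p, with p - 1 in place of -1. In the other Bézout case q x is -1 modulo p,
  -- so there the roles of h and r are exchanged.
  k = h + suc p-2 * r
... | Bézout.-+ x zero ()
... | Bézout.-+ x y@(suc y-1) eq = x * k , y * k ℕ.∸ h , ℕ.+-cancelʳ-≡ k (r + q * (x * k)) (h + p * s) (begin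
    r + q * (x * k) + k      ≡⟨ solveℕ 4 (λ r q x k → r ⟨+⟩ q ⟨*⟩ (x ⟨*⟩ k) ⟨+⟩ k ⟨=⟩ r ⟨+⟩ (conℕ 1 ⟨+⟩ x ⟨*⟩ q) ⟨*⟩ k) refl r q x k ⟩
    r + (1 + x * q) * k      ≡⟨ cong (λ t → r + t * k) eq ⟩
    r + y * p * k            ≡⟨ solveℕ 4 (λ r y p k → r ⟨+⟩ y ⟨*⟩ p ⟨*⟩ k ⟨=⟩ r ⟨+⟩ p ⟨*⟩ (y ⟨*⟩ k)) refl r y p k ⟩
    r + p * (y * k)          ≡⟨ cong (λ t → r + p * t) (ℕ.m∸n+n≡m h≤yk) ⟨
    r + p * (s + h)          ≡⟨ solveℕ 4 (λ r p′ s h → let p = conℕ 1 ⟨+⟩ p′ in r ⟨+⟩ p ⟨*⟩ (s ⟨+⟩ h) ⟨=⟩ h ⟨+⟩ p ⟨*⟩ s ⟨+⟩ (r ⟨+⟩ p′ ⟨*⟩ h)) refl r (suc p-2) s h ⟩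
    h + p * s + k            ∎)
  where
  open ≡-Reasoning
  k = r + suc p-2 * h
  s = y * k ℕ.∸ h
  h≤yk : h ≤ y * k
  h≤yk = ℕ.≤-trans (ℕ.m≤n*m h (suc p-2)) (ℕ.≤-trans (ℕ.m≤n+m (suc p-2 * h) r) (ℕ.m≤n*m k y))

∣-shift : ∀ {q n r r′ y} → r + q * y ≡ r′ → q ∣ n + r → q ∣ n + r′
∣-shift {q} {n} {r} {y = y} refl d = subst (q ∣_) (ℕ.+-assoc n r (q * y)) (∣m∣n⇒∣m+n d (m∣m*n y))

∣-unshift : ∀ {q n r r′ y} → r + q * y ≡ r′ → q ∣ n + r′ → q ∣ n + r
∣-unshift {q} {n} {r} {y = y} refl d = ∣m+n∣m⇒∣n (subst (q ∣_) (trans (sym (ℕ.+-assoc n r (q * y))) (ℕ.+-comm (n + r) (q * y))) d) (m∣m*n y)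

∑ₗ : {A : Set} → List A → (A → ℚ) → ℚ
∑ₗ []       f = 0ℚ
∑ₗ (x ∷ xs) f = f x ⊕ ∑ₗ xs f

∑-∑ₗ : ∀ {A : Set} N (xs : List A) (f : ℕ → A → ℚ) → ∑ N (λ n → ∑ₗ xs (f n)) ≡ ∑ₗ xs (λ x → ∑ N (λ n → f n x))
∑-∑ₗ N [] f = ∑-0 N
∑-∑ₗ N (x ∷ xs) f = trans (∑-⊕ N (λ n → f n x) (λ n → ∑ₗ xs (f n))) (cong (∑ N (λ n → f n x) ⊕_) (∑-∑ₗ N xs f))

∑ₗ-⊗ : ∀ {A : Set} c (xs : List A) f → ∑ₗ xs (λ x → f x ⊗ c) ≡ ∑ₗ xs f ⊗ c
∑ₗ-⊗ c [] f = sym (ℚ.*-zeroˡ c)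
∑ₗ-⊗ c (x ∷ xs) f = trans (cong (f x ⊗ c ⊕_) (∑ₗ-⊗ c xs f)) (sym (ℚ.*-distribʳ-+ c (f x) (∑ₗ xs f)))

∑ₗ-cong : ∀ {A : Set} {xs : List A} {f g} → All (λ x → f x ≡ g x) xs → ∑ₗ xs f ≡ ∑ₗ xs g
∑ₗ-cong [] = refl
∑ₗ-cong (e ∷ es) = cong₂ _⊕_ e (∑ₗ-cong es)

∑ₗ-near : ∀ {A : Set} {xs : List A} {f} {M E} → All (λ x → ∥ f x ⊖ M ∥ ⩽ E) xs →
  ∥ ∑ₗ xs f ⊖ # (length xs) ⊗ M ∥ ⩽ # (length xs) ⊗ E
∑ₗ-near {M = M} {E} [] = ≡⇒⩽ (trans (cong (λ t → ∥ 0ℚ ⊖ t ⊗ M ∥) #0) (trans (cong (λ t → ∥ 0ℚ ⊖ t ∥) (ℚ.*-zeroˡ M)) (sym (trans (cong (_⊗ E) #0) (ℚ.*-zeroˡ E)))))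
∑ₗ-near {xs = x ∷ xs} {f} {M} {E} (e ∷ es) = begin
  ∥ f x ⊕ ∑ₗ xs f ⊖ # (suc (length xs)) ⊗ M ∥              ≡⟨ cong ∥_∥ (trans (cong (λ t → f x ⊕ ∑ₗ xs f ⊖ t ⊗ M) (#-suc (length xs)))
      (solve 4 (λ a b l m → a :+ b :- (con 1ℚ :+ l) :* m := (a :- m) :+ (b :- l :* m)) refl (f x) (∑ₗ xs f) (# (length xs)) M)) ⟩
  ∥ (f x ⊖ M) ⊕ (∑ₗ xs f ⊖ # (length xs) ⊗ M) ∥            ≤⟨ ∥∥-⊕ (f x ⊖ M) (∑ₗ xs f ⊖ # (length xs) ⊗ M) ⟩
  ∥ f x ⊖ M ∥ ⊕ ∥ ∑ₗ xs f ⊖ # (length xs) ⊗ M ∥            ≤⟨ ⊕-mono e (∑ₗ-near es) ⟩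
  E ⊕ # (length xs) ⊗ E                                    ≡⟨ trans (solve 2 (λ l e → e :+ l :* e := (con 1ℚ :+ l) :* e) refl (# (length xs)) E) (cong (_⊗ E) (sym (#-suc (length xs)))) ⟩
  # (suc (length xs)) ⊗ E                                  ∎
  where open ℚ.≤-Reasoning

-- On the support of f, `e n p` is a sum of indicators of residue classes modulo p, one for each
-- shift. The moment at T is therefore a sum over length(hs)^(number of primes in T) classes modulo
-- the product, which the Chinese remainder theorem merges one prime at a time. `Ok` carries the
-- property of a class needed by the base estimate.
module Classes (N : ℕ) (f : ℕ → ℚ) (e : ℕ → ℕ → ℚ) (hs : List ℕ) (Ok : ℕ → ℕ → Set) (Good : ℕ → Set)
  (step : ∀ {q r p h y s} → Ok q r → Prime p → Good p → Any (h ≡_) hs → r + q * y ≡ h + p * s → Ok (q * p) (r + q * y)) where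

  classes : ∀ {M E : ℕ → ℚ} →
    (∀ q r → Ok q r → ∥ ∑ N (λ n → f n ⊗ 𝟙 (q ∣? (n + r))) ⊖ M q ∥ ⩽ E q) →
    ∀ T → All Prime T → All Good T → Unique T → All (λ p → ∀ n → f n ⊗ e n p ≡ ∑ₗ hs (λ h → f n ⊗ 𝟙 (p ∣? (n + h)))) T →
    ∀ q r → All (Coprime q) T → Ok q r →
    ∥ ∑ N (λ n → f n ⊗ 𝟙 (q ∣? (n + r)) ⊗ ∏ₑ (e n) T) ⊖ pow (# (length hs)) T ⊗ M (q * product T) ∥
      ⩽ pow (# (length hs)) T ⊗ E (q * product T)
  classes {M} {E} base [] _ _ _ _ q r _ ok = begin
    ∥ ∑ N (λ n → f n ⊗ 𝟙 (q ∣? (n + r)) ⊗ 1ℚ) ⊖ 1ℚ ⊗ M (q * 1) ∥   ≡⟨ cong₂ (λ x y → ∥ x ⊖ y ∥) (∑-cong N λ n _ _ → ℚ.*-identityʳ (f n ⊗ 𝟙 (q ∣? (n + r))))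
        (trans (ℚ.*-identityˡ (M (q * 1))) (cong M (ℕ.*-identityʳ q))) ⟩
    ∥ ∑ N (λ n → f n ⊗ 𝟙 (q ∣? (n + r))) ⊖ M q ∥                   ≤⟨ base q r ok ⟩
    E q                                                            ≡⟨ trans (ℚ.*-identityˡ (E (q * 1))) (cong E (ℕ.*-identityʳ q)) ⟨
    1ℚ ⊗ E (q * 1)                                                 ∎
    where open ℚ.≤-Reasoning
  classes {M} {E} base (p ∷ T) (pp ∷ pT) (gp ∷ gT) (p∉T ∷ uT) (sp ∷ sT) q r (cp ∷ cT) ok = begin
    ∥ ∑ N (λ n → f n ⊗ 𝟙 (q ∣? (n + r)) ⊗ (e n p ⊗ ∏ₑ (e n) T)) ⊖ k ⊗ pow k T ⊗ M (q * (p * product T)) ∥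
      ≡⟨ cong₂ (λ x y → ∥ x ⊖ y ∥) expand (trans (cong (λ t → k ⊗ pow k T ⊗ M t) (sym (ℕ.*-assoc q p (product T)))) (ℚ.*-assoc k (pow k T) (M (q * p * product T)))) ⟩
    ∥ ∑ₗ hs (λ h → ∑ N (g h)) ⊖ k ⊗ (pow k T ⊗ M (q * p * product T)) ∥
      ≤⟨ ∑ₗ-near (All.tabulate (λ {h} h∈ → each h h∈)) ⟩
    k ⊗ (pow k T ⊗ E (q * p * product T))
      ≡⟨ trans (sym (ℚ.*-assoc k (pow k T) (E (q * p * product T)))) (cong (λ t → k ⊗ pow k T ⊗ E t) (ℕ.*-assoc q p (product T))) ⟩
    k ⊗ pow k T ⊗ E (q * (p * product T)) ∎
    where
    open ℚ.≤-Reasoning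
    k = # (length hs)
    g : ℕ → ℕ → ℚ
    g h n = f n ⊗ 𝟙 (p ∣? (n + h)) ⊗ (𝟙 (q ∣? (n + r)) ⊗ ∏ₑ (e n) T)
    expand : ∑ N (λ n → f n ⊗ 𝟙 (q ∣? (n + r)) ⊗ (e n p ⊗ ∏ₑ (e n) T)) ≡ ∑ₗ hs (λ h → ∑ N (g h))
    expand = trans (∑-cong N λ n _ _ → begin-equality
      f n ⊗ 𝟙 (q ∣? (n + r)) ⊗ (e n p ⊗ ∏ₑ (e n) T)
        ≡⟨ solve 4 (λ f i e π → f :* i :* (e :* π) := f :* e :* (i :* π)) refl (f n) (𝟙 (q ∣? (n + r))) (e n p) (∏ₑ (e n) T) ⟩
      f n ⊗ e n p ⊗ (𝟙 (q ∣? (n + r)) ⊗ ∏ₑ (e n) T)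
        ≡⟨ cong (_⊗ (𝟙 (q ∣? (n + r)) ⊗ ∏ₑ (e n) T)) (sp n) ⟩
      ∑ₗ hs (λ h → f n ⊗ 𝟙 (p ∣? (n + h))) ⊗ (𝟙 (q ∣? (n + r)) ⊗ ∏ₑ (e n) T)
        ≡⟨ ∑ₗ-⊗ (𝟙 (q ∣? (n + r)) ⊗ ∏ₑ (e n) T) hs (λ h → f n ⊗ 𝟙 (p ∣? (n + h))) ⟨
      ∑ₗ hs (λ h → g h n) ∎) (∑-∑ₗ N hs (λ n h → g h n))
    cpT : All (Coprime (q * p)) T
    cpT = coprime-all pp p∉T pT cT
    each : ∀ h → Any (h ≡_) hs → ∥ ∑ N (g h) ⊖ pow k T ⊗ M (q * p * product T) ∥ ⩽ pow k T ⊗ E (q * p * product T)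
    each h h∈ with crt (prime>1 pp) cp r h
    ... | y , s , eq = ⩽-trans (≡⇒⩽ (cong (λ t → ∥ t ⊖ pow k T ⊗ M (q * p * product T) ∥) (∑-cong N λ n _ _ → lem n)))
        (classes base T pT gT uT sT (q * p) (r + q * y) cpT (step ok pp gp h∈ eq))
      where
      lem : ∀ n → g h n ≡ f n ⊗ 𝟙 (q * p ∣? (n + (r + q * y))) ⊗ ∏ₑ (e n) T
      lem n = trans (solve 4 (λ f i j π → f :* i :* (j :* π) := f :* (j :* i) :* π) refl (f n) (𝟙 (p ∣? (n + h))) (𝟙 (q ∣? (n + r))) (∏ₑ (e n) T))
        (cong (λ t → f n ⊗ t ⊗ ∏ₑ (e n) T) (trans (sym (𝟙-× (q ∣? (n + r)) (p ∣? (n + h)))) (𝟙-cong ((q ∣? (n + r)) ×-dec (p ∣? (n + h))) (q * p ∣? (n + (r + q * y)))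
          (λ (a , b) → coprime-lcm cp (∣-shift {n = n} {r} {y = y} refl a) (∣-shift {y = s} (sym eq) b))
          (λ c → ∣-unshift {n = n} {r} {y = y} refl (m*n∣⇒m∣ q p c) , ∣-unshift {y = s} (sym eq) (m*n∣⇒n∣ q p c)))))

multiples : ℕ → ℕ → ℚ
multiples q M = ∑ M (λ n → 𝟙 (q ∣? n))

multiples-bounds : ∀ q M → 0 < q → (# q ⊗ multiples q M ⩽ # M) × (# M ⩽ # q ⊗ multiples q M ⊕ # q)
multiples-bounds q@(suc _) M 0<q = upper , lower
  where
  d = M / q
  r = M % q
  M≡ : M ≡ q * d + r
  M≡ = trans (m≡m%n+[m/n]*n M q) (trans (ℕ.+-comm r (d * q)) (cong (_+ r) (ℕ.*-comm d q)))
  count : multiples q M ≡ # d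
  count = begin
    ∑ M (λ n → 𝟙 (q ∣? n))                               ≡⟨ cong (λ t → ∑ t (λ n → 𝟙 (q ∣? n))) M≡ ⟩
    ∑ (q * d + r) (λ n → 𝟙 (q ∣? n))                     ≡⟨ ∑-ext (ℕ.m≤m+n (q * d) r) (λ i lo hi → 𝟙-no (q ∣? i) (no-multiple i lo hi)) ⟩
    ∑ (q * d) (λ n → 𝟙 (q ∣? n))                         ≡⟨ ∑-cong (q * d) (λ n _ _ → ℚ.*-identityʳ (𝟙 (q ∣? n))) ⟨
    ∑ (q * d) (λ n → 𝟙 (q ∣? n) ⊗ 1ℚ)                    ≡⟨ ∑-multiples-block q d (λ _ → 1ℚ) 0<q ⟩
    ∑ d (λ _ → 1ℚ)                                       ≡⟨ trans (∑-const d 1ℚ) (ℚ.*-identityʳ (# d)) ⟩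
    # d                                                  ∎
    where
    open ≡-Reasoning
    no-multiple : ∀ i → q * d < i → i ≤ q * d + r → ¬ q ∣ i
    no-multiple i lo hi (divides k refl) = ℕ.<⇒≱ (ℕ.*-cancelˡ-< q d k (subst (q * d <_) (ℕ.*-comm k q) lo))
      (ℕ.m<1+n⇒m≤n (ℕ.*-cancelˡ-< q k (suc d) (ℕ.≤-<-trans (ℕ.≤-reflexive (ℕ.*-comm q k)) (ℕ.≤-<-trans hi (ℕ.<-≤-trans (ℕ.+-monoʳ-< (q * d) (m%n<n M q)) (ℕ.≤-reflexive (trans (ℕ.+-comm (q * d) q) (sym (ℕ.*-suc q d)))))))))
  upper : # q ⊗ multiples q M ⩽ # M
  upper = ⩽-trans (≡⇒⩽ (trans (cong (# q ⊗_) count) (sym (#-* q d)))) (#-mono (ℕ.≤-trans (ℕ.m≤m+n (q * d) r) (ℕ.≤-reflexive (sym M≡))))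
  lower : # M ⩽ # q ⊗ multiples q M ⊕ # q
  lower = ⩽-trans (#-mono (ℕ.≤-trans (ℕ.≤-reflexive M≡) (ℕ.+-monoʳ-≤ (q * d) (ℕ.<⇒≤ (m%n<n M q)))))
    (≡⇒⩽ (trans (#-+ (q * d) q) (cong (_⊕ # q) (trans (#-* q d) (cong (# q ⊗_) (sym count))))))

class-size : ∀ N q r → 0 < q → ∥ ∑ N (λ n → 𝟙 (q ∣? (n + r))) ⊖ # N ⊗ ⅟ q ∥ ⩽ 1ℚ
class-size N q@(suc _) r 0<q = ∥∥-intro (⊗-cancelˡ (# q) (#-pos 0<q) up) (⊗-cancelˡ (# q) (#-pos 0<q) lo)
  where
  open ℚ.≤-Reasoning
  r′ = r % q
  c = ∑ N (λ n → 𝟙 (q ∣? (n + r)))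
  r≡ : r′ + q * (r / q) ≡ r
  r≡ = sym (trans (m≡m%n+[m/n]*n r q) (cong (r′ +_) (ℕ.*-comm (r / q) q)))
  r′<q : r′ < q
  r′<q = m%n<n r q
  c≡ : c ≡ multiples q (r′ + N)
  c≡ = begin-equality
    c                                                    ≡⟨ ∑-cong N (λ n _ _ → 𝟙-cong (q ∣? (n + r)) (q ∣? (r′ + n)) (λ d → subst (q ∣_) (ℕ.+-comm n r′) (∣-unshift r≡ d)) (λ d → ∣-shift r≡ (subst (q ∣_) (ℕ.+-comm r′ n) d))) ⟩
    ∑ N (λ n → 𝟙 (q ∣? (r′ + n)))                        ≡⟨ ⊕-identityˡ (∑ N (λ n → 𝟙 (q ∣? (r′ + n)))) ⟨
    0ℚ ⊕ ∑ N (λ n → 𝟙 (q ∣? (r′ + n)))                   ≡⟨ cong (_⊕ ∑ N (λ n → 𝟙 (q ∣? (r′ + n)))) (∑-zero r′ λ { i@(suc _) 0<i i≤ → 𝟙-no (q ∣? i) λ d → ℕ.<⇒≱ (ℕ.≤-<-trans i≤ r′<q) (∣⇒≤ d) }) ⟨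
    multiples q r′ ⊕ ∑ N (λ n → 𝟙 (q ∣? (r′ + n)))       ≡⟨ ∑-split r′ N (λ n → 𝟙 (q ∣? n)) ⟨
    multiples q (r′ + N)                                 ∎
  bounds = multiples-bounds q (r′ + N) 0<q
  qNq : # q ⊗ (# N ⊗ ⅟ q) ≡ # N
  qNq = trans (solve 3 (λ q n i → q :* (n :* i) := n :* (q :* i)) refl (# q) (# N) (⅟ q)) (trans (cong (# N ⊗_) (⅟-inverse 0<q)) (ℚ.*-identityʳ (# N)))
  up : # q ⊗ (c ⊖ # N ⊗ ⅟ q) ⩽ # q ⊗ 1ℚ
  up = begin
    # q ⊗ (c ⊖ # N ⊗ ⅟ q)           ≡⟨ trans (solve 3 (λ q c n → q :* (c :- n) := q :* c :- q :* n) refl (# q) c (# N ⊗ ⅟ q)) (cong₂ (λ x y → # q ⊗ x ⊖ y) c≡ qNq) ⟩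
    # q ⊗ multiples q (r′ + N) ⊖ # N ≤⟨ ⊕-monoˡ (⊝ # N) (⩽-trans (proj₁ bounds) (≡⇒⩽ (#-+ r′ N))) ⟩
    # r′ ⊕ # N ⊖ # N                ≡⟨ solve 2 (λ r n → r :+ n :- n := r) refl (# r′) (# N) ⟩
    # r′                            ≤⟨ #-mono (ℕ.<⇒≤ r′<q) ⟩
    # q                             ≡⟨ ℚ.*-identityʳ (# q) ⟨
    # q ⊗ 1ℚ                        ∎
  lo : # q ⊗ (⊝ (c ⊖ # N ⊗ ⅟ q)) ⩽ # q ⊗ 1ℚ
  lo = begin
    # q ⊗ (⊝ (c ⊖ # N ⊗ ⅟ q))       ≡⟨ trans (solve 3 (λ q c n → q :* (:- (c :- n)) := q :* n :- q :* c) refl (# q) c (# N ⊗ ⅟ q)) (cong₂ (λ x y → y ⊖ # q ⊗ x) c≡ qNq) ⟩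
    # N ⊖ # q ⊗ m                   ≤⟨ ⊕-monoˡ (⊝ (# q ⊗ m)) (⩽-trans (#-mono (ℕ.m≤n+m N r′)) (proj₂ bounds)) ⟩
    # q ⊗ m ⊕ # q ⊖ # q ⊗ m         ≡⟨ solve 2 (λ q m → q :* m :+ q :- q :* m := q :* con 1ℚ) refl (# q) m ⟩
    # q ⊗ 1ℚ                        ∎
    where m = multiples q (r′ + N)

coprime-indicator : ℕ → ℕ → ℚ
coprime-indicator q n = 𝟙 (gcd n q ℕ.≟ 1)

module _ (q : ℕ) where
  private z = coprime-indicator q

  coprime-yes : ∀ {n} → Coprime n q → z n ≡ 1ℚ
  coprime-yes {n} c = 𝟙-yes (gcd n q ℕ.≟ 1) (coprime⇒gcd≡1 c)

  coprime-no : ∀ {n} → ¬ Coprime n q → z n ≡ 0ℚ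
  coprime-no {n} c = 𝟙-no (gcd n q ℕ.≟ 1) λ e → c (gcd≡1⇒coprime e)

  coprime-cong : ∀ {m n} → (Coprime m q → Coprime n q) → (Coprime n q → Coprime m q) → z m ≡ z n
  coprime-cong {m} {n} f g = 𝟙-cong (gcd m q ℕ.≟ 1) (gcd n q ℕ.≟ 1) (λ e → coprime⇒gcd≡1 (f (gcd≡1⇒coprime e))) (λ e → coprime⇒gcd≡1 (g (gcd≡1⇒coprime e)))

  coprime-periodic : ∀ m n → z (q * m + n) ≡ z n
  coprime-periodic m n = coprime-cong
    (λ c (d∣n , d∣q) → c (∣m∣n⇒∣m+n (∣m⇒∣m*n m d∣q) d∣n , d∣q))
    (λ c (d∣mn , d∣q) → c (∣m+n∣m⇒∣n d∣mn (∣m⇒∣m*n m d∣q) , d∣q))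

∑-applyUpTo : ∀ {P : ℕ → Set} (P? : ∀ n → Dec (P n)) (f : ℕ → ℕ) n → # (length (filter P? (applyUpTo f n))) ≡ ∑ n (λ i → 𝟙 (P? (f (ℕ.pred i))))
∑-applyUpTo P? f n = go n
  where
  len-++ : ∀ xs x → # (length (filter P? (xs ++ x ∷ []))) ≡ # (length (filter P? xs)) ⊕ 𝟙 (P? x)
  len-++ [] x with P? x
  ... | yes _ = trans #1 (sym (trans (cong (_⊕ 1ℚ) #0) (⊕-identityˡ 1ℚ)))
  ... | no _  = sym (⊕-identityʳ (# 0))
  len-++ (y ∷ xs) x with P? y
  ... | yes _ = trans (#-suc (length (filter P? (xs ++ x ∷ [])))) (trans (cong (1ℚ ⊕_) (len-++ xs x)) (trans (sym (ℚ.+-assoc 1ℚ (# (length (filter P? xs))) (𝟙 (P? x)))) (cong (_⊕ 𝟙 (P? x)) (sym (#-suc (length (filter P? xs)))))))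
  ... | no _  = len-++ xs x
  go : ∀ n → # (length (filter P? (applyUpTo f n))) ≡ ∑ n (λ i → 𝟙 (P? (f (ℕ.pred i))))
  go zero = #0
  go (suc n) = trans (cong (λ xs → # (length (filter P? xs))) (sym (List.applyUpTo-∷ʳ f n))) (trans (len-++ (applyUpTo f n) (f n)) (cong (_⊕ 𝟙 (P? (f n))) (go n)))

φ-∑ : ∀ q → # (φ q) ≡ ∑ q (coprime-indicator q)
φ-∑ zero = #0
φ-∑ q@(suc q-1) = trans (∑-applyUpTo (λ a → gcd a q ℕ.≟ 1) (λ x → x) q) (trans (rotate q-1 (λ n → z n)) (cong (∑ q-1 z ⊕_) (sym zq)))
  where
  z = coprime-indicator q
  -- `φ` counts over 0, ..., q - 1 while `∑` runs over 1, ..., q. The two end points have the same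
  -- gcd with q.
  rotate : ∀ m (z : ℕ → ℚ) → ∑ (suc m) (λ i → z (ℕ.pred i)) ≡ ∑ m z ⊕ z 0
  rotate zero z = refl
  rotate (suc m) z = trans (cong (_⊕ z (suc m)) (rotate m z)) (solve 3 (λ a b c → a :+ b :+ c := a :+ c :+ b) refl (∑ m z) (z 0) (z (suc m)))
  zq : z q ≡ z 0
  zq = trans (cong z (trans (sym (ℕ.*-identityʳ q)) (sym (ℕ.+-identityʳ (q * 1))))) (coprime-periodic q 1 0)

φ-pos : ∀ {q} → 0 < q → 0 < φ q
φ-pos {q} 0<q = #-cancel (begin
  # 1                             ≡⟨ trans #1 (sym (trans (⊕-identityˡ (coprime-indicator q 1)) (coprime-yes q (λ (d∣1 , _) → ∣1⇒≡1 d∣1)))) ⟩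
  ∑ 1 (coprime-indicator q)       ≤⟨ ∑-≤-ext 0<q (λ n _ _ → 𝟙-nonneg (gcd n q ℕ.≟ 1)) ⟩
  ∑ q (coprime-indicator q)       ≡⟨ φ-∑ q ⟨
  # (φ q)                         ∎)
  where open ℚ.≤-Reasoning

∑-periodic : ∀ q m {z : ℕ → ℚ} → (∀ m n → z (q * m + n) ≡ z n) → ∑ (q * m) z ≡ # m ⊗ ∑ q z
∑-periodic q zero {z} per = trans (cong (λ t → ∑ t z) (ℕ.*-zeroʳ q)) (sym (trans (cong (_⊗ ∑ q z) #0) (ℚ.*-zeroˡ (∑ q z))))
∑-periodic q (suc m) {z} per = begin
  ∑ (q * suc m) z                              ≡⟨ cong (λ t → ∑ t z) (trans (ℕ.*-suc q m) (ℕ.+-comm q (q * m))) ⟩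
  ∑ (q * m + q) z                              ≡⟨ ∑-split (q * m) q z ⟩
  ∑ (q * m) z ⊕ ∑ q (λ n → z (q * m + n))      ≡⟨ cong₂ _⊕_ (∑-periodic q m per) (∑-cong q λ n _ _ → per m n) ⟩
  # m ⊗ ∑ q z ⊕ ∑ q z                          ≡⟨ trans (solve 2 (λ m x → m :* x :+ x := (con 1ℚ :+ m) :* x) refl (# m) (∑ q z)) (cong (_⊗ ∑ q z) (sym (#-suc m))) ⟩
  # (suc m) ⊗ ∑ q z                            ∎
  where open ≡-Reasoning

-- Among the p φ(q) numbers up to q p that are coprime to q, the multiples of p are the p m with m ≤
-- q coprime to q. There are φ(q) of these.
φ-prime : ∀ {q p} → Prime p → Coprime q p → # (φ (q * p)) ≡ # (φ q) ⊗ # (p ℕ.∸ 1)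
φ-prime {q} {p} pp c = begin
  # (φ (q * p))                                               ≡⟨ φ-∑ (q * p) ⟩
  ∑ (q * p) (coprime-indicator (q * p))                       ≡⟨ ∑-cong (q * p) (λ n _ _ → split n) ⟩
  ∑ (q * p) (λ n → z n ⊕ ⊝ 1ℚ ⊗ (𝟙 (p ∣? n) ⊗ z n))           ≡⟨ trans (∑-⊕ (q * p) z (λ n → ⊝ 1ℚ ⊗ (𝟙 (p ∣? n) ⊗ z n))) (cong (∑ (q * p) z ⊕_) (∑-⊗ (q * p) (⊝ 1ℚ) (λ n → 𝟙 (p ∣? n) ⊗ z n))) ⟩
  ∑ (q * p) z ⊕ ⊝ 1ℚ ⊗ ∑ (q * p) (λ n → 𝟙 (p ∣? n) ⊗ z n)     ≡⟨ cong₂ (λ x y → x ⊕ ⊝ 1ℚ ⊗ y) (∑-periodic q p (coprime-periodic q))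
      (trans (cong (λ t → ∑ t (λ n → 𝟙 (p ∣? n) ⊗ z n)) (ℕ.*-comm q p)) (trans (∑-multiples-block p q z (prime-pos pp)) (∑-cong q λ n _ _ → coprime-cong q
        (λ d (e∣n , e∣q) → d (∣n⇒∣m*n p e∣n , e∣q)) (λ d → Coprimality.sym (coprime-* c (Coprimality.sym d)))))) ⟩
  # p ⊗ ∑ q z ⊕ ⊝ 1ℚ ⊗ ∑ q z                                  ≡⟨ cong (λ t → t ⊗ ∑ q z ⊕ ⊝ 1ℚ ⊗ ∑ q z) (#pred (prime>1 pp)) ⟩
  (1ℚ ⊕ # (p ℕ.∸ 1)) ⊗ ∑ q z ⊕ ⊝ 1ℚ ⊗ ∑ q z                   ≡⟨ solve 2 (λ m x → (con 1ℚ :+ m) :* x :+ con (⊝ 1ℚ) :* x := x :* m) refl (# (p ℕ.∸ 1)) (∑ q z) ⟩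
  ∑ q z ⊗ # (p ℕ.∸ 1)                                         ≡⟨ cong (_⊗ # (p ℕ.∸ 1)) (φ-∑ q) ⟨
  # (φ q) ⊗ # (p ℕ.∸ 1)                                       ∎
  where
  open ≡-Reasoning
  z = coprime-indicator q
  split : ∀ n → coprime-indicator (q * p) n ≡ z n ⊕ ⊝ 1ℚ ⊗ (𝟙 (p ∣? n) ⊗ z n)
  split n with p ∣? n
  ... | yes p∣n = trans (coprime-no (q * p) λ d → ¬prime[1] (subst Prime (d (p∣n , n∣m*n q)) pp)) (solve 1 (λ x → con 0ℚ := x :+ con (⊝ 1ℚ) :* (con 1ℚ :* x)) refl (z n))
  ... | no p∤n = trans (𝟙-cong (gcd n (q * p) ℕ.≟ 1) (gcd n q ℕ.≟ 1)
      (λ e → coprime⇒gcd≡1 (coprime-∣ (gcd≡1⇒coprime {n} {q * p} e) (m∣m*n p)))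
      (λ e → coprime⇒gcd≡1 (coprime-* (gcd≡1⇒coprime {n} {q} e) (Coprimality.sym (prime-coprime pp p∤n)))))
    (solve 1 (λ x → x := x :+ con (⊝ 1ℚ) :* (con 0ℚ :* x)) refl (z n))

⅟φ-product : ∀ T → All Prime T → Unique T → ∀ q → 0 < q → All (Coprime q) T → ⅟ (φ (q * product T)) ≡ ⅟ (φ q) ⊗ ∏ₑ μ T
⅟φ-product [] _ _ q 0<q _ = trans (cong (λ t → ⅟ (φ t)) (ℕ.*-identityʳ q)) (sym (ℚ.*-identityʳ (⅟ (φ q))))
⅟φ-product (p ∷ T) (pp ∷ pT) (p∉T ∷ uT) q 0<q (cp ∷ cT) = begin
  ⅟ (φ (q * (p * product T)))              ≡⟨ cong (λ t → ⅟ (φ t)) (ℕ.*-assoc q p (product T)) ⟨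
  ⅟ (φ (q * p * product T))                ≡⟨ ⅟φ-product T pT uT (q * p) (*-pos 0<q (prime-pos pp)) cpT ⟩
  ⅟ (φ (q * p)) ⊗ ∏ₑ μ T                   ≡⟨ cong (_⊗ ∏ₑ μ T) (sym (⅟-unique (φ-pos (*-pos 0<q (prime-pos pp))) inverse)) ⟩
  ⅟ (φ q) ⊗ μ p ⊗ ∏ₑ μ T                   ≡⟨ ℚ.*-assoc (⅟ (φ q)) (μ p) (∏ₑ μ T) ⟩
  ⅟ (φ q) ⊗ (μ p ⊗ ∏ₑ μ T)                 ∎
  where
  open ≡-Reasoning
  cpT : All (Coprime (q * p)) T
  cpT = coprime-all pp p∉T pT cT
  inverse : # (φ (q * p)) ⊗ (⅟ (φ q) ⊗ μ p) ≡ 1ℚ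
  inverse = begin
    # (φ (q * p)) ⊗ (⅟ (φ q) ⊗ μ p)                     ≡⟨ cong (_⊗ (⅟ (φ q) ⊗ μ p)) (φ-prime pp cp) ⟩
    # (φ q) ⊗ # (p ℕ.∸ 1) ⊗ (⅟ (φ q) ⊗ μ p)             ≡⟨ solve 4 (λ a b c d → a :* b :* (c :* d) := (a :* c) :* (b :* d)) refl (# (φ q)) (# (p ℕ.∸ 1)) (⅟ (φ q)) (μ p) ⟩
    (# (φ q) ⊗ ⅟ (φ q)) ⊗ (# (p ℕ.∸ 1) ⊗ μ p)           ≡⟨ cong₂ _⊗_ (⅟-inverse (φ-pos 0<q)) (⅟-inverse (ℕ.m<n⇒0<n∸m (prime>1 pp))) ⟩
    1ℚ ⊗ 1ℚ                                             ≡⟨⟩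
    1ℚ                                                  ∎

⅟-product : ∀ T → Positive T → ∀ q → 0 < q → ⅟ (q * product T) ≡ ⅟ q ⊗ ∏ₑ ⅟_ T
⅟-product [] _ q 0<q = trans (cong ⅟_ (ℕ.*-identityʳ q)) (sym (ℚ.*-identityʳ (⅟ q)))
⅟-product (p ∷ T) (0<p ∷ pos) q 0<q = trans (cong ⅟_ (sym (ℕ.*-assoc q p (product T)))) (trans (⅟-product T pos (q * p) (*-pos 0<q 0<p))
  (trans (cong (_⊗ ∏ₑ ⅟_ T) (⅟-* 0<q 0<p)) (ℚ.*-assoc (⅟ q) (⅟ p) (∏ₑ ⅟_ T))))

pow-∏ₑ : ∀ k u T → pow k T ⊗ ∏ₑ u T ≡ ∏ₑ (λ p → k ⊗ u p) T
pow-∏ₑ k u [] = refl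
pow-∏ₑ k u (p ∷ T) = trans (solve 4 (λ k x u y → k :* x :* (u :* y) := k :* u :* (x :* y)) refl k (pow k T) (u p) (∏ₑ u T)) (cong (k ⊗ u p ⊗_) (pow-∏ₑ k u T))

-- Harmonic sums

H : ℕ → ℚ
H n = ∑ n ⅟_

H-mono : ∀ {m n} → m ≤ n → H m ⩽ H n
H-mono m≤n = ∑-≤-ext m≤n λ i _ _ → ⅟-nonneg i

H-nonneg : ∀ n → 0ℚ ⩽ H n
H-nonneg n = ∑-nonneg n λ i _ _ → ⅟-nonneg i

⅟≤1 : ∀ {n} → 0 < n → ⅟ n ⩽ 1ℚ
⅟≤1 0<n = ⩽-trans (⅟-anti (s≤s z≤n) 0<n) (≡⇒⩽ ⅟1)

H≤# : ∀ n → H n ⩽ # n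
H≤# n = ⩽-trans (∑-mono n λ i 0<i _ → ⅟≤1 0<i) (≡⇒⩽ (trans (∑-const n 1ℚ) (ℚ.*-identityʳ (# n))))

H1 : H 1 ≡ 1ℚ
H1 = trans (⊕-identityˡ (⅟ 1)) ⅟1

-- `κ` is the mean of z over a period. The block of q integers after q m contributes between κ/(m +
-- 1) and κ/m to `K`, so `K` grows like κ times the harmonic sum.
module Periodic (q : ℕ) (0<q : 0 < q) (z : ℕ → ℚ) (0≤z : Nonneg z) (per : ∀ m n → z (q * m + n) ≡ z n) where

  κ : ℚ
  κ = ∑ q z ⊗ ⅟ q

  K : ℕ → ℚ
  K n = ∑ n (λ i → z i ⊗ ⅟ i)

  κ-nonneg : 0ℚ ⩽ κ
  κ-nonneg = ⊗-nonneg (∑-nonneg q λ i _ _ → 0≤z i) (⅟-nonneg q)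

  private
    block : ℕ → ℚ
    block m = ∑ q (λ i → z (q * m + i) ⊗ ⅟ (q * m + i))

    K-suc : ∀ m → K (q * suc m) ≡ K (q * m) ⊕ block m
    K-suc m = trans (cong K (trans (ℕ.*-suc q m) (ℕ.+-comm q (q * m)))) (∑-split (q * m) q (λ i → z i ⊗ ⅟ i))

    constant : ∀ m {x} → ∑ q (λ i → z (q * m + i) ⊗ (⅟ q ⊗ x)) ≡ κ ⊗ x
    constant m {x} = begin
      ∑ q (λ i → z (q * m + i) ⊗ (⅟ q ⊗ x))    ≡⟨ ∑-cong q (λ i _ _ → trans (cong (_⊗ (⅟ q ⊗ x)) (per m i)) (ℚ.*-comm (z i) (⅟ q ⊗ x))) ⟩
      ∑ q (λ i → ⅟ q ⊗ x ⊗ z i)                ≡⟨ ∑-⊗ q (⅟ q ⊗ x) z ⟩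
      ⅟ q ⊗ x ⊗ ∑ q z                          ≡⟨ solve 3 (λ q x z → q :* x :* z := z :* q :* x) refl (⅟ q) x (∑ q z) ⟩
      κ ⊗ x                                    ∎
      where open ≡-Reasoning

    block-≥ : ∀ m → κ ⊗ ⅟ (suc m) ⩽ block m
    block-≥ m = ⩽-trans (≡⇒⩽ (sym (constant m))) (∑-mono q λ i 0<i i≤q → ⊗-monoˡ (z (q * m + i)) (0≤z (q * m + i))
      (⩽-trans (≡⇒⩽ (sym (⅟-* 0<q (s≤s z≤n)))) (⅟-anti (ℕ.<-≤-trans 0<i (ℕ.m≤n+m i (q * m)))
        (ℕ.≤-trans (ℕ.+-monoʳ-≤ (q * m) i≤q) (ℕ.≤-reflexive (trans (ℕ.+-comm (q * m) q) (sym (ℕ.*-suc q m))))))))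

    block-≤ : ∀ m → 0 < m → block m ⩽ κ ⊗ ⅟ m
    block-≤ m 0<m = ⩽-trans (∑-mono q λ i 0<i i≤q → ⊗-monoˡ (z (q * m + i)) (0≤z (q * m + i))
      (⩽-trans (⅟-anti (*-pos 0<q 0<m) (ℕ.m≤m+n (q * m) i)) (≡⇒⩽ (⅟-* 0<q 0<m)))) (≡⇒⩽ (constant m))

  K-≥ : ∀ y d → K (q * y) ⊕ κ ⊗ (H (y + d) ⊖ H y) ⩽ K (q * (y + d))
  K-≥ y zero = ≡⇒⩽ (trans (cong (λ t → K (q * y) ⊕ κ ⊗ (H t ⊖ H y)) (ℕ.+-identityʳ y))
    (trans (solve 3 (λ k c h → k :+ c :* (h :- h) := k) refl (K (q * y)) κ (H y)) (cong (λ t → K (q * t)) (sym (ℕ.+-identityʳ y)))))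
  K-≥ y (suc d) = begin
    K (q * y) ⊕ κ ⊗ (H (y + suc d) ⊖ H y)                ≡⟨ cong (λ t → K (q * y) ⊕ κ ⊗ (H t ⊖ H y)) (ℕ.+-suc y d) ⟩
    K (q * y) ⊕ κ ⊗ (H (y + d) ⊕ ⅟ suc (y + d) ⊖ H y)    ≡⟨ solve 5 (λ k c h r h′ → k :+ c :* (h :+ r :- h′) := k :+ c :* (h :- h′) :+ c :* r) refl (K (q * y)) κ (H (y + d)) (⅟ suc (y + d)) (H y) ⟩
    K (q * y) ⊕ κ ⊗ (H (y + d) ⊖ H y) ⊕ κ ⊗ ⅟ suc (y + d) ≤⟨ ⊕-mono (K-≥ y d) (block-≥ (y + d)) ⟩
    K (q * (y + d)) ⊕ block (y + d)                      ≡⟨ K-suc (y + d) ⟨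
    K (q * suc (y + d))                                  ≡⟨ cong (λ t → K (q * t)) (ℕ.+-suc y d) ⟨
    K (q * (y + suc d))                                  ∎
    where open ℚ.≤-Reasoning

  private
    -- Summing κ/m instead of κ/(m + 1) shifts the harmonic sum by one index. The two boundary terms
    -- account for this shift and keep the induction exact.
    K-≤′ : ∀ y d → 0 < y → K (q * (y + d)) ⩽ K (q * y) ⊕ κ ⊗ (H (y + d) ⊖ H y ⊕ ⅟ y ⊖ ⅟ (y + d))
    K-≤′ y zero 0<y = ≡⇒⩽ (trans (cong (λ t → K (q * t)) (ℕ.+-identityʳ y)) (sym (trans (cong (λ t → K (q * y) ⊕ κ ⊗ (H t ⊖ H y ⊕ ⅟ y ⊖ ⅟ t)) (ℕ.+-identityʳ y))
      (solve 4 (λ k c h r → k :+ c :* (h :- h :+ r :- r) := k) refl (K (q * y)) κ (H y) (⅟ y)))))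
    K-≤′ y (suc d) 0<y = begin
      K (q * (y + suc d))                                ≡⟨ cong (λ t → K (q * t)) (ℕ.+-suc y d) ⟩
      K (q * suc (y + d))                                ≡⟨ K-suc (y + d) ⟩
      K (q * (y + d)) ⊕ block (y + d)                    ≤⟨ ⊕-mono (K-≤′ y d 0<y) (block-≤ (y + d) (ℕ.<-≤-trans 0<y (ℕ.m≤m+n y d))) ⟩
      K (q * y) ⊕ κ ⊗ (H (y + d) ⊖ H y ⊕ ⅟ y ⊖ ⅟ (y + d)) ⊕ κ ⊗ ⅟ (y + d)
        ≡⟨ solve 7 (λ k c h h′ r s t → k :+ c :* (h :- h′ :+ r :- s) :+ c :* s := k :+ c :* (h :+ t :- h′ :+ r :- t)) refl (K (q * y)) κ (H (y + d)) (H y) (⅟ y) (⅟ (y + d)) (⅟ suc (y + d)) ⟩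
      K (q * y) ⊕ κ ⊗ (H (suc (y + d)) ⊖ H y ⊕ ⅟ y ⊖ ⅟ suc (y + d))
        ≡⟨ cong (λ t → K (q * y) ⊕ κ ⊗ (H t ⊖ H y ⊕ ⅟ y ⊖ ⅟ t)) (ℕ.+-suc y d) ⟨
      K (q * y) ⊕ κ ⊗ (H (y + suc d) ⊖ H y ⊕ ⅟ y ⊖ ⅟ (y + suc d)) ∎
      where open ℚ.≤-Reasoning

  K-≤ : ∀ y d → 0 < y → K (q * (y + d)) ⩽ K (q * y) ⊕ κ ⊗ (H (y + d) ⊖ H y ⊕ 1ℚ)
  K-≤ y d 0<y = ⩽-trans (K-≤′ y d 0<y) (⊕-monoʳ (K (q * y)) (⊗-monoˡ κ κ-nonneg
    (by-excess ((1ℚ ⊖ ⅟ y) ⊕ ⅟ (y + d)) (⊕-nonneg (x≤y⇒0≤y-x (⅟≤1 0<y)) (⅟-nonneg (y + d)))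
      (solve 4 (λ h h′ r s → h :- h′ :+ r :- s :+ ((con 1ℚ :- r) :+ s) := h :- h′ :+ con 1ℚ) refl (H (y + d)) (H y) (⅟ y) (⅟ (y + d))))))

module _ (x : ℕ) (0<x : 0 < x) where
  private
    open module P = Periodic x 0<x (λ _ → 1ℚ) (λ _ → 0≤1) (λ _ _ → refl)
    κ≡1 : κ ≡ 1ℚ
    κ≡1 = trans (cong (_⊗ ⅟ x) (trans (∑-const x 1ℚ) (ℚ.*-identityʳ (# x)))) (⅟-inverse 0<x)
    K≡H : ∀ n → K n ≡ H n
    K≡H n = ∑-cong n λ i _ _ → ℚ.*-identityˡ (⅟ i)

  -- For the constant function 1, viewed as periodic with period x, `K` is H itself. The result is
  -- the approximate additivity that lets H stand in for the logarithm.
  H-*-≥ : ∀ m → 0 < m → H x ⊕ (H m ⊖ 1ℚ) ⩽ H (x * m)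
  H-*-≥ (suc m) _ = begin
    H x ⊕ (H (suc m) ⊖ 1ℚ)                              ≡⟨ cong₂ (λ u v → u ⊕ (H (suc m) ⊖ v)) (trans (cong H (sym (ℕ.*-identityʳ x))) (sym (K≡H (x * 1)))) (sym H1) ⟩
    K (x * 1) ⊕ (H (suc m) ⊖ H 1)                       ≡⟨ cong (K (x * 1) ⊕_) (trans (sym (ℚ.*-identityˡ (H (suc m) ⊖ H 1))) (cong (_⊗ (H (suc m) ⊖ H 1)) (sym κ≡1))) ⟩
    K (x * 1) ⊕ κ ⊗ (H (suc m) ⊖ H 1)                   ≤⟨ K-≥ 1 m ⟩
    K (x * suc m)                                       ≡⟨ K≡H (x * suc m) ⟩
    H (x * suc m)                                       ∎
    where open ℚ.≤-Reasoning

  H-*-≤ : ∀ m → 0 < m → H (x * m) ⩽ H x ⊕ H m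
  H-*-≤ (suc m) _ = begin
    H (x * suc m)                                       ≡⟨ K≡H (x * suc m) ⟨
    K (x * suc m)                                       ≤⟨ K-≤ 1 m (s≤s z≤n) ⟩
    K (x * 1) ⊕ κ ⊗ (H (suc m) ⊖ H 1 ⊕ 1ℚ)              ≡⟨ cong₂ (λ u v → K (x * 1) ⊕ u ⊗ (H (suc m) ⊖ v ⊕ 1ℚ)) κ≡1 H1 ⟩
    K (x * 1) ⊕ 1ℚ ⊗ (H (suc m) ⊖ 1ℚ ⊕ 1ℚ)              ≡⟨ cong₂ _⊕_ (trans (K≡H (x * 1)) (cong H (ℕ.*-identityʳ x))) (solve 1 (λ h → con 1ℚ :* (h :- con 1ℚ :+ con 1ℚ) := h) refl (H (suc m))) ⟩
    H x ⊕ H (suc m)                                     ∎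
    where open ℚ.≤-Reasoning

^-pos : ∀ {T} → 0 < T → ∀ j → 0 < T ℕ.^ j
^-pos 0<T zero    = s≤s z≤n
^-pos 0<T (suc j) = *-pos 0<T (^-pos 0<T j)

H-^ : ∀ {T} → 0 < T → ∀ b → 0 < b → H (T ℕ.^ b) ⩽ # b ⊗ H T
H-^ {T} 0<T (suc zero) _ = ≡⇒⩽ (trans (cong H (ℕ.*-identityʳ T)) (sym (trans (cong (_⊗ H T) #1) (ℚ.*-identityˡ (H T)))))
H-^ {T} 0<T (suc b@(suc _)) _ = ⩽-trans (H-*-≤ T 0<T (T ℕ.^ b) (^-pos 0<T b)) (⩽-trans (⊕-monoʳ (H T) (H-^ 0<T b (s≤s z≤n)))
  (≡⇒⩽ (trans (solve 2 (λ h b → h :+ b :* h := (con 1ℚ :+ b) :* h) refl (H T) (# b)) (cong (_⊗ H T) (sym (#-suc b))))))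

-- Every doubling of the argument adds at least H 2 - 1 = 1/2, and H 1 = 1.
H-2^ : ∀ n → # (2 + n) ⩽ # 2 ⊗ H (2 ℕ.^ n)
H-2^ zero = ≡⇒⩽ (sym (trans (cong (# 2 ⊗_) H1) (ℚ.*-identityʳ (# 2))))
H-2^ (suc n) = begin
  # (suc (2 + n))                        ≡⟨ #-suc (2 + n) ⟩
  1ℚ ⊕ # (2 + n)                         ≤⟨ ⊕-monoʳ 1ℚ (H-2^ n) ⟩
  1ℚ ⊕ # 2 ⊗ H (2 ℕ.^ n)                 ≡⟨ cong (_⊕ # 2 ⊗ H (2 ℕ.^ n)) (⅟-inverse {2} (s≤s z≤n)) ⟨
  # 2 ⊗ ⅟ 2 ⊕ # 2 ⊗ H (2 ℕ.^ n)          ≡⟨ solve 3 (λ t r h → t :* r :+ t :* h := t :* (h :+ (con 1ℚ :+ r :- con 1ℚ))) refl (# 2) (⅟ 2) (H (2 ℕ.^ n)) ⟩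
  # 2 ⊗ (H (2 ℕ.^ n) ⊕ (1ℚ ⊕ ⅟ 2 ⊖ 1ℚ))  ≡⟨ cong (λ t → # 2 ⊗ (H (2 ℕ.^ n) ⊕ (t ⊕ ⅟ 2 ⊖ 1ℚ))) H1 ⟨
  # 2 ⊗ (H (2 ℕ.^ n) ⊕ (H 2 ⊖ 1ℚ))       ≤⟨ ⊗-monoˡ (# 2) (#-nonneg 2) (H-*-≥ (2 ℕ.^ n) (^-pos {2} (s≤s z≤n) n) 2 (s≤s z≤n)) ⟩
  # 2 ⊗ H (2 ℕ.^ n * 2)                  ≡⟨ cong (λ t → # 2 ⊗ H t) (ℕ.*-comm (2 ℕ.^ n) 2) ⟩
  # 2 ⊗ H (2 ℕ.^ suc n)                  ∎
  where open ℚ.≤-Reasoning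

H-unbounded : ∀ x → ∃[ n ] (0 < n × x ⩽ H n)
H-unbounded x with archimedes x
... | m , x≤m = 2 ℕ.^ (2 * m) , ^-pos {2} (s≤s z≤n) (2 * m) , ⩽-trans x≤m (⊗-cancelˡ (# 2) (#-pos {2} (s≤s z≤n)) (⩽-trans (≡⇒⩽ (sym (#-* 2 m))) (⩽-trans (#-mono (ℕ.m≤n+m (2 * m) 2)) (H-2^ (2 * m)))))

-- Sums over the integers coprime to W, cut at the powers of a multiple T of W.
module Buckets (W s : ℕ) (1<W : 1 < W) (0<s : 0 < s) where

  private
    z = coprime-indicator W
    0<W : 0 < W
    0<W = ℕ.<-trans (s≤s z≤n) 1<W
    0≤z : Nonneg z
    0≤z n = 𝟙-nonneg (gcd n W ℕ.≟ 1)
    open module P = Periodic W 0<W z 0≤z (coprime-periodic W) using (K; K-≥; K-≤)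

  open P public using (κ; κ-nonneg)

  T : ℕ
  T = W * s

  private
    0<T : 0 < T
    0<T = *-pos 0<W 0<s
    1<T : 1 < T
    1<T = ℕ.<-≤-trans 1<W (m≤p*m′ W s 0<s)
      where
      m≤p*m′ : ∀ m p → 0 < p → m ≤ m * p
      m≤p*m′ m p@(suc _) _ = ℕ.m≤m*n m p

  -- W² + 1 dominates every boundary term. The first period has K W ≤ W ≤ κ W², because κ W = φ(W) ≥
  -- 1; the lower bound for the first bucket loses at most H W + 1; each later bucket loses at most
  -- 1.
  C : ℚ
  C = # (W * W + 1)

  u₊ u₋ : ℚ
  u₊ = κ ⊗ (H T ⊕ C)
  u₋ = κ ⊗ (H T ⊖ C)

  κ#W≥1 : 1ℚ ⩽ κ ⊗ # W
  κ#W≥1 = ⩽-trans (⩽-trans (1≤# (φ-pos 0<W)) (≡⇒⩽ (φ-∑ W))) (≡⇒⩽ (sym (trans (solve 3 (λ x r w → x :* r :* w := x :* (w :* r)) refl (∑ W z) (⅟ W) (# W))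
    (trans (cong (∑ W z ⊗_) (⅟-inverse 0<W)) (ℚ.*-identityʳ (∑ W z))))))

  private
    bucket : ℕ → ℚ
    bucket zero    = K T
    bucket (suc j) = K (T ℕ.^ suc (suc j)) ⊖ K (T ℕ.^ suc j)

    y : ℕ → ℕ
    y j = s * T ℕ.^ j

    0<y : ∀ j → 0 < y j
    0<y j = *-pos 0<s (^-pos 0<T j)

    T^≡ : ∀ j → T ℕ.^ suc j ≡ W * y j
    T^≡ j = ℕ.*-assoc W s (T ℕ.^ j)

    y-suc : ∀ j → ∃[ d ] y (suc j) ≡ y j + d × y (suc j) ≡ y j * T
    y-suc j = y (suc j) ℕ.∸ y j , sym (ℕ.m+[n∸m]≡n (ℕ.*-monoʳ-≤ s (m≤p*m (T ℕ.^ j) 0<T))) , trans (cong (s *_) (ℕ.*-comm T (T ℕ.^ j))) (sym (ℕ.*-assoc s (T ℕ.^ j) T))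

    1≤C : 1ℚ ⩽ C
    1≤C = 1≤# (ℕ.m≤n+m 1 (W * W))

    HW+1≤C : H W ⊕ 1ℚ ⩽ C
    HW+1≤C = ⩽-trans (⊕-mono (⩽-trans (H≤# W) (#-mono (m≤p*m W 0<W))) (≡⇒⩽ (sym #1))) (≡⇒⩽ (sym (#-+ (W * W) 1)))

    s≡ : s ≡ 1 + (s ℕ.∸ 1)
    s≡ = sym (ℕ.m+[n∸m]≡n 0<s)

    bucket-≤ : ∀ j → bucket j ⩽ u₊
    bucket-≤ zero = begin
      K T                                            ≡⟨ cong (λ t → K (W * t)) s≡ ⟩
      K (W * (1 + (s ℕ.∸ 1)))                        ≤⟨ K-≤ 1 (s ℕ.∸ 1) (s≤s z≤n) ⟩
      K (W * 1) ⊕ κ ⊗ (H (1 + (s ℕ.∸ 1)) ⊖ H 1 ⊕ 1ℚ) ≡⟨ cong₂ (λ a b → K a ⊕ κ ⊗ (H b ⊖ H 1 ⊕ 1ℚ)) (ℕ.*-identityʳ W) (sym s≡) ⟩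
      K W ⊕ κ ⊗ (H s ⊖ H 1 ⊕ 1ℚ)                     ≡⟨ cong (λ t → K W ⊕ κ ⊗ (H s ⊖ t ⊕ 1ℚ)) H1 ⟩
      K W ⊕ κ ⊗ (H s ⊖ 1ℚ ⊕ 1ℚ)                      ≡⟨ cong (λ t → K W ⊕ κ ⊗ t) (solve 1 (λ h → h :- con 1ℚ :+ con 1ℚ := h) refl (H s)) ⟩
      K W ⊕ κ ⊗ H s                                  ≤⟨ ⊕-mono K≤ (⊗-monoˡ κ κ-nonneg (H-mono (m≤p*m s 0<W))) ⟩
      κ ⊗ # (W * W) ⊕ κ ⊗ H T                        ≡⟨ solve 3 (λ k a b → k :* a :+ k :* b := k :* (b :+ a)) refl κ (# (W * W)) (H T) ⟩
      κ ⊗ (H T ⊕ # (W * W))                          ≤⟨ ⊗-monoˡ κ κ-nonneg (⊕-monoʳ (H T) (#-mono (ℕ.m≤m+n (W * W) 1))) ⟩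
      u₊                                             ∎
      where
      open ℚ.≤-Reasoning
      K≤ : K W ⩽ κ ⊗ # (W * W)
      K≤ = begin
        K W                         ≤⟨ ∑-mono W (λ i 0<i _ → ⩽-trans (⊗-mono (0≤z i) (𝟙≤1 (gcd i W ℕ.≟ 1)) (⅟-nonneg i) (⅟≤1 0<i)) (≡⇒⩽ (ℚ.*-identityˡ 1ℚ))) ⟩
        ∑ W (λ _ → 1ℚ)              ≡⟨ trans (∑-const W 1ℚ) (ℚ.*-comm (# W) 1ℚ) ⟩
        1ℚ ⊗ # W                    ≤⟨ ⊗-monoʳ (# W) (#-nonneg W) κ#W≥1 ⟩
        κ ⊗ # W ⊗ # W               ≡⟨ trans (ℚ.*-assoc κ (# W) (# W)) (cong (κ ⊗_) (sym (#-* W W))) ⟩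
        κ ⊗ # (W * W)               ∎
    bucket-≤ (suc j) with y-suc j
    ... | d , e₁ , e₂ = begin
      K (T ℕ.^ suc (suc j)) ⊖ K (T ℕ.^ suc j)        ≡⟨ cong₂ (λ a b → K a ⊖ K b) (trans (T^≡ (suc j)) (cong (W *_) e₁)) (T^≡ j) ⟩
      K (W * (y j + d)) ⊖ K (W * y j)                ≤⟨ ⊕-monoˡ (⊝ K (W * y j)) (K-≤ (y j) d (0<y j)) ⟩
      K (W * y j) ⊕ κ ⊗ (H (y j + d) ⊖ H (y j) ⊕ 1ℚ) ⊖ K (W * y j)
        ≡⟨ solve 2 (λ k x → k :+ x :- k := x) refl (K (W * y j)) (κ ⊗ (H (y j + d) ⊖ H (y j) ⊕ 1ℚ)) ⟩
      κ ⊗ (H (y j + d) ⊖ H (y j) ⊕ 1ℚ)               ≤⟨ ⊗-monoˡ κ κ-nonneg (⊕-mono (⊕-monoˡ (⊝ H (y j)) (⩽-trans (≡⇒⩽ (cong H (trans (sym e₁) e₂))) (H-*-≤ (y j) (0<y j) T 0<T))) 1≤C) ⟩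
      κ ⊗ (H (y j) ⊕ H T ⊖ H (y j) ⊕ C)              ≡⟨ cong (κ ⊗_) (solve 3 (λ a b c → a :+ b :- a :+ c := b :+ c) refl (H (y j)) (H T) C) ⟩
      u₊                                             ∎
      where open ℚ.≤-Reasoning

    bucket-≥ : ∀ j → u₋ ⩽ bucket j
    bucket-≥ zero = begin
      κ ⊗ (H T ⊖ C)                                  ≤⟨ ⊗-monoˡ κ κ-nonneg (0≤y-x⇒x≤y (⩽-trans (⊕-nonneg (x≤y⇒0≤y-x (H-*-≤ W 0<W s 0<s)) (x≤y⇒0≤y-x HW+1≤C))
          (≡⇒⩽ (trans (solve 5 (λ a b t c o → (a :+ b :- t) :+ (c :- (a :+ o)) := (b :- o) :- (t :- c)) refl (H W) (H s) (H T) C 1ℚ) (cong (λ o → H s ⊖ o ⊖ (H T ⊖ C)) (sym H1)))))) ⟩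
      κ ⊗ (H s ⊖ H 1)                                ≡⟨ cong (λ t → κ ⊗ (H t ⊖ H 1)) s≡ ⟩
      κ ⊗ (H (1 + (s ℕ.∸ 1)) ⊖ H 1)                  ≤⟨ ≤⊕ˡ (∑-nonneg (W * 1) λ i _ _ → ⊗-nonneg (0≤z i) (⅟-nonneg i)) ⟩
      K (W * 1) ⊕ κ ⊗ (H (1 + (s ℕ.∸ 1)) ⊖ H 1)      ≤⟨ K-≥ 1 (s ℕ.∸ 1) ⟩
      K (W * (1 + (s ℕ.∸ 1)))                        ≡⟨ cong (λ t → K (W * t)) s≡ ⟨
      K T                                            ∎
      where open ℚ.≤-Reasoning
    bucket-≥ (suc j) with y-suc j
    ... | d , e₁ , e₂ = begin
      κ ⊗ (H T ⊖ C)                                  ≤⟨ ⊗-monoˡ κ κ-nonneg (0≤y-x⇒x≤y (⩽-trans (⊕-nonneg (x≤y⇒0≤y-x (H-*-≥ (y j) (0<y j) T 0<T)) (x≤y⇒0≤y-x 1≤C))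
          (≡⇒⩽ (solve 4 (λ a t x c → (x :- (a :+ (t :- con 1ℚ))) :+ (c :- con 1ℚ) := (x :- a) :- (t :- c)) refl (H (y j)) (H T) (H (y j * T)) C)))) ⟩
      κ ⊗ (H (y j * T) ⊖ H (y j))                    ≡⟨ cong (λ t → κ ⊗ (H t ⊖ H (y j))) (trans (sym e₂) e₁) ⟩
      κ ⊗ (H (y j + d) ⊖ H (y j))                    ≡⟨ solve 2 (λ k x → x := k :+ x :- k) refl (K (W * y j)) (κ ⊗ (H (y j + d) ⊖ H (y j))) ⟩
      K (W * y j) ⊕ κ ⊗ (H (y j + d) ⊖ H (y j)) ⊖ K (W * y j)   ≤⟨ ⊕-monoˡ (⊝ K (W * y j)) (K-≥ (y j) d) ⟩
      K (W * (y j + d)) ⊖ K (W * y j)                ≡⟨ cong₂ (λ a b → K a ⊖ K b) (trans (T^≡ (suc j)) (cong (W *_) e₁)) (T^≡ j) ⟨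
      K (T ℕ.^ suc (suc j)) ⊖ K (T ℕ.^ suc j)        ∎
      where open ℚ.≤-Reasoning

    G : (ℕ → ℚ) → ℕ → ℚ
    G F n = z n ⊗ (⅟ n ⊗ F n)

    growth : ∀ j → T ℕ.^ suc j ≡ T ℕ.^ j + (T ℕ.^ suc j ℕ.∸ T ℕ.^ j)
    growth j = sym (ℕ.m+[n∸m]≡n (m≤p*m (T ℕ.^ j) 0<T))

    K-block : ∀ j → bucket (suc j) ≡ ∑ (T ℕ.^ suc (suc j) ℕ.∸ T ℕ.^ suc j) (λ i → z (T ℕ.^ suc j + i) ⊗ ⅟ (T ℕ.^ suc j + i))
    K-block j = trans (cong (λ t → K t ⊖ K (T ℕ.^ suc j)) (growth (suc j))) (trans (cong (_⊖ K (T ℕ.^ suc j)) (∑-split (T ℕ.^ suc j) d (λ i → z i ⊗ ⅟ i)))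
      (solve 2 (λ k x → k :+ x :- k := x) refl (K (T ℕ.^ suc j)) (∑ d (λ i → z (T ℕ.^ suc j + i) ⊗ ⅟ (T ℕ.^ suc j + i)))))
      where d = T ℕ.^ suc (suc j) ℕ.∸ T ℕ.^ suc j

    scale : ∀ n (g : ℕ → ℕ) c → ∑ n (λ i → z (g i) ⊗ ⅟ (g i)) ⊗ c ≡ ∑ n (λ i → z (g i) ⊗ (⅟ (g i) ⊗ c))
    scale n g c = trans (ℚ.*-comm (∑ n (λ i → z (g i) ⊗ ⅟ (g i))) c) (trans (sym (∑-⊗ n c (λ i → z (g i) ⊗ ⅟ (g i))))
      (∑-cong n λ i _ _ → solve 3 (λ c z r → c :* (z :* r) := z :* (r :* c)) refl c (z (g i)) (⅟ (g i))))

    -- A power of T is a multiple of W, so the right end point of a bucket carries no weight. Lower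
    -- bounds therefore need only the strict condition n < T^(j+1).
    z-T : ∀ j → z (T ℕ.^ suc j) ≡ 0ℚ
    z-T j = coprime-no W λ c → ℕ.<⇒≢ 1<W (sym (c (subst (W ∣_) (sym (T^≡ j)) (m∣m*n (y j)) , ∣-refl)))

  -- The powers of T are equally spaced on the logarithmic scale, so every bucket has nearly the
  -- same harmonic mass, at most `u₊`. The sum thus becomes a plain sum over the bucket indices.
  harmonicSum-bucket-≤ : ∀ {F Ψ} → (∀ j n → T ℕ.^ j ≤ n → F n ⩽ Ψ j) → Nonneg Ψ → ∀ M →
    harmonicSum (T ℕ.^ suc M) z F ⩽ u₊ ⊗ ∑ (suc M) (λ j → Ψ (ℕ.pred j))
  harmonicSum-bucket-≤ {F} {Ψ} F≤ 0≤Ψ zero = begin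
    ∑ (T ℕ.^ 1) (G F)                                      ≡⟨ cong (λ t → ∑ t (G F)) (ℕ.*-identityʳ T) ⟩
    ∑ T (G F)                                              ≤⟨ ∑-mono T (λ i 0<i _ → ⊗-monoˡ (z i) (0≤z i) (⊗-monoˡ (⅟ i) (⅟-nonneg i) (F≤ 0 i 0<i))) ⟩
    ∑ T (λ i → z i ⊗ (⅟ i ⊗ Ψ 0))                          ≡⟨ scale T (λ i → i) (Ψ 0) ⟨
    K T ⊗ Ψ 0                                              ≤⟨ ⊗-monoʳ (Ψ 0) (0≤Ψ 0) (bucket-≤ 0) ⟩
    u₊ ⊗ Ψ 0                                               ≡⟨ cong (u₊ ⊗_) (⊕-identityˡ (Ψ 0)) ⟨
    u₊ ⊗ (0ℚ ⊕ Ψ 0)                                        ∎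
    where open ℚ.≤-Reasoning
  harmonicSum-bucket-≤ {F} {Ψ} F≤ 0≤Ψ (suc M) = begin
    ∑ (T ℕ.^ suc (suc M)) (G F)                            ≡⟨ trans (cong (λ t → ∑ t (G F)) (growth (suc M))) (∑-split (T ℕ.^ suc M) d (G F)) ⟩
    ∑ (T ℕ.^ suc M) (G F) ⊕ ∑ d (λ i → G F (T ℕ.^ suc M + i))
      ≤⟨ ⊕-mono (harmonicSum-bucket-≤ F≤ 0≤Ψ M) (∑-mono d λ i _ _ → ⊗-monoˡ (z (T ℕ.^ suc M + i)) (0≤z (T ℕ.^ suc M + i)) (⊗-monoˡ (⅟ (T ℕ.^ suc M + i)) (⅟-nonneg (T ℕ.^ suc M + i)) (F≤ (suc M) (T ℕ.^ suc M + i) (ℕ.m≤m+n (T ℕ.^ suc M) i)))) ⟩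
    u₊ ⊗ ∑ (suc M) (λ j → Ψ (ℕ.pred j)) ⊕ ∑ d (λ i → z (T ℕ.^ suc M + i) ⊗ (⅟ (T ℕ.^ suc M + i) ⊗ Ψ (suc M)))
      ≡⟨ cong (u₊ ⊗ ∑ (suc M) (λ j → Ψ (ℕ.pred j)) ⊕_) (trans (sym (scale d (λ i → T ℕ.^ suc M + i) (Ψ (suc M)))) (cong (_⊗ Ψ (suc M)) (sym (K-block M)))) ⟩
    u₊ ⊗ ∑ (suc M) (λ j → Ψ (ℕ.pred j)) ⊕ bucket (suc M) ⊗ Ψ (suc M)
      ≤⟨ ⊕-monoʳ (u₊ ⊗ ∑ (suc M) (λ j → Ψ (ℕ.pred j))) (⊗-monoʳ (Ψ (suc M)) (0≤Ψ (suc M)) (bucket-≤ (suc M))) ⟩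
    u₊ ⊗ ∑ (suc M) (λ j → Ψ (ℕ.pred j)) ⊕ u₊ ⊗ Ψ (suc M)   ≡⟨ ℚ.*-distribˡ-+ u₊ (∑ (suc M) (λ j → Ψ (ℕ.pred j))) (Ψ (suc M)) ⟨
    u₊ ⊗ ∑ (suc (suc M)) (λ j → Ψ (ℕ.pred j))              ∎
    where
    open ℚ.≤-Reasoning
    d = T ℕ.^ suc (suc M) ℕ.∸ T ℕ.^ suc M

  private
    below : ∀ {F Ψ : ℕ → ℚ} → (∀ j n → n < T ℕ.^ suc j → Ψ j ⩽ F n) → ∀ j n → n ≤ T ℕ.^ suc j → z n ⊗ (⅟ n ⊗ Ψ j) ⩽ G F n
    below {F} {Ψ} ≤F j n n≤ with ℕ.m≤n⇒m<n∨m≡n n≤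
    ... | inj₁ n< = ⊗-monoˡ (z n) (0≤z n) (⊗-monoˡ (⅟ n) (⅟-nonneg n) (≤F j n n<))
    ... | inj₂ refl = ≡⇒⩽ (trans (trans (cong (_⊗ (⅟ n ⊗ Ψ j)) (z-T j)) (ℚ.*-zeroˡ (⅟ n ⊗ Ψ j))) (sym (trans (cong (_⊗ (⅟ n ⊗ F n)) (z-T j)) (ℚ.*-zeroˡ (⅟ n ⊗ F n)))))

  harmonicSum-bucket-≥ : ∀ {F Ψ} → (∀ j n → n < T ℕ.^ suc j → Ψ j ⩽ F n) → Nonneg Ψ → ∀ M →
    u₋ ⊗ ∑ (suc M) (λ j → Ψ (ℕ.pred j)) ⩽ harmonicSum (T ℕ.^ suc M) z F
  harmonicSum-bucket-≥ {F} {Ψ} ≤F 0≤Ψ zero = begin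
    u₋ ⊗ (0ℚ ⊕ Ψ 0)                                        ≡⟨ cong (u₋ ⊗_) (⊕-identityˡ (Ψ 0)) ⟩
    u₋ ⊗ Ψ 0                                               ≤⟨ ⊗-monoʳ (Ψ 0) (0≤Ψ 0) (bucket-≥ 0) ⟩
    K T ⊗ Ψ 0                                              ≡⟨ scale T (λ i → i) (Ψ 0) ⟩
    ∑ T (λ i → z i ⊗ (⅟ i ⊗ Ψ 0))                          ≤⟨ ∑-mono T (λ i _ i≤T → below ≤F 0 i (ℕ.≤-trans i≤T (ℕ.≤-reflexive (sym (ℕ.*-identityʳ T))))) ⟩
    ∑ T (G F)                                              ≡⟨ cong (λ t → ∑ t (G F)) (ℕ.*-identityʳ T) ⟨
    ∑ (T ℕ.^ 1) (G F)                                      ∎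
    where open ℚ.≤-Reasoning
  harmonicSum-bucket-≥ {F} {Ψ} ≤F 0≤Ψ (suc M) = begin
    u₋ ⊗ ∑ (suc (suc M)) (λ j → Ψ (ℕ.pred j))              ≡⟨ ℚ.*-distribˡ-+ u₋ (∑ (suc M) (λ j → Ψ (ℕ.pred j))) (Ψ (suc M)) ⟩
    u₋ ⊗ ∑ (suc M) (λ j → Ψ (ℕ.pred j)) ⊕ u₋ ⊗ Ψ (suc M)
      ≤⟨ ⊕-mono (harmonicSum-bucket-≥ ≤F 0≤Ψ M) (⊗-monoʳ (Ψ (suc M)) (0≤Ψ (suc M)) (bucket-≥ (suc M))) ⟩
    ∑ (T ℕ.^ suc M) (G F) ⊕ bucket (suc M) ⊗ Ψ (suc M)
      ≡⟨ cong (∑ (T ℕ.^ suc M) (G F) ⊕_) (trans (cong (_⊗ Ψ (suc M)) (K-block M)) (scale d (λ i → T ℕ.^ suc M + i) (Ψ (suc M)))) ⟩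
    ∑ (T ℕ.^ suc M) (G F) ⊕ ∑ d (λ i → z (T ℕ.^ suc M + i) ⊗ (⅟ (T ℕ.^ suc M + i) ⊗ Ψ (suc M)))
      ≤⟨ ⊕-monoʳ (∑ (T ℕ.^ suc M) (G F)) (∑-mono d λ i _ i≤d → below ≤F (suc M) (T ℕ.^ suc M + i) (ℕ.≤-trans (ℕ.+-monoʳ-≤ (T ℕ.^ suc M) i≤d) (ℕ.≤-reflexive (sym (growth (suc M)))))) ⟩
    ∑ (T ℕ.^ suc M) (G F) ⊕ ∑ d (λ i → G F (T ℕ.^ suc M + i))
      ≡⟨ trans (cong (λ t → ∑ t (G F)) (growth (suc M))) (∑-split (T ℕ.^ suc M) d (G F)) ⟨
    ∑ (T ℕ.^ suc (suc M)) (G F) ∎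
    where
    open ℚ.≤-Reasoning
    d = T ℕ.^ suc (suc M) ℕ.∸ T ℕ.^ suc M

-- Iterated harmonic sums of step functions

-- Finitely supported sequences as lists, with value 0 beyond the end.
infixl 10 _‼_
_‼_ : List ℕ → ℕ → ℕ
[]       ‼ i     = 0
(x ∷ xs) ‼ zero  = x
(x ∷ xs) ‼ suc i = xs ‼ i

private
  push : ℕ → List ℕ → List ℕ
  push x s = x + s ‼ 0 ∷ s

-- The suffix sums: entry i is the sum of all entries from i on. This is the discrete form of
-- integrating a function of x + y over y ≥ 0.
tails : List ℕ → List ℕ
tails []       = []
tails (x ∷ xs) = push x (tails xs)

tails-‼ : ∀ L i → tails L ‼ i ≡ L ‼ i + tails L ‼ suc i
tails-‼ []       i       = refl
tails-‼ (x ∷ xs) zero    = refl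
tails-‼ (x ∷ xs) (suc i) = tails-‼ xs i

‼-beyond : ∀ L {i} → length L ≤ i → L ‼ i ≡ 0
‼-beyond []       _          = refl
‼-beyond (x ∷ xs) (s≤s p) = ‼-beyond xs p

length-tails : ∀ L → length (tails L) ≡ length L
length-tails []       = refl
length-tails (x ∷ xs) = cong suc (length-tails xs)

-- The product of a number in bucket i and one in bucket j lies in bucket i + j or i + j + 1. Upper
-- bounds for a decreasing function use the first index, hence `tails`; lower bounds use the second,
-- hence suffix sums that start one entry later.
tails⁺ : List ℕ → List ℕ
tails⁺ L = drop 1 (tails L)

drop-‼ : ∀ L i → drop 1 L ‼ i ≡ L ‼ suc i
drop-‼ []       i = refl
drop-‼ (x ∷ xs) i = refl

length-drop : ∀ (L : List ℕ) → length (drop 1 L) ≤ length L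
length-drop []       = z≤n
length-drop (x ∷ xs) = ℕ.n≤1+n (length xs)

length-tails⁺ : ∀ L → length (tails⁺ L) ≤ length L
length-tails⁺ L = ℕ.≤-trans (length-drop (tails L)) (ℕ.≤-reflexive (length-tails L))

squares : List ℕ → List ℕ
squares = map (λ x → x * x)

squares-‼ : ∀ L i → squares L ‼ i ≡ L ‼ i * L ‼ i
squares-‼ []       i       = refl
squares-‼ (x ∷ xs) zero    = refl
squares-‼ (x ∷ xs) (suc i) = squares-‼ xs i

length-squares : ∀ L → length (squares L) ≡ length L
length-squares []       = refl
length-squares (x ∷ xs) = cong suc (length-squares xs)

repeat : ℕ → (List ℕ → List ℕ) → List ℕ → List ℕ
repeat zero    f L = L
repeat (suc j) f L = f (repeat j f L)

partial-tails : ∀ L i M → ∑ M (λ j → # (L ‼ (i + ℕ.pred j))) ⊕ # (tails L ‼ (i + M)) ≡ # (tails L ‼ i)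
partial-tails L i zero = trans (⊕-identityˡ (# (tails L ‼ (i + 0)))) (cong (λ t → # (tails L ‼ t)) (ℕ.+-identityʳ i))
partial-tails L i (suc M) = begin
  ∑ M f ⊕ # (L ‼ (i + M)) ⊕ # (tails L ‼ (i + suc M))       ≡⟨ ℚ.+-assoc (∑ M f) (# (L ‼ (i + M))) (# (tails L ‼ (i + suc M))) ⟩
  ∑ M f ⊕ (# (L ‼ (i + M)) ⊕ # (tails L ‼ (i + suc M)))     ≡⟨ cong (λ t → ∑ M f ⊕ (# (L ‼ (i + M)) ⊕ # (tails L ‼ t))) (ℕ.+-suc i M) ⟩
  ∑ M f ⊕ (# (L ‼ (i + M)) ⊕ # (tails L ‼ suc (i + M)))     ≡⟨ cong (∑ M f ⊕_) (trans (cong #_ (tails-‼ L (i + M))) (#-+ (L ‼ (i + M)) (tails L ‼ suc (i + M)))) ⟨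
  ∑ M f ⊕ # (tails L ‼ (i + M))                             ≡⟨ partial-tails L i M ⟩
  # (tails L ‼ i)                                           ∎
  where
  open ≡-Reasoning
  f : ℕ → ℚ
  f j = # (L ‼ (i + ℕ.pred j))

partial-≤-tails : ∀ L i M → ∑ M (λ j → # (L ‼ (i + ℕ.pred j))) ⩽ # (tails L ‼ i)
partial-≤-tails L i M = ⩽-trans (≤⊕ʳ (#-nonneg (tails L ‼ (i + M)))) (≡⇒⩽ (partial-tails L i M))

tails-≤-partial : ∀ L i M → length L ≤ M → # (tails L ‼ i) ⩽ ∑ M (λ j → # (L ‼ (i + ℕ.pred j)))
tails-≤-partial L i M len = ≡⇒⩽ (trans (sym (partial-tails L i M)) (trans (cong (∑ M (λ j → # (L ‼ (i + ℕ.pred j))) ⊕_)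
  (trans (cong #_ (‼-beyond (tails L) (ℕ.≤-trans (ℕ.≤-reflexive (length-tails L)) (ℕ.≤-trans len (ℕ.m≤n+m M i))))) #0)) (⊕-identityʳ (∑ M (λ j → # (L ‼ (i + ℕ.pred j)))))))

module Steps (W s : ℕ) (1<W : 1 < W) (0<s : 0 < s) where

  open Buckets W s 1<W 0<s public

  private
    z = coprime-indicator W
    0≤z : Nonneg z
    0≤z n = 𝟙-nonneg (gcd n W ℕ.≟ 1)
    0<T : 0 < T
    0<T = *-pos (ℕ.<-trans (s≤s z≤n) 1<W) 0<s

  -- Y n = ∑_{j} ds_j [ n < x T^(j+1) ]
  step : List ℕ → ℕ → ℕ → ℚ
  step []       x n = 0ℚ
  step (d ∷ ds) x n = # d ⊗ 𝟙 (n ℕ.<? x * T) ⊕ step ds (x * T) n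

  step-nonneg : ∀ ds x n → 0ℚ ⩽ step ds x n
  step-nonneg []       x n = ⩽-refl
  step-nonneg (d ∷ ds) x n = ⊕-nonneg (⊗-nonneg (#-nonneg d) (𝟙-nonneg (n ℕ.<? x * T))) (step-nonneg ds (x * T) n)

  step-anti : ∀ ds x {m n} → m ≤ n → step ds x n ⩽ step ds x m
  step-anti []       x m≤n = ⩽-refl
  step-anti (d ∷ ds) x {m} {n} m≤n = ⊕-mono (⊗-monoˡ (# d) (#-nonneg d) (𝟙-mono (n ℕ.<? x * T) (m ℕ.<? x * T) (ℕ.≤-<-trans m≤n))) (step-anti ds (x * T) m≤n)

  private
    rearrange : ∀ i x → T ℕ.^ suc i * x ≡ T ℕ.^ i * (x * T)
    rearrange i x = trans (cong (_* x) (ℕ.*-comm T (T ℕ.^ i))) (trans (ℕ.*-assoc (T ℕ.^ i) T x) (cong (T ℕ.^ i *_) (ℕ.*-comm T x)))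

    x≤xT : ∀ x → x ≤ x * T
    x≤xT x = ℕ.≤-trans (m≤p*m x 0<T) (ℕ.≤-reflexive (ℕ.*-comm T x))

  step-≤ : ∀ ds i x n → T ℕ.^ i * x ≤ n → step ds x n ⩽ # (tails ds ‼ i)
  step-≤ [] i x n p = ≡⇒⩽ (sym #0)
  step-≤ (d ∷ ds) zero x n p = ⩽-trans (⊕-mono (⩽-trans (⊗-monoˡ (# d) (#-nonneg d) (𝟙≤1 (n ℕ.<? x * T))) (≡⇒⩽ (ℚ.*-identityʳ (# d)))) (all ds (x * T)))
    (≡⇒⩽ (sym (#-+ d (tails ds ‼ 0))))
    where
    all : ∀ ds x → step ds x n ⩽ # (tails ds ‼ 0)
    all [] x = ≡⇒⩽ (sym #0)
    all (d ∷ ds) x = ⩽-trans (⊕-mono (⩽-trans (⊗-monoˡ (# d) (#-nonneg d) (𝟙≤1 (n ℕ.<? x * T))) (≡⇒⩽ (ℚ.*-identityʳ (# d)))) (all ds (x * T)))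
      (≡⇒⩽ (sym (#-+ d (tails ds ‼ 0))))
  step-≤ (d ∷ ds) (suc i) x n p = ⩽-trans (≡⇒⩽ (trans (cong (_⊕ step ds (x * T) n) (trans (cong (# d ⊗_) (𝟙-no (n ℕ.<? x * T) λ n< →
      ℕ.<⇒≱ n< (ℕ.≤-trans (m≤p*m (x * T) (^-pos 0<T i)) p′))) (ℚ.*-zeroʳ (# d)))) (⊕-identityˡ (step ds (x * T) n))))
    (step-≤ ds i (x * T) n p′)
    where
    p′ : T ℕ.^ i * (x * T) ≤ n
    p′ = ℕ.≤-trans (ℕ.≤-reflexive (sym (rearrange i x))) p

  step-≥ : ∀ ds i x n → n < T ℕ.^ suc i * x → # (tails ds ‼ i) ⩽ step ds x n
  step-≥ [] i x n p = ≡⇒⩽ #0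
  step-≥ (d ∷ ds) zero x n p = all (d ∷ ds) x (ℕ.<-≤-trans p (ℕ.≤-reflexive (trans (rearrange 0 x) (ℕ.*-identityˡ (x * T)))))
    where
    all : ∀ ds x → n < x * T → # (tails ds ‼ 0) ⩽ step ds x n
    all [] x p = ≡⇒⩽ #0
    all (d ∷ ds) x p = ⩽-trans (≡⇒⩽ (#-+ d (tails ds ‼ 0))) (⊕-mono (≡⇒⩽ (sym (trans (cong (# d ⊗_) (𝟙-yes (n ℕ.<? x * T) p)) (ℚ.*-identityʳ (# d)))))
      (all ds (x * T) (ℕ.<-≤-trans p (x≤xT (x * T)))))
  step-≥ (d ∷ ds) (suc i) x n p = ⩽-trans (step-≥ ds i (x * T) n (ℕ.<-≤-trans p (ℕ.≤-reflexive (rearrange (suc i) x))))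
    (≤⊕ˡ (⊗-nonneg (#-nonneg d) (𝟙-nonneg (n ℕ.<? x * T))))

  step-vanish : ∀ ds n → T ℕ.^ length ds ≤ n → step ds 1 n ≡ 0ℚ
  step-vanish ds n p = ℚ.≤-antisym (⩽-trans (step-≤ ds (length ds) 1 n (ℕ.≤-trans (ℕ.≤-reflexive (ℕ.*-identityʳ (T ℕ.^ length ds))) p))
    (≡⇒⩽ (trans (cong #_ (‼-beyond (tails ds) (ℕ.≤-reflexive (length-tails ds)))) #0))) (step-nonneg ds 1 n)

  step-decreasing : ∀ ds {R} → T ℕ.^ length ds ≤ R → Decreasing R (step ds 1)
  step-decreasing ds p .nonneg = step-nonneg ds 1
  step-decreasing ds p .anti = step-anti ds 1
  step-decreasing ds p .vanish n R<n = step-vanish ds n (ℕ.≤-trans p (ℕ.<⇒≤ R<n))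

  -- Bucket i consists of the x with T^i ≤ x < T^(i+1). Each relation uses only one of the two
  -- inequalities, in the form in which it passes to products. The scalar c collects powers of `u₊`
  -- or `u₋`, so that the lists stay integral.
  _UpperBoundOf_ _LowerBoundOf_ : ℚ × List ℕ → (ℕ → ℚ) → Set
  (c , L) UpperBoundOf F = ∀ i x → T ℕ.^ i ≤ x → F x ⩽ c ⊗ # (L ‼ i)
  (c , L) LowerBoundOf F = ∀ i x → x < T ℕ.^ suc i → c ⊗ # (L ‼ i) ⩽ F x

  step-upper : ∀ ds → (1ℚ , tails ds) UpperBoundOf step ds 1
  step-upper ds i x p = ⩽-trans (step-≤ ds i 1 x (ℕ.≤-trans (ℕ.≤-reflexive (ℕ.*-identityʳ (T ℕ.^ i))) p)) (≡⇒⩽ (sym (ℚ.*-identityˡ (# (tails ds ‼ i)))))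

  step-lower : ∀ ds → (1ℚ , tails ds) LowerBoundOf step ds 1
  step-lower ds i x p = ⩽-trans (≡⇒⩽ (ℚ.*-identityˡ (# (tails ds ‼ i)))) (step-≥ ds i 1 x (ℕ.<-≤-trans p (ℕ.≤-reflexive (sym (ℕ.*-identityʳ (T ℕ.^ suc i))))))

  private
    square-‼ : ∀ c L i → (c ⊗ # (L ‼ i)) ⊗ (c ⊗ # (L ‼ i)) ≡ c ⊗ c ⊗ # (squares L ‼ i)
    square-‼ c L i = trans (solve 2 (λ c x → (c :* x) :* (c :* x) := c :* c :* (x :* x)) refl c (# (L ‼ i)))
      (cong (c ⊗ c ⊗_) (trans (sym (#-* (L ‼ i) (L ‼ i))) (cong #_ (sym (squares-‼ L i)))))

  square-upper : ∀ {c L F} → Nonneg F → (c , L) UpperBoundOf F → (c ⊗ c , squares L) UpperBoundOf (λ n → F n ⊗ F n)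
  square-upper {c} {L} 0≤F U i x p = ⩽-trans (⊗-mono (0≤F x) (U i x p) (0≤F x) (U i x p)) (≡⇒⩽ (square-‼ c L i))

  square-lower : ∀ {c L F} → 0ℚ ⩽ c → (c , L) LowerBoundOf F → (c ⊗ c , squares L) LowerBoundOf (λ n → F n ⊗ F n)
  square-lower {c} {L} 0≤c U i x p = ⩽-trans (≡⇒⩽ (sym (square-‼ c L i))) (⊗-mono 0≤ (U i x p) 0≤ (U i x p))
    where 0≤ = ⊗-nonneg 0≤c (#-nonneg (L ‼ i))

  module _ (M : ℕ) where

    𝔸 : Operator
    𝔸 = harmonicSum (T ℕ.^ suc M) z

    𝔸-monotone : Monotone 𝔸
    𝔸-monotone = harmonicSum-monotone (T ℕ.^ suc M) 0≤z

    u₊-nonneg : 0ℚ ⩽ u₊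
    u₊-nonneg = ⊗-nonneg κ-nonneg (⊕-nonneg (H-nonneg T) (#-nonneg (W * W + 1)))

    𝔸-upper : ∀ {c L F} → 0ℚ ⩽ c → (c , L) UpperBoundOf F → (u₊ ⊗ c , tails L) UpperBoundOf (λ x → 𝔸 (λ n → F (x * n)))
    𝔸-upper {c} {L} {F} 0≤c U i x p = begin
      𝔸 (λ n → F (x * n))                                          ≤⟨ harmonicSum-bucket-≤ (λ j n q → U (i + j) (x * n) (ℕ.≤-trans (ℕ.≤-reflexive (ℕ.^-distribˡ-+-* T i j)) (ℕ.*-mono-≤ p q)))
          (λ j → ⊗-nonneg 0≤c (#-nonneg (L ‼ (i + j)))) M ⟩
      u₊ ⊗ ∑ (suc M) (λ j → c ⊗ # (L ‼ (i + ℕ.pred j)))            ≡⟨ cong (u₊ ⊗_) (∑-⊗ (suc M) c (λ j → # (L ‼ (i + ℕ.pred j)))) ⟩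
      u₊ ⊗ (c ⊗ ∑ (suc M) (λ j → # (L ‼ (i + ℕ.pred j))))          ≤⟨ ⊗-monoˡ u₊ u₊-nonneg (⊗-monoˡ c 0≤c (partial-≤-tails L i (suc M))) ⟩
      u₊ ⊗ (c ⊗ # (tails L ‼ i))                                   ≡⟨ ℚ.*-assoc u₊ c (# (tails L ‼ i)) ⟨
      u₊ ⊗ c ⊗ # (tails L ‼ i)                                     ∎
      where open ℚ.≤-Reasoning

    𝔸-lower : ∀ {c L F} → 0ℚ ⩽ u₋ → 0ℚ ⩽ c → length L ≤ suc M → (c , L) LowerBoundOf F → (u₋ ⊗ c , tails⁺ L) LowerBoundOf (λ x → 𝔸 (λ n → F (x * n)))
    𝔸-lower {c} {L} {F} 0≤u 0≤c len U i x p = begin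
      u₋ ⊗ c ⊗ # (tails⁺ L ‼ i)                                    ≡⟨ trans (ℚ.*-assoc u₋ c (# (tails⁺ L ‼ i))) (cong (λ t → u₋ ⊗ (c ⊗ # t)) (drop-‼ (tails L) i)) ⟩
      u₋ ⊗ (c ⊗ # (tails L ‼ suc i))                               ≤⟨ ⊗-monoˡ u₋ 0≤u (⊗-monoˡ c 0≤c (tails-≤-partial L (suc i) (suc M) len)) ⟩
      u₋ ⊗ (c ⊗ ∑ (suc M) (λ j → # (L ‼ suc (i + ℕ.pred j))))      ≡⟨ cong (u₋ ⊗_) (∑-⊗ (suc M) c (λ j → # (L ‼ suc (i + ℕ.pred j)))) ⟨
      u₋ ⊗ ∑ (suc M) (λ j → c ⊗ # (L ‼ suc (i + ℕ.pred j)))        ≤⟨ harmonicSum-bucket-≥ (λ j n q → U (suc (i + j)) (x * n) (ℕ.<-≤-trans (ℕ.*-mono-< p q) (ℕ.≤-reflexive (trans (sym (ℕ.^-distribˡ-+-* T (suc i) (suc j))) (cong (T ℕ.^_) (cong suc (ℕ.+-suc i j)))))))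
          (λ j → ⊗-nonneg 0≤c (#-nonneg (L ‼ suc (i + j)))) M ⟩
      𝔸 (λ n → F (x * n))                                          ∎
      where open ℚ.≤-Reasoning

    private
      unfold : ∀ j F x → 𝔸 (λ y → iterate 𝔸 j (λ d → F (x * (y * d)))) ≡ 𝔸 (λ y → iterate 𝔸 j (λ d → F (x * y * d)))
      unfold j F x = op-cong 𝔸-monotone λ y _ → op-cong (iterate-monotone 𝔸-monotone j) λ d _ → cong F (sym (ℕ.*-assoc x y d))

    iterate-upper : ∀ {c L F} → 0ℚ ⩽ c → (c , L) UpperBoundOf F → ∀ j →
      (u₊ ^ℚ j ⊗ c , repeat j tails L) UpperBoundOf (λ x → iterate 𝔸 j (λ d → F (x * d)))
    iterate-upper {c} {L} {F} 0≤c U zero i x p = ⩽-trans (≡⇒⩽ (cong F (ℕ.*-identityʳ x))) (⩽-trans (U i x p) (≡⇒⩽ (cong (_⊗ # (L ‼ i)) (sym (ℚ.*-identityˡ c)))))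
    iterate-upper {c} {L} {F} 0≤c U (suc j) i x p = ⩽-trans (≡⇒⩽ (unfold j F x)) (⩽-trans
      (𝔸-upper {L = repeat j tails L} (⊗-nonneg (^ℚ-nonneg u₊-nonneg j) 0≤c) (iterate-upper {L = L} {F} 0≤c U j) i x p)
      (≡⇒⩽ (cong (_⊗ # (repeat (suc j) tails L ‼ i)) (sym (ℚ.*-assoc u₊ (u₊ ^ℚ j) c)))))

    length-repeat : ∀ j L → length (repeat j tails⁺ L) ≤ length L
    length-repeat zero    L = ℕ.≤-refl
    length-repeat (suc j) L = ℕ.≤-trans (length-tails⁺ (repeat j tails⁺ L)) (length-repeat j L)

    iterate-lower : ∀ {c L F} → 0ℚ ⩽ u₋ → 0ℚ ⩽ c → length L ≤ suc M → (c , L) LowerBoundOf F → ∀ j →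
      (u₋ ^ℚ j ⊗ c , repeat j tails⁺ L) LowerBoundOf (λ x → iterate 𝔸 j (λ d → F (x * d)))
    iterate-lower {c} {L} {F} 0≤u 0≤c len U zero i x p = ⩽-trans (≡⇒⩽ (cong (_⊗ # (L ‼ i)) (ℚ.*-identityˡ c))) (⩽-trans (U i x p) (≡⇒⩽ (cong F (sym (ℕ.*-identityʳ x)))))
    iterate-lower {c} {L} {F} 0≤u 0≤c len U (suc j) i x p = ⩽-trans (≡⇒⩽ (cong (_⊗ # (repeat (suc j) tails⁺ L ‼ i)) (ℚ.*-assoc u₋ (u₋ ^ℚ j) c))) (⩽-trans
      (𝔸-lower {L = repeat j tails⁺ L} 0≤u (⊗-nonneg (^ℚ-nonneg 0≤u j) 0≤c) (ℕ.≤-trans (length-repeat j L) len) (iterate-lower {L = L} {F} 0≤u 0≤c len U j) i x p)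
      (≡⇒⩽ (sym (unfold j F x))))

-- Sums with sieve weights: main term and error

Unique-resp-⊆ : ∀ {T ps : List ℕ} → T ⊆ ps → Unique ps → Unique T
Unique-resp-⊆ [] [] = []
Unique-resp-⊆ (_ ∷ʳ τ) (_ ∷ u) = Unique-resp-⊆ τ u
Unique-resp-⊆ (refl ∷ τ) (a ∷ u) = All-resp-⊆ τ a ∷ Unique-resp-⊆ τ u

iterate-harmonicSum-≤ : ∀ B {z} → Nonneg z → (∀ n → z n ⩽ 1ℚ) → ∀ j {f} → (∀ n → f n ⩽ 1ℚ) →
  iterate (harmonicSum B z) j f ⩽ H B ^ℚ j
iterate-harmonicSum-≤ B 0≤z z≤1 zero    f≤1 = f≤1 1
iterate-harmonicSum-≤ B {z} 0≤z z≤1 (suc j) {f} f≤1 = begin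
  ∑ B (λ x → z x ⊗ (⅟ x ⊗ iterate (harmonicSum B z) j (λ d → f (x * d))))
    ≤⟨ ∑-mono B (λ x _ _ → ⊗-monoˡ (z x) (0≤z x) (⊗-monoˡ (⅟ x) (⅟-nonneg x) (iterate-harmonicSum-≤ B 0≤z z≤1 j λ d → f≤1 (x * d)))) ⟩
  ∑ B (λ x → z x ⊗ (⅟ x ⊗ H B ^ℚ j))
    ≤⟨ ∑-mono B (λ x _ _ → ⩽-trans (⊗-monoʳ (⅟ x ⊗ H B ^ℚ j) (⊗-nonneg (⅟-nonneg x) (^ℚ-nonneg (H-nonneg B) j)) (z≤1 x)) (≡⇒⩽ (trans (ℚ.*-identityˡ (⅟ x ⊗ H B ^ℚ j)) (ℚ.*-comm (⅟ x) (H B ^ℚ j))))) ⟩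
  ∑ B (λ x → H B ^ℚ j ⊗ ⅟ x)
    ≡⟨ trans (∑-⊗ B (H B ^ℚ j) ⅟_) (ℚ.*-comm (H B ^ℚ j) (H B)) ⟩
  H B ⊗ H B ^ℚ j ∎
  where open ℚ.≤-Reasoning

indicator-decreasing : ∀ R {B} → R ≤ B → Decreasing B (λ n → 𝟙 (n ℕ.≤? R))
indicator-decreasing R R≤B .nonneg n = 𝟙-nonneg (n ℕ.≤? R)
indicator-decreasing R R≤B .anti {m} {n} m≤n = 𝟙-mono (n ℕ.≤? R) (m ℕ.≤? R) (ℕ.≤-trans m≤n)
indicator-decreasing R R≤B .vanish n B<n = 𝟙-no (n ℕ.≤? R) λ n≤R → ℕ.<⇒≱ B<n (ℕ.≤-trans n≤R R≤B)

-- The weight j per prime counts the ordered factorisations of a squarefree d into j factors.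
-- Dropping all conditions on the factors leaves the j-th power of a harmonic sum.
𝕊-⅟-≤-H^ : ∀ {B z ps} → 0 < B → SiftedBy B z ps → (∀ n → z n ⩽ 1ℚ) → ∀ j {f} → Decreasing B f → (∀ n → f n ⩽ 1ℚ) →
  𝕊 (λ p → # j ⊗ ⅟ p) ps f ⩽ H B ^ℚ j
𝕊-⅟-≤-H^ {B} {z} {ps} 0<B S z≤1 j {f} F f≤1 = begin
  𝕊 (λ p → # j ⊗ ⅟ p) ps f         ≤⟨ iterate-𝕊-≥ ⅟-nonneg (positive S) j (nonneg F) ⟩
  iterate (𝕊 ⅟_ ps) j f            ≤⟨ iterate-≤ (𝕊-monotone ⅟-nonneg (positive S)) (harmonicSum-monotone B (z-nonneg S)) (λ G → 𝕊-≤-harmonicSum 0<B S (nonneg G) (vanish G)) j F ⟩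
  iterate (harmonicSum B z) j f    ≤⟨ iterate-harmonicSum-≤ B (z-nonneg S) z≤1 j f≤1 ⟩
  H B ^ℚ j                         ∎
  where open ℚ.≤-Reasoning

module Sieve
  (W r₀ R N : ℕ) (0<W : 0 < W) (0<R : 0 < R)
  (ps : List ℕ) (S : SiftedBy (R * R) (coprime-indicator W) ps) (ps-coprime : All (Coprime W) ps)
  (h : ℕ → ℚ) (0≤h : Nonneg h) (h≤1 : All (λ p → h p ⩽ 1ℚ) ps)
  (Y : ℕ → ℚ) (DY : Decreasing R Y) (y₀ : ℚ) (Y≤y₀ : ∀ n → Y n ⩽ y₀)
  (e : ℕ → ℕ → ℚ) (idem : ∀ n p → e n p ⊗ e n p ≡ e n p) where

  B : ℕ
  B = R * R

  0<B : 0 < B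
  0<B = *-pos 0<R 0<R

  0≤y₀ : 0ℚ ⩽ y₀
  0≤y₀ = ⩽-trans (nonneg DY 1) (Y≤y₀ 1)

  weight : ℕ → ℚ
  weight n = 𝕊 (χ h (e n)) ps Y ⊗ 𝕊 (χ h (e n)) ps Y

  mass : ℚ
  mass = Mass 0≤h R 0≤y₀ ps 1

  -- The parameter t balances the error averaged over all moduli against the trivial bound Z times a
  -- product of 2/p. The exponent is 2 (5 k)² = 50 k²: `eval-bounded` gives 5 per prime, the classes
  -- give k, `𝕃-split` squares the product, and the trivial bound gives the 2.
  error : ℕ → ℚ → ℚ → ℚ → ℚ
  error k t ΣE Z = y₀ ⊗ y₀ ⊗ (mass ⊗ mass ⊗ (t ⊗ ΣE ⊕ invℚ t ⊗ (Z ⊗ H B ^ℚ (50 * (k * k)))))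

  module _ (f : ℕ → ℚ) (hs′ : List ℕ) (Ok : ℕ → ℕ → Set) (Good : ℕ → Set)
    (step : ∀ {q r p h y s} → Ok q r → Prime p → Good p → Any (h ≡_) hs′ → r + q * y ≡ h + p * s → Ok (q * p) (r + q * y))
    (good : All Good ps) (ok₀ : Ok W r₀)
    (split : All (λ p → ∀ n → f n ⊗ e n p ≡ ∑ₗ hs′ (λ h → f n ⊗ 𝟙 (p ∣? (n + h)))) ps) where

    private
      open Classes N f e hs′ Ok Good step using (classes)
      k = length hs′

    -- Each class sum has main term M q and two bounds for its error: E q, which is good on average
    -- over q, and V q, which is good for every single q up to a constant per prime. The main terms
    -- have multiplicative density g, so they assemble to the covariance with mean a and variance v.
    evaluate : ∀ {M E V g a v : ℕ → ℚ} {X Z t : ℚ} →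
      (∀ q r → Ok q r → ∥ ∑ N (λ n → f n ⊗ 𝟙 (q ∣? (n + r))) ⊖ M q ∥ ⩽ E q) → Nonneg E →
      (∀ q r → Ok q r → ∥ ∑ N (λ n → f n ⊗ 𝟙 (q ∣? (n + r))) ⊖ M q ∥ ⩽ V q) → 0ℚ ⩽ Z →
      (∀ T → T ⊆ ps → product T ≤ B → V (W * product T) ⩽ Z ⊗ ∏ₑ (λ p → # 2 ⊗ ⅟ p) T) →
      (∀ T → T ⊆ ps → pow (# k) T ⊗ M (W * product T) ≡ X ⊗ ∏ₑ g T) →
      All (λ p → h p ⊖ (1ℚ ⊕ h p) ⊗ g p ≡ a p) ps →
      All (λ p → h p ⊗ h p ⊕ (1ℚ ⊖ h p ⊗ h p) ⊗ g p ≡ a p ⊗ a p ⊕ v p) ps →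
      0ℚ ≺ t →
      ∥ ∑ N (λ n → f n ⊗ 𝟙 (W ∣? (n + r₀)) ⊗ weight n) ⊖ X ⊗ covariance a v ps Y Y ∥ ⩽ error k t (∑ (W * B) E) Z
    evaluate {M} {E} {V} {g} {a} {v} {X} {Z} {t} baseE 0≤E baseV 0≤Z V≤ main mean var 0<t = begin
      ∥ ∑ N (λ n → f₀ n ⊗ weight n) ⊖ X ⊗ covariance a v ps Y Y ∥
        ≡⟨ cong ∥_∥ difference ⟩
      ∥ eval h ps Y Y Δ ∥
        ≤⟨ eval-bounded 0≤h R 0≤y₀ (positive S) h≤1 {1} {1} {1} {1} 0<1′ 0<1′ 0<1′ 0<1′ bounded bounded Δ ⟩
      y₀ ⊗ y₀ ⊗ (mass ⊗ mass ⊗ 𝕃 (# 5) ps (Level 0≤h R 0≤y₀ 1 Δ))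
        ≤⟨ ⊗-monoˡ (y₀ ⊗ y₀) (⊗-nonneg 0≤y₀ 0≤y₀) (⊗-monoˡ (mass ⊗ mass) (⊗-nonneg 0≤mass 0≤mass) total) ⟩
      error k t (∑ (W * B) E) Z ∎
      where
      open ℚ.≤-Reasoning
      0<1′ : 0 < 1
      0<1′ = s≤s z≤n
      z = coprime-indicator W
      f₀ : ℕ → ℚ
      f₀ n = f n ⊗ 𝟙 (W ∣? (n + r₀))
      m m′ Δ : Moment
      m T = ∑ N (λ n → f₀ n ⊗ ∏ₑ (e n) T)
      m′ T = X ⊗ ∏ₑ g T
      Δ T = m T ⊖ m′ T
      0≤mass : 0ℚ ⩽ mass
      0≤mass = 𝕊-nonneg 0≤h ps λ r → 𝟙-nonneg (1 * r ℕ.≤? R)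
      bounded : ∀ r → 0 < r → ∥ Y r ∥ ⩽ y₀ ⊗ 𝟙 (1 * 1 * r ℕ.≤? R)
      bounded r 0<r = go (1 * 1 * r ℕ.≤? R)
        where
        go : (d : Dec (1 * 1 * r ≤ R)) → ∥ Y r ∥ ⩽ y₀ ⊗ 𝟙 d
        go (yes _) = ⩽-trans (≡⇒⩽ (ℚ.0≤p⇒∣p∣≡p (nonneg DY r))) (⩽-trans (Y≤y₀ r) (≡⇒⩽ (sym (ℚ.*-identityʳ y₀))))
        go (no q) = ≡⇒⩽ (trans (cong ∥_∥ (vanish DY r (ℕ.<-≤-trans (ℕ.≰⇒> q) (ℕ.≤-reflexive (ℕ.*-identityˡ r))))) (sym (ℚ.*-zeroʳ y₀)))
      difference : ∑ N (λ n → f₀ n ⊗ weight n) ⊖ X ⊗ covariance a v ps Y Y ≡ eval h ps Y Y Δ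
      difference = begin-equality
        ∑ N (λ n → f₀ n ⊗ weight n) ⊖ X ⊗ covariance a v ps Y Y
          ≡⟨ cong₂ _⊖_ (eval-∑ h N f₀ e idem ps Y Y) (trans (cong (X ⊗_) (sym (eval-independent h ps mean var Y Y))) (sym (eval-⊗ h ps Y Y X (∏ₑ g)))) ⟩
        eval h ps Y Y m ⊖ eval h ps Y Y m′
          ≡⟨ solve 2 (λ x y → x :- y := x :+ con (⊝ 1ℚ) :* y) refl (eval h ps Y Y m) (eval h ps Y Y m′) ⟩
        eval h ps Y Y m ⊕ ⊝ 1ℚ ⊗ eval h ps Y Y m′
          ≡⟨ cong (eval h ps Y Y m ⊕_) (sym (eval-⊗ h ps Y Y (⊝ 1ℚ) m′)) ⟩
        eval h ps Y Y m ⊕ eval h ps Y Y (λ T → ⊝ 1ℚ ⊗ m′ T)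
          ≡⟨ eval-⊕ h ps Y Y m (λ T → ⊝ 1ℚ ⊗ m′ T) ⟨
        eval h ps Y Y (λ T → m T ⊕ ⊝ 1ℚ ⊗ m′ T)
          ≡⟨ eval-cong h ps Y Y (λ T → solve 2 (λ x y → x :+ con (⊝ 1ℚ) :* y := x :- y) refl (m T) (m′ T)) ⟩
        eval h ps Y Y Δ ∎
      primesT : ∀ {T} → T ⊆ ps → All Prime T
      primesT τ = All-resp-⊆ τ (primes S)
      Δ≤ : ∀ {F : ℕ → ℚ} → (∀ q r → Ok q r → ∥ ∑ N (λ n → f n ⊗ 𝟙 (q ∣? (n + r))) ⊖ M q ∥ ⩽ F q) →
        ∀ T → T ⊆ ps → ∥ Δ T ∥ ⩽ pow (# k) T ⊗ F (W * product T)
      Δ≤ base T τ = ⩽-trans (≡⇒⩽ (cong (λ x → ∥ m T ⊖ x ∥) (sym (main T τ))))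
        (classes base T (primesT τ) (All-resp-⊆ τ good) (Unique-resp-⊆ τ (unique S)) (All-resp-⊆ τ split) W r₀ (All-resp-⊆ τ ps-coprime) ok₀)
      ind : List ℕ → ℚ
      ind T = 𝟙 (product T ℕ.≤? B)
      α β : List ℕ → ℚ
      α T = ind T ⊗ E (W * product T)
      β T = ∏ₑ (λ p → # 2 ⊗ ⅟ p) T ⊗ (ind T ⊗ Z)
      0≤u : Nonneg (λ p → # 2 ⊗ ⅟ p)
      0≤u p = ⊗-nonneg (#-nonneg 2) (⅟-nonneg p)
      -- Both bounds hold for the same moment, so it is at most their minimum. This minimum plays
      -- the role of the function K in `𝕃-split`.
      level≤ : ∀ T → T ⊆ ps → Level 0≤h R 0≤y₀ 1 Δ T ⩽ pow (# k) T ⊗ (α T ℚ.⊓ β T)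
      level≤ T τ = ⩽-trans (≡⇒⩽ (cong (λ n → 𝟙 (n ℕ.≤? B) ⊗ ∥ Δ T ∥) (ℕ.*-identityˡ (product T)))) (case (ℚ.≤-total (α T) (β T)))
        where
        toα : ind T ⊗ ∥ Δ T ∥ ⩽ pow (# k) T ⊗ α T
        toα = ⩽-trans (⊗-monoˡ (ind T) (𝟙-nonneg (product T ℕ.≤? B)) (Δ≤ baseE T τ))
          (≡⇒⩽ (solve 3 (λ i k x → i :* (k :* x) := k :* (i :* x)) refl (ind T) (pow (# k) T) (E (W * product T))))
        toβ : ind T ⊗ ∥ Δ T ∥ ⩽ pow (# k) T ⊗ β T
        toβ = go (product T ℕ.≤? B)
          where
          go : (d : Dec (product T ≤ B)) → 𝟙 d ⊗ ∥ Δ T ∥ ⩽ pow (# k) T ⊗ (∏ₑ (λ p → # 2 ⊗ ⅟ p) T ⊗ (𝟙 d ⊗ Z))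
          go (yes q) = ⩽-trans (≡⇒⩽ (ℚ.*-identityˡ ∥ Δ T ∥)) (⩽-trans (Δ≤ baseV T τ) (⊗-monoˡ (pow (# k) T) (∏ₑ-nonneg (λ _ → #-nonneg k) T)
            (⩽-trans (V≤ T τ q) (≡⇒⩽ (solve 2 (λ z u → z :* u := u :* (con 1ℚ :* z)) refl Z (∏ₑ (λ p → # 2 ⊗ ⅟ p) T))))))
          go (no _) = ⩽-trans (≡⇒⩽ (ℚ.*-zeroˡ ∥ Δ T ∥)) (⊗-nonneg (∏ₑ-nonneg (λ _ → #-nonneg k) T) (⊗-nonneg (∏ₑ-nonneg 0≤u T) (⊗-nonneg (⩽-refl {0ℚ}) 0≤Z)))
        case : α T ⩽ β T ⊎ β T ⩽ α T → ind T ⊗ ∥ Δ T ∥ ⩽ pow (# k) T ⊗ (α T ℚ.⊓ β T)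
        case (inj₁ le) = ⩽-trans toα (≡⇒⩽ (cong (pow (# k) T ⊗_) (sym (ℚ.p≤q⇒p⊓q≡p le))))
        case (inj₂ ge) = ⩽-trans toβ (≡⇒⩽ (cong (pow (# k) T ⊗_) (sym (ℚ.p≥q⇒p⊓q≡q ge))))
      0≤α : ∀ T → 0ℚ ⩽ α T
      0≤α T = ⊗-nonneg (𝟙-nonneg (product T ℕ.≤? B)) (0≤E (W * product T))
      0≤β : ∀ T → 0ℚ ⩽ β T
      0≤β T = ⊗-nonneg (∏ₑ-nonneg 0≤u T) (⊗-nonneg (𝟙-nonneg (product T ℕ.≤? B)) 0≤Z)
      c = # 5 ⊗ # k
      0≤c : 0ℚ ⩽ c
      0≤c = ⊗-nonneg (#-nonneg 5) (#-nonneg k)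
      -- With weight 1 per prime, different T give different moduli W product(T), all at most W B.
      -- The sum is thus part of the sum of E over all moduli up to W B.
      sumα : 𝕃 1ℚ ps α ⩽ ∑ (W * B) E
      sumα = begin
        𝕃 1ℚ ps α                                                  ≡⟨ 𝕃-cong 1ℚ ps (λ T → trans (sym (ℚ.*-identityˡ (α T))) (cong (_⊗ α T) (sym (ones T)))) ⟩
        𝕃 1ℚ ps (λ T → ∏ₑ (λ _ → 1ℚ) T ⊗ F (product T))            ≡⟨ 𝕃-𝕊 1ℚ (λ _ → 1ℚ) ps F ⟩
        𝕊 (λ _ → 1ℚ ⊗ 1ℚ) ps F                                     ≤⟨ 𝕊-mono-weight (λ _ → 0≤1) {ps} (All.tabulate λ _ → ⩽-refl) 0≤F ⟩
        𝕊 (λ _ → 1ℚ) ps F                                          ≤⟨ 𝕊-≤-siftedSum 0<B S 0≤F vF ⟩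
        ∑ B (λ n → z n ⊗ F n)                                      ≤⟨ ∑-mono B (λ n _ n≤B → ⩽-trans (⊗-monoʳ (F n) (0≤F n) (𝟙≤1 (gcd n W ℕ.≟ 1))) (⩽-trans (≡⇒⩽ (ℚ.*-identityˡ (F n)))
            (≡⇒⩽ (trans (cong (_⊗ E (W * n)) (𝟙-yes (n ℕ.≤? B) n≤B)) (ℚ.*-identityˡ (E (W * n))))))) ⟩
        ∑ B (λ n → E (W * n))                                      ≡⟨ ∑-multiples-block W B E 0<W ⟨
        ∑ (W * B) (λ n → 𝟙 (W ∣? n) ⊗ E n)                         ≤⟨ ∑-mono (W * B) (λ n _ _ → ⩽-trans (⊗-monoʳ (E n) (0≤E n) (𝟙≤1 (W ∣? n))) (≡⇒⩽ (ℚ.*-identityˡ (E n)))) ⟩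
        ∑ (W * B) E                                                ∎
        where
        F : ℕ → ℚ
        F n = 𝟙 (n ℕ.≤? B) ⊗ E (W * n)
        0≤F : Nonneg F
        0≤F n = ⊗-nonneg (𝟙-nonneg (n ℕ.≤? B)) (0≤E (W * n))
        vF : ∀ n → B < n → F n ≡ 0ℚ
        vF n B<n = trans (cong (_⊗ E (W * n)) (𝟙-no (n ℕ.≤? B) (ℕ.<⇒≱ B<n))) (ℚ.*-zeroˡ (E (W * n)))
        ones : ∀ T → ∏ₑ (λ _ → 1ℚ) T ≡ 1ℚ
        ones [] = refl
        ones (p ∷ T) = trans (ℚ.*-identityˡ (∏ₑ (λ _ → 1ℚ) T)) (ones T)
      sumβ : 𝕃 (c ⊗ c) ps β ⩽ Z ⊗ H B ^ℚ (50 * (k * k))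
      sumβ = begin
        𝕃 (c ⊗ c) ps β                                                             ≡⟨ 𝕃-𝕊 (c ⊗ c) (λ p → # 2 ⊗ ⅟ p) ps (λ n → 𝟙 (n ℕ.≤? B) ⊗ Z) ⟩
        𝕊 (λ p → c ⊗ c ⊗ (# 2 ⊗ ⅟ p)) ps (λ n → 𝟙 (n ℕ.≤? B) ⊗ Z)                  ≤⟨ 𝕊-mono-weight (λ p → ⊗-nonneg (⊗-nonneg 0≤c 0≤c) (0≤u p)) {ps} (All.tabulate λ {p} _ → ≡⇒⩽ (const≡ p)) (λ n → ⊗-nonneg (𝟙-nonneg (n ℕ.≤? B)) 0≤Z) ⟩
        𝕊 (λ p → # (50 * (k * k)) ⊗ ⅟ p) ps (λ n → 𝟙 (n ℕ.≤? B) ⊗ Z)               ≡⟨ trans (𝕊-cong (λ p → # (50 * (k * k)) ⊗ ⅟ p) (positive S) λ n _ → ℚ.*-comm (𝟙 (n ℕ.≤? B)) Z) (𝕊-⊗ (λ p → # (50 * (k * k)) ⊗ ⅟ p) ps Z (λ n → 𝟙 (n ℕ.≤? B))) ⟩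
        Z ⊗ 𝕊 (λ p → # (50 * (k * k)) ⊗ ⅟ p) ps (λ n → 𝟙 (n ℕ.≤? B))               ≤⟨ ⊗-monoˡ Z 0≤Z (𝕊-⅟-≤-H^ 0<B S (λ n → 𝟙≤1 (gcd n W ℕ.≟ 1)) (50 * (k * k)) (indicator-decreasing B ℕ.≤-refl) (λ n → 𝟙≤1 (n ℕ.≤? B))) ⟩
        Z ⊗ H B ^ℚ (50 * (k * k))                                                  ∎
        where
        const≡ : ∀ p → c ⊗ c ⊗ (# 2 ⊗ ⅟ p) ≡ # (50 * (k * k)) ⊗ ⅟ p
        const≡ p = trans (solve 4 (λ a k t r → a :* k :* (a :* k) :* (t :* r) := a :* a :* t :* (k :* k) :* r) refl (# 5) (# k) (# 2) (⅟ p))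
          (cong (_⊗ ⅟ p) (sym (trans (#-* 50 (k * k)) (cong₂ _⊗_ (trans (#-* 25 2) (cong (_⊗ # 2) (#-* 5 5))) (#-* k k)))))
      total : 𝕃 (# 5) ps (Level 0≤h R 0≤y₀ 1 Δ) ⩽ t ⊗ ∑ (W * B) E ⊕ invℚ t ⊗ (Z ⊗ H B ^ℚ (50 * (k * k)))
      total = begin
        𝕃 (# 5) ps (Level 0≤h R 0≤y₀ 1 Δ)                    ≤⟨ 𝕃-mono (#-nonneg 5) ps level≤ ⟩
        𝕃 (# 5) ps (λ T → pow (# k) T ⊗ (α T ℚ.⊓ β T))       ≡⟨ 𝕃-pow (# 5) (# k) ps (λ T → α T ℚ.⊓ β T) ⟩
        𝕃 c ps (λ T → α T ℚ.⊓ β T)                           ≡⟨ ℚ.*-identityˡ (𝕃 c ps (λ T → α T ℚ.⊓ β T)) ⟨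
        1ℚ ⊗ 𝕃 c ps (λ T → α T ℚ.⊓ β T)                      ≤⟨ 𝕃-split 0≤c 0<t ps 1ℚ 0≤1 (λ T _ → ℚ.⊓-glb (0≤α T) (0≤β T)) (λ T _ → ℚ.p⊓q≤p (α T) (β T)) (λ T _ → ℚ.p⊓q≤q (α T) (β T)) ⟩
        t ⊗ 𝕃 1ℚ ps α ⊕ 1ℚ ⊗ 1ℚ ⊗ invℚ t ⊗ 𝕃 (c ⊗ c) ps β    ≤⟨ ⊕-mono (⊗-monoˡ t (≺⇒⩽ 0<t) sumα) (⩽-trans (≡⇒⩽ (cong (_⊗ 𝕃 (c ⊗ c) ps β) (ℚ.*-identityˡ (invℚ t)))) (⊗-monoˡ (invℚ t) (≺⇒⩽ (invℚ-pos 0<t)) sumβ)) ⟩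
        t ⊗ ∑ (W * B) E ⊕ invℚ t ⊗ (Z ⊗ H B ^ℚ (50 * (k * k))) ∎

-- The residue class of the tuple and the sieving primes

any-sum : ∀ {P : ℕ → Set} (P? : ∀ h → Dec (P h)) {hs : List ℕ} → Unique hs → (∀ {h h′} → h ∈ hs → h′ ∈ hs → P h → P h′ → h ≡ h′) →
  𝟙 (any? P? hs) ≡ ∑ₗ hs (λ h → 𝟙 (P? h))
any-sum P? {[]} _ _ = refl
any-sum {P} P? {h ∷ hs} (h∉ ∷ u) ex = go (P? h)
  where
  rest : 𝟙 (any? P? hs) ≡ ∑ₗ hs (λ h → 𝟙 (P? h))
  rest = any-sum P? u λ a b → ex (there a) (there b)
  none : P h → ¬ Any P hs
  none p a with find a
  ... | _ , h′∈ , p′ = All.lookup h∉ h′∈ (ex (here refl) (there h′∈) p p′)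
  go : (d : Dec (P h)) → 𝟙 (any? P? (h ∷ hs)) ≡ 𝟙 d ⊕ ∑ₗ hs (λ h → 𝟙 (P? h))
  go (yes p) = trans (𝟙-yes (any? P? (h ∷ hs)) (here p)) (sym (trans (cong (1ℚ ⊕_) (trans (sym rest) (𝟙-no (any? P? hs) (none p)))) (⊕-identityʳ 1ℚ)))
  go (no ¬p) = trans (𝟙-cong (any? P? (h ∷ hs)) (any? P? hs) (λ { (here p) → ⊥-elim (¬p p) ; (there a) → a }) there) (trans rest (sym (⊕-identityˡ (∑ₗ hs (λ h → 𝟙 (P? h))))))

∣-difference : ∀ {p n h h′} → p ∣ n + h → p ∣ n + h′ → p ∣ ℕ.∣ h - h′ ∣
∣-difference {p} {n} {h} {h′} a b with ℕ.≤-total h h′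
... | inj₁ h≤h′ = subst (p ∣_) (sym (ℕ.m≤n⇒∣m-n∣≡n∸m h≤h′)) (∣m+n∣m⇒∣n (subst (p ∣_) (trans (cong (n +_) (sym (ℕ.m+[n∸m]≡n h≤h′))) (sym (ℕ.+-assoc n h (h′ ℕ.∸ h)))) b) a)
... | inj₂ h′≤h = subst (p ∣_) (sym (ℕ.m≤n⇒∣n-m∣≡n∸m h′≤h)) (∣m+n∣m⇒∣n (subst (p ∣_) (trans (cong (n +_) (sym (ℕ.m+[n∸m]≡n h′≤h))) (sym (ℕ.+-assoc n h′ (h ℕ.∸ h′)))) a) b)

shift-unique : ∀ {p n h h′} → h < p → h′ < p → p ∣ n + h → p ∣ n + h′ → h ≡ h′
shift-unique {p} {n} {h} {h′} h<p h′<p a b with ℕ.∣ h - h′ ∣ in eq | ∣-difference {p} {n} {h} {h′} a b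
... | zero  | _ = ℕ.∣m-n∣≡0⇒m≡n eq
... | suc d | p∣ = ⊥-elim (ℕ.<⇒≱ (ℕ.≤-<-trans (ℕ.≤-trans (ℕ.≤-reflexive (sym eq)) (ℕ.∣m-n∣≤m⊔n h h′)) (ℕ.⊔-lub h<p h′<p)) (∣⇒≤ p∣))

-- The primes 2, 3, 5 and 7 are kept apart in the modulus, since the residue class must be chosen
-- differently for them. The other factor only has to be coprime to 210 and divisible by the
-- remaining primes up to n, and a product of all integers coprime to 210 achieves this.
coprimeProduct : ℕ → ℕ
coprimeProduct zero    = 1
coprimeProduct (suc n) with gcd (suc n) 210 ℕ.≟ 1
... | yes _ = suc n * coprimeProduct n
... | no  _ = coprimeProduct n

coprimeProduct-pos : ∀ n → 0 < coprimeProduct n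
coprimeProduct-pos zero = s≤s z≤n
coprimeProduct-pos (suc n) with gcd (suc n) 210 ℕ.≟ 1
... | yes _ = *-pos {suc n} (s≤s z≤n) (coprimeProduct-pos n)
... | no  _ = coprimeProduct-pos n

coprimeProduct-coprime : ∀ n → Coprime (coprimeProduct n) 210
coprimeProduct-coprime zero (d∣1 , _) = ∣1⇒≡1 d∣1
coprimeProduct-coprime (suc n) with gcd (suc n) 210 ℕ.≟ 1
... | yes e = Coprimality.sym (coprime-* {a = suc n} (Coprimality.sym (gcd≡1⇒coprime {suc n} e)) (Coprimality.sym (coprimeProduct-coprime n)))
... | no  _ = coprimeProduct-coprime n

coprimeProduct-∣ : ∀ n {m} → 0 < m → m ≤ n → Coprime m 210 → m ∣ coprimeProduct n
coprimeProduct-∣ zero {suc m} _ () c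
coprimeProduct-∣ (suc n) {m} 0<m m≤ c with gcd (suc n) 210 ℕ.≟ 1 | ℕ.m≤n⇒m<n∨m≡n m≤
... | yes e | inj₁ m< = ∣n⇒∣m*n (suc n) (coprimeProduct-∣ n 0<m (ℕ.m<1+n⇒m≤n m<) c)
... | yes e | inj₂ refl = m∣m*n (coprimeProduct n)
... | no ¬e | inj₁ m< = coprimeProduct-∣ n 0<m (ℕ.m<1+n⇒m≤n m<) c
... | no ¬e | inj₂ refl = ⊥-elim (¬e (coprime⇒gcd≡1 c))

modulus : ℕ → ℕ
modulus w = coprimeProduct w * 210

prime-∣-modulus : ∀ w {p} → Prime p → p ≤ w → p ∣ modulus w
prime-∣-modulus w {p} pp p≤w with p ∣? 210
... | yes d = ∣n⇒∣m*n (coprimeProduct w) d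
... | no ¬d = ∣m⇒∣m*n 210 (coprimeProduct-∣ w (prime-pos pp) p≤w (prime-coprime pp ¬d))

1<modulus : ∀ w → 1 < modulus w
1<modulus w = ℕ.<-≤-trans (s≤s (s≤s z≤n)) (m≤p*m 210 (coprimeProduct-pos w))

-- The number 199 = 210 - 11 encodes the class of 11 modulo 210: for the shifts 0, 2, 6, 8, 12 the
-- numbers 11 + h are 11, 13, 17, 19, 23. The cube of 210 is there because h + 2 = 8 occurs.
AdmissibleShift : ℕ → Set
AdmissibleShift h = h ≤ 199 × gcd (199 ℕ.∸ h) 210 ≡ 1 × h + 2 ∣ 210 * (210 * 210)

-- The class n ≡ 11 mod 210 and n ≡ 2 modulo the remaining primes: the numbers
-- 11 + h are coprime to 210, and the numbers 2 + h have no prime factor above 7.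
coprime-class : ∀ w → ∃[ r ] (∀ {h} → AdmissibleShift h → ∀ n → modulus w ∣ n + r → Coprime (modulus w) (n + h))
coprime-class w with crt {coprimeProduct w} {210} (s≤s (s≤s z≤n)) (coprimeProduct-coprime w) (2 * (coprimeProduct w ℕ.∸ 1)) 199
... | y , s , eq = 2 * (V ℕ.∸ 1) + V * y , λ {h} → cop {h}
  where
  V = coprimeProduct w
  cop : ∀ {h} → AdmissibleShift h → ∀ n → modulus w ∣ n + (2 * (V ℕ.∸ 1) + V * y) → Coprime (modulus w) (n + h)
  cop {h} (h≤ , c₂₁₀ , h+2∣) n W∣ = Coprimality.sym (coprime-* (Coprimality.sym cV) (Coprimality.sym c210))
    where
    V∣ : V ∣ n + 2 * (V ℕ.∸ 1)
    V∣ = ∣-unshift {V} {n} {2 * (V ℕ.∸ 1)} {y = y} refl (m*n∣⇒m∣ V 210 W∣)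
    210∣ : 210 ∣ n + 199
    210∣ = ∣-unshift {210} {n} {199} {y = s} (sym eq) (m*n∣⇒n∣ V 210 W∣)
    cV : Coprime V (n + h)
    cV {d} (d∣V , d∣) = coprime-* c (coprime-* c c) (d∣V , ∣-trans (∣m+n∣m⇒∣n {m = n + 2 * (V ℕ.∸ 1)} (subst (d ∣_) arr (∣m∣n⇒∣m+n d∣ (∣n⇒∣m*n 2 d∣V))) (∣-trans d∣V V∣)) h+2∣)
      where
      c : Coprime V 210
      c = coprimeProduct-coprime w
      arr : n + h + 2 * V ≡ n + 2 * (V ℕ.∸ 1) + (h + 2)
      arr = trans (cong (λ v → n + h + 2 * v) (sym (ℕ.m+[n∸m]≡n (coprimeProduct-pos w)))) (solveℕ 3 (λ n h v → n ⟨+⟩ h ⟨+⟩ conℕ 2 ⟨*⟩ (conℕ 1 ⟨+⟩ v) ⟨=⟩ n ⟨+⟩ conℕ 2 ⟨*⟩ v ⟨+⟩ (h ⟨+⟩ conℕ 2)) refl n h (V ℕ.∸ 1))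
    c210 : Coprime 210 (n + h)
    c210 {d} (d∣210 , d∣) = gcd≡1⇒coprime c₂₁₀ (∣m+n∣m⇒∣n {m = n + h} (subst (d ∣_) (trans (cong (n +_) (sym (ℕ.m+[n∸m]≡n h≤))) (sym (ℕ.+-assoc n h (199 ℕ.∸ h)))) (∣-trans d∣210 210∣)) d∣ , d∣210)

sievingPrimes : ℕ → ℕ → List ℕ
sievingPrimes W B = filter (λ p → prime? p ×-dec (gcd p W ℕ.≟ 1)) [1⋯ B ]

prime-divisor : ∀ n → 1 < n → ∃[ p ] (Prime p × p ∣ n)
prime-divisor n@(suc _) 1<n with factorise n
... | record { factors = [] ; isFactorisation = eq } = ⊥-elim (ℕ.<⇒≢ 1<n (sym eq))
... | record { factors = p ∷ fs ; isFactorisation = eq ; factorsPrime = pp ∷ _ } = p , pp , subst (p ∣_) (sym eq) (m∣m*n (product fs))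

module _ (w B : ℕ) where
  private
    W = modulus w
    P? = λ p → prime? p ×-dec (gcd p W ℕ.≟ 1)
    ps = sievingPrimes W B

  sieving-∈ : ∀ {p} → p ∈ ps → (0 < p × p ≤ B) × Prime p × Coprime p W
  sieving-∈ {p} p∈ with ∈-filter⁻ P? {xs = [1⋯ B ]} p∈
  ... | p∈B , pp , c with ∈-map⁻ suc p∈B
  ... | i , i∈ , refl = (s≤s z≤n , ∈-upTo⁻ i∈) , pp , λ {d} → gcd≡1⇒coprime {suc i} {W} c {d}
    where
    ∈-upTo⁻ : ∀ {n i} → i ∈ upTo n → i < n
    ∈-upTo⁻ {n} i∈ = All.lookup (All.all-upTo n) i∈

  sieving-large : ∀ {p} → p ∈ ps → w < p
  sieving-large {p} p∈ with sieving-∈ p∈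
  ... | _ , pp , c = ℕ.≰⇒> λ p≤w → ¬prime[1] (subst Prime (c (∣-refl , prime-∣-modulus w pp p≤w)) pp)

  sieving-SiftedBy : SiftedBy B (coprime-indicator W) ps
  sieving-SiftedBy .primes = All.tabulate λ p∈ → proj₁ (proj₂ (sieving-∈ p∈))
  sieving-SiftedBy .unique = Unique.filter⁺ P? (Unique.map⁺ ℕ.suc-injective (Unique.upTo⁺ B))
  sieving-SiftedBy .z-nonneg n = 𝟙-nonneg (gcd n W ℕ.≟ 1)
  sieving-SiftedBy .z-1 = coprime-yes W λ (d∣1 , _) → ∣1⇒≡1 d∣1
  sieving-SiftedBy .invariant = All.tabulate λ {p} p∈ n _ → coprime-cong W
    (λ c (d∣n , d∣W) → c (∣n⇒∣m*n p d∣n , d∣W))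
    (λ c → Coprimality.sym (coprime-* (Coprimality.sym (proj₂ (proj₂ (sieving-∈ p∈)))) (Coprimality.sym c)))
  sieving-SiftedBy .exhausted n 1<n n≤B with gcd n W ℕ.≟ 1
  ... | no ¬e = inj₁ (coprime-no W {n} λ c → ¬e (coprime⇒gcd≡1 c))
  ... | yes e with prime-divisor n 1<n
  ... | zero , pp , _ = ⊥-elim (¬prime[0] pp)
  ... | p@(suc i) , pp , p∣n = inj₂ (Any.map (λ { refl → p∣n }) (∈-filter⁺ P? (∈-map⁺ suc (∈-upTo⁺ (ℕ.≤-trans p≤n n≤B))) (pp , coprime⇒gcd≡1 cp)))
    where
    p≤n : p ≤ n
    p≤n = ∣⇒≤ {{ℕ.>-nonZero (ℕ.<-trans (s≤s z≤n) 1<n)}} p∣n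
    cp : Coprime p W
    cp (d∣p , d∣W) = gcd≡1⇒coprime {n} {W} e (∣-trans d∣p p∣n , d∣W)

  sieving-coprime : All (Coprime W) ps
  sieving-coprime = go ps (λ p∈ → p∈)
    where
    go : ∀ qs → (∀ {p} → p ∈ qs → p ∈ ps) → All (Coprime W) qs
    go [] _ = []
    go (q ∷ qs) i = c ∷ go qs (λ p∈ → i (there p∈))
      where
      c : Coprime W q
      c = Coprimality.sym (proj₂ (proj₂ (sieving-∈ (i (here refl)))))

∑ₗ-++ : ∀ {A : Set} (xs ys : List A) f → ∑ₗ (xs ++ ys) f ≡ ∑ₗ xs f ⊕ ∑ₗ ys f
∑ₗ-++ [] ys f = sym (⊕-identityˡ (∑ₗ ys f))
∑ₗ-++ (x ∷ xs) ys f = trans (cong (f x ⊕_) (∑ₗ-++ xs ys f)) (sym (ℚ.+-assoc (f x) (∑ₗ xs f) (∑ₗ ys f)))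

[1⋯suc] : ∀ n → [1⋯ suc n ] ≡ [1⋯ n ] ++ suc n ∷ []
[1⋯suc] n = trans (cong (map suc) (sym (List.applyUpTo-∷ʳ (λ x → x) n))) (List.map-++ suc (upTo n) (n ∷ []))

∑ₗ-filter : ∀ {P : ℕ → Set} (P? : ∀ n → Dec (P n)) n f → ∑ₗ (filter P? [1⋯ n ]) f ≡ ∑ n (λ i → 𝟙 (P? i) ⊗ f i)
∑ₗ-filter P? zero f = refl
∑ₗ-filter P? (suc n) f = begin
  ∑ₗ (filter P? [1⋯ suc n ]) f                              ≡⟨ cong (λ xs → ∑ₗ (filter P? xs) f) ([1⋯suc] n) ⟩
  ∑ₗ (filter P? ([1⋯ n ] ++ suc n ∷ [])) f                  ≡⟨ cong (λ xs → ∑ₗ xs f) (List.filter-++ P? [1⋯ n ] (suc n ∷ [])) ⟩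
  ∑ₗ (filter P? [1⋯ n ] ++ filter P? (suc n ∷ [])) f        ≡⟨ ∑ₗ-++ (filter P? [1⋯ n ]) (filter P? (suc n ∷ [])) f ⟩
  ∑ₗ (filter P? [1⋯ n ]) f ⊕ ∑ₗ (filter P? (suc n ∷ [])) f  ≡⟨ cong₂ _⊕_ (∑ₗ-filter P? n f) (single (suc n)) ⟩
  ∑ (suc n) (λ i → 𝟙 (P? i) ⊗ f i)                          ∎
  where
  open ≡-Reasoning
  single : ∀ m → ∑ₗ (filter P? (m ∷ [])) f ≡ 𝟙 (P? m) ⊗ f m
  single m with P? m
  ... | yes _ = trans (⊕-identityʳ (f m)) (sym (ℚ.*-identityˡ (f m)))
  ... | no _  = sym (ℚ.*-zeroˡ (f m))

-- Local densities of the sieve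

∏₁-bound : ∀ {δ} → Nonneg δ → ∀ ps → ∏₁ δ ps ⊗ (1ℚ ⊖ ∑ₗ ps δ) ⩽ 1ℚ
∏₁-bound 0≤δ [] = ⩽-refl
∏₁-bound {δ} 0≤δ (p ∷ ps) = begin
  P ⊗ (1ℚ ⊕ δ p) ⊗ (1ℚ ⊖ (δ p ⊕ s))             ≤⟨ by-excess (P ⊗ (δ p ⊗ (δ p ⊕ s))) (⊗-nonneg (∏₁-nonneg 0≤δ ps) (⊗-nonneg (0≤δ p) (⊕-nonneg (0≤δ p) (∑ₗ-nonneg ps))))
      (solve 3 (λ P d s → P :* (con 1ℚ :+ d) :* (con 1ℚ :- (d :+ s)) :+ P :* (d :* (d :+ s)) := P :* (con 1ℚ :- s)) refl P (δ p) s) ⟩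
  P ⊗ (1ℚ ⊖ s)                                  ≤⟨ ∏₁-bound 0≤δ ps ⟩
  1ℚ                                            ∎
  where
  open ℚ.≤-Reasoning
  P = ∏₁ δ ps
  s = ∑ₗ ps δ
  ∑ₗ-nonneg : ∀ ps → 0ℚ ⩽ ∑ₗ ps δ
  ∑ₗ-nonneg [] = ⩽-refl
  ∑ₗ-nonneg (p ∷ ps) = ⊕-nonneg (0≤δ p) (∑ₗ-nonneg ps)

⅟-telescope : ∀ {n} → 1 < n → ⅟ (n ℕ.∸ 1) ⊖ ⅟ n ≡ ⅟ (n ℕ.∸ 1) ⊗ ⅟ n
⅟-telescope {n} 1<n = begin
  a ⊖ b                        ≡⟨ solve 2 (λ a b → a :- b := a :* con 1ℚ :- b :* con 1ℚ) refl a b ⟩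
  a ⊗ 1ℚ ⊖ b ⊗ 1ℚ              ≡⟨ cong₂ (λ u v → a ⊗ u ⊖ b ⊗ v) (⅟-inverse (ℕ.<-trans (s≤s z≤n) 1<n)) (⅟-inverse (ℕ.m<n⇒0<n∸m 1<n)) ⟨
  a ⊗ (# n ⊗ b) ⊖ b ⊗ (# (n ℕ.∸ 1) ⊗ a)   ≡⟨ cong (λ t → a ⊗ (t ⊗ b) ⊖ b ⊗ (# (n ℕ.∸ 1) ⊗ a)) (#pred 1<n) ⟩
  a ⊗ ((1ℚ ⊕ # (n ℕ.∸ 1)) ⊗ b) ⊖ b ⊗ (# (n ℕ.∸ 1) ⊗ a)   ≡⟨ solve 3 (λ a b m → a :* ((con 1ℚ :+ m) :* b) :- b :* (m :* a) := a :* b) refl a b (# (n ℕ.∸ 1)) ⟩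
  a ⊗ b                        ∎
  where
  open ≡-Reasoning
  a = ⅟ (n ℕ.∸ 1)
  b = ⅟ n

-- The majorant 1/((n - 1) n) telescopes from w on. This is where fixing a large W makes the loss in
-- the singular series small.
∑-tail-≤ : ∀ {w c} {δ : ℕ → ℚ} → 0 < w → 0ℚ ⩽ c → (∀ n → n ≤ w → δ n ≡ 0ℚ) → (∀ n → w < n → δ n ⩽ c ⊗ (⅟ (n ℕ.∸ 1) ⊗ ⅟ n)) → ∀ B → ∑ B δ ⩽ c ⊗ ⅟ w
∑-tail-≤ {w} {c} {δ} 0<w 0≤c small large B with ℕ.≤-total B w
... | inj₁ B≤w = ⩽-trans (≡⇒⩽ (∑-zero B λ i _ i≤B → small i (ℕ.≤-trans i≤B B≤w))) (⊗-nonneg 0≤c (⅟-nonneg w))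
... | inj₂ w≤B = ⩽-trans (≡⇒⩽ (cong (λ t → ∑ t δ) (sym (ℕ.m+[n∸m]≡n w≤B)))) (⩽-trans (go (B ℕ.∸ w)) (⊗-monoˡ c 0≤c (by-excess (⅟ (w + (B ℕ.∸ w))) (⅟-nonneg (w + (B ℕ.∸ w))) (solve 2 (λ a b → a :- b :+ b := a) refl (⅟ w) (⅟ (w + (B ℕ.∸ w)))))))
  where
  go : ∀ d → ∑ (w + d) δ ⩽ c ⊗ (⅟ w ⊖ ⅟ (w + d))
  go zero = ≡⇒⩽ (trans (cong (λ t → ∑ t δ) (ℕ.+-identityʳ w)) (trans (∑-zero w λ i _ i≤w → small i i≤w)
    (sym (trans (cong (λ t → c ⊗ (⅟ w ⊖ ⅟ t)) (ℕ.+-identityʳ w)) (solve 2 (λ c a → c :* (a :- a) := con 0ℚ) refl c (⅟ w))))))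
  go (suc d) = begin
    ∑ (w + suc d) δ                                        ≡⟨ cong (λ t → ∑ t δ) (ℕ.+-suc w d) ⟩
    ∑ (w + d) δ ⊕ δ (suc (w + d))                          ≤⟨ ⊕-mono (go d) (⩽-trans (large (suc (w + d)) (s≤s (ℕ.m≤m+n w d))) (≡⇒⩽ (cong (c ⊗_) (sym (⅟-telescope (s≤s (ℕ.<-≤-trans 0<w (ℕ.m≤m+n w d)))))))) ⟩
    c ⊗ (⅟ w ⊖ ⅟ (w + d)) ⊕ c ⊗ (⅟ (w + d) ⊖ ⅟ suc (w + d)) ≡⟨ solve 4 (λ c a b d → c :* (a :- b) :+ c :* (b :- d) := c :* (a :- d)) refl c (⅟ w) (⅟ (w + d)) (⅟ suc (w + d)) ⟩
    c ⊗ (⅟ w ⊖ ⅟ suc (w + d))                              ≡⟨ cong (λ t → c ⊗ (⅟ w ⊖ ⅟ t)) (ℕ.+-suc w d) ⟨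
    c ⊗ (⅟ w ⊖ ⅟ (w + suc d))                              ∎
    where open ℚ.≤-Reasoning

module Local (k₁ : ℕ) where

  k : ℕ
  k = suc k₁

  -- `g` is the density of p dividing some n + h, and `gᵖ` the density of p dividing one of the
  -- other k - 1 numbers when n + hᵢ is prime. The choice `h` = g/(1 - g) centres χ for the first
  -- density. For the second, χ has mean `μ` and variance `vᵖ`, which has the shape required by
  -- `covariance-≥`. `δ` is h - g.
  h hᵖ g gᵖ vᵖ δ : ℕ → ℚ
  h p = # k ⊗ ⅟ (p ℕ.∸ k)
  hᵖ p = # k₁ ⊗ ⅟ (p ℕ.∸ k)
  g p = # k ⊗ ⅟ p
  gᵖ p = # k₁ ⊗ μ p
  vᵖ p = hᵖ p ⊗ ((1ℚ ⊕ μ p) ⊗ (1ℚ ⊕ μ p))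
  δ p = # k ⊗ h p ⊗ ⅟ p

  h-nonneg : Nonneg h
  h-nonneg p = ⊗-nonneg (#-nonneg k) (⅟-nonneg (p ℕ.∸ k))

  hᵖ-nonneg : Nonneg hᵖ
  hᵖ-nonneg p = ⊗-nonneg (#-nonneg k₁) (⅟-nonneg (p ℕ.∸ k))

  g-nonneg : Nonneg g
  g-nonneg p = ⊗-nonneg (#-nonneg k) (⅟-nonneg p)

  δ-nonneg : Nonneg δ
  δ-nonneg p = ⊗-nonneg (⊗-nonneg (#-nonneg k) (h-nonneg p)) (⅟-nonneg p)

  vᵖ-nonneg : Nonneg vᵖ
  vᵖ-nonneg p = ⊗-nonneg (hᵖ-nonneg p) (⊗-nonneg (⊕-nonneg 0≤1 (μ-nonneg p)) (⊕-nonneg 0≤1 (μ-nonneg p)))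

  module _ {p : ℕ} (2k<p : k + k < p) where

    private
      k<p : k < p
      k<p = ℕ.≤-<-trans (ℕ.m≤m+n k k) 2k<p
      0<p : 0 < p
      0<p = ℕ.<-trans (s≤s z≤n) k<p
      1<p : 1 < p
      1<p = ℕ.≤-<-trans (s≤s z≤n) k<p
      P Q K j i m : ℚ
      P = # p
      Q = # (p ℕ.∸ k)
      K = # k
      j = ⅟ (p ℕ.∸ k)
      i = ⅟ p
      m = μ p
      P≡ : P ≡ K ⊕ Q
      P≡ = trans (cong #_ (sym (ℕ.m+[n∸m]≡n (ℕ.<⇒≤ k<p)))) (#-+ k (p ℕ.∸ k))
      Qj : Q ⊗ j ≡ 1ℚ
      Qj = ⅟-inverse (ℕ.m<n⇒0<n∸m k<p)
      Pi : P ⊗ i ≡ 1ℚ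
      Pi = ⅟-inverse 0<p
      Sm : # (p ℕ.∸ 1) ⊗ m ≡ 1ℚ
      Sm = ⅟-inverse (ℕ.m<n⇒0<n∸m 1<p)
      1+h : 1ℚ ⊕ h p ≡ P ⊗ j
      1+h = trans (cong (_⊕ K ⊗ j) (sym Qj)) (trans (solve 3 (λ q k j → q :* j :+ k :* j := (k :+ q) :* j) refl Q K j) (cong (_⊗ j) (sym P≡)))
      1+μ : 1ℚ ⊕ m ≡ P ⊗ m
      1+μ = trans (cong (_⊕ m) (sym Sm)) (trans (solve 2 (λ s m → s :* m :+ m := (con 1ℚ :+ s) :* m) refl (# (p ℕ.∸ 1)) m) (cong (_⊗ m) (sym (#pred 1<p))))

    1+h⊗g : (1ℚ ⊕ h p) ⊗ g p ≡ h p
    1+h⊗g = trans (cong (_⊗ g p) 1+h) (trans (solve 4 (λ P j K i → P :* j :* (K :* i) := K :* j :* (P :* i)) refl P j K i) (trans (cong (K ⊗ j ⊗_) Pi) (ℚ.*-identityʳ (h p))))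

    mean : h p ⊖ (1ℚ ⊕ h p) ⊗ g p ≡ 0ℚ
    mean = trans (cong (h p ⊖_) 1+h⊗g) (ℚ.+-inverseʳ (h p))

    variance : h p ⊗ h p ⊕ (1ℚ ⊖ h p ⊗ h p) ⊗ g p ≡ 0ℚ ⊗ 0ℚ ⊕ h p
    variance = trans (solve 2 (λ h g → h :* h :+ (con 1ℚ :- h :* h) :* g := h :* h :+ (con 1ℚ :- h) :* ((con 1ℚ :+ h) :* g)) refl (h p) (g p))
      (trans (cong (λ t → h p ⊗ h p ⊕ (1ℚ ⊖ h p) ⊗ t) 1+h⊗g) (solve 1 (λ h → h :* h :+ (con 1ℚ :- h) :* h := con 0ℚ :* con 0ℚ :+ h) refl (h p)))

    private
      1+h⊗gᵖ : (1ℚ ⊕ h p) ⊗ gᵖ p ≡ h p ⊖ m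
      1+h⊗gᵖ = begin
        (1ℚ ⊕ h p) ⊗ gᵖ p                                ≡⟨ cong (_⊗ gᵖ p) 1+h ⟩
        P ⊗ j ⊗ (K₁ ⊗ m)                                 ≡⟨ cong (λ t → t ⊗ j ⊗ (K₁ ⊗ m)) (#pred 1<p) ⟩
        (1ℚ ⊕ s) ⊗ j ⊗ (K₁ ⊗ m)                          ≡⟨ solve 4 (λ s j k m → (con 1ℚ :+ s) :* j :* (k :* m) := (s :* m) :* (k :* j) :+ m :* (k :* j)) refl s j K₁ m ⟩
        (s ⊗ m) ⊗ (K₁ ⊗ j) ⊕ m ⊗ (K₁ ⊗ j)                ≡⟨ cong (λ t → t ⊗ (K₁ ⊗ j) ⊕ m ⊗ (K₁ ⊗ j)) Sm ⟩
        1ℚ ⊗ (K₁ ⊗ j) ⊕ m ⊗ (K₁ ⊗ j)                     ≡⟨ solve 4 (λ k j m q → con 1ℚ :* (k :* j) :+ m :* (k :* j)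
                                                              := (con 1ℚ :+ k) :* j :- j :+ m :* (k :* j)) refl K₁ j m Q ⟩
        (1ℚ ⊕ K₁) ⊗ j ⊖ j ⊕ m ⊗ (K₁ ⊗ j)                 ≡⟨ cong₂ (λ t u → t ⊗ j ⊖ u ⊕ m ⊗ (K₁ ⊗ j)) (sym (#-suc k₁)) (sym (trans (cong (_⊗ j) Sm) (ℚ.*-identityˡ j))) ⟩
        K ⊗ j ⊖ s ⊗ m ⊗ j ⊕ m ⊗ (K₁ ⊗ j)                 ≡⟨ cong (λ t → K ⊗ j ⊖ t ⊗ m ⊗ j ⊕ m ⊗ (K₁ ⊗ j)) s≡ ⟩
        K ⊗ j ⊖ (K₁ ⊕ Q) ⊗ m ⊗ j ⊕ m ⊗ (K₁ ⊗ j)          ≡⟨ solve 5 (λ K j k q m → K :* j :- (k :+ q) :* m :* j :+ m :* (k :* j) := K :* j :- (q :* j) :* m) refl K j K₁ Q m ⟩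
        K ⊗ j ⊖ (Q ⊗ j) ⊗ m                              ≡⟨ cong (K ⊗ j ⊖_) (trans (cong (_⊗ m) Qj) (ℚ.*-identityˡ m)) ⟩
        h p ⊖ m                                          ∎
        where
        open ≡-Reasoning
        s = # (p ℕ.∸ 1)
        K₁ = # k₁
        s≡ : s ≡ K₁ ⊕ Q
        s≡ = trans (cong #_ (sym (ℕ.m+[n∸m]≡n (ℕ.∸-monoˡ-≤ 1 (ℕ.<⇒≤ k<p))))) (trans (#-+ k₁ (p ℕ.∸ 1 ℕ.∸ k₁)) (cong (λ t → K₁ ⊕ # t) (ℕ.∸-+-assoc p 1 k₁)))

    meanᵖ : h p ⊖ (1ℚ ⊕ h p) ⊗ gᵖ p ≡ m
    meanᵖ = trans (cong (h p ⊖_) 1+h⊗gᵖ) (solve 2 (λ h m → h :- (h :- m) := m) refl (h p) m)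

    private
      h-μ : h p ⊖ m ≡ hᵖ p ⊗ (1ℚ ⊕ m)
      h-μ = trans (sym 1+h⊗gᵖ) (trans (cong (_⊗ gᵖ p) 1+h) (trans (solve 4 (λ P j k m → P :* j :* (k :* m) := k :* j :* (P :* m)) refl P j (# k₁) m) (cong (hᵖ p ⊗_) (sym 1+μ))))

    varianceᵖ : h p ⊗ h p ⊕ (1ℚ ⊖ h p ⊗ h p) ⊗ gᵖ p ≡ m ⊗ m ⊕ vᵖ p
    varianceᵖ = begin
      h p ⊗ h p ⊕ (1ℚ ⊖ h p ⊗ h p) ⊗ gᵖ p                ≡⟨ solve 2 (λ h g → h :* h :+ (con 1ℚ :- h :* h) :* g := h :* h :+ (con 1ℚ :- h) :* ((con 1ℚ :+ h) :* g)) refl (h p) (gᵖ p) ⟩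
      h p ⊗ h p ⊕ (1ℚ ⊖ h p) ⊗ ((1ℚ ⊕ h p) ⊗ gᵖ p)       ≡⟨ cong (λ t → h p ⊗ h p ⊕ (1ℚ ⊖ h p) ⊗ t) 1+h⊗gᵖ ⟩
      h p ⊗ h p ⊕ (1ℚ ⊖ h p) ⊗ (h p ⊖ m)                 ≡⟨ solve 2 (λ h m → h :* h :+ (con 1ℚ :- h) :* (h :- m) := m :* m :+ (h :- m) :* (con 1ℚ :+ m)) refl (h p) m ⟩
      m ⊗ m ⊕ (h p ⊖ m) ⊗ (1ℚ ⊕ m)                       ≡⟨ cong (λ t → m ⊗ m ⊕ t ⊗ (1ℚ ⊕ m)) h-μ ⟩
      m ⊗ m ⊕ hᵖ p ⊗ (1ℚ ⊕ m) ⊗ (1ℚ ⊕ m)                 ≡⟨ cong (m ⊗ m ⊕_) (ℚ.*-assoc (hᵖ p) (1ℚ ⊕ m) (1ℚ ⊕ m)) ⟩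
      m ⊗ m ⊕ vᵖ p                                       ∎
      where open ≡-Reasoning

    h≤1 : h p ⩽ 1ℚ
    h≤1 = ⩽-trans (⊗-monoʳ j (⅟-nonneg (p ℕ.∸ k)) (#-mono (ℕ.m+n≤o⇒m≤o∸n k (ℕ.<⇒≤ 2k<p)))) (≡⇒⩽ Qj)

    h≡g+δ : h p ≡ g p ⊕ δ p
    h≡g+δ = trans (sym 1+h⊗g) (solve 3 (λ h k i → (con 1ℚ :+ h) :* (k :* i) := k :* i :+ k :* h :* i) refl (h p) K i)

    δ≤ : δ p ⩽ # (2 * (k * k)) ⊗ (μ p ⊗ ⅟ p)
    δ≤ = begin
      K ⊗ h p ⊗ i                       ≤⟨ ⊗-monoʳ i (⅟-nonneg p) (⊗-monoˡ K (#-nonneg k) h≤) ⟩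
      K ⊗ (# 2 ⊗ K ⊗ m) ⊗ i             ≡⟨ solve 4 (λ K t m i → K :* (t :* K :* m) :* i := t :* (K :* K) :* (m :* i)) refl K (# 2) m i ⟩
      # 2 ⊗ (K ⊗ K) ⊗ (m ⊗ i)           ≡⟨ cong (_⊗ (m ⊗ i)) (trans (cong (# 2 ⊗_) (sym (#-* k k))) (sym (#-* 2 (k * k)))) ⟩
      # (2 * (k * k)) ⊗ (m ⊗ i)         ∎
      where
      open ℚ.≤-Reasoning
      p-1≤ : p ℕ.∸ 1 ≤ 2 * (p ℕ.∸ k)
      p-1≤ = ℕ.≤-trans (ℕ.m∸n≤m p 1) (ℕ.≤-trans (ℕ.≤-reflexive (sym (ℕ.m+[n∸m]≡n (ℕ.<⇒≤ k<p)))) (ℕ.≤-trans (ℕ.+-monoˡ-≤ (p ℕ.∸ k) (ℕ.m+n≤o⇒m≤o∸n k (ℕ.<⇒≤ 2k<p))) (ℕ.≤-reflexive (cong (p ℕ.∸ k +_) (sym (ℕ.+-identityʳ (p ℕ.∸ k)))))))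
      h≤ : h p ⩽ # 2 ⊗ K ⊗ m
      h≤ = begin
        K ⊗ j                           ≡⟨ trans (sym (ℚ.*-identityʳ (K ⊗ j))) (cong (K ⊗ j ⊗_) (sym Sm)) ⟩
        K ⊗ j ⊗ (# (p ℕ.∸ 1) ⊗ m)       ≤⟨ ⊗-monoˡ (K ⊗ j) (h-nonneg p) (⊗-monoʳ m (μ-nonneg p) (⩽-trans (#-mono p-1≤) (≡⇒⩽ (#-* 2 (p ℕ.∸ k))))) ⟩
        K ⊗ j ⊗ (# 2 ⊗ Q ⊗ m)           ≡⟨ solve 5 (λ K j t q m → K :* j :* (t :* q :* m) := t :* K :* m :* (q :* j)) refl K j (# 2) Q m ⟩
        # 2 ⊗ K ⊗ m ⊗ (Q ⊗ j)           ≡⟨ trans (cong (# 2 ⊗ K ⊗ m ⊗_) Qj) (ℚ.*-identityʳ (# 2 ⊗ K ⊗ m)) ⟩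
        # 2 ⊗ K ⊗ m                     ∎

    -- (1 + μ)^l - 1 ≤ l / (p - 1 - l)
    compound≤ : ∀ l → l ≤ k₁ → # (p ℕ.∸ suc l) ⊗ compound μ-nonneg l p ⩽ # l
    compound≤ zero    _ = ≡⇒⩽ (trans (ℚ.*-zeroʳ (# (p ℕ.∸ 1))) (sym #0))
    compound≤ (suc l) l<k = begin
      c ⊗ (x ⊕ m ⊕ x ⊗ m)                      ≡⟨ solve 3 (λ c x m → c :* (x :+ m :+ x :* m) := c :* (con 1ℚ :+ m) :* x :+ c :* m) refl c x m ⟩
      c ⊗ (1ℚ ⊕ m) ⊗ x ⊕ c ⊗ m                 ≤⟨ ⊕-mono (⊗-monoʳ x (compound-nonneg μ-nonneg l p) c≤) cm≤1 ⟩
      c′ ⊗ x ⊕ 1ℚ                              ≤⟨ ⊕-monoˡ 1ℚ (compound≤ l (ℕ.<⇒≤ l<k)) ⟩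
      # l ⊕ 1ℚ                                 ≡⟨ trans (ℚ.+-comm (# l) 1ℚ) (sym (#-suc l)) ⟩
      # (suc l)                                ∎
      where
      open ℚ.≤-Reasoning
      x = compound μ-nonneg l p
      c = # (p ℕ.∸ suc (suc l))
      c′ = # (p ℕ.∸ suc l)
      l+2≤p : suc (suc l) ≤ p
      l+2≤p = ℕ.≤-trans (s≤s l<k) (ℕ.<⇒≤ k<p)
      c′≡ : c′ ≡ 1ℚ ⊕ c
      c′≡ = trans (cong #_ (sym (trans (cong suc (sym (ℕ.pred[m∸n]≡m∸[1+n] p (suc l)))) (ℕ.suc-pred (p ℕ.∸ suc l) {{ℕ.>-nonZero (ℕ.m<n⇒0<n∸m l+2≤p)}})))) (#-suc (p ℕ.∸ suc (suc l)))
      cm≤1 : c ⊗ m ⩽ 1ℚ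
      cm≤1 = ⩽-trans (⊗-monoʳ m (μ-nonneg p) (#-mono (ℕ.∸-monoʳ-≤ p (s≤s z≤n)))) (≡⇒⩽ Sm)
      c≤ : c ⊗ (1ℚ ⊕ m) ⩽ c′
      c≤ = ⩽-trans (≡⇒⩽ (solve 2 (λ c m → c :* (con 1ℚ :+ m) := c :* m :+ c) refl c m)) (⩽-trans (⊕-monoˡ c cm≤1) (≡⇒⩽ (sym c′≡)))

    compound≤hᵖ : compound μ-nonneg k₁ p ⩽ hᵖ p
    compound≤hᵖ = begin
      x                    ≡⟨ trans (sym (ℚ.*-identityˡ x)) (cong (_⊗ x) (sym Qj)) ⟩
      Q ⊗ j ⊗ x            ≡⟨ solve 3 (λ q j x → q :* j :* x := q :* x :* j) refl Q j x ⟩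
      Q ⊗ x ⊗ j            ≤⟨ ⊗-monoʳ j (⅟-nonneg (p ℕ.∸ k)) (compound≤ k₁ ℕ.≤-refl) ⟩
      # k₁ ⊗ j             ∎
      where
      open ℚ.≤-Reasoning
      x = compound μ-nonneg k₁ p

    μ≤2⅟ : μ p ⩽ # 2 ⊗ ⅟ p
    μ≤2⅟ = begin
      m                         ≡⟨ trans (sym (ℚ.*-identityˡ m)) (cong (_⊗ m) (sym Pi)) ⟩
      P ⊗ i ⊗ m                 ≤⟨ ⊗-monoʳ m (μ-nonneg p) (⊗-monoʳ i (⅟-nonneg p) (⩽-trans (#-mono p≤) (≡⇒⩽ (#-* 2 (p ℕ.∸ 1))))) ⟩
      # 2 ⊗ s ⊗ i ⊗ m           ≡⟨ solve 4 (λ t s i m → t :* s :* i :* m := t :* i :* (s :* m)) refl (# 2) s i m ⟩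
      # 2 ⊗ i ⊗ (s ⊗ m)         ≡⟨ trans (cong (# 2 ⊗ i ⊗_) Sm) (ℚ.*-identityʳ (# 2 ⊗ i)) ⟩
      # 2 ⊗ i                   ∎
      where
      open ℚ.≤-Reasoning
      s = # (p ℕ.∸ 1)
      p≤ : p ≤ 2 * (p ℕ.∸ 1)
      p≤ = ℕ.≤-trans (ℕ.≤-reflexive (sym (ℕ.m+[n∸m]≡n 0<p))) (ℕ.≤-trans (ℕ.+-monoˡ-≤ (p ℕ.∸ 1) (ℕ.m<n⇒0<n∸m 1<p)) (ℕ.≤-reflexive (cong (p ℕ.∸ 1 +_) (sym (ℕ.+-identityʳ (p ℕ.∸ 1))))))

  module _ (w : ℕ) (0<w : 0 < w) (2k≤w : k + k ≤ w) (B : ℕ) where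
    private
      W = modulus w
      ps = sievingPrimes W B

    sieving-2k : ∀ {p} → p ∈ ps → k + k < p
    sieving-2k p∈ = ℕ.≤-<-trans 2k≤w (sieving-large w B p∈)

    ∑δ≤ : ∑ₗ ps δ ⩽ # (2 * (k * k)) ⊗ ⅟ w
    ∑δ≤ = ⩽-trans (≡⇒⩽ (∑ₗ-filter P? B δ)) (∑-tail-≤ 0<w (#-nonneg (2 * (k * k))) small large B)
      where
      P? = λ p → prime? p ×-dec (gcd p W ℕ.≟ 1)
      small : ∀ n → n ≤ w → 𝟙 (P? n) ⊗ δ n ≡ 0ℚ
      small n n≤w = trans (cong (_⊗ δ n) (𝟙-no (P? n) λ (pp , c) → ¬prime[1] (subst Prime (gcd≡1⇒coprime {n} {W} c (∣-refl , prime-∣-modulus w pp n≤w)) pp))) (ℚ.*-zeroˡ (δ n))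
      large : ∀ n → w < n → 𝟙 (P? n) ⊗ δ n ⩽ # (2 * (k * k)) ⊗ (⅟ (n ℕ.∸ 1) ⊗ ⅟ n)
      large n w<n = ⩽-trans (⊗-monoʳ (δ n) (δ-nonneg n) (𝟙≤1 (P? n))) (⩽-trans (≡⇒⩽ (ℚ.*-identityˡ (δ n))) (δ≤ (ℕ.≤-<-trans 2k≤w w<n)))

-- Weighted sums of 1, of λ and over primes

≡mod⇔∣ : ∀ {q a n} → a ≤ q → (n ≡ a [mod q ] → q ∣ n + (q ℕ.∸ a)) × (q ∣ n + (q ℕ.∸ a) → n ≡ a [mod q ])
≡mod⇔∣ {q} {a} {n} a≤q = to , from
  where
  c = q ℕ.∸ a
  a+c : a + c ≡ q
  a+c = ℕ.m+[n∸m]≡n a≤q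
  to : n ≡ a [mod q ] → q ∣ n + c
  to d with ℕ.≤-total n a
  ... | inj₁ n≤a = ∣m+n∣m⇒∣n {m = a ℕ.∸ n} (subst (q ∣_) (trans (sym a+c) (trans (cong (_+ c) (sym (ℕ.m∸n+n≡m n≤a))) (ℕ.+-assoc (a ℕ.∸ n) n c))) ∣-refl) (subst (q ∣_) (ℕ.m≤n⇒∣m-n∣≡n∸m n≤a) d)
  ... | inj₂ a≤n = subst (q ∣_) (trans (cong (n ℕ.∸ a +_) (sym a+c)) (trans (sym (ℕ.+-assoc (n ℕ.∸ a) a c)) (cong (_+ c) (ℕ.m∸n+n≡m a≤n)))) (∣m∣n⇒∣m+n (subst (q ∣_) (ℕ.m≤n⇒∣n-m∣≡n∸m a≤n) d) ∣-refl)
  from : q ∣ n + c → n ≡ a [mod q ]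
  from d = ∣-difference {q} {c} {n} {a} (subst (q ∣_) (ℕ.+-comm n c) d) (subst (q ∣_) (trans (sym a+c) (ℕ.+-comm a c)) ∣-refl)

-- Translates the class of n in the sieve into the class of n + h used in (A) and (B). `lift`
-- supplies an actual member of the class, from which coprimality of a and q can be read off.
record Residue (q r h : ℕ) : Set where
  field
    a    : ℕ
    a<q  : a < q
    to   : ∀ {n} → q ∣ n + r → n + h ≡ a [mod q ]
    from : ∀ {n} → n + h ≡ a [mod q ] → q ∣ n + r
    lift : ∃[ n ] ∃[ m ] (q ∣ n + r × n + h ≡ a + q * m)

residue : ∀ {q} → 0 < q → ∀ r h → Residue q r h
residue {q@(suc q-1)} _ r h = record
  { a = a ; a<q = m%n<n x q
  ; to = λ {n} d → proj₂ (≡mod⇔∣ {q} {a} {n + h} (ℕ.<⇒≤ (m%n<n x q))) (subst (q ∣_) (sym (ℕ.+-assoc n h c)) (∣-unshift {q} {n} {h + c} {y = r} refl (subst (λ t → q ∣ n + t) (sym eq) (∣-shift {q} {n} {r} {y = m + 1} refl d))))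
  ; from = λ {n} d → ∣-unshift {q} {n} {r} {y = m + 1} refl (subst (λ t → q ∣ n + t) eq (∣-shift {q} {n} {h + c} {y = r} refl (subst (q ∣_) (ℕ.+-assoc n h c) (proj₁ (≡mod⇔∣ {q} {a} {n + h} (ℕ.<⇒≤ (m%n<n x q))) d))))
  ; lift = q-1 * r , m , divides r (trans (ℕ.+-comm (q-1 * r) r) (ℕ.*-comm q r)) , trans (ℕ.+-comm (q-1 * r) h) x≡
  }
  where
  -- This is h - r modulo q, with (q - 1) r in place of -r; the residue a is its remainder.
  x = h + q-1 * r
  a = x % q
  m = x / q
  c = q ℕ.∸ a
  x≡ : x ≡ a + q * m
  x≡ = trans (m≡m%n+[m/n]*n x q) (cong (a +_) (ℕ.*-comm m q))
  eq : h + c + q * r ≡ r + q * (m + 1)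
  eq = begin
    h + c + q * r           ≡⟨ solveℕ 4 (λ h c r q → h ⟨+⟩ c ⟨+⟩ (conℕ 1 ⟨+⟩ q) ⟨*⟩ r ⟨=⟩ h ⟨+⟩ q ⟨*⟩ r ⟨+⟩ c ⟨+⟩ r) refl h c r q-1 ⟩
    x + c + r               ≡⟨ cong (λ t → t + c + r) x≡ ⟩
    a + q * m + c + r       ≡⟨ solveℕ 4 (λ a y c r → a ⟨+⟩ y ⟨+⟩ c ⟨+⟩ r ⟨=⟩ (a ⟨+⟩ c) ⟨+⟩ y ⟨+⟩ r) refl a (q * m) c r ⟩
    a + c + q * m + r       ≡⟨ cong (λ t → t + q * m + r) (ℕ.m+[n∸m]≡n (ℕ.<⇒≤ (m%n<n x q))) ⟩
    q + q * m + r           ≡⟨ solveℕ 3 (λ q m r → q ⟨+⟩ q ⟨*⟩ m ⟨+⟩ r ⟨=⟩ r ⟨+⟩ q ⟨*⟩ (m ⟨+⟩ conℕ 1)) refl q m r ⟩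
    r + q * (m + 1)         ∎
    where open ≡-Reasoning

∑-translate : ∀ h N (G : ℕ → ℚ) → ∑ N (λ n → G (h + n)) ≡ ∑ (h + N) G ⊖ ∑ h G
∑-translate h N G = trans (solve 2 (λ a b → b := a :+ b :- a) refl (∑ h G) (∑ N (λ n → G (h + n)))) (cong (_⊖ ∑ h G) (sym (∑-split h N G)))

class-size-≤ : ∀ N {q} r → 0 < q → ∑ N (λ n → 𝟙 (q ∣? (n + r))) ⩽ # N ⊗ ⅟ q ⊕ 1ℚ
class-size-≤ N {q} r 0<q = begin
  c                                 ≡⟨ solve 2 (λ c x → c := x :+ (c :- x)) refl c (# N ⊗ ⅟ q) ⟩
  # N ⊗ ⅟ q ⊕ (c ⊖ # N ⊗ ⅟ q)       ≤⟨ ⊕-monoʳ (# N ⊗ ⅟ q) (⩽-trans (x≤∥x∥ (c ⊖ # N ⊗ ⅟ q)) (class-size N q r 0<q)) ⟩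
  # N ⊗ ⅟ q ⊕ 1ℚ                    ∎
  where
  open ℚ.≤-Reasoning
  c = ∑ N (λ n → 𝟙 (q ∣? (n + r)))

class-sum-≤ : ∀ N {q} r → 0 < q → ∀ {f : ℕ → ℚ} {y} → 0ℚ ⩽ y → (∀ n → 0 < n → n ≤ N → ∥ f n ∥ ⩽ y) →
  ∥ ∑ N (λ n → f n ⊗ 𝟙 (q ∣? (n + r))) ∥ ⩽ y ⊗ (# N ⊗ ⅟ q ⊕ 1ℚ)
class-sum-≤ N {q} r 0<q {f} {y} 0≤y f≤ = begin
  ∥ ∑ N (λ n → f n ⊗ 𝟙 (q ∣? (n + r))) ∥      ≤⟨ ∑-∥∥ N (λ n → f n ⊗ 𝟙 (q ∣? (n + r))) ⟩
  ∑ N (λ n → ∥ f n ⊗ 𝟙 (q ∣? (n + r)) ∥)      ≤⟨ ∑-mono N (λ n 0<n n≤N → ⩽-trans (≡⇒⩽ (trans (∥∥-⊗ (f n) (𝟙 (q ∣? (n + r)))) (cong (∥ f n ∥ ⊗_) (ℚ.0≤p⇒∣p∣≡p (𝟙-nonneg (q ∣? (n + r)))))))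
      (⊗-monoʳ (𝟙 (q ∣? (n + r))) (𝟙-nonneg (q ∣? (n + r))) (f≤ n 0<n n≤N))) ⟩
  ∑ N (λ n → y ⊗ 𝟙 (q ∣? (n + r)))            ≡⟨ ∑-⊗ N y (λ n → 𝟙 (q ∣? (n + r))) ⟩
  y ⊗ ∑ N (λ n → 𝟙 (q ∣? (n + r)))            ≤⟨ ⊗-monoˡ y 0≤y (class-size-≤ N r 0<q) ⟩
  y ⊗ (# N ⊗ ⅟ q ⊕ 1ℚ)                        ∎
  where open ℚ.≤-Reasoning

∑-≤-length : ∀ n {f : ℕ → ℚ} → (∀ i → ∥ f i ∥ ⩽ 1ℚ) → ∥ ∑ n f ∥ ⩽ # n
∑-≤-length n {f} f≤ = ⩽-trans (∑-∥∥ n f) (⩽-trans (∑-mono n λ i _ _ → f≤ i) (≡⇒⩽ (trans (∑-const n 1ℚ) (ℚ.*-identityʳ (# n)))))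

∏ₑ-mono : ∀ {u u′ : ℕ → ℚ} → Nonneg u → ∀ {T} → All (λ p → u p ⩽ u′ p) T → ∏ₑ u T ⩽ ∏ₑ u′ T
∏ₑ-mono 0≤u [] = ⩽-refl
∏ₑ-mono 0≤u {p ∷ T} (e ∷ es) = ⊗-mono (0≤u p) e (∏ₑ-nonneg 0≤u T) (∏ₑ-mono 0≤u es)

others : List ℕ → ℕ → List ℕ
others hs hᵢ = filter (λ h → ¬? (h ℕ.≟ hᵢ)) hs

record Tuple (k₁ : ℕ) (hs : List ℕ) : Set where
  field
    size       : length hs ≡ suc k₁
    distinct   : Unique hs
    small      : All (_≤ 14) hs
    admissible : All AdmissibleShift hs
    size-rest  : All (λ hᵢ → length (others hs hᵢ) ≡ k₁) hs

-- The interface between analysis and sieve, with rational data only. `ℓ` stands for a partial sum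
-- of the logarithm, `e₁` and `e₂` for the errors in (A) and (B) at one index of their sequences,
-- and `lam` for the Liouville function.
record Inputs (W B N : ℕ) : Set where
  field
    ℓ e₁ e₂ lam : ℕ → ℚ
    e₁-nonneg : Nonneg e₁
    e₂-nonneg : Nonneg e₂
    ℓ-nonneg  : ∀ n → 0 < n → n ≤ N → 0ℚ ⩽ ℓ n
    ℓ≤H       : ∀ n → 0 < n → n ≤ N → ℓ n ⩽ H N
    lam≤1     : ∀ n → ∥ lam n ∥ ⩽ 1ℚ
    primes-equidistributed : ∀ q a → a < q → gcd a q ≡ 1 →
      ∥ ∑ N (λ n → 𝟙 (prime? n ×-dec (n ≡? a [mod q ])) ⊗ ℓ n) ⊖ # N ⊗ ⅟ (φ q) ∥ ⩽ e₁ q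
    lam-equidistributed : ∀ q a → a < q → ∥ ∑ N (λ n → 𝟙 (n ≡? a [mod q ]) ⊗ lam n) ∥ ⩽ e₂ q

module Evaluations
  {k₁ : ℕ} {hs : List ℕ} (tuple : Tuple k₁ hs) (w : ℕ) (15≤w : 15 ≤ w) (2k≤w : suc k₁ + suc k₁ ≤ w)
  (R N : ℕ) (14≤R : 14 ≤ R) (B≤N : R * R ≤ N) (inputs : Inputs (modulus w) (R * R) N)
  (Y : ℕ → ℚ) (DY : Decreasing R Y) (y₀ : ℚ) (Y≤y₀ : ∀ n → Y n ⩽ y₀) where

  open Tuple tuple
  open Inputs inputs
  open Local k₁

  W r₀ : ℕ
  W = modulus w
  r₀ = proj₁ (coprime-class w)

  ps : List ℕ
  ps = sievingPrimes W (R * R)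

  e : ℕ → ℕ → ℚ
  e n p = 𝟙 (any? (λ h → p ∣? (n + h)) hs)

  private
    0<W : 0 < W
    0<W = ℕ.<-trans (s≤s z≤n) (1<modulus w)
    0<R : 0 < R
    0<R = ℕ.<-≤-trans (s≤s z≤n) 14≤R
    0<w : 0 < w
    0<w = ℕ.<-≤-trans (s≤s z≤n) 15≤w
    idem : ∀ n p → e n p ⊗ e n p ≡ e n p
    idem n p = go (any? (λ h → p ∣? (n + h)) hs)
      where
      go : ∀ {P : Set} (d : Dec P) → 𝟙 d ⊗ 𝟙 d ≡ 𝟙 d
      go (yes _) = refl
      go (no _)  = refl
    2k< : ∀ {p} → p ∈ ps → k + k < p
    2k< = sieving-2k w 0<w 2k≤w (R * R)
    S : SiftedBy (R * R) (coprime-indicator W) ps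
    S = sieving-SiftedBy w (R * R)

  open Sieve W r₀ R N 0<W 0<R ps S (sieving-coprime w (R * R)) h h-nonneg (All.tabulate λ p∈ → h≤1 (2k< p∈)) Y DY y₀ Y≤y₀ e idem public

  weight-nonneg : ∀ n → 0ℚ ⩽ weight n
  weight-nonneg n = square-nonneg (𝕊 (χ h (e n)) ps Y)

  -- Each trivial error consists of at most three terms: H N times N/q, H N times 1, and N/φ(q). For
  -- q = W product(T) with product(T) ≤ B ≤ N, every one of them is at most N H N times the product
  -- of 2/p over T.
  Z : ℚ
  Z = # 3 ⊗ # N ⊗ H N

  private
    0<N : 0 < N
    0<N = ℕ.<-≤-trans 0<B B≤N
    1≤HN : 1ℚ ⩽ H N
    1≤HN = ⩽-trans (≡⇒⩽ (sym H1)) (H-mono 0<N)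
    0≤Z : 0ℚ ⩽ Z
    0≤Z = ⊗-nonneg (⊗-nonneg (#-nonneg 3) (#-nonneg N)) (H-nonneg N)
    N≤NH : # N ⩽ # N ⊗ H N
    N≤NH = ⩽-trans (≡⇒⩽ (sym (ℚ.*-identityʳ (# N)))) (⊗-monoˡ (# N) (#-nonneg N) 1≤HN)
    3≡ : ∀ x → x ⊕ x ⊕ x ≡ # 3 ⊗ x
    3≡ x = trans (solve 1 (λ x → x :+ x :+ x := (con 1ℚ :+ con 1ℚ :+ con 1ℚ) :* x) refl x) (cong (_⊗ x) (sym (trans (#-+ 2 1) (cong₂ _⊕_ (trans (#-+ 1 1) (cong₂ _⊕_ #1 #1)) #1))))
    Z≡ : # N ⊗ H N ⊕ # N ⊗ H N ⊕ # N ⊗ H N ≡ Z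
    Z≡ = trans (3≡ (# N ⊗ H N)) (sym (ℚ.*-assoc (# 3) (# N) (H N)))
    Π : List ℕ → ℚ
    Π = ∏ₑ (λ p → # 2 ⊗ ⅟ p)
    Π-nonneg : ∀ T → 0ℚ ⩽ Π T
    Π-nonneg = ∏ₑ-nonneg λ p → ⊗-nonneg (#-nonneg 2) (⅟-nonneg p)
    posT : ∀ {T} → T ⊆ ps → Positive T
    posT τ = All-resp-⊆ τ (positive S)
    ⅟≤2⅟ : ∀ p → ⅟ p ⩽ # 2 ⊗ ⅟ p
    ⅟≤2⅟ p = ⩽-trans (≡⇒⩽ (sym (ℚ.*-identityˡ (⅟ p)))) (⊗-monoʳ (⅟ p) (⅟-nonneg p) (1≤# {2} (s≤s z≤n)))
    ⅟Π≤ : ∀ {T} → T ⊆ ps → ⅟ (W * product T) ⩽ Π T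
    ⅟Π≤ {T} τ = begin
      ⅟ (W * product T)       ≡⟨ ⅟-product T (posT τ) W 0<W ⟩
      ⅟ W ⊗ ∏ₑ ⅟_ T           ≤⟨ ⊗-mono (⅟-nonneg W) (⅟≤1 0<W) (∏ₑ-nonneg ⅟-nonneg T) (∏ₑ-mono ⅟-nonneg {T} (All.tabulate λ {p} _ → ⅟≤2⅟ p)) ⟩
      1ℚ ⊗ Π T                ≡⟨ ℚ.*-identityˡ (Π T) ⟩
      Π T                     ∎
      where open ℚ.≤-Reasoning
    1≤NΠ : ∀ {T} → T ⊆ ps → product T ≤ B → 1ℚ ⩽ # N ⊗ Π T
    1≤NΠ {T} τ T≤B = begin
      1ℚ                               ≡⟨ ⅟-inverse 0<T ⟨
      # (product T) ⊗ ⅟ (product T)    ≡⟨ cong (# (product T) ⊗_) (trans (cong ⅟_ (sym (ℕ.*-identityˡ (product T)))) (trans (⅟-product T (posT τ) 1 (s≤s z≤n)) (trans (cong (_⊗ ∏ₑ ⅟_ T) ⅟1) (ℚ.*-identityˡ (∏ₑ ⅟_ T))))) ⟩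
      # (product T) ⊗ ∏ₑ ⅟_ T          ≤⟨ ⊗-mono (#-nonneg (product T)) (#-mono (ℕ.≤-trans T≤B B≤N)) (∏ₑ-nonneg ⅟-nonneg T) (∏ₑ-mono ⅟-nonneg {T} (All.tabulate λ {p} _ → ⅟≤2⅟ p)) ⟩
      # N ⊗ Π T                        ∎
      where
      open ℚ.≤-Reasoning
      pos-product : ∀ {T} → Positive T → 0 < product T
      pos-product [] = s≤s z≤n
      pos-product (p ∷ ps) = *-pos p (pos-product ps)
      0<T = pos-product (posT τ)
    NΠ≤NHΠ : ∀ T → # N ⊗ Π T ⩽ # N ⊗ H N ⊗ Π T
    NΠ≤NHΠ T = ⊗-monoʳ (Π T) (Π-nonneg T) N≤NH
    ≤Z : ∀ {x y z T} → x ⩽ # N ⊗ H N ⊗ Π T → y ⩽ # N ⊗ H N ⊗ Π T → z ⩽ # N ⊗ H N ⊗ Π T → x ⊕ y ⊕ z ⩽ Z ⊗ Π T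
    ≤Z {x} {y} {z} {T} p q r = ⩽-trans (⊕-mono (⊕-mono p q) r) (≡⇒⩽ (trans (solve 2 (λ a π → a :* π :+ a :* π :+ a :* π := (a :+ a :+ a) :* π) refl (# N ⊗ H N) (Π T)) (cong (_⊗ Π T) Z≡)))
    0≤NHΠ : ∀ T → 0ℚ ⩽ # N ⊗ H N ⊗ Π T
    0≤NHΠ T = ⊗-nonneg (⊗-nonneg (#-nonneg N) (H-nonneg N)) (Π-nonneg T)

    h< : ∀ {p hᵢ} → p ∈ ps → hᵢ ∈ hs → hᵢ < p
    h< p∈ h∈ = ℕ.≤-<-trans (All.lookup small h∈) (ℕ.≤-<-trans (ℕ.n≤1+n 14) (ℕ.≤-<-trans 15≤w (sieving-large w (R * R) p∈)))

    splitAll : All (λ p → ∀ (f : ℕ → ℚ) n → f n ⊗ e n p ≡ ∑ₗ hs (λ h → f n ⊗ 𝟙 (p ∣? (n + h)))) ps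
    splitAll = All.tabulate λ {p} p∈ f n → trans (cong (f n ⊗_) (any-sum (λ h → p ∣? (n + h)) distinct λ a b → shift-unique {p} {n} (h< p∈ a) (h< p∈ b))) (∑ₗ-scale (f n) hs (λ h → 𝟙 (p ∣? (n + h))))
      where
      ∑ₗ-scale : ∀ c xs (g : ℕ → ℚ) → c ⊗ ∑ₗ xs g ≡ ∑ₗ xs (λ x → c ⊗ g x)
      ∑ₗ-scale c [] g = ℚ.*-zeroʳ c
      ∑ₗ-scale c (x ∷ xs) g = trans (ℚ.*-distribˡ-+ c (g x) (∑ₗ xs g)) (cong (c ⊗ g x ⊕_) (∑ₗ-scale c xs g))

    Okay : ℕ → ℕ → Set
    Okay q r = 0 < q

    meanAll = All.tabulate (λ {p} (p∈ : p ∈ ps) → mean (2k< p∈))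
    varAll = All.tabulate (λ {p} (p∈ : p ∈ ps) → variance (2k< p∈))

  evaluate-1 : ∀ {t} → 0ℚ ≺ t →
    ∥ ∑ N (λ n → 1ℚ ⊗ 𝟙 (W ∣? (n + r₀)) ⊗ weight n) ⊖ # N ⊗ ⅟ W ⊗ 𝕊 h ps (λ d → Y d ⊗ Y d) ∥ ⩽ error k t (∑ (W * B) (λ _ → 1ℚ)) Z
  evaluate-1 {t} 0<t = subst (λ l → ∥ ∑ N (λ n → 1ℚ ⊗ 𝟙 (W ∣? (n + r₀)) ⊗ weight n) ⊖ # N ⊗ ⅟ W ⊗ 𝕊 h ps (λ d → Y d ⊗ Y d) ∥ ⩽ error l t (∑ (W * B) (λ _ → 1ℚ)) Z) size
    (⩽-trans (≡⇒⩽ (cong (λ x → ∥ ∑ N (λ n → 1ℚ ⊗ 𝟙 (W ∣? (n + r₀)) ⊗ weight n) ⊖ # N ⊗ ⅟ W ⊗ x ∥) (sym (covariance-centred h ps Y Y))))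
      (evaluate (λ _ → 1ℚ) hs Okay (λ _ → ⊤) (λ 0<q pp _ _ _ → *-pos 0<q (prime-pos pp)) (All.tabulate λ _ → tt) 0<W
        (All.map (λ sp n → sp (λ _ → 1ℚ) n) splitAll)
        {M = λ q → # N ⊗ ⅟ q} {g = g} {a = λ _ → 0ℚ} {v = h} {X = # N ⊗ ⅟ W} base (λ _ → 0≤1) base 0≤Z V≤ main meanAll varAll 0<t))
    where
    base : ∀ q r → Okay q r → ∥ ∑ N (λ n → 1ℚ ⊗ 𝟙 (q ∣? (n + r))) ⊖ # N ⊗ ⅟ q ∥ ⩽ 1ℚ
    base q r 0<q = ⩽-trans (≡⇒⩽ (cong (λ x → ∥ x ⊖ # N ⊗ ⅟ q ∥) (∑-cong N λ n _ _ → ℚ.*-identityˡ (𝟙 (q ∣? (n + r)))))) (class-size N q r 0<q)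
    V≤ : ∀ T → T ⊆ ps → product T ≤ B → 1ℚ ⩽ Z ⊗ Π T
    V≤ T τ T≤B = ⩽-trans (≡⇒⩽ refl) (≤Z {1ℚ} {0ℚ} {0ℚ} {T} (⩽-trans (1≤NΠ τ T≤B) (NΠ≤NHΠ T)) (0≤NHΠ T) (0≤NHΠ T))
    main : ∀ T → T ⊆ ps → pow (# (length hs)) T ⊗ (# N ⊗ ⅟ (W * product T)) ≡ # N ⊗ ⅟ W ⊗ ∏ₑ g T
    main T τ = trans (cong₂ (λ l x → pow (# l) T ⊗ (# N ⊗ x)) size (⅟-product T (posT τ) W 0<W))
      (trans (solve 4 (λ k n w x → k :* (n :* (w :* x)) := n :* w :* (k :* x)) refl (pow (# k) T) (# N) (⅟ W) (∏ₑ ⅟_ T)) (cong (# N ⊗ ⅟ W ⊗_) (pow-∏ₑ (# k) ⅟_ T)))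

  evaluate-lam : ∀ h′ {t} → 0ℚ ≺ t →
    ∥ ∑ N (λ n → lam (n + h′) ⊗ 𝟙 (W ∣? (n + r₀)) ⊗ weight n) ∥ ⩽ error k t (∑ (W * B) (λ q → e₂ q ⊕ # (2 * h′))) Z
  evaluate-lam h′ {t} 0<t = subst (λ l → ∥ s ∥ ⩽ error l t (∑ (W * B) (λ q → e₂ q ⊕ # (2 * h′))) Z) size
    (⩽-trans (≡⇒⩽ (cong ∥_∥ (sym (trans (cong (s ⊖_) (ℚ.*-zeroˡ (covariance (λ _ → 0ℚ) h ps Y Y))) (⊕-identityʳ s)))))
      (evaluate (λ n → lam (n + h′)) hs Okay (λ _ → ⊤) (λ 0<q pp _ _ _ → *-pos 0<q (prime-pos pp)) (All.tabulate λ _ → tt) 0<W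
        (All.map (λ sp n → sp (λ n → lam (n + h′)) n) splitAll)
        {M = λ _ → 0ℚ} {g = g} {a = λ _ → 0ℚ} {v = h} {X = 0ℚ} base (λ q → ⊕-nonneg (e₂-nonneg q) (#-nonneg (2 * h′))) baseV 0≤Z V≤ main meanAll varAll 0<t))
    where
    open ℚ.≤-Reasoning
    s = ∑ N (λ n → lam (n + h′) ⊗ 𝟙 (W ∣? (n + r₀)) ⊗ weight n)
    minus-0 : ∀ x → ∥ x ⊖ 0ℚ ∥ ≡ ∥ x ∥
    minus-0 x = cong ∥_∥ (⊕-identityʳ x)
    -- Shifting the range by h′ changes at most h′ terms at each end, and each of them is at most 1
    -- in absolute value.
    base : ∀ q r → Okay q r → ∥ ∑ N (λ n → lam (n + h′) ⊗ 𝟙 (q ∣? (n + r))) ⊖ 0ℚ ∥ ⩽ e₂ q ⊕ # (2 * h′)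
    base q r 0<q = begin
      ∥ ∑ N (λ n → lam (n + h′) ⊗ 𝟙 (q ∣? (n + r))) ⊖ 0ℚ ∥   ≡⟨ trans (minus-0 (∑ N (λ n → lam (n + h′) ⊗ 𝟙 (q ∣? (n + r))))) (cong ∥_∥ (∑-cong N λ n _ _ → lem n)) ⟩
      ∥ ∑ N (λ n → G (h′ + n)) ∥                             ≡⟨ cong ∥_∥ (∑-translate h′ N G) ⟩
      ∥ ∑ (h′ + N) G ⊖ ∑ h′ G ∥                              ≡⟨ cong (λ t → ∥ ∑ t G ⊖ ∑ h′ G ∥) (ℕ.+-comm h′ N) ⟩
      ∥ ∑ (N + h′) G ⊖ ∑ h′ G ∥                              ≡⟨ cong (λ t → ∥ t ⊖ ∑ h′ G ∥) (∑-split N h′ G) ⟩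
      ∥ ∑ N G ⊕ ∑ h′ (λ i → G (N + i)) ⊖ ∑ h′ G ∥            ≤⟨ ⩽-trans (ℚ.∣p-q∣≤∣p∣+∣q∣ (∑ N G ⊕ ∑ h′ (λ i → G (N + i))) (∑ h′ G)) (⊕-monoˡ ∥ ∑ h′ G ∥ (∥∥-⊕ (∑ N G) (∑ h′ (λ i → G (N + i))))) ⟩
      ∥ ∑ N G ∥ ⊕ ∥ ∑ h′ (λ i → G (N + i)) ∥ ⊕ ∥ ∑ h′ G ∥    ≤⟨ ⊕-mono (⊕-mono (lam-equidistributed q a a<q) (∑-≤-length h′ λ i → G≤ (N + i))) (∑-≤-length h′ G≤) ⟩
      e₂ q ⊕ # h′ ⊕ # h′                                     ≡⟨ trans (ℚ.+-assoc (e₂ q) (# h′) (# h′)) (cong (e₂ q ⊕_) (trans (sym (#-+ h′ h′)) (cong (λ t → # (h′ + t)) (sym (ℕ.+-identityʳ h′))))) ⟩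
      e₂ q ⊕ # (2 * h′)                                      ∎
      where
      open Residue (residue 0<q r h′)
      G : ℕ → ℚ
      G n = 𝟙 (n ≡? a [mod q ]) ⊗ lam n
      G≤ : ∀ n → ∥ G n ∥ ⩽ 1ℚ
      G≤ n = ⩽-trans (≡⇒⩽ (trans (∥∥-⊗ (𝟙 (n ≡? a [mod q ])) (lam n)) (cong (_⊗ ∥ lam n ∥) (ℚ.0≤p⇒∣p∣≡p (𝟙-nonneg (n ≡? a [mod q ]))))))
        (⩽-trans (⊗-mono (𝟙-nonneg (n ≡? a [mod q ])) (𝟙≤1 (n ≡? a [mod q ])) (∥∥-nonneg (lam n)) (lam≤1 n)) (≡⇒⩽ (ℚ.*-identityˡ 1ℚ)))
      lem : ∀ n → lam (n + h′) ⊗ 𝟙 (q ∣? (n + r)) ≡ G (h′ + n)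
      lem n = trans (ℚ.*-comm (lam (n + h′)) (𝟙 (q ∣? (n + r)))) (trans (cong (_⊗ lam (n + h′)) (𝟙-cong (q ∣? (n + r)) (n + h′ ≡? a [mod q ]) to from)) (cong G (ℕ.+-comm n h′)))
    baseV : ∀ q r → Okay q r → ∥ ∑ N (λ n → lam (n + h′) ⊗ 𝟙 (q ∣? (n + r))) ⊖ 0ℚ ∥ ⩽ # N ⊗ ⅟ q ⊕ 1ℚ
    baseV q r 0<q = ⩽-trans (≡⇒⩽ (minus-0 (∑ N (λ n → lam (n + h′) ⊗ 𝟙 (q ∣? (n + r)))))) (⩽-trans (class-sum-≤ N r 0<q 0≤1 λ n _ _ → lam≤1 (n + h′)) (≡⇒⩽ (ℚ.*-identityˡ (# N ⊗ ⅟ q ⊕ 1ℚ))))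
    V≤ : ∀ T → T ⊆ ps → product T ≤ B → # N ⊗ ⅟ (W * product T) ⊕ 1ℚ ⩽ Z ⊗ Π T
    V≤ T τ T≤B = ⩽-trans (≡⇒⩽ (sym (⊕-identityʳ (# N ⊗ ⅟ (W * product T) ⊕ 1ℚ)))) (≤Z {# N ⊗ ⅟ (W * product T)} {1ℚ} {0ℚ} {T} (⩽-trans (⊗-monoˡ (# N) (#-nonneg N) (⅟Π≤ τ)) (NΠ≤NHΠ T)) (⩽-trans (1≤NΠ τ T≤B) (NΠ≤NHΠ T)) (0≤NHΠ T))
    main : ∀ T → T ⊆ ps → pow (# (length hs)) T ⊗ 0ℚ ≡ 0ℚ ⊗ ∏ₑ g T
    main T τ = trans (ℚ.*-zeroʳ (pow (# (length hs)) T)) (sym (ℚ.*-zeroˡ (∏ₑ g T)))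

  module _ {hᵢ : ℕ} (hᵢ∈ : hᵢ ∈ hs) where

    isPrime? : ∀ n → Dec (Prime n × (B < n × n ≤ N))
    isPrime? n = prime? n ×-dec (B ℕ.<? n ×-dec n ℕ.≤? N)

    -- Primes up to B are left out, so that no sieving prime can divide n + hᵢ. The indicator
    -- `e n p` then involves only the other shifts, and only k - 1 classes remain for each prime.
    logPrime : ℕ → ℚ
    logPrime n = 𝟙 (isPrime? n) ⊗ ℓ n

    -- The cost of leaving out the primes up to B, by counting all integers of the class and
    -- bounding the logarithm by H N.
    extra : ℕ → ℚ
    extra q = H N ⊗ (# B ⊗ ⅟ q ⊕ 1ℚ)

    private
      hs′ = others hs hᵢ
      size′ : length hs′ ≡ k₁
      size′ = All.lookup size-rest hᵢ∈
      hs′⊆ : ∀ {h} → h ∈ hs′ → h ∈ hs × h ≢ hᵢ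
      hs′⊆ = ∈-filter⁻ (λ h → ¬? (h ℕ.≟ hᵢ)) {xs = hs}
      Good : ℕ → Set
      Good p = 14 < p × p ≤ B
      good : All Good ps
      good = All.tabulate λ p∈ → ℕ.<-trans (ℕ.≤-trans (s≤s ℕ.≤-refl) 15≤w) (sieving-large w (R * R) p∈) , proj₂ (proj₁ (sieving-∈ w (R * R) p∈))
      -- Condition (A) covers only reduced residue classes. The coprimality of n + hᵢ to the modulus
      -- holds modulo W by the choice of `r₀`, and is preserved at p because n is placed at another
      -- shift there.
      Ok : ℕ → ℕ → Set
      Ok q r = 0 < q × (∀ n → q ∣ n + r → Coprime q (n + hᵢ))
      f : ℕ → ℚ
      f n = logPrime (n + hᵢ)
      step : ∀ {q r p h y s} → Ok q r → Prime p → Good p → Any (h ≡_) hs′ → r + q * y ≡ h + p * s → Ok (q * p) (r + q * y)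
      step {q} {r} {p} {h} {y} {s} (0<q , ok) pp (14<p , _) h∈ eq = *-pos 0<q (prime-pos pp) , λ n d → cop n d
        where
        cop : ∀ n → q * p ∣ n + (r + q * y) → Coprime (q * p) (n + hᵢ)
        cop n d = Coprimality.sym (coprime-* (Coprimality.sym (ok n (∣-unshift {q} {n} {r} {y = y} refl (m*n∣⇒m∣ q p d)))) (Coprimality.sym (prime-coprime pp
          λ p∣ → proj₂ (hs′⊆ h∈) (shift-unique {p} {n} (ℕ.≤-<-trans (All.lookup small (proj₁ (hs′⊆ h∈))) 14<p) (ℕ.≤-<-trans (All.lookup small hᵢ∈) 14<p)
            (∣-unshift {p} {n} {h} {y = s} (sym eq) (m*n∣⇒n∣ q p d)) p∣))))
      split : All (λ p → ∀ n → f n ⊗ e n p ≡ ∑ₗ hs′ (λ h → f n ⊗ 𝟙 (p ∣? (n + h)))) ps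
      split = All.tabulate λ {p} p∈ n → go p∈ n (isPrime? (n + hᵢ))
        where
        ∑ₗ-scale : ∀ c xs (g : ℕ → ℚ) → c ⊗ ∑ₗ xs g ≡ ∑ₗ xs (λ x → c ⊗ g x)
        ∑ₗ-scale c [] g = ℚ.*-zeroʳ c
        ∑ₗ-scale c (x ∷ xs) g = trans (ℚ.*-distribˡ-+ c (g x) (∑ₗ xs g)) (cong (c ⊗ g x ⊕_) (∑ₗ-scale c xs g))
        go : ∀ {p} → p ∈ ps → ∀ n (d : Dec (Prime (n + hᵢ) × (B < n + hᵢ × n + hᵢ ≤ N))) → 𝟙 d ⊗ ℓ (n + hᵢ) ⊗ e n p ≡ ∑ₗ hs′ (λ h → 𝟙 d ⊗ ℓ (n + hᵢ) ⊗ 𝟙 (p ∣? (n + h)))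
        go {p} p∈ n d = trans (lem d) (∑ₗ-scale (𝟙 d ⊗ ℓ (n + hᵢ)) hs′ (λ h → 𝟙 (p ∣? (n + h))))
          where
          lem : ∀ d → 𝟙 d ⊗ ℓ (n + hᵢ) ⊗ e n p ≡ 𝟙 d ⊗ ℓ (n + hᵢ) ⊗ ∑ₗ hs′ (λ h → 𝟙 (p ∣? (n + h)))
          lem (no _) = trans (zero-left (e n p)) (sym (zero-left (∑ₗ hs′ (λ h → 𝟙 (p ∣? (n + h))))))
            where
            zero-left : ∀ x → 0ℚ ⊗ ℓ (n + hᵢ) ⊗ x ≡ 0ℚ
            zero-left x = trans (cong (_⊗ x) (ℚ.*-zeroˡ (ℓ (n + hᵢ)))) (ℚ.*-zeroˡ x)
          -- A sieving prime p is at most B, so it cannot divide the prime n + hᵢ, which exceeds B.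
          -- The shift hᵢ can therefore be dropped from the list.
          lem (yes (pn , B<n , _)) = cong (1ℚ ⊗ ℓ (n + hᵢ) ⊗_) (trans (𝟙-cong (any? (λ h → p ∣? (n + h)) hs) (any? (λ h → p ∣? (n + h)) hs′) to from)
              (any-sum (λ h → p ∣? (n + h)) (Unique.filter⁺ (λ h → ¬? (h ℕ.≟ hᵢ)) distinct) λ a b → shift-unique {p} {n} (h< p∈ (proj₁ (hs′⊆ a))) (h< p∈ (proj₁ (hs′⊆ b)))))
            where
            p∤ : ¬ p ∣ n + hᵢ
            p∤ p∣ = ℕ.<⇒≱ B<n (ℕ.≤-trans (ℕ.≤-reflexive (sym (prime-∣-prime (proj₁ (proj₂ (sieving-∈ w (R * R) p∈))) pn p∣))) (proj₂ (proj₁ (sieving-∈ w (R * R) p∈))))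
            to : Any (λ h → p ∣ n + h) hs → Any (λ h → p ∣ n + h) hs′
            to a = go′ a (λ i → i)
              where
              go′ : ∀ {xs} → Any (λ h → p ∣ n + h) xs → (∀ {x} → x ∈ xs → x ∈ hs) → Any (λ h → p ∣ n + h) hs′
              go′ {x ∷ xs} (here px) inc = Any.map (λ { refl → px }) (∈-filter⁺ (λ h → ¬? (h ℕ.≟ hᵢ)) (inc (here refl)) λ { refl → p∤ px })
              go′ (there a) inc = go′ a λ i → inc (there i)
            from : Any (λ h → p ∣ n + h) hs′ → Any (λ h → p ∣ n + h) hs
            from a = go′ a (λ i → i)
              where
              go′ : ∀ {xs} → Any (λ h → p ∣ n + h) xs → (∀ {x} → x ∈ xs → x ∈ hs′) → Any (λ h → p ∣ n + h) hs
              go′ {x ∷ xs} (here px) inc = Any.map (λ { refl → px }) (proj₁ (hs′⊆ (inc (here refl))))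
              go′ (there a) inc = go′ a λ i → inc (there i)
      f≤ : ∀ n → ∥ f n ∥ ⩽ H N
      f≤ n = go (isPrime? (n + hᵢ))
        where
        go : ∀ (d : Dec (Prime (n + hᵢ) × (B < n + hᵢ × n + hᵢ ≤ N))) → ∥ 𝟙 d ⊗ ℓ (n + hᵢ) ∥ ⩽ H N
        go (no _) = ⩽-trans (≡⇒⩽ (cong ∥_∥ (ℚ.*-zeroˡ (ℓ (n + hᵢ))))) (H-nonneg N)
        go (yes (pp , _ , ≤N)) = ⩽-trans (≡⇒⩽ (trans (cong ∥_∥ (ℚ.*-identityˡ (ℓ (n + hᵢ)))) (ℚ.0≤p⇒∣p∣≡p (ℓ-nonneg (n + hᵢ) (prime-pos pp) ≤N)))) (ℓ≤H (n + hᵢ) (prime-pos pp) ≤N)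
      base : ∀ q r → Ok q r → ∥ ∑ N (λ n → f n ⊗ 𝟙 (q ∣? (n + r))) ⊖ # N ⊗ ⅟ (φ q) ∥ ⩽ e₁ q ⊕ extra q
      base q r (0<q , ok) = begin
        ∥ ∑ N (λ n → f n ⊗ 𝟙 (q ∣? (n + r))) ⊖ X ∥          ≡⟨ cong (λ t → ∥ t ⊖ X ∥) (trans (∑-cong N λ n _ _ → lem n) (∑-translate hᵢ N G)) ⟩
        ∥ ∑ (hᵢ + N) G ⊖ ∑ hᵢ G ⊖ X ∥                        ≡⟨ cong₂ (λ t u → ∥ t ⊖ u ⊖ X ∥) (∑-ext (ℕ.m≤n+m N hᵢ) λ i N<i _ → G-large i N<i) (∑-zero hᵢ λ i _ i≤ → G-small i (ℕ.≤-trans i≤ hᵢ≤B)) ⟩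
        ∥ ∑ N G ⊖ 0ℚ ⊖ X ∥                                   ≡⟨ cong (λ t → ∥ t ⊖ X ∥) (trans (⊕-identityʳ (∑ N G)) remove) ⟩
        ∥ ∑ N F ⊖ ∑ B F ⊖ X ∥                                ≡⟨ cong ∥_∥ (solve 3 (λ a b x → a :- b :- x := (a :- x) :- b) refl (∑ N F) (∑ B F) X) ⟩
        ∥ (∑ N F ⊖ X) ⊖ ∑ B F ∥                              ≤⟨ ℚ.∣p-q∣≤∣p∣+∣q∣ (∑ N F ⊖ X) (∑ B F) ⟩
        ∥ ∑ N F ⊖ X ∥ ⊕ ∥ ∑ B F ∥                            ≤⟨ ⊕-mono (primes-equidistributed q a a<q (coprime⇒gcd≡1 a-coprime)) small-primes ⟩
        e₁ q ⊕ extra q                                       ∎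
        where
        open ℚ.≤-Reasoning
        open Residue (residue 0<q r hᵢ)
        X = # N ⊗ ⅟ (φ q)
        F G : ℕ → ℚ
        F n = 𝟙 (prime? n ×-dec (n ≡? a [mod q ])) ⊗ ℓ n
        G n = logPrime n ⊗ 𝟙 (n ≡? a [mod q ])
        hᵢ≤B : hᵢ ≤ B
        hᵢ≤B = ℕ.≤-trans (All.lookup small hᵢ∈) (ℕ.≤-trans 14≤R (m≤p*m R 0<R))
        lem : ∀ n → f n ⊗ 𝟙 (q ∣? (n + r)) ≡ G (hᵢ + n)
        lem n = trans (cong (f n ⊗_) (𝟙-cong (q ∣? (n + r)) (n + hᵢ ≡? a [mod q ]) to from)) (cong G (ℕ.+-comm n hᵢ))
        G-0 : ∀ i → ¬ (Prime i × (B < i × i ≤ N)) → G i ≡ 0ℚ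
        G-0 i ¬p = trans (cong (λ t → t ⊗ ℓ i ⊗ 𝟙 (i ≡? a [mod q ])) (𝟙-no (isPrime? i) ¬p)) (trans (cong (_⊗ 𝟙 (i ≡? a [mod q ])) (ℚ.*-zeroˡ (ℓ i))) (ℚ.*-zeroˡ (𝟙 (i ≡? a [mod q ]))))
        G-large : ∀ i → N < i → G i ≡ 0ℚ
        G-large i N<i = G-0 i λ (_ , _ , i≤N) → ℕ.<⇒≱ N<i i≤N
        G-small : ∀ i → i ≤ B → G i ≡ 0ℚ
        G-small i i≤B = G-0 i λ (_ , B<i , _) → ℕ.<⇒≱ B<i i≤B
        remove : ∑ N G ≡ ∑ N F ⊖ ∑ B F
        remove = begin-equality
          ∑ N G                                                          ≡⟨ cong (λ t → ∑ t G) (sym (ℕ.m+[n∸m]≡n B≤N)) ⟩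
          ∑ (B + (N ℕ.∸ B)) G                                            ≡⟨ ∑-split B (N ℕ.∸ B) G ⟩
          ∑ B G ⊕ ∑ (N ℕ.∸ B) (λ i → G (B + i))                          ≡⟨ cong₂ _⊕_ (∑-zero B λ i _ i≤B → G-small i i≤B) (∑-cong (N ℕ.∸ B) λ i 0<i i≤ → same (B + i) (ℕ.m<m+n B 0<i) (ℕ.≤-trans (ℕ.+-monoʳ-≤ B i≤) (ℕ.≤-reflexive (ℕ.m+[n∸m]≡n B≤N)))) ⟩
          0ℚ ⊕ ∑ (N ℕ.∸ B) (λ i → F (B + i))                             ≡⟨ solve 2 (λ b x → con 0ℚ :+ x := b :+ x :- b) refl (∑ B F) (∑ (N ℕ.∸ B) (λ i → F (B + i))) ⟩
          ∑ B F ⊕ ∑ (N ℕ.∸ B) (λ i → F (B + i)) ⊖ ∑ B F                  ≡⟨ cong (_⊖ ∑ B F) (trans (sym (∑-split B (N ℕ.∸ B) F)) (cong (λ t → ∑ t F) (ℕ.m+[n∸m]≡n B≤N))) ⟩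
          ∑ N F ⊖ ∑ B F                                                  ∎
          where
          same : ∀ i → B < i → i ≤ N → G i ≡ F i
          same i B<i i≤N = trans (cong (λ t → t ⊗ ℓ i ⊗ 𝟙 (i ≡? a [mod q ])) (𝟙-cong (isPrime? i) (prime? i) proj₁ (λ p → p , B<i , i≤N)))
            (trans (solve 3 (λ p l m → p :* l :* m := p :* m :* l) refl (𝟙 (prime? i)) (ℓ i) (𝟙 (i ≡? a [mod q ]))) (cong (_⊗ ℓ i) (sym (𝟙-× (prime? i) (i ≡? a [mod q ])))))
        small-primes : ∥ ∑ B F ∥ ⩽ extra q
        small-primes = ⩽-trans (≡⇒⩽ (cong ∥_∥ (∑-cong B λ n _ _ → rewriteF n))) (class-sum-≤ B (q ℕ.∸ a) 0<q (H-nonneg N) λ n 0<n n≤B → bound n 0<n (ℕ.≤-trans n≤B B≤N) (prime? n))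
          where
          rewriteF : ∀ n → F n ≡ 𝟙 (prime? n) ⊗ ℓ n ⊗ 𝟙 (q ∣? (n + (q ℕ.∸ a)))
          rewriteF n = trans (cong (_⊗ ℓ n) (trans (𝟙-× (prime? n) (n ≡? a [mod q ])) (cong (𝟙 (prime? n) ⊗_) (𝟙-cong (n ≡? a [mod q ]) (q ∣? (n + (q ℕ.∸ a))) (proj₁ (≡mod⇔∣ {q} {a} {n} (ℕ.<⇒≤ a<q))) (proj₂ (≡mod⇔∣ {q} {a} {n} (ℕ.<⇒≤ a<q)))))))
            (solve 3 (λ p m l → p :* m :* l := p :* l :* m) refl (𝟙 (prime? n)) (𝟙 (q ∣? (n + (q ℕ.∸ a)))) (ℓ n))
          bound : ∀ n → 0 < n → n ≤ N → (d : Dec (Prime n)) → ∥ 𝟙 d ⊗ ℓ n ∥ ⩽ H N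
          bound n 0<n n≤N (yes _) = ⩽-trans (≡⇒⩽ (trans (cong ∥_∥ (ℚ.*-identityˡ (ℓ n))) (ℚ.0≤p⇒∣p∣≡p (ℓ-nonneg n 0<n n≤N)))) (ℓ≤H n 0<n n≤N)
          bound n 0<n n≤N (no _) = ⩽-trans (≡⇒⩽ (cong ∥_∥ (ℚ.*-zeroˡ (ℓ n)))) (H-nonneg N)
        -- A common divisor of a and q divides the member n + hᵢ = a + q m of the class, which is
        -- coprime to q by `ok`.
        a-coprime : Coprime a q
        a-coprime {d} (d∣a , d∣q) with lift
        ... | n , m , q∣ , eq = ok n q∣ (d∣q , subst (d ∣_) (sym eq) (∣m∣n⇒∣m+n d∣a (∣m⇒∣m*n m d∣q)))
      baseV : ∀ q r → Ok q r → ∥ ∑ N (λ n → f n ⊗ 𝟙 (q ∣? (n + r))) ⊖ # N ⊗ ⅟ (φ q) ∥ ⩽ H N ⊗ (# N ⊗ ⅟ q ⊕ 1ℚ) ⊕ # N ⊗ ⅟ (φ q)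
      baseV q r (0<q , _) = ⩽-trans (ℚ.∣p-q∣≤∣p∣+∣q∣ (∑ N (λ n → f n ⊗ 𝟙 (q ∣? (n + r)))) (# N ⊗ ⅟ (φ q)))
        (⊕-mono (class-sum-≤ N r 0<q (H-nonneg N) λ n _ _ → f≤ n) (≡⇒⩽ (ℚ.0≤p⇒∣p∣≡p (⊗-nonneg (#-nonneg N) (⅟-nonneg (φ q))))))
      ⅟φ≡ : ∀ T → T ⊆ ps → ⅟ (φ (W * product T)) ≡ ⅟ (φ W) ⊗ ∏ₑ μ T
      ⅟φ≡ T τ = ⅟φ-product T (All-resp-⊆ τ (primes S)) (Unique-resp-⊆ τ (unique S)) W 0<W (All-resp-⊆ τ (sieving-coprime w (R * R)))
      V≤ : ∀ T → T ⊆ ps → product T ≤ B → H N ⊗ (# N ⊗ ⅟ (W * product T) ⊕ 1ℚ) ⊕ # N ⊗ ⅟ (φ (W * product T)) ⩽ Z ⊗ Π T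
      V≤ T τ T≤B = ⩽-trans (≡⇒⩽ (cong (_⊕ # N ⊗ ⅟ (φ (W * product T))) (ℚ.*-distribˡ-+ (H N) (# N ⊗ ⅟ (W * product T)) 1ℚ)))
        (≤Z {H N ⊗ (# N ⊗ ⅟ (W * product T))} {H N ⊗ 1ℚ} {# N ⊗ ⅟ (φ (W * product T))} {T} (⩽-trans (⊗-monoˡ (H N) (H-nonneg N) (⊗-monoˡ (# N) (#-nonneg N) (⅟Π≤ τ))) (≡⇒⩽ (comm (Π T))))
          (⩽-trans (⊗-monoˡ (H N) (H-nonneg N) (1≤NΠ τ T≤B)) (≡⇒⩽ (comm (Π T))))
          (⩽-trans (⊗-monoˡ (# N) (#-nonneg N) φ≤) (NΠ≤NHΠ T)))
        where
        comm : ∀ x → H N ⊗ (# N ⊗ x) ≡ # N ⊗ H N ⊗ x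
        comm x = solve 3 (λ h n x → h :* (n :* x) := n :* h :* x) refl (H N) (# N) x
        φ≤ : ⅟ (φ (W * product T)) ⩽ Π T
        φ≤ = ⩽-trans (≡⇒⩽ (⅟φ≡ T τ)) (⩽-trans (⊗-mono (⅟-nonneg (φ W)) (⅟≤1 (φ-pos 0<W)) (∏ₑ-nonneg μ-nonneg T) (∏ₑ-mono μ-nonneg (All-resp-⊆ τ (All.tabulate λ p∈ → μ≤2⅟ (2k< p∈))))) (≡⇒⩽ (ℚ.*-identityˡ (Π T))))
      main : ∀ T → T ⊆ ps → pow (# (length hs′)) T ⊗ (# N ⊗ ⅟ (φ (W * product T))) ≡ # N ⊗ ⅟ (φ W) ⊗ ∏ₑ gᵖ T
      main T τ = trans (cong₂ (λ l x → pow (# l) T ⊗ (# N ⊗ x)) size′ (⅟φ≡ T τ))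
        (trans (solve 4 (λ k n w x → k :* (n :* (w :* x)) := n :* w :* (k :* x)) refl (pow (# k₁) T) (# N) (⅟ (φ W)) (∏ₑ μ T)) (cong (# N ⊗ ⅟ (φ W) ⊗_) (pow-∏ₑ (# k₁) μ T)))

    evaluate-prime : ∀ {t} → 0ℚ ≺ t →
      ∥ ∑ N (λ n → logPrime (n + hᵢ) ⊗ 𝟙 (W ∣? (n + r₀)) ⊗ weight n) ⊖ # N ⊗ ⅟ (φ W) ⊗ covariance μ vᵖ ps Y Y ∥ ⩽ error k₁ t (∑ (W * B) (λ q → e₁ q ⊕ extra q)) Z
    evaluate-prime {t} 0<t = subst (λ l → ∥ ∑ N (λ n → logPrime (n + hᵢ) ⊗ 𝟙 (W ∣? (n + r₀)) ⊗ weight n) ⊖ # N ⊗ ⅟ (φ W) ⊗ covariance μ vᵖ ps Y Y ∥ ⩽ error l t (∑ (W * B) (λ q → e₁ q ⊕ extra q)) Z) size′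
      (evaluate f hs′ Ok Good step good (0<W , λ n d → λ {x} → proj₂ (coprime-class w) (All.lookup admissible hᵢ∈) n d {x}) split
        {M = λ q → # N ⊗ ⅟ (φ q)} {V = λ q → H N ⊗ (# N ⊗ ⅟ q ⊕ 1ℚ) ⊕ # N ⊗ ⅟ (φ q)} {g = gᵖ} {a = μ} {v = vᵖ} {X = # N ⊗ ⅟ (φ W)} base (λ q → ⊕-nonneg (e₁-nonneg q) (⊗-nonneg (H-nonneg N) (⊕-nonneg (⊗-nonneg (#-nonneg B) (⅟-nonneg q)) 0≤1))) baseV 0≤Z V≤ main
        (All.tabulate λ p∈ → meanᵖ (2k< p∈)) (All.tabulate λ p∈ → varianceᵖ (2k< p∈)) 0<t)

-- Powers of rationals and domination by the leading coefficient

^ℚ-mono : ∀ {x y} → 0ℚ ⩽ x → x ⩽ y → ∀ n → x ^ℚ n ⩽ y ^ℚ n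
^ℚ-mono 0≤x x≤y zero    = ⩽-refl
^ℚ-mono 0≤x x≤y (suc n) = ⊗-mono 0≤x x≤y (^ℚ-nonneg 0≤x n) (^ℚ-mono 0≤x x≤y n)

^ℚ-⊗ : ∀ x y n → (x ⊗ y) ^ℚ n ≡ x ^ℚ n ⊗ y ^ℚ n
^ℚ-⊗ x y zero    = refl
^ℚ-⊗ x y (suc n) = trans (cong (x ⊗ y ⊗_) (^ℚ-⊗ x y n)) (solve 4 (λ x y a b → x :* y :* (a :* b) := x :* a :* (y :* b)) refl x y (x ^ℚ n) (y ^ℚ n))

^ℚ-+ : ∀ x m n → x ^ℚ (m + n) ≡ x ^ℚ m ⊗ x ^ℚ n
^ℚ-+ x zero    n = sym (ℚ.*-identityˡ (x ^ℚ n))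
^ℚ-+ x (suc m) n = trans (cong (x ⊗_) (^ℚ-+ x m n)) (sym (ℚ.*-assoc x (x ^ℚ m) (x ^ℚ n)))

^ℚ-pos : ∀ {x} → 0ℚ ≺ x → ∀ n → 0ℚ ≺ x ^ℚ n
^ℚ-pos 0<x zero    = 0<1
^ℚ-pos 0<x (suc n) = ⊗-pos 0<x (^ℚ-pos 0<x n)

1≤^ℚ : ∀ {x} → 1ℚ ⩽ x → ∀ n → 1ℚ ⩽ x ^ℚ n
1≤^ℚ 1≤x zero    = ⩽-refl
1≤^ℚ 1≤x (suc n) = ⩽-trans (≡⇒⩽ (sym (ℚ.*-identityˡ 1ℚ))) (⊗-mono 0≤1 1≤x 0≤1 (1≤^ℚ 1≤x n))

^ℚ-mono-exponent : ∀ {x} → 1ℚ ⩽ x → ∀ {m n} → m ≤ n → x ^ℚ m ⩽ x ^ℚ n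
^ℚ-mono-exponent {x} 1≤x {m} {n} m≤n = begin
  x ^ℚ m                        ≡⟨ ℚ.*-identityʳ (x ^ℚ m) ⟨
  x ^ℚ m ⊗ 1ℚ                   ≤⟨ ⊗-monoˡ (x ^ℚ m) (^ℚ-nonneg (⩽-trans 0≤1 1≤x) m) (1≤^ℚ 1≤x (n ℕ.∸ m)) ⟩
  x ^ℚ m ⊗ x ^ℚ (n ℕ.∸ m)       ≡⟨ ^ℚ-+ x m (n ℕ.∸ m) ⟨
  x ^ℚ (m + (n ℕ.∸ m))          ≡⟨ cong (x ^ℚ_) (ℕ.m+[n∸m]≡n m≤n) ⟩
  x ^ℚ n                        ∎
  where open ℚ.≤-Reasoning

#-^ : ∀ m n → # (m ℕ.^ n) ≡ (# m) ^ℚ n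
#-^ m zero    = #1
#-^ m (suc n) = trans (#-* m (m ℕ.^ n)) (cong (# m ⊗_) (#-^ m n))

bernoulli : ∀ {η} → 0ℚ ⩽ η → η ⩽ 1ℚ → ∀ n → 1ℚ ⊖ # n ⊗ η ⩽ (1ℚ ⊖ η) ^ℚ n
bernoulli {η} 0≤η η≤1 zero = ≡⇒⩽ (trans (cong (λ t → 1ℚ ⊖ t ⊗ η) #0) (solve 1 (λ η → con 1ℚ :- con 0ℚ :* η := con 1ℚ) refl η))
bernoulli {η} 0≤η η≤1 (suc n) = begin
  1ℚ ⊖ # (suc n) ⊗ η                         ≡⟨ cong (λ t → 1ℚ ⊖ t ⊗ η) (#-suc n) ⟩
  1ℚ ⊖ (1ℚ ⊕ # n) ⊗ η                        ≤⟨ by-excess (# n ⊗ (η ⊗ η)) (⊗-nonneg (#-nonneg n) (⊗-nonneg 0≤η 0≤η))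
      (solve 2 (λ n η → con 1ℚ :- (con 1ℚ :+ n) :* η :+ n :* (η :* η) := (con 1ℚ :- η) :* (con 1ℚ :- n :* η)) refl (# n) η) ⟩
  (1ℚ ⊖ η) ⊗ (1ℚ ⊖ # n ⊗ η)                  ≤⟨ ⊗-monoˡ (1ℚ ⊖ η) (x≤y⇒0≤y-x η≤1) (bernoulli 0≤η η≤1 n) ⟩
  (1ℚ ⊖ η) ⊗ (1ℚ ⊖ η) ^ℚ n                   ∎
  where open ℚ.≤-Reasoning

-- Both sides of the last inequality have degree k + 1 in ℓ, with leading coefficients 2001 and
-- 2002. It is the final step of the contradiction, with ℓ = H T.
eventually : ∀ k {C C′ : ℚ} → 0ℚ ⩽ C → 0ℚ ⩽ C′ → ∃[ L ] (∀ ℓ → L ⩽ ℓ →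
  (1ℚ ⩽ ℓ) × (C ⩽ ℓ) × (# 2001 ⊗ (ℓ ⊗ (ℓ ⊕ C) ^ℚ k) ⊕ C′ ≺ # 2002 ⊗ (ℓ ⊖ C) ^ℚ suc k))
eventually k {C} {C′} 0≤C 0≤C′ = L , λ ℓ L≤ℓ → 1≤ ℓ L≤ℓ , C≤ ℓ L≤ℓ , main ℓ L≤ℓ
  where
  open ℚ.≤-Reasoning
  -- With C ≤ ℓ/D, the two power estimates lose at most the factor y = 1 - x each, where x =
  -- 1/20000. Then 4004 y² ≥ 4004 - 8008 x ≥ 4003, so a failure would give 4003 P ≤ 4002 P + 2 C′,
  -- against P ≥ 2 C′ + 3. The last two summands of L provide this lower bound.
  D : ℕ
  D = 20000 * suc k
  0<D : 0 < D
  0<D = *-pos {20000} {suc k} (s≤s z≤n) (s≤s z≤n)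
  η : ℚ
  η = ⅟ D
  L : ℚ
  L = # D ⊗ C ⊕ # 2 ⊗ C′ ⊕ # 3
  0≤η : 0ℚ ⩽ η
  0≤η = ⅟-nonneg D
  η≤1 : η ⩽ 1ℚ
  η≤1 = ⅟≤1 0<D
  module _ (ℓ : ℚ) (L≤ℓ : L ⩽ ℓ) where
    3≤ : # 3 ⩽ ℓ
    3≤ = ⩽-trans (≤⊕ˡ (⊕-nonneg (⊗-nonneg (#-nonneg D) 0≤C) (⊗-nonneg (#-nonneg 2) 0≤C′))) L≤ℓ
    1≤ : 1ℚ ⩽ ℓ
    1≤ = ⩽-trans (1≤# {3} (s≤s z≤n)) 3≤
    0≤ℓ : 0ℚ ⩽ ℓ
    0≤ℓ = ⩽-trans 0≤1 1≤
    DC≤ : # D ⊗ C ⩽ ℓ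
    DC≤ = ⩽-trans (⩽-trans (≤⊕ʳ (⊗-nonneg (#-nonneg 2) 0≤C′)) (≤⊕ʳ (#-nonneg 3))) L≤ℓ
    C≤ηℓ : C ⩽ η ⊗ ℓ
    C≤ηℓ = ⩽-trans (≡⇒⩽ (sym (trans (solve 3 (λ η d c → η :* (d :* c) := (d :* η) :* c) refl η (# D) C) (trans (cong (_⊗ C) (⅟-inverse 0<D)) (ℚ.*-identityˡ C))))) (⊗-monoˡ η 0≤η DC≤)
    C≤ : C ⩽ ℓ
    C≤ = ⩽-trans C≤ηℓ (⩽-trans (⊗-monoʳ ℓ 0≤ℓ η≤1) (≡⇒⩽ (ℚ.*-identityˡ ℓ)))
    P = ℓ ^ℚ suc k
    1≤P : 1ℚ ⩽ P
    1≤P = 1≤^ℚ 1≤ (suc k)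
    0≤P : 0ℚ ⩽ P
    0≤P = ⩽-trans 0≤1 1≤P
    K = # (suc k)
    x = K ⊗ η
    lower : (1ℚ ⊖ x) ⊗ P ⩽ (ℓ ⊖ C) ^ℚ suc k
    lower = begin
      (1ℚ ⊖ x) ⊗ P                         ≤⟨ ⊗-monoʳ P 0≤P (bernoulli 0≤η η≤1 (suc k)) ⟩
      (1ℚ ⊖ η) ^ℚ suc k ⊗ P                ≡⟨ ^ℚ-⊗ (1ℚ ⊖ η) ℓ (suc k) ⟨
      ((1ℚ ⊖ η) ⊗ ℓ) ^ℚ suc k              ≤⟨ ^ℚ-mono (⊗-nonneg (x≤y⇒0≤y-x η≤1) 0≤ℓ) (by-excess (η ⊗ ℓ ⊖ C) (x≤y⇒0≤y-x C≤ηℓ) (solve 3 (λ η ℓ c → (con 1ℚ :- η) :* ℓ :+ (η :* ℓ :- c) := ℓ :- c) refl η ℓ C)) (suc k) ⟩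
      (ℓ ⊖ C) ^ℚ suc k                     ∎
    -- (1 + η)^k ≤ 1 / (1 - k η)
    upper : (1ℚ ⊖ x) ⊗ (ℓ ⊗ (ℓ ⊕ C) ^ℚ k) ⩽ P
    upper = begin
      (1ℚ ⊖ x) ⊗ (ℓ ⊗ (ℓ ⊕ C) ^ℚ k)                       ≤⟨ ⊗-mono-flex ⟩
      (1ℚ ⊖ η) ^ℚ k ⊗ (ℓ ⊗ ((1ℚ ⊕ η) ^ℚ k ⊗ ℓ ^ℚ k))      ≡⟨ solve 4 (λ a l b c → a :* (l :* (b :* c)) := (a :* b) :* (l :* c)) refl ((1ℚ ⊖ η) ^ℚ k) ℓ ((1ℚ ⊕ η) ^ℚ k) (ℓ ^ℚ k) ⟩
      ((1ℚ ⊖ η) ^ℚ k ⊗ (1ℚ ⊕ η) ^ℚ k) ⊗ P                 ≡⟨ cong (_⊗ P) (^ℚ-⊗ (1ℚ ⊖ η) (1ℚ ⊕ η) k) ⟨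
      ((1ℚ ⊖ η) ⊗ (1ℚ ⊕ η)) ^ℚ k ⊗ P                      ≤⟨ ⊗-monoʳ P 0≤P (⩽-trans (^ℚ-mono (⊗-nonneg (x≤y⇒0≤y-x η≤1) (⊕-nonneg 0≤1 0≤η)) (by-excess (η ⊗ η) (⊗-nonneg 0≤η 0≤η) (solve 1 (λ η → (con 1ℚ :- η) :* (con 1ℚ :+ η) :+ η :* η := con 1ℚ) refl η)) k) (≡⇒⩽ (one k))) ⟩
      1ℚ ⊗ P                                              ≡⟨ ℚ.*-identityˡ P ⟩
      P                                                   ∎
      where
      one : ∀ k → 1ℚ ^ℚ k ≡ 1ℚ
      one zero = refl
      one (suc k) = trans (ℚ.*-identityˡ (1ℚ ^ℚ k)) (one k)
      ℓ+C : (ℓ ⊕ C) ^ℚ k ⩽ (1ℚ ⊕ η) ^ℚ k ⊗ ℓ ^ℚ k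
      ℓ+C = ⩽-trans (^ℚ-mono (⊕-nonneg 0≤ℓ 0≤C) (⩽-trans (⊕-monoʳ ℓ C≤ηℓ) (≡⇒⩽ (solve 2 (λ l η → l :+ η :* l := (con 1ℚ :+ η) :* l) refl ℓ η))) k) (≡⇒⩽ (^ℚ-⊗ (1ℚ ⊕ η) ℓ k))
      1-x≤ : 1ℚ ⊖ x ⩽ (1ℚ ⊖ η) ^ℚ k
      1-x≤ = ⩽-trans (⊕-monoʳ 1ℚ (ℚ.neg-antimono-≤ (⊗-monoʳ η 0≤η (#-mono (ℕ.n≤1+n k))))) (bernoulli 0≤η η≤1 k)
      ⊗-mono-flex : (1ℚ ⊖ x) ⊗ (ℓ ⊗ (ℓ ⊕ C) ^ℚ k) ⩽ (1ℚ ⊖ η) ^ℚ k ⊗ (ℓ ⊗ ((1ℚ ⊕ η) ^ℚ k ⊗ ℓ ^ℚ k))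
      ⊗-mono-flex = ⩽-trans (⊗-monoʳ (ℓ ⊗ (ℓ ⊕ C) ^ℚ k) (⊗-nonneg 0≤ℓ (^ℚ-nonneg (⊕-nonneg 0≤ℓ 0≤C) k)) 1-x≤) (⊗-monoˡ ((1ℚ ⊖ η) ^ℚ k) (^ℚ-nonneg (x≤y⇒0≤y-x η≤1) k) (⊗-monoˡ ℓ 0≤ℓ ℓ+C))
    x≡ : # 20000 ⊗ x ≡ 1ℚ
    x≡ = trans (solve 3 (λ a k η → a :* (k :* η) := a :* k :* η) refl (# 20000) K η) (trans (cong (_⊗ η) (sym (#-* 20000 (suc k)))) (⅟-inverse 0<D))
    Q = ℓ ⊗ (ℓ ⊕ C) ^ℚ k
    0≤x : 0ℚ ⩽ x
    0≤x = ⊗-nonneg (#-nonneg (suc k)) 0≤η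
    x≤ : x ⩽ 1ℚ
    x≤ = ⩽-trans (⩽-trans (≡⇒⩽ (sym (ℚ.*-identityˡ x))) (⊗-monoʳ x (⊗-nonneg (#-nonneg (suc k)) 0≤η) (1≤# {20000} (s≤s z≤n)))) (≡⇒⩽ x≡)
    C′<P : # 2 ⊗ C′ ⊕ # 3 ⩽ P
    C′<P = ⩽-trans (⩽-trans (⩽-trans (≤⊕ˡ (⊗-nonneg (#-nonneg D) 0≤C)) (≡⇒⩽ (sym (ℚ.+-assoc (# D ⊗ C) (# 2 ⊗ C′) (# 3))))) L≤ℓ)
      (⩽-trans (≡⇒⩽ (sym (ℚ.*-identityʳ ℓ))) (⊗-monoˡ ℓ 0≤ℓ (1≤^ℚ 1≤ k)))
    main : # 2001 ⊗ Q ⊕ C′ ≺ # 2002 ⊗ (ℓ ⊖ C) ^ℚ suc k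
    main = ℚ.≰⇒> contradictory
      where
      y = 1ℚ ⊖ x
      0≤y : 0ℚ ⩽ y
      0≤y = x≤y⇒0≤y-x x≤
      -- 2002 y P ≤ 2001 Q + C′ times y, using y Q ≤ P
      step₁ : # 2002 ⊗ (ℓ ⊖ C) ^ℚ suc k ⩽ # 2001 ⊗ Q ⊕ C′ → # 2002 ⊗ (y ⊗ y) ⊗ P ⩽ # 2001 ⊗ P ⊕ C′
      step₁ bad = begin
        # 2002 ⊗ (y ⊗ y) ⊗ P              ≡⟨ solve 3 (λ a y p → a :* (y :* y) :* p := y :* (a :* (y :* p))) refl (# 2002) y P ⟩
        y ⊗ (# 2002 ⊗ (y ⊗ P))            ≤⟨ ⊗-monoˡ y 0≤y (⩽-trans (⊗-monoˡ (# 2002) (#-nonneg 2002) lower) bad) ⟩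
        y ⊗ (# 2001 ⊗ Q ⊕ C′)             ≡⟨ solve 4 (λ y a q c → y :* (a :* q :+ c) := a :* (y :* q) :+ y :* c) refl y (# 2001) Q C′ ⟩
        # 2001 ⊗ (y ⊗ Q) ⊕ y ⊗ C′         ≤⟨ ⊕-mono (⊗-monoˡ (# 2001) (#-nonneg 2001) upper) (⩽-trans (⊗-monoʳ {y} {1ℚ} C′ 0≤C′ (by-excess x (⊗-nonneg (#-nonneg (suc k)) 0≤η) (solve 1 (λ x → con 1ℚ :- x :+ x := con 1ℚ) refl x))) (≡⇒⩽ (ℚ.*-identityˡ C′))) ⟩
        # 2001 ⊗ P ⊕ C′                   ∎
      gap : # 4003 ⩽ # 4004 ⊗ (y ⊗ y)
      gap = begin
        # 4003                                  ≡⟨ solve 1 (λ a → a := con 1ℚ :+ a :- con 1ℚ) refl (# 4003) ⟩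
        1ℚ ⊕ # 4003 ⊖ 1ℚ                        ≡⟨ cong₂ _⊖_ (#-suc 4003) x≡ ⟨
        # 4004 ⊖ # 20000 ⊗ x                    ≤⟨ ⊕-monoʳ (# 4004) (ℚ.neg-antimono-≤ (⊗-monoʳ x 0≤x (#-mono {8008} {20000} (ℕ.m≤m+n 8008 11992)))) ⟩
        # 4004 ⊖ # 8008 ⊗ x                     ≡⟨ cong (λ t → # 4004 ⊖ t ⊗ x) (#-* 2 4004) ⟩
        # 4004 ⊖ # 2 ⊗ # 4004 ⊗ x               ≡⟨ cong (λ t → # 4004 ⊖ t ⊗ # 4004 ⊗ x) (trans (#-suc 1) (cong (1ℚ ⊕_) #1)) ⟩
        # 4004 ⊖ (1ℚ ⊕ 1ℚ) ⊗ # 4004 ⊗ x         ≤⟨ by-excess (# 4004 ⊗ (x ⊗ x)) (⊗-nonneg (#-nonneg 4004) (square-nonneg x))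
            (solve 2 (λ a x → a :- (con 1ℚ :+ con 1ℚ) :* a :* x :+ a :* (x :* x) := a :* ((con 1ℚ :- x) :* (con 1ℚ :- x))) refl (# 4004) x) ⟩
        # 4004 ⊗ (y ⊗ y)                        ∎
      contradictory : # 2002 ⊗ (ℓ ⊖ C) ^ℚ suc k ⩽ # 2001 ⊗ Q ⊕ C′ → ⊥
      contradictory bad = ≺⇒⋡ (#-pos {3} (s≤s z≤n)) (0≤y-x⇒x≤y (⩽-trans (⊕-nonneg (x≤y⇒0≤y-x P≤2C′) (x≤y⇒0≤y-x C′<P))
          (≡⇒⩽ (solve 3 (λ a b p → (a :- p) :+ (p :- (a :+ b)) := con 0ℚ :- b) refl (# 2 ⊗ C′) (# 3) P))))
        where
        P≤2C′ : P ⩽ # 2 ⊗ C′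
        P≤2C′ = 0≤y-x⇒x≤y (⩽-trans (x≤y⇒0≤y-x (begin
          # 4003 ⊗ P                             ≤⟨ ⊗-monoʳ P 0≤P gap ⟩
          # 4004 ⊗ (y ⊗ y) ⊗ P                   ≡⟨ trans (cong (λ t → t ⊗ (y ⊗ y) ⊗ P) (#-* 2 2002)) (solve 4 (λ t a y p → t :* a :* y :* p := t :* (a :* y :* p)) refl (# 2) (# 2002) (y ⊗ y) P) ⟩
          # 2 ⊗ (# 2002 ⊗ (y ⊗ y) ⊗ P)           ≤⟨ ⊗-monoˡ (# 2) (#-nonneg 2) (step₁ bad) ⟩
          # 2 ⊗ (# 2001 ⊗ P ⊕ C′)                ∎))
          (≡⇒⩽ (trans (cong (λ t → # 2 ⊗ (# 2001 ⊗ P ⊕ C′) ⊖ t ⊗ P) (trans (#-suc 4002) (cong (1ℚ ⊕_) (#-* 2 2001))))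
            (solve 4 (λ t a p c → t :* (a :* p :+ c) :- (con 1ℚ :+ t :* a) :* p := t :* c :- p) refl (# 2) (# 2001) P C′))))

-- The contradiction at a large scale

square-decreasing : ∀ {R f} → Decreasing R f → Decreasing R (λ n → f n ⊗ f n)
square-decreasing F .nonneg n = ⊗-nonneg (nonneg F n) (nonneg F n)
square-decreasing F .anti {m} {n} m≤n = ⊗-mono (nonneg F n) (anti F m≤n) (nonneg F n) (anti F m≤n)
square-decreasing {f = f} F .vanish n R<n = trans (cong (λ t → t ⊗ t) (vanish F n R<n)) refl

weaken-decreasing : ∀ {R B f} → R ≤ B → Decreasing R f → Decreasing B f
weaken-decreasing R≤B F .nonneg = nonneg F
weaken-decreasing R≤B F .anti = anti F
weaken-decreasing R≤B F .vanish n B<n = vanish F n (ℕ.≤-<-trans R≤B B<n)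

∑ₗ-≥ : ∀ {xs : List ℕ} {f : ℕ → ℚ} {c} → All (λ x → c ⩽ f x) xs → # (length xs) ⊗ c ⩽ ∑ₗ xs f
∑ₗ-≥ {c = c} [] = ≡⇒⩽ (trans (cong (_⊗ c) #0) (ℚ.*-zeroˡ c))
∑ₗ-≥ {x ∷ xs} {f} {c} (e ∷ es) = ⩽-trans (≡⇒⩽ (trans (cong (_⊗ c) (#-suc (length xs))) (solve 2 (λ n c → (con 1ℚ :+ n) :* c := c :+ n :* c) refl (# (length xs)) c))) (⊕-mono e (∑ₗ-≥ es))

-- The numerical hypotheses have separate tasks. `w-large` makes the sum of `δ` at most 1/4000.
-- `b-large` leaves room in N = T^b for the level and for powers of H N. The margin 1001/1000 =
-- 2002/2000 in `certificate` splits into 2001/2000 for the perturbation from g to h and 2002/2001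
-- for the error terms and the gap between H T + C and H T - C.
module Contradiction
  {k₁ : ℕ} {hs : List ℕ} (tuple : Tuple k₁ hs) (h′ : ℕ) (h′≤16 : h′ ≤ 16)
  (w : ℕ) (15≤w : 15 ≤ w) (2k≤w : suc k₁ + suc k₁ ≤ w) (w-large : 2 * (suc k₁ * suc k₁) * 4000 ≤ w)
  (i b : ℕ) (ds : List ℕ) (len : length ds ≡ suc i)
  (b-large : 50 * (suc k₁ * suc k₁) + (2 * suc k₁ + 2) + (2 * suc k₁ + 1) + 2 + (1 + (suc i + suc i)) ≤ b)
  (certificate : 1001 * (b * repeat (suc k₁) tails (squares (tails ds)) ‼ 0) ≤ 2000 * suc k₁ * repeat k₁ tails⁺ (squares (tails⁺ (tails ds))) ‼ 0)
  (nonzero : 0 < repeat (suc k₁) tails (squares (tails ds)) ‼ 0) where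

  open Tuple tuple using (size)
  open Local k₁

  private
    -- `Â` is an upper sum for the k-fold integral of the square of the step function, and `B̂` a
    -- lower sum for the (k - 1)-fold integral of the square of its single integral. These are the
    -- two functionals whose ratio decides the sieve.
    Â B̂ a₁ A₁ : ℕ
    Â = repeat k tails (squares (tails ds)) ‼ 0
    B̂ = repeat k₁ tails⁺ (squares (tails⁺ (tails ds))) ‼ 0
    a₁ = 50 * (k * k) + (2 * k + 2)

  -- The number of powers of η = H N that the distribution hypotheses must save. Since the mass is
  -- at most 2 η^k, the weight t = η^a₁ reduces η times the trivial part to a multiple of N. It
  -- turns the averaged part into η^(1 + 2 k + a₁) ΣE.
  A₀ : ℕ
  A₀ = 50 * (k * k) + (2 * k + 2) + (2 * k + 1)

  W : ℕ
  W = modulus w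

  private
    1<W : 1 < W
    1<W = 1<modulus w
    0<W : 0 < W
    0<W = ℕ.<-trans (s≤s z≤n) 1<W
    0<w : 0 < w
    0<w = ℕ.<-≤-trans (s≤s z≤n) 15≤w
    A₁ = A₀ + 2
    J = suc i
    0<b : 0 < b
    0<b = ℕ.<-≤-trans (s≤s z≤n) (ℕ.≤-trans (ℕ.m≤n+m (1 + (J + J)) A₁) b-large)

  module At (s : ℕ) where
    T R N : ℕ
    T = W * s
    R = T ℕ.^ suc i
    N = T ℕ.^ b

  -- The constant C is shared by all s, since the contradiction comes from letting s, and with it T,
  -- R and N, grow while W stays fixed.
  record Hypotheses (C : ℚ) (s : ℕ) : Set where
    open At s
    field
      inputs : Inputs W (R * R) N
    open Inputs inputs public
    field
      ∑e₁≤ : H N ^ℚ A₀ ⊗ ∑ (W * (R * R)) e₁ ⩽ C ⊗ # N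
      ∑e₂≤ : H N ^ℚ A₀ ⊗ ∑ (W * (R * R)) e₂ ⩽ C ⊗ # N
      exclusive : ∀ n → 0 < n → n ≤ N →
        # 2 ⊗ ∑ₗ hs (λ h → 𝟙 (prime? (n + h) ×-dec (R * R ℕ.<? n + h ×-dec n + h ℕ.≤? N)) ⊗ ℓ (n + h)) ⩽ H N ⊗ (1ℚ ⊕ lam (n + h′))

  module _ {C : ℚ} (0≤C : 0ℚ ⩽ C) where

    private
      y₀ C₂ C₃ : ℚ
      y₀ = # (tails ds ‼ 0)
      -- The 32 bounds 2 h′ and the other constants of the elementary error terms. The factor b^A₁
      -- comes from η ≤ b T raised to the power A₁.
      C₂ = # (32 * b ℕ.^ A₁)
      C₃ = y₀ ⊗ y₀ ⊗ # 4 ⊗ (C ⊕ C₂ ⊕ # 3)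

      0≤C₂ : 0ℚ ⩽ C₂
      0≤C₂ = #-nonneg (32 * b ℕ.^ A₁)
      0≤C₃ : 0ℚ ⩽ C₃
      0≤C₃ = ⊗-nonneg (⊗-nonneg (square-nonneg y₀) (#-nonneg 4)) (⊕-nonneg (⊕-nonneg 0≤C 0≤C₂) (#-nonneg 3))

    module AtScale (s : ℕ) (0<s : 0 < s) (hyp : Hypotheses C s) where

      open At s
      open Hypotheses hyp
      open Steps W s 1<W 0<s hiding (T; C; κ; κ-nonneg; u₊; u₋)
      open Steps W s 1<W 0<s public using (κ; κ-nonneg; u₊; u₋) renaming (C to C₀)

      private
        0<T : 0 < T
        0<T = *-pos 0<W 0<s
        W≤T : W ≤ T
        W≤T = ℕ.≤-trans (m≤p*m W 0<s) (ℕ.≤-reflexive (ℕ.*-comm s W))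
        14≤T : 14 ≤ T
        14≤T = ℕ.≤-trans (ℕ.≤-trans (ℕ.m≤m+n 14 196) (m≤p*m 210 (coprimeProduct-pos w))) W≤T
        0<R : 0 < R
        0<R = ^-pos 0<T J
        T≤R : T ≤ R
        T≤R = ℕ.≤-trans (m≤p*m T (^-pos 0<T i)) (ℕ.≤-reflexive (ℕ.*-comm (T ℕ.^ i) T))
        T^-mono : ∀ {m n} → m ≤ n → T ℕ.^ m ≤ T ℕ.^ n
        T^-mono = ℕ.^-monoʳ-≤ T {{ℕ.>-nonZero 0<T}}
        RR≡ : R * R ≡ T ℕ.^ (J + J)
        RR≡ = sym (ℕ.^-distribˡ-+-* T J J)
        WB≤ : W * (R * R) ≤ T ℕ.^ (1 + (J + J))
        WB≤ = ℕ.≤-trans (ℕ.*-monoˡ-≤ (R * R) W≤T) (ℕ.≤-reflexive (cong (T *_) RR≡))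
        WB≤N : W * (R * R) ≤ N
        WB≤N = ℕ.≤-trans WB≤ (T^-mono (ℕ.≤-trans (ℕ.m≤n+m (1 + (J + J)) A₁) b-large))
        B≤N : R * R ≤ N
        B≤N = ℕ.≤-trans (m≤p*m (R * R) 0<W) WB≤N
        Y : ℕ → ℚ
        Y = step ds 1
        DY : Decreasing R Y
        DY = step-decreasing ds (ℕ.≤-reflexive (cong (T ℕ.^_) len))
        Y≤y₀ : ∀ n → Y n ⩽ y₀
        Y≤y₀ n = step-at-0 ds 1 n
          where
          step-at-0 : ∀ ds x n → step ds x n ⩽ # (tails ds ‼ 0)
          step-at-0 [] x n = ≡⇒⩽ (sym #0)
          step-at-0 (d ∷ ds) x n = ⩽-trans (⊕-mono (⩽-trans (⊗-monoˡ (# d) (#-nonneg d) (𝟙≤1 (n ℕ.<? x * T))) (≡⇒⩽ (ℚ.*-identityʳ (# d)))) (step-at-0 ds (x * T) n)) (≡⇒⩽ (sym (#-+ d (tails ds ‼ 0))))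

      open Evaluations tuple w 15≤w 2k≤w R N (ℕ.≤-trans 14≤T T≤R) B≤N inputs Y DY y₀ Y≤y₀ hiding (W)

      private
        S : SiftedBy B (coprime-indicator W) ps
        S = sieving-SiftedBy w B
        2k< : ∀ {p} → p ∈ ps → k + k < p
        2k< = sieving-2k w 0<w 2k≤w B
        0<N : 0 < N
        0<N = ℕ.<-≤-trans 0<B B≤N
        η : ℚ
        η = H N
        1≤η : 1ℚ ⩽ η
        1≤η = ⩽-trans (≡⇒⩽ (sym H1)) (H-mono 0<N)
        0<η : 0ℚ ≺ η
        0<η = ℚ.<-≤-trans 0<1 1≤η
        0≤η : 0ℚ ⩽ η
        0≤η = ≺⇒⩽ 0<η
        HB≤η : H B ⩽ η
        HB≤η = H-mono B≤N
        Δ : ℚ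
        Δ = ∏₁ δ ps
        0≤Δ : 0ℚ ⩽ Δ
        0≤Δ = ∏₁-nonneg δ-nonneg ps

        -- The sum σ of `δ` is at most 1/4000, so `∏₁-bound` gives Δ ≤ 4000/3999. This is below
        -- 2001/2000.
        Δ≤ : # 2000 ⊗ Δ ⩽ # 2001
        Δ≤ = ⊗-cancelˡ (# 3999) (#-pos {3999} (s≤s z≤n)) (begin
          # 3999 ⊗ (# 2000 ⊗ Δ)                      ≡⟨ solve 3 (λ a b x → a :* (b :* x) := b :* (x :* a)) refl (# 3999) (# 2000) Δ ⟩
          # 2000 ⊗ (Δ ⊗ # 3999)                      ≤⟨ ⊗-monoˡ (# 2000) (#-nonneg 2000) Δ3999 ⟩
          # 2000 ⊗ # 4000                            ≡⟨ #-* 2000 4000 ⟨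
          # (2000 * 4000)                            ≤⟨ #-mono {2000 * 4000} {3999 * 2001} (ℕ.≤ᵇ⇒≤ (2000 * 4000) (3999 * 2001) _) ⟩
          # (3999 * 2001)                            ≡⟨ #-* 3999 2001 ⟩
          # 3999 ⊗ # 2001                            ∎)
          where
          open ℚ.≤-Reasoning
          σ = ∑ₗ ps δ
          4000σ≤1 : # 4000 ⊗ σ ⩽ 1ℚ
          4000σ≤1 = begin
            # 4000 ⊗ σ                               ≤⟨ ⊗-monoˡ (# 4000) (#-nonneg 4000) (∑δ≤ w 0<w 2k≤w B) ⟩
            # 4000 ⊗ (# (2 * (k * k)) ⊗ ⅟ w)         ≡⟨ trans (solve 3 (λ a b c → a :* (b :* c) := b :* a :* c) refl (# 4000) (# (2 * (k * k))) (⅟ w)) (cong (_⊗ ⅟ w) (sym (#-* (2 * (k * k)) 4000))) ⟩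
            # (2 * (k * k) * 4000) ⊗ ⅟ w             ≤⟨ ⊗-monoʳ (⅟ w) (⅟-nonneg w) (#-mono w-large) ⟩
            # w ⊗ ⅟ w                                ≡⟨ ⅟-inverse 0<w ⟩
            1ℚ                                       ∎
          Δ3999 : Δ ⊗ # 3999 ⩽ # 4000
          Δ3999 = begin
            Δ ⊗ # 3999                               ≡⟨ cong (Δ ⊗_) (trans (solve 1 (λ a → a := con 1ℚ :+ a :- con 1ℚ) refl (# 3999)) (cong (_⊖ 1ℚ) (sym (#-suc 3999)))) ⟩
            Δ ⊗ (# 4000 ⊖ 1ℚ)                        ≤⟨ ⊗-monoˡ Δ 0≤Δ (⊕-monoʳ (# 4000) (ℚ.neg-antimono-≤ 4000σ≤1)) ⟩
            Δ ⊗ (# 4000 ⊖ # 4000 ⊗ σ)                ≡⟨ solve 3 (λ d a s → d :* (a :- a :* s) := a :* (d :* (con 1ℚ :- s))) refl Δ (# 4000) σ ⟩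
            # 4000 ⊗ (Δ ⊗ (1ℚ ⊖ σ))                  ≤⟨ ⊗-monoˡ (# 4000) (#-nonneg 4000) (∏₁-bound δ-nonneg ps) ⟩
            # 4000 ⊗ 1ℚ                              ≡⟨ ℚ.*-identityʳ (# 4000) ⟩
            # 4000                                   ∎

        Δ≤2 : Δ ⩽ # 2
        Δ≤2 = ⊗-cancelˡ (# 2000) (#-pos {2000} (s≤s z≤n)) (⩽-trans Δ≤ (⩽-trans (#-mono {2001} {2000 * 2} (ℕ.≤ᵇ⇒≤ 2001 (2000 * 2) _)) (≡⇒⩽ (#-* 2000 2))))

        perturb : ∀ {F} → Decreasing B F → 𝕊 h ps F ⩽ Δ ⊗ 𝕊 g ps F
        perturb F = 𝕊-perturb h-nonneg g-nonneg δ-nonneg (positive S) (All.tabulate λ p∈ → ≡⇒⩽ (h≡g+δ (2k< p∈))) F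

        mass≤ : mass ⩽ # 2 ⊗ η ^ℚ k
        mass≤ = begin
          𝕊 h ps I                   ≤⟨ perturb DI ⟩
          Δ ⊗ 𝕊 g ps I               ≤⟨ ⊗-mono 0≤Δ Δ≤2 (𝕊-nonneg g-nonneg ps (nonneg DI)) (⩽-trans (𝕊-⅟-≤-H^ 0<B S (λ n → 𝟙≤1 (gcd n W ℕ.≟ 1)) k DI (λ n → 𝟙≤1 (1 * n ℕ.≤? R))) (^ℚ-mono (H-nonneg B) HB≤η k)) ⟩
          # 2 ⊗ η ^ℚ k               ∎
          where
          open ℚ.≤-Reasoning
          I : ℕ → ℚ
          I r = 𝟙 (1 * r ℕ.≤? R)
          DI : Decreasing B I
          DI .nonneg n = 𝟙-nonneg (1 * n ℕ.≤? R)
          DI .anti {m} {n} m≤n = 𝟙-mono (1 * n ℕ.≤? R) (1 * m ℕ.≤? R) (ℕ.≤-trans (ℕ.*-monoʳ-≤ 1 m≤n))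
          DI .vanish n B<n = 𝟙-no (1 * n ℕ.≤? R) λ n≤R → ℕ.<⇒≱ B<n (ℕ.≤-trans (ℕ.≤-trans (ℕ.≤-reflexive (sym (ℕ.*-identityˡ n))) n≤R) (m≤p*m R 0<R))

        t : ℚ
        t = η ^ℚ a₁
        0<t : 0ℚ ≺ t
        0<t = ^ℚ-pos 0<η a₁

        0≤mass : 0ℚ ⩽ mass
        0≤mass = 𝕊-nonneg h-nonneg ps λ r → 𝟙-nonneg (1 * r ℕ.≤? R)

        error≤ : ∀ {l ΣE} → l ≤ k → 0ℚ ⩽ ΣE → η ^ℚ A₀ ⊗ ΣE ⩽ (C ⊕ C₂) ⊗ # N → η ⊗ error l t ΣE Z ⩽ C₃ ⊗ # N
        error≤ {l} {ΣE} l≤k 0≤ΣE ΣE≤ = begin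
          η ⊗ error l t ΣE Z
            ≤⟨ ⊗-monoˡ η 0≤η (⊗-monoˡ (y₀ ⊗ y₀) (square-nonneg y₀) (⊗-mono (⊗-nonneg 0≤mass 0≤mass) (⊗-mono 0≤mass mass≤ 0≤mass mass≤) (⊕-nonneg (⊗-nonneg (≺⇒⩽ 0<t) 0≤ΣE) (⊗-nonneg (≺⇒⩽ (invℚ-pos 0<t)) (⊗-nonneg 0≤Z′ (^ℚ-nonneg (H-nonneg B) (50 * (l * l)))))) (⊕-monoʳ (t ⊗ ΣE) (⊗-monoˡ (invℚ t) (≺⇒⩽ (invℚ-pos 0<t)) (⊗-monoˡ Z 0≤Z′ H^≤))))) ⟩
          η ⊗ (y₀ ⊗ y₀ ⊗ (# 2 ⊗ p ⊗ (# 2 ⊗ p) ⊗ (t ⊗ ΣE ⊕ invℚ t ⊗ (# 3 ⊗ # N ⊗ η ⊗ q))))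
            ≡⟨ solve 11 (λ η y w p t E it th n q r → η :* (y :* (w :* p :* (w :* p) :* (t :* E :+ it :* (th :* n :* η :* q))))
                 := y :* (w :* w) :* ((p :* p :* η :* t) :* E :+ it :* (p :* p :* η :* η :* q) :* (th :* n))) refl η (y₀ ⊗ y₀) (# 2) p t ΣE (invℚ t) (# 3) (# N) q 1ℚ ⟩
          y₀ ⊗ y₀ ⊗ (# 2 ⊗ # 2) ⊗ ((p ⊗ p ⊗ η ⊗ t) ⊗ ΣE ⊕ invℚ t ⊗ (p ⊗ p ⊗ η ⊗ η ⊗ q) ⊗ (# 3 ⊗ # N))
            ≡⟨ cong₂ (λ u v → y₀ ⊗ y₀ ⊗ (# 2 ⊗ # 2) ⊗ (u ⊗ ΣE ⊕ invℚ t ⊗ v ⊗ (# 3 ⊗ # N))) e₁≡ e₂≡ ⟩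
          y₀ ⊗ y₀ ⊗ (# 2 ⊗ # 2) ⊗ (η ^ℚ A₀ ⊗ ΣE ⊕ invℚ t ⊗ t ⊗ (# 3 ⊗ # N))
            ≡⟨ cong₂ (λ u v → y₀ ⊗ y₀ ⊗ u ⊗ (η ^ℚ A₀ ⊗ ΣE ⊕ v)) (sym (#-* 2 2)) (trans (cong (_⊗ (# 3 ⊗ # N)) (trans (ℚ.*-comm (invℚ t) t) (invℚ-inverseʳ 0<t))) (ℚ.*-identityˡ (# 3 ⊗ # N))) ⟩
          y₀ ⊗ y₀ ⊗ # 4 ⊗ (η ^ℚ A₀ ⊗ ΣE ⊕ # 3 ⊗ # N)
            ≤⟨ ⊗-monoˡ (y₀ ⊗ y₀ ⊗ # 4) (⊗-nonneg (square-nonneg y₀) (#-nonneg 4)) (⊕-monoˡ (# 3 ⊗ # N) ΣE≤) ⟩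
          y₀ ⊗ y₀ ⊗ # 4 ⊗ ((C ⊕ C₂) ⊗ # N ⊕ # 3 ⊗ # N)
            ≡⟨ solve 4 (λ y c t n → y :* (c :* n :+ t :* n) := y :* (c :+ t) :* n) refl (y₀ ⊗ y₀ ⊗ # 4) (C ⊕ C₂) (# 3) (# N) ⟩
          C₃ ⊗ # N ∎
          where
          open ℚ.≤-Reasoning
          p = η ^ℚ k
          q = η ^ℚ (50 * (k * k))
          0≤Z′ : 0ℚ ⩽ Z
          0≤Z′ = ⊗-nonneg (⊗-nonneg (#-nonneg 3) (#-nonneg N)) 0≤η
          H^≤ : H B ^ℚ (50 * (l * l)) ⩽ q
          H^≤ = ⩽-trans (^ℚ-mono (H-nonneg B) HB≤η (50 * (l * l))) (^ℚ-mono-exponent 1≤η (ℕ.*-monoʳ-≤ 50 (ℕ.*-mono-≤ l≤k l≤k)))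
          pp : p ⊗ p ≡ η ^ℚ (2 * k)
          pp = trans (sym (^ℚ-+ η k k)) (cong (λ m → η ^ℚ (k + m)) (sym (ℕ.+-identityʳ k)))
          η¹ : η ≡ η ^ℚ 1
          η¹ = sym (ℚ.*-identityʳ η)
          e₁≡ : p ⊗ p ⊗ η ⊗ t ≡ η ^ℚ A₀
          e₁≡ = trans (cong₂ (λ u v → u ⊗ v ⊗ t) pp η¹) (trans (cong (_⊗ t) (sym (^ℚ-+ η (2 * k) 1))) (trans (ℚ.*-comm (η ^ℚ (2 * k + 1)) t) (sym (^ℚ-+ η a₁ (2 * k + 1)))))
          e₂≡ : p ⊗ p ⊗ η ⊗ η ⊗ q ≡ t
          e₂≡ = trans (cong (_⊗ q) (trans (ℚ.*-assoc (p ⊗ p) η η) (trans (cong₂ _⊗_ pp (cong (η ⊗_) η¹)) (sym (^ℚ-+ η (2 * k) 2))))) (trans (ℚ.*-comm (η ^ℚ (2 * k + 2)) q) (sym (^ℚ-+ η (50 * (k * k)) (2 * k + 2))))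

        -- Even the crude bound η ≤ b T suffices: the A₁ powers of T together with W B ≤ T^(1 + 2 J)
        -- stay below T^b by `b-large`. Logarithmic losses on terms of size W B are therefore
        -- harmless.
        negligible : η ^ℚ A₀ ⊗ (# 32 ⊗ # (W * B) ⊗ (η ⊗ η)) ⩽ C₂ ⊗ # N
        negligible = begin
          η ^ℚ A₀ ⊗ (# 32 ⊗ # (W * B) ⊗ (η ⊗ η))     ≡⟨ trans (solve 4 (λ p a b e → p :* (a :* b :* e) := a :* ((p :* e) :* b)) refl (η ^ℚ A₀) (# 32) (# (W * B)) (η ⊗ η))
                (cong (λ x → # 32 ⊗ (x ⊗ # (W * B))) (trans (cong (η ^ℚ A₀ ⊗_) (cong (η ⊗_) (sym (ℚ.*-identityʳ η)))) (sym (^ℚ-+ η A₀ 2)))) ⟩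
          # 32 ⊗ (η ^ℚ A₁ ⊗ # (W * B))               ≤⟨ ⊗-monoˡ (# 32) (#-nonneg 32) (⊗-mono (^ℚ-nonneg 0≤η A₁) (^ℚ-mono 0≤η η≤ A₁) (#-nonneg (W * B)) (#-mono WB≤)) ⟩
          # 32 ⊗ ((# (b * T)) ^ℚ A₁ ⊗ # (T ℕ.^ (1 + (J + J))))
            ≡⟨ cong (# 32 ⊗_) (trans (cong (_⊗ # (T ℕ.^ (1 + (J + J)))) (sym (#-^ (b * T) A₁))) (trans (sym (#-* ((b * T) ℕ.^ A₁) (T ℕ.^ (1 + (J + J))))) (cong #_ power))) ⟩
          # 32 ⊗ # (b ℕ.^ A₁ * T ℕ.^ (A₁ + (1 + (J + J))))
            ≤⟨ ⊗-monoˡ (# 32) (#-nonneg 32) (#-mono (ℕ.*-monoʳ-≤ (b ℕ.^ A₁) (T^-mono b-large))) ⟩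
          # 32 ⊗ # (b ℕ.^ A₁ * N)                    ≡⟨ trans (cong (# 32 ⊗_) (#-* (b ℕ.^ A₁) N)) (trans (sym (ℚ.*-assoc (# 32) (# (b ℕ.^ A₁)) (# N))) (cong (_⊗ # N) (sym (#-* 32 (b ℕ.^ A₁))))) ⟩
          C₂ ⊗ # N                                   ∎
          where
          open ℚ.≤-Reasoning
          η≤ : η ⩽ # (b * T)
          η≤ = ⩽-trans (H-^ 0<T b 0<b) (⩽-trans (⊗-monoˡ (# b) (#-nonneg b) (H≤# T)) (≡⇒⩽ (sym (#-* b T))))
          power : (b * T) ℕ.^ A₁ * T ℕ.^ (1 + (J + J)) ≡ b ℕ.^ A₁ * T ℕ.^ (A₁ + (1 + (J + J)))
          power = trans (cong (_* T ℕ.^ (1 + (J + J))) (^-distribʳ b T A₁)) (trans (ℕ.*-assoc (b ℕ.^ A₁) (T ℕ.^ A₁) (T ℕ.^ (1 + (J + J)))) (cong (b ℕ.^ A₁ *_) (sym (ℕ.^-distribˡ-+-* T A₁ (1 + (J + J))))))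
            where
            ^-distribʳ : ∀ m n o → (m * n) ℕ.^ o ≡ m ℕ.^ o * n ℕ.^ o
            ^-distribʳ m n zero = refl
            ^-distribʳ m n (suc o) = trans (cong (m * n *_) (^-distribʳ m n o)) (solveℕ 4 (λ m n a b → m ⟨*⟩ n ⟨*⟩ (a ⟨*⟩ b) ⟨=⟩ m ⟨*⟩ a ⟨*⟩ (n ⟨*⟩ b)) refl m n (m ℕ.^ o) (n ℕ.^ o))

        1≤ηη : 1ℚ ⩽ η ⊗ η
        1≤ηη = ⩽-trans (≡⇒⩽ (sym (ℚ.*-identityˡ 1ℚ))) (⊗-mono 0≤1 1≤η 0≤1 1≤η)

        constant-sum : ∀ {c} → c ≤ 32 → # (W * B) ⊗ # c ⩽ # 32 ⊗ # (W * B) ⊗ (η ⊗ η)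
        constant-sum {c} c≤ = begin
          # (W * B) ⊗ # c                       ≤⟨ ⊗-monoˡ (# (W * B)) (#-nonneg (W * B)) (#-mono c≤) ⟩
          # (W * B) ⊗ # 32                      ≡⟨ trans (ℚ.*-comm (# (W * B)) (# 32)) (sym (ℚ.*-identityʳ (# 32 ⊗ # (W * B)))) ⟩
          # 32 ⊗ # (W * B) ⊗ 1ℚ                 ≤⟨ ⊗-monoˡ (# 32 ⊗ # (W * B)) (⊗-nonneg (#-nonneg 32) (#-nonneg (W * B))) 1≤ηη ⟩
          # 32 ⊗ # (W * B) ⊗ (η ⊗ η)            ∎
          where open ℚ.≤-Reasoning

        add-error : ∀ {x y} → η ^ℚ A₀ ⊗ x ⩽ C ⊗ # N → y ⩽ # 32 ⊗ # (W * B) ⊗ (η ⊗ η) → η ^ℚ A₀ ⊗ (x ⊕ y) ⩽ (C ⊕ C₂) ⊗ # N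
        add-error {x} {y} p q = begin
          η ^ℚ A₀ ⊗ (x ⊕ y)                     ≡⟨ ℚ.*-distribˡ-+ (η ^ℚ A₀) x y ⟩
          η ^ℚ A₀ ⊗ x ⊕ η ^ℚ A₀ ⊗ y             ≤⟨ ⊕-mono p (⩽-trans (⊗-monoˡ (η ^ℚ A₀) (^ℚ-nonneg 0≤η A₀) q) negligible) ⟩
          C ⊗ # N ⊕ C₂ ⊗ # N                    ≡⟨ ℚ.*-distribʳ-+ (# N) C C₂ ⟨
          (C ⊕ C₂) ⊗ # N                        ∎
          where open ℚ.≤-Reasoning

        zero-error : η ^ℚ A₀ ⊗ 0ℚ ⩽ C ⊗ # N
        zero-error = ⩽-trans (≡⇒⩽ (ℚ.*-zeroʳ (η ^ℚ A₀))) (⊗-nonneg 0≤C (#-nonneg N))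

        ΣE₁ ΣE₂ ΣE₃ : ℚ
        ΣE₁ = ∑ (W * B) (λ _ → 1ℚ)
        ΣE₂ = ∑ (W * B) (λ q → e₂ q ⊕ # (2 * h′))
        ΣE₃ = ∑ (W * B) (λ q → e₁ q ⊕ η ⊗ (# B ⊗ ⅟ q ⊕ 1ℚ))

        Err₁ Err₂ Err₃ : ℚ
        Err₁ = error k t ΣE₁ Z
        Err₂ = error k t ΣE₂ Z
        Err₃ = error k₁ t ΣE₃ Z

        Err₁≤ : η ⊗ Err₁ ⩽ C₃ ⊗ # N
        Err₁≤ = error≤ ℕ.≤-refl (∑-nonneg (W * B) λ _ _ _ → 0≤1) (⩽-trans (⊗-monoˡ (η ^ℚ A₀) (^ℚ-nonneg 0≤η A₀) (≡⇒⩽ (trans (∑-const (W * B) 1ℚ) (trans (cong (# (W * B) ⊗_) (sym #1)) (sym (⊕-identityˡ (# (W * B) ⊗ # 1)))))))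
          (add-error zero-error (constant-sum {1} (s≤s z≤n))))

        Err₂≤ : η ⊗ Err₂ ⩽ C₃ ⊗ # N
        Err₂≤ = error≤ ℕ.≤-refl (∑-nonneg (W * B) λ q _ _ → ⊕-nonneg (e₂-nonneg q) (#-nonneg (2 * h′)))
          (⩽-trans (≡⇒⩽ (cong (η ^ℚ A₀ ⊗_) (trans (∑-⊕ (W * B) e₂ (λ _ → # (2 * h′))) (cong (∑ (W * B) e₂ ⊕_) (∑-const (W * B) (# (2 * h′)))))))
            (add-error ∑e₂≤ (constant-sum (ℕ.*-monoʳ-≤ 2 h′≤16))))

        Err₃≤ : η ⊗ Err₃ ⩽ C₃ ⊗ # N
        Err₃≤ = error≤ (ℕ.n≤1+n k₁) (∑-nonneg (W * B) λ q _ _ → ⊕-nonneg (e₁-nonneg q) (⊗-nonneg 0≤η (⊕-nonneg (⊗-nonneg (#-nonneg B) (⅟-nonneg q)) 0≤1)))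
          (⩽-trans (≡⇒⩽ (cong (η ^ℚ A₀ ⊗_) (trans (∑-⊕ (W * B) e₁ (λ q → η ⊗ (# B ⊗ ⅟ q ⊕ 1ℚ))) (cong (∑ (W * B) e₁ ⊕_) sum≡))))
            (add-error ∑e₁≤ bound))
          where
          open ℚ.≤-Reasoning
          sum≡ : ∑ (W * B) (λ q → η ⊗ (# B ⊗ ⅟ q ⊕ 1ℚ)) ≡ η ⊗ (# B ⊗ H (W * B) ⊕ # (W * B) ⊗ 1ℚ)
          sum≡ = trans (∑-⊗ (W * B) η (λ q → # B ⊗ ⅟ q ⊕ 1ℚ)) (cong (η ⊗_) (trans (∑-⊕ (W * B) (λ q → # B ⊗ ⅟ q) (λ _ → 1ℚ)) (cong₂ _⊕_ (∑-⊗ (W * B) (# B) ⅟_) (∑-const (W * B) 1ℚ))))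
          bound : η ⊗ (# B ⊗ H (W * B) ⊕ # (W * B) ⊗ 1ℚ) ⩽ # 32 ⊗ # (W * B) ⊗ (η ⊗ η)
          bound = begin
            η ⊗ (# B ⊗ H (W * B) ⊕ # (W * B) ⊗ 1ℚ)        ≤⟨ ⊗-monoˡ η 0≤η (⊕-mono (⊗-mono (#-nonneg B) (#-mono (m≤p*m B 0<W)) (H-nonneg (W * B)) (H-mono WB≤N)) (⊗-monoˡ (# (W * B)) (#-nonneg (W * B)) 1≤η)) ⟩
            η ⊗ (# (W * B) ⊗ η ⊕ # (W * B) ⊗ η)           ≡⟨ solve 2 (λ e m → e :* (m :* e :+ m :* e) := (con 1ℚ :+ con 1ℚ) :* m :* (e :* e)) refl η (# (W * B)) ⟩
            (1ℚ ⊕ 1ℚ) ⊗ # (W * B) ⊗ (η ⊗ η)               ≡⟨ cong (λ x → x ⊗ # (W * B) ⊗ (η ⊗ η)) (trans (cong (1ℚ ⊕_) (sym #1)) (sym (#-suc 1))) ⟩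
            # 2 ⊗ # (W * B) ⊗ (η ⊗ η)                     ≤⟨ ⊗-monoʳ (η ⊗ η) (⊗-nonneg 0≤η 0≤η) (⊗-monoʳ (# (W * B)) (#-nonneg (W * B)) (#-mono {2} {32} (s≤s (s≤s z≤n)))) ⟩
            # 32 ⊗ # (W * B) ⊗ (η ⊗ η)                    ∎

        ≤C₃N : ∀ {x} → 0ℚ ⩽ x → η ⊗ x ⩽ C₃ ⊗ # N → x ⩽ C₃ ⊗ # N
        ≤C₃N {x} 0≤x p = ⩽-trans (⩽-trans (≡⇒⩽ (sym (ℚ.*-identityˡ x))) (⊗-monoʳ x 0≤x 1≤η)) p

        M = i + suc i
        𝔸′ : Operator
        𝔸′ = 𝔸 M
        𝔸≡ : ∀ F → harmonicSum B (coprime-indicator W) F ≡ 𝔸′ F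
        𝔸≡ F = cong (λ x → harmonicSum x (coprime-indicator W) F) RR≡
        M𝔸 : Monotone 𝔸′
        M𝔸 = 𝔸-monotone M
        DYB : Decreasing B Y
        DYB = weaken-decreasing (m≤p*m R 0<R) DY

        Σw Σlam : ℚ
        Σw = ∑ N (λ n → 1ℚ ⊗ 𝟙 (W ∣? (n + r₀)) ⊗ weight n)
        Σlam = ∑ N (λ n → lam (n + h′) ⊗ 𝟙 (W ∣? (n + r₀)) ⊗ weight n)

        X₁ X₂ : ℚ
        X₁ = # N ⊗ ⅟ W ⊗ (Δ ⊗ (u₊ ^ℚ k ⊗ # Â))
        X₂ = # N ⊗ ⅟ (φ W) ⊗ (u₋ ^ℚ k₁ ⊗ (u₋ ⊗ u₋) ⊗ # B̂)

        main₁ : 𝕊 h ps (λ d → Y d ⊗ Y d) ⩽ Δ ⊗ (u₊ ^ℚ k ⊗ # Â)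
        main₁ = ⩽-trans (perturb D²) (⊗-monoˡ Δ 0≤Δ (begin
          𝕊 g ps Y²                                    ≤⟨ iterate-𝕊-≥ ⅟-nonneg (positive S) k (nonneg D²) ⟩
          iterate (𝕊 ⅟_ ps) k Y²                       ≤⟨ iterate-≤ (𝕊-monotone ⅟-nonneg (positive S)) M𝔸 (λ {f} G → ⩽-trans (𝕊-≤-harmonicSum 0<B S (nonneg G) (vanish G)) (≡⇒⩽ (𝔸≡ f))) k D² ⟩
          iterate 𝔸′ k Y²                              ≡⟨ op-cong (iterate-monotone M𝔸 k) (λ d _ → cong Y² (sym (ℕ.*-identityˡ d))) ⟩
          iterate 𝔸′ k (λ d → Y² (1 * d))              ≤⟨ iterate-upper M {L = squares (tails ds)} {Y²} 0≤1 (square-upper′) k 0 1 (s≤s z≤n) ⟩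
          u₊ ^ℚ k ⊗ 1ℚ ⊗ # Â                           ≡⟨ cong (_⊗ # Â) (ℚ.*-identityʳ (u₊ ^ℚ k)) ⟩
          u₊ ^ℚ k ⊗ # Â                                ∎))
          where
          open ℚ.≤-Reasoning
          Y² : ℕ → ℚ
          Y² d = Y d ⊗ Y d
          D² : Decreasing B Y²
          D² = square-decreasing DYB
          square-upper′ : (1ℚ , squares (tails ds)) UpperBoundOf Y²
          square-upper′ = square-upper {1ℚ} {tails ds} (nonneg DY) (step-upper ds)

        -- `covariance-≥` leaves a sum with weight `hᵖ` of squares of sums with weight `μ`. Since
        -- `hᵖ` dominates (1 + μ)^(k-1) - 1, the outer sum dominates k - 1 iterates of `𝕊 μ`. Every
        -- `𝕊 μ` in turn dominates a harmonic sum over integers coprime to W, to which the buckets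
        -- apply.
        main₂ : 0ℚ ⩽ u₋ → u₋ ^ℚ k₁ ⊗ (u₋ ⊗ u₋) ⊗ # B̂ ⩽ covariance μ vᵖ ps Y Y
        main₂ 0≤u₋ = begin
          u₋ ^ℚ k₁ ⊗ (u₋ ⊗ u₋) ⊗ # B̂                   ≡⟨ cong (λ x → u₋ ^ℚ k₁ ⊗ (x ⊗ x) ⊗ # B̂) (ℚ.*-identityʳ u₋) ⟨
          u₋ ^ℚ k₁ ⊗ (u₋ ⊗ 1ℚ ⊗ (u₋ ⊗ 1ℚ)) ⊗ # B̂       ≤⟨ iterate-lower M {L = squares (tails⁺ (tails ds))} {F𝔸} 0≤u₋ (⊗-nonneg 0≤u1 0≤u1) len₂ lower₂ k₁ 0 1 1<T ⟩
          iterate 𝔸′ k₁ (λ d → F𝔸 (1 * d))             ≡⟨ op-cong (iterate-monotone M𝔸 k₁) (λ d _ → cong F𝔸 (ℕ.*-identityˡ d)) ⟩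
          iterate 𝔸′ k₁ F𝔸                             ≤⟨ mono (iterate-monotone M𝔸 k₁) (λ d 0<d → ⊗-mono (nonneg (op-decreasing M𝔸 DYB) d) (𝔸≤𝕊 (shift-decreasing 0<d DYB)) (nonneg (op-decreasing M𝔸 DYB) d) (𝔸≤𝕊 (shift-decreasing 0<d DYB))) ⟩
          iterate 𝔸′ k₁ F𝕊                             ≤⟨ iterate-≤ M𝔸 (𝕊-monotone μ-nonneg (positive S)) 𝔸≤𝕊 k₁ DF𝕊 ⟩
          iterate (𝕊 μ ps) k₁ F𝕊                       ≤⟨ iterate-𝕊-≤ μ-nonneg (positive S) k₁ DF𝕊 ⟩
          𝕊 (compound μ-nonneg k₁) ps F𝕊               ≤⟨ 𝕊-mono-weight (compound-nonneg μ-nonneg k₁) (All.tabulate λ p∈ → compound≤hᵖ (2k< p∈)) (nonneg DF𝕊) ⟩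
          𝕊 hᵖ ps F𝕊                                   ≤⟨ covariance-≥ μ-nonneg hᵖ-nonneg vᵖ-nonneg (positive S) (All.tabulate λ _ → refl) DYB ⟩
          covariance μ vᵖ ps Y Y                       ∎
          where
          open ℚ.≤-Reasoning
          F𝔸 F𝕊 : ℕ → ℚ
          F𝔸 x = 𝔸′ (λ d → Y (x * d)) ⊗ 𝔸′ (λ d → Y (x * d))
          F𝕊 x = 𝕊 μ ps (λ d → Y (x * d)) ⊗ 𝕊 μ ps (λ d → Y (x * d))
          0≤u1 : 0ℚ ⩽ u₋ ⊗ 1ℚ
          0≤u1 = ⊗-nonneg 0≤u₋ 0≤1
          DF𝕊 : Decreasing B F𝕊
          DF𝕊 = square-decreasing (op-decreasing (𝕊-monotone μ-nonneg (positive S)) DYB)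
          𝔸≤𝕊 : ∀ {F} → Decreasing B F → 𝔸′ F ⩽ 𝕊 μ ps F
          𝔸≤𝕊 {F} G = ⩽-trans (≡⇒⩽ (sym (𝔸≡ F))) (harmonicSum-≤-𝕊 0<B S G)
          len₁ : length (tails ds) ≤ suc M
          len₁ = ℕ.≤-trans (ℕ.≤-reflexive (trans (length-tails ds) len)) (s≤s (ℕ.m≤m+n i (suc i)))
          len₂ : length (squares (tails⁺ (tails ds))) ≤ suc M
          len₂ = ℕ.≤-trans (ℕ.≤-reflexive (length-squares (tails⁺ (tails ds)))) (ℕ.≤-trans (length-tails⁺ (tails ds)) len₁)
          lower₁ : (u₋ ⊗ 1ℚ , tails⁺ (tails ds)) LowerBoundOf (λ x → 𝔸′ (λ n → Y (x * n)))
          lower₁ = 𝔸-lower M {1ℚ} {tails ds} 0≤u₋ 0≤1 len₁ (step-lower ds)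
          lower₂ : (u₋ ⊗ 1ℚ ⊗ (u₋ ⊗ 1ℚ) , squares (tails⁺ (tails ds))) LowerBoundOf F𝔸
          lower₂ = square-lower {u₋ ⊗ 1ℚ} {tails⁺ (tails ds)} 0≤u1 lower₁
          1<T : 1 < T ℕ.^ 1
          1<T = ℕ.<-≤-trans (ℕ.<-≤-trans (s≤s (s≤s z≤n)) 14≤T) (ℕ.≤-reflexive (sym (ℕ.*-identityʳ T)))

        Σw≤ : Σw ⩽ X₁ ⊕ Err₁
        Σw≤ = begin
          Σw                          ≡⟨ solve 2 (λ a x → a := x :+ (a :- x)) refl Σw X ⟩
          X ⊕ (Σw ⊖ X)                ≤⟨ ⊕-mono (⊗-monoˡ (# N ⊗ ⅟ W) (⊗-nonneg (#-nonneg N) (⅟-nonneg W)) main₁) (⩽-trans (x≤∥x∥ (Σw ⊖ X)) (evaluate-1 0<t)) ⟩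
          X₁ ⊕ Err₁                   ∎
          where
          open ℚ.≤-Reasoning
          X = # N ⊗ ⅟ W ⊗ 𝕊 h ps (λ d → Y d ⊗ Y d)

        Σlam≤ : Σlam ⩽ Err₂
        Σlam≤ = ⩽-trans (x≤∥x∥ Σlam) (evaluate-lam h′ 0<t)

        Σprime : ℕ → ℚ
        Σprime hᵢ = ∑ N (λ n → 𝟙 (prime? (n + hᵢ) ×-dec (B ℕ.<? n + hᵢ ×-dec n + hᵢ ℕ.≤? N)) ⊗ ℓ (n + hᵢ) ⊗ 𝟙 (W ∣? (n + r₀)) ⊗ weight n)

        Σprime≥ : 0ℚ ⩽ u₋ → ∀ {hᵢ} → hᵢ ∈ hs → X₂ ⊖ Err₃ ⩽ Σprime hᵢ
        Σprime≥ 0≤u₋ {hᵢ} h∈ = begin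
          X₂ ⊖ Err₃                   ≤⟨ ⊕-mono (⊗-monoˡ (# N ⊗ ⅟ (φ W)) (⊗-nonneg (#-nonneg N) (⅟-nonneg (φ W))) (main₂ 0≤u₋)) (ℚ.neg-antimono-≤ (⩽-trans (-x≤∥x∥ (Σprime hᵢ ⊖ X)) (evaluate-prime h∈ 0<t))) ⟩
          X ⊖ ⊝ (Σprime hᵢ ⊖ X)       ≡⟨ solve 2 (λ x a → x :- (:- (a :- x)) := a) refl X (Σprime hᵢ) ⟩
          Σprime hᵢ                   ∎
          where
          open ℚ.≤-Reasoning
          X = # N ⊗ ⅟ (φ W) ⊗ covariance μ vᵖ ps Y Y

        summed : # 2 ⊗ ∑ₗ hs Σprime ⩽ η ⊗ (Σw ⊕ Σlam)
        summed = begin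
          # 2 ⊗ ∑ₗ hs Σprime
            ≡⟨ cong (# 2 ⊗_) (sym (∑-∑ₗ N hs (λ n hᵢ → lp n hᵢ ⊗ v n ⊗ weight n))) ⟩
          # 2 ⊗ ∑ N (λ n → ∑ₗ hs (λ hᵢ → lp n hᵢ ⊗ v n ⊗ weight n))
            ≡⟨ trans (sym (∑-⊗ N (# 2) (λ n → ∑ₗ hs (λ hᵢ → lp n hᵢ ⊗ v n ⊗ weight n)))) (∑-cong N λ n _ _ → cong (# 2 ⊗_) (trans (∑ₗ-cong {xs = hs} (All.tabulate λ {hᵢ} _ → ℚ.*-assoc (lp n hᵢ) (v n) (weight n))) (∑ₗ-⊗ (v n ⊗ weight n) hs (lp n)))) ⟩
          ∑ N (λ n → # 2 ⊗ (∑ₗ hs (lp n) ⊗ (v n ⊗ weight n)))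
            ≤⟨ ∑-mono N (λ n 0<n n≤N → ⩽-trans (≡⇒⩽ (sym (ℚ.*-assoc (# 2) (∑ₗ hs (lp n)) (v n ⊗ weight n)))) (⊗-monoʳ (v n ⊗ weight n) (⊗-nonneg (𝟙-nonneg (W ∣? (n + r₀))) (weight-nonneg n)) (exclusive n 0<n n≤N))) ⟩
          ∑ N (λ n → η ⊗ (1ℚ ⊕ lam (n + h′)) ⊗ (v n ⊗ weight n))
            ≡⟨ trans (∑-cong N λ n _ _ → solve 4 (λ e l v w → e :* (con 1ℚ :+ l) :* (v :* w) := e :* (con 1ℚ :* v :* w :+ l :* v :* w)) refl η (lam (n + h′)) (v n) (weight n))
                 (trans (∑-⊗ N η (λ n → 1ℚ ⊗ v n ⊗ weight n ⊕ lam (n + h′) ⊗ v n ⊗ weight n)) (cong (η ⊗_) (∑-⊕ N (λ n → 1ℚ ⊗ v n ⊗ weight n) (λ n → lam (n + h′) ⊗ v n ⊗ weight n)))) ⟩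
          η ⊗ (Σw ⊕ Σlam) ∎
          where
          open ℚ.≤-Reasoning
          v : ℕ → ℚ
          v n = 𝟙 (W ∣? (n + r₀))
          lp : ℕ → ℕ → ℚ
          lp n hᵢ = 𝟙 (prime? (n + hᵢ) ×-dec (B ℕ.<? n + hᵢ ×-dec n + hᵢ ℕ.≤? N)) ⊗ ℓ (n + hᵢ)

      -- The exclusion inequality carries the factor η on its right side, so `Err₁` and `Err₂` are
      -- needed multiplied by η. Together with 2 k copies of `Err₃` they give 2 k + 2 error terms of
      -- order N.
      inequality : 0ℚ ⩽ u₋ → # 2 ⊗ # k ⊗ X₂ ⩽ # (2 * k + 2) ⊗ (C₃ ⊗ # N) ⊕ η ⊗ X₁
      inequality 0≤u₋ = begin
        # 2 ⊗ # k ⊗ X₂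
          ≡⟨ solve 4 (λ t k x e → t :* k :* x := t :* (k :* (x :- e)) :+ t :* k :* e) refl (# 2) (# k) X₂ Err₃ ⟩
        # 2 ⊗ (# k ⊗ (X₂ ⊖ Err₃)) ⊕ # 2 ⊗ # k ⊗ Err₃
          ≤⟨ ⊕-mono (⩽-trans (⊗-monoˡ (# 2) (#-nonneg 2) (⩽-trans (≡⇒⩽ (cong (λ l → # l ⊗ (X₂ ⊖ Err₃)) (sym size))) (∑ₗ-≥ (All.tabulate (Σprime≥ 0≤u₋))))) summed) ⩽-refl ⟩
        η ⊗ (Σw ⊕ Σlam) ⊕ # 2 ⊗ # k ⊗ Err₃
          ≤⟨ ⊕-mono (⊗-monoˡ η 0≤η (⊕-mono Σw≤ Σlam≤)) (⊗-monoˡ (# 2 ⊗ # k) (⊗-nonneg (#-nonneg 2) (#-nonneg k)) (≤C₃N 0≤Err₃ Err₃≤)) ⟩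
        η ⊗ (X₁ ⊕ Err₁ ⊕ Err₂) ⊕ # 2 ⊗ # k ⊗ (C₃ ⊗ # N)
          ≡⟨ solve 6 (λ e x a b t c → e :* (x :+ a :+ b) :+ t :* c := (e :* a :+ e :* b) :+ (t :* c :+ e :* x)) refl η X₁ Err₁ Err₂ (# 2 ⊗ # k) (C₃ ⊗ # N) ⟩
        (η ⊗ Err₁ ⊕ η ⊗ Err₂) ⊕ (# 2 ⊗ # k ⊗ (C₃ ⊗ # N) ⊕ η ⊗ X₁)
          ≤⟨ ⊕-monoˡ (# 2 ⊗ # k ⊗ (C₃ ⊗ # N) ⊕ η ⊗ X₁) (⊕-mono Err₁≤ Err₂≤) ⟩
        (C₃ ⊗ # N ⊕ C₃ ⊗ # N) ⊕ (# 2 ⊗ # k ⊗ (C₃ ⊗ # N) ⊕ η ⊗ X₁)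
          ≡⟨ solve 3 (λ c t x → (c :+ c) :+ (t :* c :+ x) := (t :+ (con 1ℚ :+ con 1ℚ)) :* c :+ x) refl (C₃ ⊗ # N) (# 2 ⊗ # k) (η ⊗ X₁) ⟩
        (# 2 ⊗ # k ⊕ (1ℚ ⊕ 1ℚ)) ⊗ (C₃ ⊗ # N) ⊕ η ⊗ X₁
          ≡⟨ cong (λ x → x ⊗ (C₃ ⊗ # N) ⊕ η ⊗ X₁) (sym (trans (#-+ (2 * k) 2) (cong₂ _⊕_ (#-* 2 k) (trans (#-suc 1) (cong (1ℚ ⊕_) #1))))) ⟩
        # (2 * k + 2) ⊗ (C₃ ⊗ # N) ⊕ η ⊗ X₁ ∎
        where
        open ℚ.≤-Reasoning
        0≤Err₃ : 0ℚ ⩽ Err₃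
        0≤Err₃ = ⩽-trans (∥∥-nonneg (∑ N (λ n → logPrime h∈ (n + hᵢ) ⊗ 𝟙 (W ∣? (n + r₀)) ⊗ weight n) ⊖ # N ⊗ ⅟ (φ W) ⊗ covariance μ vᵖ ps Y Y)) (evaluate-prime h∈ 0<t)
          where
          first : ∀ {xs : List ℕ} {l} → length xs ≡ suc l → ∃[ x ] x ∈ xs
          first {x ∷ xs} _ = x , here refl
          hᵢ = proj₁ (first {hs} size)
          h∈ = proj₂ (first {hs} size)

      private
        ℓ₀ : ℚ
        ℓ₀ = H T
        γ : ℚ
        γ = ⅟ W ⊗ κ ^ℚ k
        0≤γ : 0ℚ ⩽ γ
        0≤γ = ⊗-nonneg (⅟-nonneg W) (^ℚ-nonneg κ-nonneg k)
        a : ℚ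
        a = # (b * Â)

      -- The prime side has one more factor κ and 1/φ(W) instead of 1/W. As κ = φ(W)/W, both sides
      -- share the factor `γ`, and after division by N only powers of H T are left to compare.
      reduced : C₀ ⩽ H T → γ ⊗ (a ⊗ (# 2002 ⊗ (H T ⊖ C₀) ^ℚ suc k)) ⩽ # 2000 ⊗ (# (2 * k + 2) ⊗ C₃) ⊕ γ ⊗ (a ⊗ (# 2001 ⊗ (H T ⊗ (H T ⊕ C₀) ^ℚ k)))
      reduced C₀≤ = ⊗-cancelˡ (# N) (#-pos 0<N) (begin
        # N ⊗ (γ ⊗ (a ⊗ (# 2002 ⊗ x)))
          ≡⟨ solve 5 (λ n g a t x → n :* (g :* (a :* (t :* x))) := n :* g :* x :* (t :* a)) refl (# N) γ a (# 2002) x ⟩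
        # N ⊗ γ ⊗ x ⊗ (# 2002 ⊗ a)
          ≤⟨ ⊗-monoˡ (# N ⊗ γ ⊗ x) (⊗-nonneg (⊗-nonneg (#-nonneg N) 0≤γ) (^ℚ-nonneg (x≤y⇒0≤y-x C₀≤) (suc k))) cert ⟩
        # N ⊗ γ ⊗ x ⊗ (# 2000 ⊗ (# 2 ⊗ # k ⊗ # B̂))
          ≡⟨ solve 6 (λ n g x t m B → n :* g :* x :* (t :* (m :* B)) := t :* (m :* (n :* (g :* x) :* B))) refl (# N) γ x (# 2000) (# 2 ⊗ # k) (# B̂) ⟩
        # 2000 ⊗ (# 2 ⊗ # k ⊗ (# N ⊗ (γ ⊗ x) ⊗ # B̂))
          ≡⟨ cong (λ y → # 2000 ⊗ (# 2 ⊗ # k ⊗ y)) X₂≡ ⟨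
        # 2000 ⊗ (# 2 ⊗ # k ⊗ X₂)
          ≤⟨ ⊗-monoˡ (# 2000) (#-nonneg 2000) (inequality 0≤u₋) ⟩
        # 2000 ⊗ (# (2 * k + 2) ⊗ (C₃ ⊗ # N) ⊕ η ⊗ X₁)
          ≤⟨ ⊗-monoˡ (# 2000) (#-nonneg 2000) (⊕-monoʳ (# (2 * k + 2) ⊗ (C₃ ⊗ # N)) (⊗-monoʳ X₁ 0≤X₁ (H-^ 0<T b 0<b))) ⟩
        # 2000 ⊗ (# (2 * k + 2) ⊗ (C₃ ⊗ # N) ⊕ # b ⊗ ℓ₀ ⊗ X₁)
          ≡⟨ cong (λ y → # 2000 ⊗ (# (2 * k + 2) ⊗ (C₃ ⊗ # N) ⊕ # b ⊗ ℓ₀ ⊗ (# N ⊗ ⅟ W ⊗ (Δ ⊗ (y ⊗ # Â))))) (^ℚ-⊗ κ (ℓ₀ ⊕ C₀) k) ⟩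
        # 2000 ⊗ (# (2 * k + 2) ⊗ (C₃ ⊗ # N) ⊕ # b ⊗ ℓ₀ ⊗ (# N ⊗ ⅟ W ⊗ (Δ ⊗ (κ ^ℚ k ⊗ (ℓ₀ ⊕ C₀) ^ℚ k ⊗ # Â))))
          ≡⟨ solve 11 (λ t m c n b l w d kk y A → t :* (m :* (c :* n) :+ b :* l :* (n :* w :* (d :* (kk :* y :* A)))) := n :* (t :* (m :* c) :+ w :* kk :* (b :* A :* (t :* d :* (l :* y))))) refl
               (# 2000) (# (2 * k + 2)) C₃ (# N) (# b) ℓ₀ (⅟ W) Δ (κ ^ℚ k) ((ℓ₀ ⊕ C₀) ^ℚ k) (# Â) ⟩
        # N ⊗ (# 2000 ⊗ (# (2 * k + 2) ⊗ C₃) ⊕ γ ⊗ (# b ⊗ # Â ⊗ (# 2000 ⊗ Δ ⊗ (ℓ₀ ⊗ (ℓ₀ ⊕ C₀) ^ℚ k))))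
          ≤⟨ ⊗-monoˡ (# N) (#-nonneg N) (⊕-monoʳ (# 2000 ⊗ (# (2 * k + 2) ⊗ C₃)) (⊗-monoˡ γ 0≤γ (⊗-mono (⊗-nonneg (#-nonneg b) (#-nonneg Â)) (≡⇒⩽ (sym (#-* b Â))) (⊗-nonneg (⊗-nonneg (#-nonneg 2000) 0≤Δ) 0≤y) (⊗-monoʳ (ℓ₀ ⊗ (ℓ₀ ⊕ C₀) ^ℚ k) 0≤y Δ≤)))) ⟩
        # N ⊗ (# 2000 ⊗ (# (2 * k + 2) ⊗ C₃) ⊕ γ ⊗ (a ⊗ (# 2001 ⊗ (ℓ₀ ⊗ (ℓ₀ ⊕ C₀) ^ℚ k)))) ∎)
        where
        open ℚ.≤-Reasoning
        x = (ℓ₀ ⊖ C₀) ^ℚ suc k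
        0≤C₀ : 0ℚ ⩽ C₀
        0≤C₀ = #-nonneg (W * W + 1)
        0≤y : 0ℚ ⩽ ℓ₀ ⊗ (ℓ₀ ⊕ C₀) ^ℚ k
        0≤y = ⊗-nonneg (H-nonneg T) (^ℚ-nonneg (⊕-nonneg (H-nonneg T) 0≤C₀) k)
        0≤u₋ : 0ℚ ⩽ u₋
        0≤u₋ = ⊗-nonneg κ-nonneg (x≤y⇒0≤y-x C₀≤)
        0≤X₁ : 0ℚ ⩽ X₁
        0≤X₁ = ⊗-nonneg (⊗-nonneg (#-nonneg N) (⅟-nonneg W)) (⊗-nonneg 0≤Δ (⊗-nonneg (^ℚ-nonneg (⊗-nonneg κ-nonneg (⊕-nonneg (H-nonneg T) 0≤C₀)) k) (#-nonneg Â)))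
        cert : # 2002 ⊗ a ⩽ # 2000 ⊗ (# 2 ⊗ # k ⊗ # B̂)
        cert = begin
          # 2002 ⊗ a                              ≡⟨ #-* 2002 (b * Â) ⟨
          # (2002 * (b * Â))                      ≡⟨ cong #_ (ℕ.*-assoc 2 1001 (b * Â)) ⟩
          # (2 * (1001 * (b * Â)))                ≤⟨ #-mono (ℕ.*-monoʳ-≤ 2 certificate) ⟩
          # (2 * (2000 * k * B̂))                  ≡⟨ trans (#-* 2 (2000 * k * B̂)) (cong (# 2 ⊗_) (trans (#-* (2000 * k) B̂) (cong (_⊗ # B̂) (#-* 2000 k)))) ⟩
          # 2 ⊗ (# 2000 ⊗ # k ⊗ # B̂)              ≡⟨ solve 4 (λ t m k b → t :* (m :* k :* b) := m :* (t :* k :* b)) refl (# 2) (# 2000) (# k) (# B̂) ⟩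
          # 2000 ⊗ (# 2 ⊗ # k ⊗ # B̂)              ∎
        φκ : ⅟ (φ W) ⊗ κ ≡ ⅟ W
        φκ = trans (cong (λ y → ⅟ (φ W) ⊗ (y ⊗ ⅟ W)) (sym (φ-∑ W))) (trans (solve 3 (λ r f w → r :* (f :* w) := (f :* r) :* w) refl (⅟ (φ W)) (# (φ W)) (⅟ W)) (trans (cong (_⊗ ⅟ W) (⅟-inverse (φ-pos 0<W))) (ℚ.*-identityˡ (⅟ W))))
        X₂≡ : X₂ ≡ # N ⊗ (γ ⊗ x) ⊗ # B̂
        X₂≡ = begin-equality
          # N ⊗ ⅟ (φ W) ⊗ (u₋ ^ℚ k₁ ⊗ (u₋ ⊗ u₋) ⊗ # B̂)           ≡⟨ solve 5 (λ n f p u b → n :* f :* (p :* (u :* u) :* b) := n :* (f :* (u :* (u :* p))) :* b) refl (# N) (⅟ (φ W)) (u₋ ^ℚ k₁) u₋ (# B̂) ⟩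
          # N ⊗ (⅟ (φ W) ⊗ u₋ ^ℚ suc k) ⊗ # B̂                    ≡⟨ cong (λ y → # N ⊗ (⅟ (φ W) ⊗ y) ⊗ # B̂) (^ℚ-⊗ κ (ℓ₀ ⊖ C₀) (suc k)) ⟩
          # N ⊗ (⅟ (φ W) ⊗ (κ ⊗ κ ^ℚ k ⊗ x)) ⊗ # B̂               ≡⟨ cong (λ y → # N ⊗ y ⊗ # B̂) (trans (solve 4 (λ f c p x → f :* (c :* p :* x) := f :* c :* p :* x) refl (⅟ (φ W)) κ (κ ^ℚ k) x) (cong (λ y → y ⊗ κ ^ℚ k ⊗ x) φκ)) ⟩
          # N ⊗ (γ ⊗ x) ⊗ # B̂                                    ∎

    impossible : ∀ s₀ → (∀ s → s₀ ≤ s → 0 < s → Hypotheses C s) → ⊥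
    impossible s₀ hyps = ≺⇒⋡ strict (reduced (proj₁ (proj₂ big)))
      where
      -- `κ` and `C` depend only on W. Taking them at s = 1 allows the threshold for H T to be fixed
      -- before s is chosen.
      open Steps W 1 1<W (s≤s z≤n) using () renaming (κ to κ₁; C to C₁; κ-nonneg to κ₁-nonneg; κ#W≥1 to κ₁#W≥1)
      γ₁ : ℚ
      γ₁ = ⅟ W ⊗ κ₁ ^ℚ k
      0<κ₁ : 0ℚ ≺ κ₁
      0<κ₁ = ℚ.≰⇒> λ κ≤0 → ≺⇒⋡ 0<1 (⩽-trans κ₁#W≥1 (⩽-trans (⊗-monoʳ (# W) (#-nonneg W) κ≤0) (≡⇒⩽ (ℚ.*-zeroˡ (# W)))))
      0<γ₁ : 0ℚ ≺ γ₁
      0<γ₁ = ⊗-pos (⅟-pos 0<W) (^ℚ-pos 0<κ₁ k)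
      C₆ C₇ : ℚ
      C₆ = # 2000 ⊗ (# (2 * k + 2) ⊗ C₃)
      C₇ = C₆ ⊗ invℚ γ₁
      0≤C₆ : 0ℚ ⩽ C₆
      0≤C₆ = ⊗-nonneg (#-nonneg 2000) (⊗-nonneg (#-nonneg (2 * k + 2)) 0≤C₃)
      ev = eventually k {C₁} {C₇} (#-nonneg (W * W + 1)) (⊗-nonneg 0≤C₆ (≺⇒⩽ (invℚ-pos 0<γ₁)))
      large = H-unbounded (proj₁ ev)
      s = proj₁ large + s₀
      0<s : 0 < s
      0<s = ℕ.<-≤-trans (proj₁ (proj₂ large)) (ℕ.m≤m+n (proj₁ large) s₀)
      open At s using (T)
      big = proj₂ ev (H T) (⩽-trans (proj₂ (proj₂ large)) (H-mono (ℕ.≤-trans (ℕ.m≤m+n (proj₁ large) s₀) (m≤p*m s 0<W))))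
      open AtScale s 0<s (hyps s (ℕ.m≤n+m s₀ (proj₁ large)) 0<s) using (reduced)
      X Y′ a : ℚ
      X = # 2002 ⊗ (H T ⊖ C₁) ^ℚ suc k
      Y′ = # 2001 ⊗ (H T ⊗ (H T ⊕ C₁) ^ℚ k)
      a = # (b * Â)
      1≤a : 1ℚ ⩽ a
      1≤a = 1≤# (*-pos 0<b nonzero)
      C₆≡ : γ₁ ⊗ C₇ ≡ C₆
      C₆≡ = trans (solve 3 (λ g c i → g :* (c :* i) := c :* (g :* i)) refl γ₁ C₆ (invℚ γ₁)) (trans (cong (C₆ ⊗_) (invℚ-inverseʳ 0<γ₁)) (ℚ.*-identityʳ C₆))
      strict : C₆ ⊕ γ₁ ⊗ (a ⊗ Y′) ≺ γ₁ ⊗ (a ⊗ X)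
      strict = begin-strict
        C₆ ⊕ γ₁ ⊗ (a ⊗ Y′)                    ≡⟨ cong (_⊕ γ₁ ⊗ (a ⊗ Y′)) (trans (sym C₆≡) (cong (γ₁ ⊗_) (sym (ℚ.*-identityˡ C₇)))) ⟩
        γ₁ ⊗ (1ℚ ⊗ C₇) ⊕ γ₁ ⊗ (a ⊗ Y′)        ≤⟨ ⊕-monoˡ (γ₁ ⊗ (a ⊗ Y′)) (⊗-monoˡ γ₁ (≺⇒⩽ 0<γ₁) (⊗-monoʳ C₇ (⊗-nonneg 0≤C₆ (≺⇒⩽ (invℚ-pos 0<γ₁))) 1≤a)) ⟩
        γ₁ ⊗ (a ⊗ C₇) ⊕ γ₁ ⊗ (a ⊗ Y′)         ≡⟨ solve 4 (λ g a c y → g :* (a :* c) :+ g :* (a :* y) := g :* a :* (y :+ c)) refl γ₁ a C₇ Y′ ⟩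
        γ₁ ⊗ a ⊗ (Y′ ⊕ C₇)                    <⟨ ℚ.*-monoʳ-<-pos (γ₁ ⊗ a) {{ℚ.positive (⊗-pos 0<γ₁ (ℚ.<-≤-trans 0<1 1≤a))}} (proj₂ (proj₂ big)) ⟩
        γ₁ ⊗ a ⊗ X                            ≡⟨ ℚ.*-assoc γ₁ a X ⟩
        γ₁ ⊗ (a ⊗ X)                          ∎
        where open ℚ.≤-Reasoning

sumℚ-++ : ∀ xs y → sumℚ (xs ++ y ∷ []) ≡ sumℚ xs ⊕ y
sumℚ-++ [] y = trans (⊕-identityʳ y) (sym (⊕-identityˡ y))
sumℚ-++ (x ∷ xs) y = trans (cong (x ⊕_) (sumℚ-++ xs y)) (sym (ℚ.+-assoc x (sumℚ xs) y))

sumℚ-upTo : ∀ (f : ℕ → ℚ) n → sumℚ (map f (upTo n)) ≡ ∑ n (λ i → f (ℕ.pred i))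
sumℚ-upTo f zero = refl
sumℚ-upTo f (suc n) = trans (cong (λ xs → sumℚ (map f xs)) (sym (List.applyUpTo-∷ʳ (λ x → x) n)))
  (trans (cong sumℚ (List.map-++ f (upTo n) (n ∷ []))) (trans (sumℚ-++ (map f (upTo n)) (f n)) (cong (_⊕ f n) (sumℚ-upTo f n))))

invℚ-ℕ : ∀ n → invℚ (ℕ→ℚ n) ≡ ⅟ n
invℚ-ℕ n = trans (cong invℚ (sym (#-unfold n))) (sym (⅟-unfold n))

-- Exponential and logarithm

-- Convexity of powers: the slope of the secant is at least the derivative at the left end. The
-- companion bound uses the derivative at the right end. Both series below inherit their functional
-- inequalities from these two, term by term.
^-secant-≥ : ∀ {y a} → 0ℚ ⩽ y → 0ℚ ⩽ a → ∀ k → y ^ℚ suc k ⊕ # (suc k) ⊗ (a ⊗ y ^ℚ k) ⩽ (y ⊕ a) ^ℚ suc k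
^-secant-≥ {y} {a} 0≤y 0≤a zero = ≡⇒⩽ (trans (cong (λ t → y ⊗ 1ℚ ⊕ t ⊗ (a ⊗ 1ℚ)) #1) (solve 2 (λ y a → y :* con 1ℚ :+ con 1ℚ :* (a :* con 1ℚ) := (y :+ a) :* con 1ℚ) refl y a))
^-secant-≥ {y} {a} 0≤y 0≤a (suc k) = begin
  y ^ℚ suc (suc k) ⊕ # (suc (suc k)) ⊗ (a ⊗ P)        ≡⟨ cong (λ t → y ⊗ P ⊕ t ⊗ (a ⊗ P)) (#-suc (suc k)) ⟩
  y ⊗ (y ⊗ p) ⊕ (1ℚ ⊕ K) ⊗ (a ⊗ (y ⊗ p))              ≤⟨ by-excess (a ⊗ (K ⊗ (a ⊗ p))) (⊗-nonneg 0≤a (⊗-nonneg (#-nonneg (suc k)) (⊗-nonneg 0≤a (^ℚ-nonneg 0≤y k))))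
      (solve 4 (λ y a p K → y :* (y :* p) :+ (con 1ℚ :+ K) :* (a :* (y :* p)) :+ a :* (K :* (a :* p)) := (y :+ a) :* (y :* p :+ K :* (a :* p))) refl y a p K) ⟩
  (y ⊕ a) ⊗ (P ⊕ K ⊗ (a ⊗ p))                         ≤⟨ ⊗-monoˡ (y ⊕ a) (⊕-nonneg 0≤y 0≤a) (^-secant-≥ 0≤y 0≤a k) ⟩
  (y ⊕ a) ^ℚ suc (suc k)                              ∎
  where
  open ℚ.≤-Reasoning
  p = y ^ℚ k
  P = y ^ℚ suc k
  K = # (suc k)

^-secant-≤ : ∀ {y a} → 0ℚ ⩽ y → 0ℚ ⩽ a → ∀ k → (y ⊕ a) ^ℚ suc k ⩽ y ^ℚ suc k ⊕ # (suc k) ⊗ (a ⊗ (y ⊕ a) ^ℚ k)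
^-secant-≤ {y} {a} 0≤y 0≤a zero = ≡⇒⩽ (sym (trans (cong (λ t → y ⊗ 1ℚ ⊕ t ⊗ (a ⊗ 1ℚ)) #1) (solve 2 (λ y a → y :* con 1ℚ :+ con 1ℚ :* (a :* con 1ℚ) := (y :+ a) :* con 1ℚ) refl y a)))
^-secant-≤ {y} {a} 0≤y 0≤a (suc k) = begin
  (y ⊕ a) ⊗ Q                                         ≡⟨ ℚ.*-distribʳ-+ Q y a ⟩
  y ⊗ Q ⊕ a ⊗ Q                                       ≤⟨ ⊕-monoˡ (a ⊗ Q) (⊗-monoˡ y 0≤y (^-secant-≤ 0≤y 0≤a k)) ⟩
  y ⊗ (P ⊕ K ⊗ (a ⊗ q)) ⊕ a ⊗ Q                       ≤⟨ by-excess (a ⊗ (K ⊗ (a ⊗ q))) (⊗-nonneg 0≤a (⊗-nonneg (#-nonneg (suc k)) (⊗-nonneg 0≤a (^ℚ-nonneg (⊕-nonneg 0≤y 0≤a) k))))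
      (solve 5 (λ y a q K P → y :* (P :+ K :* (a :* q)) :+ a :* ((y :+ a) :* q) :+ a :* (K :* (a :* q)) := y :* P :+ (con 1ℚ :+ K) :* (a :* ((y :+ a) :* q))) refl y a q K P) ⟩
  y ⊗ P ⊕ (1ℚ ⊕ K) ⊗ (a ⊗ Q)                          ≡⟨ cong (λ t → y ⊗ P ⊕ t ⊗ (a ⊗ Q)) (#-suc (suc k)) ⟨
  y ^ℚ suc (suc k) ⊕ # (suc (suc k)) ⊗ (a ⊗ Q)        ∎
  where
  open ℚ.≤-Reasoning
  q = (y ⊕ a) ^ℚ k
  Q = (y ⊕ a) ^ℚ suc k
  P = y ^ℚ suc k
  K = # (suc k)

⅟! : ℕ → ℚ
⅟! k = ⅟ (k !)

!-pos : ∀ k → 0 < k !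
!-pos zero    = s≤s z≤n
!-pos (suc k) = *-pos {suc k} (s≤s z≤n) (!-pos k)

⅟!-suc : ∀ k → # (suc k) ⊗ ⅟! (suc k) ≡ ⅟! k
⅟!-suc k = trans (cong (# (suc k) ⊗_) (⅟-* {suc k} (s≤s z≤n) (!-pos k))) (trans (sym (ℚ.*-assoc (# (suc k)) (⅟ (suc k)) (⅟! k))) (trans (cong (_⊗ ⅟! k) (⅟-inverse {suc k} (s≤s z≤n))) (ℚ.*-identityˡ (⅟! k))))

⅟!-nonneg : ∀ k → 0ℚ ⩽ ⅟! k
⅟!-nonneg k = ⅟-nonneg (k !)

expo : ℕ → ℚ → ℚ
expo n y = ∑ (suc n) (λ i → y ^ℚ (ℕ.pred i) ⊗ ⅟! (ℕ.pred i))

expPartial≡ : ∀ n y → expPartial n y ≡ expo n y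
expPartial≡ n y = trans (sumℚ-upTo (λ k → (y ^ℚ k) ⊗ invℚ (ℕ→ℚ (k !))) (suc n)) (∑-cong (suc n) λ i _ _ → cong (y ^ℚ (ℕ.pred i) ⊗_) (invℚ-ℕ ((ℕ.pred i) !)))

expo-0 : ∀ y → expo 0 y ≡ 1ℚ
expo-0 y = trans (⊕-identityˡ (1ℚ ⊗ ⅟! 0)) (trans (ℚ.*-identityˡ (⅟! 0)) ⅟1)

expo-nonneg : ∀ n {y} → 0ℚ ⩽ y → 0ℚ ⩽ expo n y
expo-nonneg n 0≤y = ∑-nonneg (suc n) λ i _ _ → ⊗-nonneg (^ℚ-nonneg 0≤y (ℕ.pred i)) (⅟!-nonneg (ℕ.pred i))

expo-mono : ∀ {m n y y′} → m ≤ n → 0ℚ ⩽ y → y ⩽ y′ → expo m y ⩽ expo n y′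
expo-mono {m} {n} {y} {y′} m≤n 0≤y y≤y′ = ⩽-trans
  (∑-≤-ext (s≤s m≤n) λ i _ _ → ⊗-nonneg (^ℚ-nonneg 0≤y (ℕ.pred i)) (⅟!-nonneg (ℕ.pred i)))
  (∑-mono (suc n) λ i _ _ → ⊗-monoʳ (⅟! (ℕ.pred i)) (⅟!-nonneg (ℕ.pred i)) (^ℚ-mono 0≤y y≤y′ (ℕ.pred i)))

private
  term : ∀ k (a x : ℚ) → # (suc k) ⊗ (a ⊗ x) ⊗ ⅟! (suc k) ≡ a ⊗ (x ⊗ ⅟! k)
  term k a x = trans (solve 4 (λ n a x f → n :* (a :* x) :* f := a :* (x :* (n :* f))) refl (# (suc k)) a x (⅟! (suc k))) (cong (λ t → a ⊗ (x ⊗ t)) (⅟!-suc k))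

-- A truncated form of exp (y + a) ≥ (1 + a) exp y. Dividing the power inequality of exponent k + 1
-- by (k + 1)! pairs it with term k of the second series, hence the shifted truncation.
expo-step-≥ : ∀ {y a} → 0ℚ ⩽ y → 0ℚ ⩽ a → ∀ n → expo (suc n) y ⊕ a ⊗ expo n y ⩽ expo (suc n) (y ⊕ a)
expo-step-≥ {y} {a} 0≤y 0≤a n = go n
  where
  open ℚ.≤-Reasoning
  t : ∀ k → y ^ℚ suc k ⊗ ⅟! (suc k) ⊕ a ⊗ (y ^ℚ k ⊗ ⅟! k) ⩽ (y ⊕ a) ^ℚ suc k ⊗ ⅟! (suc k)
  t k = ⩽-trans (≡⇒⩽ (trans (cong (y ^ℚ suc k ⊗ ⅟! (suc k) ⊕_) (sym (term k a (y ^ℚ k)))) (sym (ℚ.*-distribʳ-+ (⅟! (suc k)) (y ^ℚ suc k) (# (suc k) ⊗ (a ⊗ y ^ℚ k))))))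
    (⊗-monoʳ (⅟! (suc k)) (⅟!-nonneg (suc k)) (^-secant-≥ 0≤y 0≤a k))
  go : ∀ n → expo (suc n) y ⊕ a ⊗ expo n y ⩽ expo (suc n) (y ⊕ a)
  go zero = begin
    expo 0 y ⊕ u 1 ⊕ a ⊗ expo 0 y               ≡⟨ solve 3 (λ e u x → e :+ u :+ x := e :+ (u :+ x)) refl (expo 0 y) (u 1) (a ⊗ expo 0 y) ⟩
    expo 0 y ⊕ (u 1 ⊕ a ⊗ expo 0 y)             ≡⟨ cong₂ (λ e x → e ⊕ (u 1 ⊕ a ⊗ x)) (trans (expo-0 y) (sym (expo-0 (y ⊕ a)))) (⊕-identityˡ (u 0)) ⟩
    expo 0 (y ⊕ a) ⊕ (u 1 ⊕ a ⊗ u 0)            ≤⟨ ⊕-monoʳ (expo 0 (y ⊕ a)) (t 0) ⟩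
    expo 1 (y ⊕ a)                              ∎
    where
    u : ℕ → ℚ
    u k = y ^ℚ k ⊗ ⅟! k
  go (suc n) = begin
    expo (suc n) y ⊕ u (suc (suc n)) ⊕ a ⊗ (expo n y ⊕ u (suc n))      ≡⟨ solve 5 (λ e u a f v → e :+ u :+ a :* (f :+ v) := (e :+ a :* f) :+ (u :+ a :* v)) refl (expo (suc n) y) (u (suc (suc n))) a (expo n y) (u (suc n)) ⟩
    (expo (suc n) y ⊕ a ⊗ expo n y) ⊕ (u (suc (suc n)) ⊕ a ⊗ u (suc n)) ≤⟨ ⊕-mono (go n) (t (suc n)) ⟩
    expo (suc (suc n)) (y ⊕ a)                  ∎
    where
    u : ℕ → ℚ
    u k = y ^ℚ k ⊗ ⅟! k

expo-step-≤ : ∀ {y a} → 0ℚ ⩽ y → 0ℚ ⩽ a → ∀ n → expo (suc n) (y ⊕ a) ⩽ expo (suc n) y ⊕ a ⊗ expo n (y ⊕ a)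
expo-step-≤ {y} {a} 0≤y 0≤a n = go n
  where
  open ℚ.≤-Reasoning
  u v : ℕ → ℚ
  u k = y ^ℚ k ⊗ ⅟! k
  v k = (y ⊕ a) ^ℚ k ⊗ ⅟! k
  t : ∀ k → v (suc k) ⩽ u (suc k) ⊕ a ⊗ v k
  t k = ⩽-trans (⊗-monoʳ (⅟! (suc k)) (⅟!-nonneg (suc k)) (^-secant-≤ 0≤y 0≤a k))
    (≡⇒⩽ (trans (ℚ.*-distribʳ-+ (⅟! (suc k)) (y ^ℚ suc k) (# (suc k) ⊗ (a ⊗ (y ⊕ a) ^ℚ k))) (cong (u (suc k) ⊕_) (term k a ((y ⊕ a) ^ℚ k)))))
  go : ∀ n → expo (suc n) (y ⊕ a) ⩽ expo (suc n) y ⊕ a ⊗ expo n (y ⊕ a)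
  go zero = begin
    expo 0 (y ⊕ a) ⊕ v 1                        ≤⟨ ⊕-mono (≡⇒⩽ (trans (expo-0 (y ⊕ a)) (sym (expo-0 y)))) (t 0) ⟩
    expo 0 y ⊕ (u 1 ⊕ a ⊗ v 0)                  ≡⟨ trans (sym (ℚ.+-assoc (expo 0 y) (u 1) (a ⊗ v 0))) (cong (λ x → expo 1 y ⊕ a ⊗ x) (sym (⊕-identityˡ (v 0)))) ⟩
    expo 1 y ⊕ a ⊗ expo 0 (y ⊕ a)               ∎
  go (suc n) = begin
    expo (suc n) (y ⊕ a) ⊕ v (suc (suc n))      ≤⟨ ⊕-mono (go n) (t (suc n)) ⟩
    (expo (suc n) y ⊕ a ⊗ expo n (y ⊕ a)) ⊕ (u (suc (suc n)) ⊕ a ⊗ v (suc n))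
      ≡⟨ solve 5 (λ e a f u v → (e :+ a :* f) :+ (u :+ a :* v) := e :+ u :+ a :* (f :+ v)) refl (expo (suc n) y) a (expo n (y ⊕ a)) (u (suc (suc n))) (v (suc n)) ⟩
    expo (suc (suc n)) y ⊕ a ⊗ expo (suc n) (y ⊕ a) ∎

-- Each step of 1/2 at most doubles the value: E ≤ expo (suc n) y + E/2 by `expo-step-≤`. The bound
-- does not depend on n, which is what boundedness of the partial sums requires.
expo-half : ∀ j n → expo n (# j ⊗ ⅟ 2) ⩽ # (2 ℕ.^ j)
expo-half zero n = ≡⇒⩽ (trans (trans (cong (expo n) (trans (cong (_⊗ ⅟ 2) #0) (ℚ.*-zeroˡ (⅟ 2)))) (at-0 n)) (sym #1))
  where
  at-0 : ∀ n → expo n 0ℚ ≡ 1ℚ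
  at-0 zero = expo-0 0ℚ
  at-0 (suc n) = trans (cong (expo n 0ℚ ⊕_) (trans (cong (_⊗ ⅟! (suc n)) (ℚ.*-zeroˡ (0ℚ ^ℚ n))) (ℚ.*-zeroˡ (⅟! (suc n))))) (trans (⊕-identityʳ (expo n 0ℚ)) (at-0 n))
expo-half (suc j) n = begin
  expo n (# (suc j) ⊗ r)             ≡⟨ cong (expo n) (trans (cong (_⊗ r) (#-suc j)) (solve 2 (λ j r → (con 1ℚ :+ j) :* r := j :* r :+ r) refl (# j) r)) ⟩
  expo n (y ⊕ r)                     ≤⟨ expo-mono (ℕ.n≤1+n n) (⊕-nonneg 0≤y 0≤r) ⩽-refl ⟩
  E                                  ≡⟨ trans (sym (ℚ.*-identityˡ E)) (trans (cong (_⊗ E) (sym (⅟-inverse {2} (s≤s z≤n)))) (ℚ.*-assoc (# 2) r E)) ⟩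
  # 2 ⊗ (r ⊗ E)                      ≡⟨ cong (λ t → # 2 ⊗ (t ⊗ E)) half ⟩
  # 2 ⊗ ((1ℚ ⊖ r) ⊗ E)               ≤⟨ ⊗-monoˡ (# 2) (#-nonneg 2) shrink ⟩
  # 2 ⊗ expo (suc n) y               ≤⟨ ⊗-monoˡ (# 2) (#-nonneg 2) (expo-half j (suc n)) ⟩
  # 2 ⊗ # (2 ℕ.^ j)                  ≡⟨ #-* 2 (2 ℕ.^ j) ⟨
  # (2 ℕ.^ suc j)                    ∎
  where
  open ℚ.≤-Reasoning
  r = ⅟ 2
  y = # j ⊗ r
  E = expo (suc n) (y ⊕ r)
  0≤r : 0ℚ ⩽ r
  0≤r = ⅟-nonneg 2
  0≤y : 0ℚ ⩽ y
  0≤y = ⊗-nonneg (#-nonneg j) 0≤r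
  half : r ≡ 1ℚ ⊖ r
  half = trans (solve 1 (λ r → r := (con 1ℚ :+ con 1ℚ) :* r :- r) refl r) (cong (_⊖ r) (trans (cong (_⊗ r) (sym (trans (#-suc 1) (cong (1ℚ ⊕_) #1)))) (⅟-inverse {2} (s≤s z≤n))))
  shrink : (1ℚ ⊖ r) ⊗ E ⩽ expo (suc n) y
  shrink = begin
    (1ℚ ⊖ r) ⊗ E                                     ≡⟨ solve 2 (λ r e → (con 1ℚ :- r) :* e := e :- r :* e) refl r E ⟩
    E ⊖ r ⊗ E                                        ≤⟨ ⊕-monoˡ (⊝ (r ⊗ E)) (⩽-trans (expo-step-≤ 0≤y 0≤r n) (⊕-monoʳ (expo (suc n) y) (⊗-monoˡ r 0≤r (expo-mono (ℕ.n≤1+n n) (⊕-nonneg 0≤y 0≤r) ⩽-refl)))) ⟩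
    expo (suc n) y ⊕ r ⊗ E ⊖ r ⊗ E                   ≡⟨ solve 2 (λ a b → a :+ b :- b := a) refl (expo (suc n) y) (r ⊗ E) ⟩
    expo (suc n) y                                   ∎

expo-bounded : ∀ {y} Y → 0ℚ ⩽ y → y ⩽ # Y → ∀ n → expo n y ⩽ # (2 ℕ.^ (Y * 2))
expo-bounded {y} Y 0≤y y≤ n = ⩽-trans (expo-mono {n} {n} ℕ.≤-refl 0≤y (⩽-trans y≤ (≡⇒⩽ Y≡))) (expo-half (Y * 2) n)
  where
  Y≡ : # Y ≡ # (Y * 2) ⊗ ⅟ 2
  Y≡ = sym (trans (cong (_⊗ ⅟ 2) (#-* Y 2)) (trans (ℚ.*-assoc (# Y) (# 2) (⅟ 2)) (trans (cong (# Y ⊗_) (⅟-inverse {2} (s≤s z≤n))) (ℚ.*-identityʳ (# Y)))))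

-- exp (j H m) ≥ (∏_{i ≤ m} (1 + 1/i))^j = (m + 1)^j
expo-harmonic : ∀ m y → 0ℚ ⩽ y → ∀ n → # (suc m) ⊗ expo n y ⩽ expo (m + n) (y ⊕ H m)
expo-harmonic zero y 0≤y n = ≡⇒⩽ (trans (trans (cong (_⊗ expo n y) #1) (ℚ.*-identityˡ (expo n y))) (cong (expo n) (sym (⊕-identityʳ y))))
expo-harmonic (suc m) y 0≤y n = begin
  # (suc (suc m)) ⊗ expo n y                                ≡⟨ cong (_⊗ expo n y) factor ⟩
  (1ℚ ⊕ a) ⊗ # (suc m) ⊗ expo n y                           ≡⟨ ℚ.*-assoc (1ℚ ⊕ a) (# (suc m)) (expo n y) ⟩
  (1ℚ ⊕ a) ⊗ (# (suc m) ⊗ expo n y)                         ≤⟨ ⊗-monoˡ (1ℚ ⊕ a) (⊕-nonneg 0≤1 0≤a) (expo-harmonic m y 0≤y n) ⟩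
  (1ℚ ⊕ a) ⊗ expo (m + n) (y ⊕ H m)                         ≡⟨ solve 2 (λ a e → (con 1ℚ :+ a) :* e := e :+ a :* e) refl a (expo (m + n) (y ⊕ H m)) ⟩
  expo (m + n) (y ⊕ H m) ⊕ a ⊗ expo (m + n) (y ⊕ H m)       ≤⟨ ⊕-monoˡ (a ⊗ expo (m + n) (y ⊕ H m)) (expo-mono (ℕ.n≤1+n (m + n)) 0≤yH ⩽-refl) ⟩
  expo (suc (m + n)) (y ⊕ H m) ⊕ a ⊗ expo (m + n) (y ⊕ H m) ≤⟨ expo-step-≥ 0≤yH 0≤a (m + n) ⟩
  expo (suc (m + n)) (y ⊕ H m ⊕ a)                          ≡⟨ cong (expo (suc (m + n))) (ℚ.+-assoc y (H m) a) ⟩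
  expo (suc m + n) (y ⊕ H (suc m))                          ∎
  where
  open ℚ.≤-Reasoning
  a = ⅟ (suc m)
  0≤a = ⅟-nonneg (suc m)
  0≤yH : 0ℚ ⩽ y ⊕ H m
  0≤yH = ⊕-nonneg 0≤y (H-nonneg m)
  factor : # (suc (suc m)) ≡ (1ℚ ⊕ a) ⊗ # (suc m)
  factor = trans (#-suc (suc m)) (trans (cong (_⊕ # (suc m)) (sym (⅟-inverse {suc m} (s≤s z≤n)))) (solve 2 (λ n a → n :* a :+ n := (con 1ℚ :+ a) :* n) refl (# (suc m)) a))

expo-power : ∀ m j → (# (suc m)) ^ℚ j ⩽ expo (j * m) (# j ⊗ H m)
expo-power m zero = ≡⇒⩽ (sym (expo-0 (# 0 ⊗ H m)))
expo-power m (suc j) = begin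
  # (suc m) ⊗ (# (suc m)) ^ℚ j                  ≤⟨ ⊗-monoˡ (# (suc m)) (#-nonneg (suc m)) (expo-power m j) ⟩
  # (suc m) ⊗ expo (j * m) (# j ⊗ H m)          ≤⟨ expo-harmonic m (# j ⊗ H m) (⊗-nonneg (#-nonneg j) (H-nonneg m)) (j * m) ⟩
  expo (m + j * m) (# j ⊗ H m ⊕ H m)            ≡⟨ cong (expo (m + j * m)) (trans (solve 2 (λ j h → j :* h :+ h := (con 1ℚ :+ j) :* h) refl (# j) (H m)) (cong (_⊗ H m) (sym (#-suc j)))) ⟩
  expo (suc j * m) (# (suc j) ⊗ H m)            ∎
  where open ℚ.≤-Reasoning

odd : ℕ → ℕ
odd k = suc (2 * k)

-- The factor 2 is included, so this truncates 2 artanh z, which is the logarithm of x at z =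
-- `cayley x`.
artanh : ℕ → ℚ → ℚ
artanh n z = # 2 ⊗ ∑ (suc n) (λ i → z ^ℚ odd (ℕ.pred i) ⊗ ⅟ (odd (ℕ.pred i)))

cayley : ℚ → ℚ
cayley x = (x ⊖ 1ℚ) ⊗ invℚ (x ⊕ 1ℚ)

logo : ℕ → ℚ → ℚ
logo n x = artanh n (cayley x)

logPartial≡ : ∀ n x → logPartial n x ≡ logo n x
logPartial≡ n x = cong₂ _⊗_ (sym (#-unfold 2)) (trans (sumℚ-upTo (λ k → (cayley x ^ℚ odd k) ⊗ invℚ (ℕ→ℚ (odd k))) (suc n))
  (∑-cong (suc n) λ i _ _ → cong (cayley x ^ℚ odd (ℕ.pred i) ⊗_) (invℚ-ℕ (odd (ℕ.pred i)))))

artanh-nonneg : ∀ n {z} → 0ℚ ⩽ z → 0ℚ ⩽ artanh n z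
artanh-nonneg n 0≤z = ⊗-nonneg (#-nonneg 2) (∑-nonneg (suc n) λ i _ _ → ⊗-nonneg (^ℚ-nonneg 0≤z (odd (ℕ.pred i))) (⅟-nonneg (odd (ℕ.pred i))))

artanh-mono : ∀ {m n z z′} → m ≤ n → 0ℚ ⩽ z → z ⩽ z′ → artanh m z ⩽ artanh n z′
artanh-mono {m} {n} {z} {z′} m≤n 0≤z z≤z′ = ⊗-monoˡ (# 2) (#-nonneg 2) (⩽-trans
  (∑-≤-ext (s≤s m≤n) λ i _ _ → ⊗-nonneg (^ℚ-nonneg 0≤z (odd (ℕ.pred i))) (⅟-nonneg (odd (ℕ.pred i))))
  (∑-mono (suc n) λ i _ _ → ⊗-monoʳ (⅟ (odd (ℕ.pred i))) (⅟-nonneg (odd (ℕ.pred i))) (^ℚ-mono 0≤z z≤z′ (odd (ℕ.pred i)))))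

module _ {x : ℚ} (1≤x : 1ℚ ⩽ x) where
  private
    0<x+1 : 0ℚ ≺ x ⊕ 1ℚ
    0<x+1 = ℚ.<-≤-trans 0<1 (≤⊕ˡ (⩽-trans 0≤1 1≤x))

  cayley≡ : cayley x ≡ 1ℚ ⊖ (1ℚ ⊕ 1ℚ) ⊗ invℚ (x ⊕ 1ℚ)
  cayley≡ = trans (solve 2 (λ x i → (x :- con 1ℚ) :* i := (x :+ con 1ℚ) :* i :- (con 1ℚ :+ con 1ℚ) :* i) refl x (invℚ (x ⊕ 1ℚ))) (cong (_⊖ (1ℚ ⊕ 1ℚ) ⊗ invℚ (x ⊕ 1ℚ)) (invℚ-inverseʳ 0<x+1))

  cayley-nonneg : 0ℚ ⩽ cayley x
  cayley-nonneg = ⊗-nonneg (x≤y⇒0≤y-x 1≤x) (≺⇒⩽ (invℚ-pos 0<x+1))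

  cayley-mono : ∀ {y} → x ⩽ y → cayley x ⩽ cayley y
  cayley-mono {y} x≤y = ⩽-trans (≡⇒⩽ cayley≡) (⩽-trans (⊕-monoʳ 1ℚ (ℚ.neg-antimono-≤ (⊗-monoˡ (1ℚ ⊕ 1ℚ) (⊕-nonneg 0≤1 0≤1) (invℚ-anti 0<x+1 (⊕-monoˡ 1ℚ x≤y)))))
    (≡⇒⩽ (sym (trans (solve 2 (λ x i → (x :- con 1ℚ) :* i := (x :+ con 1ℚ) :* i :- (con 1ℚ :+ con 1ℚ) :* i) refl y (invℚ (y ⊕ 1ℚ))) (cong (_⊖ (1ℚ ⊕ 1ℚ) ⊗ invℚ (y ⊕ 1ℚ)) (invℚ-inverseʳ (ℚ.<-≤-trans 0<x+1 (⊕-monoˡ 1ℚ x≤y))))))))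

logo-nonneg : ∀ n {x} → 1ℚ ⩽ x → 0ℚ ⩽ logo n x
logo-nonneg n 1≤x = artanh-nonneg n (cayley-nonneg 1≤x)

logo-mono : ∀ {m n x y} → m ≤ n → 1ℚ ⩽ x → x ⩽ y → logo m x ⩽ logo n y
logo-mono m≤n 1≤x x≤y = artanh-mono m≤n (cayley-nonneg 1≤x) (cayley-mono 1≤x x≤y)

geometric : ℕ → ℚ → ℚ
geometric n y = ∑ (suc n) (λ i → y ^ℚ (2 * ℕ.pred i))

geometric-sum : ∀ n y → geometric n y ⊗ (1ℚ ⊖ y ⊗ y) ≡ 1ℚ ⊖ y ^ℚ (2 * suc n)
geometric-sum zero y = solve 1 (λ y → (con 0ℚ :+ con 1ℚ) :* (con 1ℚ :- y :* y) := con 1ℚ :- y :* (y :* con 1ℚ)) refl y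
geometric-sum (suc n) y = begin
  (geometric n y ⊕ p) ⊗ (1ℚ ⊖ y ⊗ y)                     ≡⟨ ℚ.*-distribʳ-+ (1ℚ ⊖ y ⊗ y) (geometric n y) p ⟩
  geometric n y ⊗ (1ℚ ⊖ y ⊗ y) ⊕ p ⊗ (1ℚ ⊖ y ⊗ y)        ≡⟨ cong (_⊕ p ⊗ (1ℚ ⊖ y ⊗ y)) (geometric-sum n y) ⟩
  1ℚ ⊖ p ⊕ p ⊗ (1ℚ ⊖ y ⊗ y)                              ≡⟨ solve 2 (λ p y → con 1ℚ :- p :+ p :* (con 1ℚ :- y :* y) := con 1ℚ :- y :* (y :* p)) refl p y ⟩
  1ℚ ⊖ y ⊗ (y ⊗ p)                                       ≡⟨ cong (λ m → 1ℚ ⊖ y ^ℚ m) (sym (ℕ.*-suc 2 (suc n))) ⟩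
  1ℚ ⊖ y ^ℚ (2 * suc (suc n))                            ∎
  where
  open ≡-Reasoning
  p = y ^ℚ (2 * suc n)

geometric-nonneg : ∀ n {y} → 0ℚ ⩽ y → 0ℚ ⩽ geometric n y
geometric-nonneg n 0≤y = ∑-nonneg (suc n) λ i _ _ → ^ℚ-nonneg 0≤y (2 * ℕ.pred i)

-- `geometric` is the derivative of the truncated artanh series, with the denominators odd k
-- cancelled. It is taken at the right end here and at the left end in the lower bound.
artanh-secant-≤ : ∀ n {u a} → 0ℚ ⩽ u → 0ℚ ⩽ a → artanh n (u ⊕ a) ⩽ artanh n u ⊕ # 2 ⊗ (a ⊗ geometric n (u ⊕ a))
artanh-secant-≤ n {u} {a} 0≤u 0≤a = ⩽-trans (⊗-monoˡ (# 2) (#-nonneg 2) (⩽-trans (∑-mono (suc n) λ i _ _ → t (ℕ.pred i))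
  (≡⇒⩽ (trans (∑-⊕ (suc n) (λ i → u ^ℚ odd (ℕ.pred i) ⊗ ⅟ (odd (ℕ.pred i))) (λ i → a ⊗ (u ⊕ a) ^ℚ (2 * ℕ.pred i))) (cong (∑ (suc n) (λ i → u ^ℚ odd (ℕ.pred i) ⊗ ⅟ (odd (ℕ.pred i))) ⊕_) (∑-⊗ (suc n) a (λ i → (u ⊕ a) ^ℚ (2 * ℕ.pred i))))))))
  (≡⇒⩽ (ℚ.*-distribˡ-+ (# 2) (∑ (suc n) (λ i → u ^ℚ odd (ℕ.pred i) ⊗ ⅟ (odd (ℕ.pred i)))) (a ⊗ geometric n (u ⊕ a))))
  where
  t : ∀ k → (u ⊕ a) ^ℚ odd k ⊗ ⅟ (odd k) ⩽ u ^ℚ odd k ⊗ ⅟ (odd k) ⊕ a ⊗ (u ⊕ a) ^ℚ (2 * k)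
  t k = ⩽-trans (⊗-monoʳ (⅟ (odd k)) (⅟-nonneg (odd k)) (^-secant-≤ 0≤u 0≤a (2 * k))) (≡⇒⩽ (trans (solve 5 (λ p n a q r → (p :+ n :* (a :* q)) :* r := p :* r :+ n :* r :* (a :* q)) refl (u ^ℚ odd k) (# (odd k)) a ((u ⊕ a) ^ℚ (2 * k)) (⅟ (odd k)))
    (cong (u ^ℚ odd k ⊗ ⅟ (odd k) ⊕_) (trans (cong (_⊗ (a ⊗ (u ⊕ a) ^ℚ (2 * k))) (⅟-inverse {odd k} (s≤s z≤n))) (ℚ.*-identityˡ (a ⊗ (u ⊕ a) ^ℚ (2 * k)))))))

artanh-secant-≥ : ∀ n {u a} → 0ℚ ⩽ u → 0ℚ ⩽ a → artanh n u ⊕ # 2 ⊗ (a ⊗ geometric n u) ⩽ artanh n (u ⊕ a)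
artanh-secant-≥ n {u} {a} 0≤u 0≤a = ⩽-trans (≡⇒⩽ (sym (ℚ.*-distribˡ-+ (# 2) (∑ (suc n) (λ i → u ^ℚ odd (ℕ.pred i) ⊗ ⅟ (odd (ℕ.pred i)))) (a ⊗ geometric n u))))
  (⊗-monoˡ (# 2) (#-nonneg 2) (⩽-trans (≡⇒⩽ (sym (trans (∑-⊕ (suc n) (λ i → u ^ℚ odd (ℕ.pred i) ⊗ ⅟ (odd (ℕ.pred i))) (λ i → a ⊗ u ^ℚ (2 * ℕ.pred i))) (cong (∑ (suc n) (λ i → u ^ℚ odd (ℕ.pred i) ⊗ ⅟ (odd (ℕ.pred i))) ⊕_) (∑-⊗ (suc n) a (λ i → u ^ℚ (2 * ℕ.pred i)))))))
    (∑-mono (suc n) λ i _ _ → t (ℕ.pred i))))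
  where
  t : ∀ k → u ^ℚ odd k ⊗ ⅟ (odd k) ⊕ a ⊗ u ^ℚ (2 * k) ⩽ (u ⊕ a) ^ℚ odd k ⊗ ⅟ (odd k)
  t k = ⩽-trans (≡⇒⩽ (sym (trans (solve 5 (λ p n a q r → (p :+ n :* (a :* q)) :* r := p :* r :+ n :* r :* (a :* q)) refl (u ^ℚ odd k) (# (odd k)) a (u ^ℚ (2 * k)) (⅟ (odd k)))
    (cong (u ^ℚ odd k ⊗ ⅟ (odd k) ⊕_) (trans (cong (_⊗ (a ⊗ u ^ℚ (2 * k))) (⅟-inverse {odd k} (s≤s z≤n))) (ℚ.*-identityˡ (a ⊗ u ^ℚ (2 * k))))))))
    (⊗-monoʳ (⅟ (odd k)) (⅟-nonneg (odd k)) (^-secant-≥ 0≤u 0≤a (2 * k)))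

-- For partial sums, a form of 1 / (j + 1) ≤ log (j + 1) - log j ≤ 1 / j.
module _ (j : ℕ) (0<j : 0 < j) where
  private
    u v r t a two : ℚ
    two = 1ℚ ⊕ 1ℚ
    r = ⅟ (suc j)
    t = ⅟ (suc (suc j))
    u = cayley (# j)
    v = cayley (# (suc j))
    -- The increment of `cayley` from j to j + 1: 2/(j + 1) - 2/(j + 2) = 2/((j + 1)(j + 2)).
    a = two ⊗ (r ⊗ t)
    2≡ : # 2 ≡ two
    2≡ = trans (#-suc 1) (cong (1ℚ ⊕_) #1)
    cay : ∀ m → 0 < m → cayley (# m) ≡ 1ℚ ⊖ two ⊗ ⅟ (suc m)
    cay m 0<m = trans (cayley≡ (1≤# 0<m)) (cong (λ x → 1ℚ ⊖ two ⊗ x) (trans (cong invℚ (trans (ℚ.+-comm (# m) 1ℚ) (sym (#-suc m)))) (sym (⅟-unfold (suc m)))))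
    u≡ : u ≡ 1ℚ ⊖ two ⊗ r
    u≡ = cay j 0<j
    v≡ : v ≡ 1ℚ ⊖ two ⊗ t
    v≡ = cay (suc j) (s≤s z≤n)
    r-t : r ⊖ t ≡ r ⊗ t
    r-t = ⅟-telescope {suc (suc j)} (s≤s (s≤s z≤n))
    ⅟j-r : ⅟ j ⊖ r ≡ ⅟ j ⊗ r
    ⅟j-r = ⅟-telescope {suc j} (s≤s 0<j)
    0≤u : 0ℚ ⩽ u
    0≤u = cayley-nonneg (1≤# 0<j)
    0≤v : 0ℚ ⩽ v
    0≤v = cayley-nonneg (1≤# {suc j} (s≤s z≤n))
    0≤r = ⅟-nonneg (suc j)
    0≤t = ⅟-nonneg (suc (suc j))
    0≤a : 0ℚ ⩽ a
    0≤a = ⊗-nonneg (⊕-nonneg 0≤1 0≤1) (⊗-nonneg 0≤r 0≤t)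
    u+a : u ⊕ a ≡ v
    u+a = trans (cong₂ (λ x y → x ⊕ two ⊗ y) u≡ (sym r-t)) (trans (solve 3 (λ w r t → con 1ℚ :- w :* r :+ w :* (r :- t) := con 1ℚ :- w :* t) refl two r t) (sym v≡))
    1-v² : 1ℚ ⊖ v ⊗ v ≡ two ⊗ two ⊗ (t ⊗ (1ℚ ⊖ t))
    1-v² = trans (cong (λ x → 1ℚ ⊖ x ⊗ x) v≡) (solve 1 (λ t → let w = con 1ℚ :+ con 1ℚ in con 1ℚ :- (con 1ℚ :- w :* t) :* (con 1ℚ :- w :* t) := w :* w :* (t :* (con 1ℚ :- t))) refl t)
    1-u² : 1ℚ ⊖ u ⊗ u ≡ two ⊗ two ⊗ (r ⊗ (1ℚ ⊖ r))
    1-u² = trans (cong (λ x → 1ℚ ⊖ x ⊗ x) u≡) (solve 1 (λ t → let w = con 1ℚ :+ con 1ℚ in con 1ℚ :- (con 1ℚ :- w :* t) :* (con 1ℚ :- w :* t) := w :* w :* (t :* (con 1ℚ :- t))) refl r)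
    0≤4 : 0ℚ ⩽ two ⊗ two
    0≤4 = ⊗-nonneg (⊕-nonneg 0≤1 0≤1) (⊕-nonneg 0≤1 0≤1)

  logo-suc-≤ : ∀ n → logo n (# (suc j)) ⩽ logo n (# j) ⊕ ⅟ j
  logo-suc-≤ n = begin
    artanh n v                                           ≡⟨ cong (artanh n) (sym u+a) ⟩
    artanh n (u ⊕ a)                                     ≤⟨ artanh-secant-≤ n 0≤u 0≤a ⟩
    artanh n u ⊕ # 2 ⊗ (a ⊗ geometric n (u ⊕ a))         ≡⟨ cong (λ x → artanh n u ⊕ # 2 ⊗ (a ⊗ geometric n x)) u+a ⟩
    artanh n u ⊕ # 2 ⊗ (a ⊗ G)                           ≤⟨ ⊕-monoʳ (artanh n u) bound ⟩
    artanh n u ⊕ ⅟ j                                     ∎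
    where
    open ℚ.≤-Reasoning
    G = geometric n v
    0≤G = geometric-nonneg n 0≤v
    r≤ : r ⩽ ⅟ j ⊗ (1ℚ ⊖ t)
    r≤ = by-excess (⅟ j ⊗ (r ⊗ t)) (⊗-nonneg (⅟-nonneg j) (⊗-nonneg 0≤r 0≤t)) (trans (cong (λ x → r ⊕ ⅟ j ⊗ x) (sym r-t)) (trans (solve 3 (λ r i t → r :+ i :* (r :- t) := r :+ i :* r :- i :* t) refl r (⅟ j) t)
      (trans (cong (λ x → r ⊕ x ⊖ ⅟ j ⊗ t) (sym ⅟j-r)) (solve 3 (λ r i t → r :+ (i :- r) :- i :* t := i :* (con 1ℚ :- t)) refl r (⅟ j) t))))
    bound : # 2 ⊗ (a ⊗ G) ⩽ ⅟ j
    bound = begin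
      # 2 ⊗ (a ⊗ G)                                      ≡⟨ trans (cong (_⊗ (a ⊗ G)) 2≡) (solve 4 (λ w r t g → w :* (w :* (r :* t) :* g) := r :* (w :* w :* t :* g)) refl two r t G) ⟩
      r ⊗ (two ⊗ two ⊗ t ⊗ G)                            ≤⟨ ⊗-monoʳ (two ⊗ two ⊗ t ⊗ G) (⊗-nonneg (⊗-nonneg 0≤4 0≤t) 0≤G) r≤ ⟩
      ⅟ j ⊗ (1ℚ ⊖ t) ⊗ (two ⊗ two ⊗ t ⊗ G)               ≡⟨ solve 4 (λ i t w g → i :* (con 1ℚ :- t) :* (w :* t :* g) := i :* (g :* (w :* (t :* (con 1ℚ :- t))))) refl (⅟ j) t (two ⊗ two) G ⟩
      ⅟ j ⊗ (G ⊗ (two ⊗ two ⊗ (t ⊗ (1ℚ ⊖ t))))           ≡⟨ cong (λ x → ⅟ j ⊗ (G ⊗ x)) 1-v² ⟨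
      ⅟ j ⊗ (G ⊗ (1ℚ ⊖ v ⊗ v))                           ≡⟨ cong (⅟ j ⊗_) (geometric-sum n v) ⟩
      ⅟ j ⊗ (1ℚ ⊖ v ^ℚ (2 * suc n))                      ≤⟨ ⊗-monoˡ (⅟ j) (⅟-nonneg j) (by-excess (v ^ℚ (2 * suc n)) (^ℚ-nonneg 0≤v (2 * suc n)) (solve 1 (λ x → con 1ℚ :- x :+ x := con 1ℚ) refl (v ^ℚ (2 * suc n)))) ⟩
      ⅟ j ⊗ 1ℚ                                           ≡⟨ ℚ.*-identityʳ (⅟ j) ⟩
      ⅟ j                                                ∎

  logo-suc-≥ : ∀ n {y} → u ⩽ y → logo n (# j) ⊕ ⅟ (suc j) ⊗ (1ℚ ⊖ y ^ℚ (2 * suc n)) ⩽ logo n (# (suc j))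
  logo-suc-≥ n {y} u≤y = begin
    artanh n u ⊕ r ⊗ (1ℚ ⊖ y ^ℚ (2 * suc n))             ≤⟨ ⊕-monoʳ (artanh n u) bound ⟩
    artanh n u ⊕ # 2 ⊗ (a ⊗ G)                           ≤⟨ artanh-secant-≥ n 0≤u 0≤a ⟩
    artanh n (u ⊕ a)                                     ≡⟨ cong (artanh n) u+a ⟩
    artanh n v                                           ∎
    where
    open ℚ.≤-Reasoning
    G = geometric n u
    0≤G = geometric-nonneg n 0≤u
    t≤r : t ⩽ r
    t≤r = ⅟-anti {suc j} (s≤s z≤n) (ℕ.n≤1+n (suc j))
    r² : r ⊗ (1ℚ ⊖ r) ⩽ t
    r² = begin
      r ⊗ (1ℚ ⊖ r)       ≡⟨ solve 1 (λ r → r :* (con 1ℚ :- r) := r :- r :* r) refl r ⟩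
      r ⊖ r ⊗ r          ≤⟨ ⊕-monoʳ r (ℚ.neg-antimono-≤ (⊗-monoˡ r 0≤r t≤r)) ⟩
      r ⊖ r ⊗ t          ≡⟨ cong (r ⊖_) r-t ⟨
      r ⊖ (r ⊖ t)        ≡⟨ solve 2 (λ r t → r :- (r :- t) := t) refl r t ⟩
      t                  ∎
    bound : r ⊗ (1ℚ ⊖ y ^ℚ (2 * suc n)) ⩽ # 2 ⊗ (a ⊗ G)
    bound = begin
      r ⊗ (1ℚ ⊖ y ^ℚ (2 * suc n))                        ≤⟨ ⊗-monoˡ r 0≤r (⊕-monoʳ 1ℚ (ℚ.neg-antimono-≤ (^ℚ-mono 0≤u u≤y (2 * suc n)))) ⟩
      r ⊗ (1ℚ ⊖ u ^ℚ (2 * suc n))                        ≡⟨ cong (r ⊗_) (geometric-sum n u) ⟨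
      r ⊗ (G ⊗ (1ℚ ⊖ u ⊗ u))                             ≡⟨ cong (λ x → r ⊗ (G ⊗ x)) 1-u² ⟩
      r ⊗ (G ⊗ (two ⊗ two ⊗ (r ⊗ (1ℚ ⊖ r))))             ≤⟨ ⊗-monoˡ r 0≤r (⊗-monoˡ G 0≤G (⊗-monoˡ (two ⊗ two) 0≤4 r²)) ⟩
      r ⊗ (G ⊗ (two ⊗ two ⊗ t))                          ≡⟨ trans (solve 4 (λ r g w t → r :* (g :* (w :* w :* t)) := w :* (w :* (r :* t) :* g)) refl r G two t) (cong (_⊗ (a ⊗ G)) (sym 2≡)) ⟩
      # 2 ⊗ (a ⊗ G)                                      ∎

logo-1 : ∀ n → logo n (# 1) ≡ 0ℚ
logo-1 n = trans (cong (# 2 ⊗_) (∑-zero (suc n) λ i _ _ → trans (cong (λ z → z ^ℚ odd (ℕ.pred i) ⊗ ⅟ (odd (ℕ.pred i))) cay) (trans (cong (_⊗ ⅟ (odd (ℕ.pred i))) (ℚ.*-zeroˡ (0ℚ ^ℚ (2 * ℕ.pred i)))) (ℚ.*-zeroˡ (⅟ (odd (ℕ.pred i))))))) (ℚ.*-zeroʳ (# 2))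
  where
  cay : cayley (# 1) ≡ 0ℚ
  cay = trans (cong (λ t → (t ⊖ 1ℚ) ⊗ invℚ (t ⊕ 1ℚ)) #1) (ℚ.*-zeroˡ (invℚ (1ℚ ⊕ 1ℚ)))

logo≤H : ∀ n j → 0 < j → logo n (# j) ⩽ H j
logo≤H n (suc zero) _ = ⩽-trans (≡⇒⩽ (logo-1 n)) (H-nonneg 1)
logo≤H n (suc j@(suc _)) _ = begin
  logo n (# (suc j))               ≤⟨ logo-suc-≤ j (s≤s z≤n) n ⟩
  logo n (# j) ⊕ ⅟ j               ≤⟨ strong j (s≤s z≤n) ⟩
  H j                              ≤⟨ H-mono (ℕ.n≤1+n j) ⟩
  H (suc j)                        ∎
  where
  open ℚ.≤-Reasoning
  strong : ∀ j → 0 < j → logo n (# j) ⊕ ⅟ j ⩽ H j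
  strong (suc zero) _ = ≡⇒⩽ (cong (_⊕ ⅟ 1) (logo-1 n))
  strong (suc j@(suc _)) _ = ⊕-monoˡ (⅟ (suc j)) (⩽-trans (logo-suc-≤ j (s≤s z≤n) n) (strong j (s≤s z≤n)))

-- The increments 1/(j + 1) add up to H N - 1. Truncation costs each of them a factor, and the
-- factor at N, where `cayley` is largest, serves for all j.
logo≥ : ∀ n N → 0 < N → (H N ⊖ 1ℚ) ⊗ (1ℚ ⊖ cayley (# N) ^ℚ (2 * suc n)) ⩽ logo n (# N)
logo≥ n N 0<N = go N 0<N ℕ.≤-refl
  where
  open ℚ.≤-Reasoning
  y = cayley (# N)
  q = 1ℚ ⊖ y ^ℚ (2 * suc n)
  go : ∀ j → 0 < j → j ≤ N → (H j ⊖ 1ℚ) ⊗ q ⩽ logo n (# j)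
  go (suc zero) _ _ = ≡⇒⩽ (trans (cong (λ x → (x ⊖ 1ℚ) ⊗ q) H1) (trans (ℚ.*-zeroˡ q) (sym (logo-1 n))))
  go (suc j@(suc _)) _ j<N = begin
    (H j ⊕ ⅟ (suc j) ⊖ 1ℚ) ⊗ q           ≡⟨ solve 3 (λ h r q → (h :+ r :- con 1ℚ) :* q := (h :- con 1ℚ) :* q :+ r :* q) refl (H j) (⅟ (suc j)) q ⟩
    (H j ⊖ 1ℚ) ⊗ q ⊕ ⅟ (suc j) ⊗ q       ≤⟨ ⊕-monoˡ (⅟ (suc j) ⊗ q) (go j (s≤s z≤n) (ℕ.<⇒≤ j<N)) ⟩
    logo n (# j) ⊕ ⅟ (suc j) ⊗ q         ≤⟨ logo-suc-≥ j (s≤s z≤n) n (cayley-mono (1≤# {j} (s≤s z≤n)) (#-mono (ℕ.<⇒≤ j<N))) ⟩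
    logo n (# (suc j))                   ∎

power-decay : ∀ {θ} → 0ℚ ⩽ θ → θ ⩽ 1ℚ → ∀ m → (1ℚ ⊖ θ) ^ℚ m ⊗ (1ℚ ⊕ # m ⊗ θ) ⩽ 1ℚ
power-decay {θ} 0≤θ θ≤1 zero = ≡⇒⩽ (trans (cong (λ t → 1ℚ ⊗ (1ℚ ⊕ t ⊗ θ)) #0) (solve 1 (λ θ → con 1ℚ :* (con 1ℚ :+ con 0ℚ :* θ) := con 1ℚ) refl θ))
power-decay {θ} 0≤θ θ≤1 (suc m) = begin
  (1ℚ ⊖ θ) ⊗ p ⊗ (1ℚ ⊕ # (suc m) ⊗ θ)     ≡⟨ trans (cong (λ t → (1ℚ ⊖ θ) ⊗ p ⊗ (1ℚ ⊕ t ⊗ θ)) (#-suc m)) (solve 3 (λ θ p m → (con 1ℚ :- θ) :* p :* (con 1ℚ :+ (con 1ℚ :+ m) :* θ) := p :* ((con 1ℚ :- θ) :* (con 1ℚ :+ (con 1ℚ :+ m) :* θ))) refl θ p (# m)) ⟩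
  p ⊗ ((1ℚ ⊖ θ) ⊗ (1ℚ ⊕ (1ℚ ⊕ # m) ⊗ θ))  ≤⟨ ⊗-monoˡ p (^ℚ-nonneg (x≤y⇒0≤y-x θ≤1) m) (by-excess ((1ℚ ⊕ # m) ⊗ (θ ⊗ θ)) (⊗-nonneg (⊕-nonneg 0≤1 (#-nonneg m)) (⊗-nonneg 0≤θ 0≤θ)) (solve 2 (λ θ m → (con 1ℚ :- θ) :* (con 1ℚ :+ (con 1ℚ :+ m) :* θ) :+ (con 1ℚ :+ m) :* (θ :* θ) := con 1ℚ :+ m :* θ) refl θ (# m))) ⟩
  p ⊗ (1ℚ ⊕ # m ⊗ θ)                      ≤⟨ power-decay 0≤θ θ≤1 m ⟩
  1ℚ                                      ∎
  where
  open ℚ.≤-Reasoning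
  p = (1ℚ ⊖ θ) ^ℚ m

-- Of the loss 2, one unit comes from H 1 = 1 against log 1 = 0. The other covers the truncation
-- once n is large in terms of N.
logo-eventually : ∀ N → 0 < N → ∃[ k ] (∀ n → k ≤ n → H N ⊖ (1ℚ ⊕ 1ℚ) ⩽ logo n (# N))
logo-eventually N 0<N = k , λ n k≤n → ⩽-trans (bound n k≤n) (logo≥ n N 0<N)
  where
  open ℚ.≤-Reasoning
  two = 1ℚ ⊕ 1ℚ
  θ = two ⊗ ⅟ (suc N)
  y = cayley (# N)
  y≡ : y ≡ 1ℚ ⊖ θ
  y≡ = trans (cayley≡ (1≤# 0<N)) (cong (λ x → 1ℚ ⊖ two ⊗ x) (trans (cong invℚ (trans (ℚ.+-comm (# N) 1ℚ) (sym (#-suc N)))) (sym (⅟-unfold (suc N)))))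
  0≤θ : 0ℚ ⩽ θ
  0≤θ = ⊗-nonneg (⊕-nonneg 0≤1 0≤1) (⅟-nonneg (suc N))
  0≤y : 0ℚ ⩽ y
  0≤y = cayley-nonneg (1≤# 0<N)
  θ≤1 : θ ⩽ 1ℚ
  θ≤1 = 0≤y-x⇒x≤y (⩽-trans 0≤y (≡⇒⩽ y≡))
  k = suc N * N
  -- with m ≥ N (N + 1) the power is at most 1 / N ≤ 1 / H N
  small : ∀ m → k ≤ m → # N ⊗ y ^ℚ m ⩽ 1ℚ
  small m k≤m = begin
    # N ⊗ y ^ℚ m                    ≡⟨ trans (ℚ.*-comm (# N) (y ^ℚ m)) (cong (λ x → x ^ℚ m ⊗ # N) y≡) ⟩
    (1ℚ ⊖ θ) ^ℚ m ⊗ # N             ≤⟨ ⊗-monoˡ ((1ℚ ⊖ θ) ^ℚ m) (^ℚ-nonneg (x≤y⇒0≤y-x θ≤1) m) N≤ ⟩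
    (1ℚ ⊖ θ) ^ℚ m ⊗ (1ℚ ⊕ # m ⊗ θ)  ≤⟨ power-decay 0≤θ θ≤1 m ⟩
    1ℚ                              ∎
    where
    N≤ : # N ⩽ 1ℚ ⊕ # m ⊗ θ
    N≤ = begin
      # N                           ≡⟨ trans (sym (ℚ.*-identityʳ (# N))) (cong (# N ⊗_) (sym (⅟-inverse {suc N} (s≤s z≤n)))) ⟩
      # N ⊗ (# (suc N) ⊗ ⅟ (suc N)) ≡⟨ trans (sym (ℚ.*-assoc (# N) (# (suc N)) (⅟ (suc N)))) (cong (_⊗ ⅟ (suc N)) (trans (ℚ.*-comm (# N) (# (suc N))) (sym (#-* (suc N) N)))) ⟩
      # k ⊗ ⅟ (suc N)               ≤⟨ ⊗-mono (#-nonneg k) (#-mono k≤m) (⅟-nonneg (suc N)) (⩽-trans (≡⇒⩽ (sym (ℚ.*-identityˡ (⅟ (suc N))))) (⊗-monoʳ (⅟ (suc N)) (⅟-nonneg (suc N)) (≤⊕ʳ {1ℚ} {1ℚ} 0≤1))) ⟩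
      # m ⊗ θ                       ≤⟨ ≤⊕ˡ 0≤1 ⟩
      1ℚ ⊕ # m ⊗ θ                  ∎
  bound : ∀ n → k ≤ n → H N ⊖ two ⩽ (H N ⊖ 1ℚ) ⊗ (1ℚ ⊖ y ^ℚ (2 * suc n))
  bound n k≤n = begin
    H N ⊖ two                            ≡⟨ solve 1 (λ h → h :- (con 1ℚ :+ con 1ℚ) := h :- con 1ℚ :- con 1ℚ) refl (H N) ⟩
    H N ⊖ 1ℚ ⊖ 1ℚ                        ≤⟨ ⊕-monoʳ (H N ⊖ 1ℚ) (ℚ.neg-antimono-≤ (small m (ℕ.≤-trans k≤n (ℕ.≤-trans (ℕ.n≤1+n n) (ℕ.m≤n*m (suc n) 2))))) ⟩
    H N ⊖ 1ℚ ⊖ # N ⊗ p                   ≤⟨ ⊕-monoʳ (H N ⊖ 1ℚ) (ℚ.neg-antimono-≤ (⊗-monoʳ p 0≤p (⩽-trans (by-excess {H N ⊖ 1ℚ} 1ℚ 0≤1 (solve 1 (λ h → h :- con 1ℚ :+ con 1ℚ := h) refl (H N))) (H≤# N)))) ⟩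
    H N ⊖ 1ℚ ⊖ (H N ⊖ 1ℚ) ⊗ p            ≡⟨ solve 2 (λ h p → h :- con 1ℚ :- (h :- con 1ℚ) :* p := (h :- con 1ℚ) :* (con 1ℚ :- p)) refl (H N) p ⟩
    (H N ⊖ 1ℚ) ⊗ (1ℚ ⊖ p)                ∎
    where
    m = 2 * suc n
    p = y ^ℚ m
    0≤p = ^ℚ-nonneg 0≤y m

-- Real numbers

cauchy-cong : ∀ {s s′} → (∀ n → s n ≡ s′ n) → IsCauchy s → IsCauchy s′
cauchy-cong e c ε 0<ε with c ε 0<ε
... | k , p = k , λ m n k≤m k≤n → ⩽-trans (≡⇒⩽ (cong₂ (λ x y → ∥ x ⊖ y ∥) (sym (e m)) (sym (e n)))) (p m n k≤m k≤n)

cauchy-const : ∀ x → IsCauchy (λ _ → x)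
cauchy-const x = cauchy (ℚ→ℝ x)

private
  halves : ∀ ε → 0ℚ ≺ ε → ∃[ δ ] (0ℚ ≺ δ × δ ⊕ δ ≡ ε)
  halves ε 0<ε = ε ⊗ ⅟ 2 , ⊗-pos 0<ε (⅟-pos {2} (s≤s z≤n)) , trans (sym (ℚ.*-distribˡ-+ ε (⅟ 2) (⅟ 2)))
    (trans (cong (ε ⊗_) (trans (solve 1 (λ r → r :+ r := (con 1ℚ :+ con 1ℚ) :* r) refl (⅟ 2)) (trans (cong (_⊗ ⅟ 2) (sym (trans (#-suc 1) (cong (1ℚ ⊕_) #1)))) (⅟-inverse {2} (s≤s z≤n))))) (ℚ.*-identityʳ ε))

  cauchy-lift : ∀ (f : ℚ → ℚ → ℚ) → (∀ a b c d → ∥ f a b ⊖ f c d ∥ ⩽ ∥ a ⊖ c ∥ ⊕ ∥ b ⊖ d ∥) →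
    ∀ s s′ → IsCauchy s → IsCauchy s′ → IsCauchy (λ n → f (s n) (s′ n))
  cauchy-lift f nonexp s s′ c c′ ε 0<ε = k ℕ.⊔ k′ , λ m n q r → ⩽-trans (⩽-trans (nonexp (s m) (s′ m) (s n) (s′ n))
    (⊕-mono (proj₂ (c δ 0<δ) m n (ℕ.≤-trans (ℕ.m≤m⊔n k k′) q) (ℕ.≤-trans (ℕ.m≤m⊔n k k′) r))
            (proj₂ (c′ δ 0<δ) m n (ℕ.≤-trans (ℕ.m≤n⊔m k k′) q) (ℕ.≤-trans (ℕ.m≤n⊔m k k′) r)))) (≡⇒⩽ (proj₂ (proj₂ (halves ε 0<ε))))
    where
    δ = proj₁ (halves ε 0<ε)
    0<δ = proj₁ (proj₂ (halves ε 0<ε))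
    k = proj₁ (c δ 0<δ)
    k′ = proj₁ (c′ δ 0<δ)

cauchy-⊕ : ∀ s s′ → IsCauchy s → IsCauchy s′ → IsCauchy (λ n → s n ⊕ s′ n)
cauchy-⊕ = cauchy-lift _⊕_ λ a b c d → ⩽-trans (≡⇒⩽ (cong ∥_∥ (solve 4 (λ a b c d → a :+ b :- (c :+ d) := (a :- c) :+ (b :- d)) refl a b c d))) (∥∥-⊕ (a ⊖ c) (b ⊖ d))

cauchy-⊖ : ∀ s s′ → IsCauchy s → IsCauchy s′ → IsCauchy (λ n → s n ⊖ s′ n)
cauchy-⊖ = cauchy-lift _⊖_ λ a b c d → ⩽-trans (≡⇒⩽ (cong ∥_∥ (solve 4 (λ a b c d → a :- b :- (c :- d) := (a :- c) :- (b :- d)) refl a b c d))) (ℚ.∣p-q∣≤∣p∣+∣q∣ (a ⊖ c) (b ⊖ d))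

private
  swap-sign : ∀ a c → ∥ a ⊖ c ∥ ≡ ∥ c ⊖ a ∥
  swap-sign a c = trans (sym (ℚ.∣-p∣≡∣p∣ (a ⊖ c))) (cong ∥_∥ (solve 2 (λ a c → :- (a :- c) := c :- a) refl a c))

  ≤+∥∥ : ∀ a c → a ⩽ c ⊕ ∥ a ⊖ c ∥
  ≤+∥∥ a c = ⩽-trans (≡⇒⩽ (solve 2 (λ a c → a := c :+ (a :- c)) refl a c)) (⊕-monoʳ c (x≤∥x∥ (a ⊖ c)))

  by-bounds : ∀ {x y e} → x ⩽ y ⊕ e → y ⩽ x ⊕ e → ∥ x ⊖ y ∥ ⩽ e
  by-bounds {x} {y} {e} p q = ∥∥-intro
    (⩽-trans (⊕-monoˡ (⊝ y) p) (≡⇒⩽ (solve 2 (λ y e → y :+ e :- y := e) refl y e)))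
    (⩽-trans (≡⇒⩽ (solve 2 (λ x y → :- (x :- y) := y :- x) refl x y)) (⩽-trans (⊕-monoˡ (⊝ x) q) (≡⇒⩽ (solve 2 (λ y e → y :+ e :- y := e) refl x e))))

cauchy-⊔ : ∀ s s′ → IsCauchy s → IsCauchy s′ → IsCauchy (λ n → s n ℚ.⊔ s′ n)
cauchy-⊔ = cauchy-lift ℚ._⊔_ λ a b c d → by-bounds (half a b c d) (⩽-trans (half c d a b) (≡⇒⩽ (cong₂ (λ x y → a ℚ.⊔ b ⊕ (x ⊕ y)) (swap-sign c a) (swap-sign d b))))
  where
  half : ∀ a b c d → a ℚ.⊔ b ⩽ c ℚ.⊔ d ⊕ (∥ a ⊖ c ∥ ⊕ ∥ b ⊖ d ∥)
  half a b c d = ℚ.⊔-lub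
    (⩽-trans (≤+∥∥ a c) (⊕-mono (ℚ.p≤p⊔q c d) (≤⊕ʳ (∥∥-nonneg (b ⊖ d)))))
    (⩽-trans (≤+∥∥ b d) (⊕-mono (ℚ.p≤q⊔p c d) (≤⊕ˡ (∥∥-nonneg (a ⊖ c)))))

cauchy-∥∥ : ∀ s → IsCauchy s → IsCauchy (λ n → ∥ s n ∥)
cauchy-∥∥ s c = cauchy-lift (λ a _ → ∥ a ∥) (λ a b c d → ⩽-trans (by-bounds (half a c) (⩽-trans (half c a) (≡⇒⩽ (cong (∥ a ∥ ⊕_) (swap-sign c a))))) (≤⊕ʳ (∥∥-nonneg (b ⊖ d)))) s s c c
  where
  half : ∀ a c → ∥ a ∥ ⩽ ∥ c ∥ ⊕ ∥ a ⊖ c ∥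
  half a c = ⩽-trans (≡⇒⩽ (cong ∥_∥ (solve 2 (λ a c → a := c :+ (a :- c)) refl a c))) (∥∥-⊕ c (a ⊖ c))

cauchy-bounded : ∀ {s} → IsCauchy s → ∃[ K ] ∃[ k ] (∀ n → k ≤ n → ∥ s n ∥ ⩽ # K)
cauchy-bounded {s} c with c 1ℚ 0<1
... | k , p with archimedes (∥ s k ∥ ⊕ 1ℚ)
... | K , q = K , k , λ n k≤n → ⩽-trans (≡⇒⩽ (cong ∥_∥ (solve 2 (λ a b → a := b :+ (a :- b)) refl (s n) (s k)))) (⩽-trans (∥∥-⊕ (s k) (s n ⊖ s k)) (⩽-trans (⊕-monoʳ ∥ s k ∥ (p n k k≤n ℕ.≤-refl)) q))

-- `start` is needed for the iterated logarithm, whose partial sums are controlled only from the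
-- index on at which the inner logarithm has reached 1.
record MonotoneBounded (s : ℕ → ℚ) : Set where
  field
    start    : ℕ
    monotone : ∀ {m n} → start ≤ m → m ≤ n → s m ⩽ s n
    bound    : ℚ
    bounded  : ∀ {n} → start ≤ n → s n ⩽ bound

open MonotoneBounded

module Reals (em : ExcludedMiddle 0ℓ) where

  open Classical em

  -- By excluded middle the sequence either stays within ε of its present value or climbs by more
  -- than ε at some later index. J climbs would exceed the bound.
  monotone-cauchy : ∀ {s} → MonotoneBounded s → IsCauchy s
  monotone-cauchy {s} M ε 0<ε = conclude (climb J)
    where
    Settled : Set
    Settled = ∃[ k ] (start M ≤ k × (∀ n → k ≤ n → s n ⩽ s k ⊕ ε))
    s₀ = s (start M)
    J : ℕ
    J = suc (proj₁ (archimedes ((bound M ⊖ s₀) ⊗ invℚ ε)))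
    climb : ∀ j → Settled ⊎ (∃[ n ] (start M ≤ n × s₀ ⊕ # j ⊗ ε ⩽ s n))
    climb zero = inj₂ (start M , ℕ.≤-refl , ≡⇒⩽ (trans (cong (λ t → s₀ ⊕ t ⊗ ε) #0) (trans (cong (s₀ ⊕_) (ℚ.*-zeroˡ ε)) (⊕-identityʳ s₀))))
    climb (suc j) with climb j
    ... | inj₁ settled = inj₁ settled
    ... | inj₂ (k , k₀≤k , p) with em {∃[ n ] (k ≤ n × s k ⊕ ε ≺ s n)}
    ... | yes (n , k≤n , q) = inj₂ (n , ℕ.≤-trans k₀≤k k≤n , ⩽-trans (≡⇒⩽ (trans (cong (λ t → s₀ ⊕ t ⊗ ε) (#-suc j)) (solve 3 (λ a j e → a :+ (con 1ℚ :+ j) :* e := a :+ j :* e :+ e) refl s₀ (# j) ε))) (⩽-trans (⊕-monoˡ ε p) (≺⇒⩽ q)))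
    ... | no ¬n = inj₁ (k , k₀≤k , λ n k≤n → ℚ.≮⇒≥ λ q → ¬n (n , k≤n , q))
    conclude : Settled ⊎ (∃[ n ] (start M ≤ n × s₀ ⊕ # J ⊗ ε ⩽ s n)) → ∃[ k ] (∀ m n → k ≤ m → k ≤ n → ∥ s m ⊖ s n ∥ ⩽ ε)
    conclude (inj₁ (k , k₀≤k , p)) = k , λ m n k≤m k≤n → by-bounds (⩽-trans (p m k≤m) (⊕-monoˡ ε (monotone M k₀≤k k≤n))) (⩽-trans (p n k≤n) (⊕-monoˡ ε (monotone M k₀≤k k≤m)))
    conclude (inj₂ (n , k₀≤n , p)) = ⊥-elim (≺⇒⋡ exceeds (⩽-trans p (bounded M k₀≤n)))
      where
      open ℚ.≤-Reasoning
      x = (bound M ⊖ s₀) ⊗ invℚ ε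
      exceeds : bound M ≺ s₀ ⊕ # J ⊗ ε
      exceeds = begin-strict
        bound M                         ≡⟨ solve 2 (λ a b → b := a :+ (b :- a)) refl s₀ (bound M) ⟩
        s₀ ⊕ (bound M ⊖ s₀)             ≡⟨ cong (s₀ ⊕_) (trans (sym (ℚ.*-identityʳ (bound M ⊖ s₀))) (trans (cong ((bound M ⊖ s₀) ⊗_) (sym (trans (ℚ.*-comm (invℚ ε) ε) (invℚ-inverseʳ 0<ε)))) (sym (ℚ.*-assoc (bound M ⊖ s₀) (invℚ ε) ε)))) ⟩
        s₀ ⊕ x ⊗ ε                      <⟨ ℚ.+-monoʳ-< s₀ (ℚ.*-monoˡ-<-pos ε {{ℚ.positive 0<ε}} (ℚ.≤-<-trans (proj₂ (archimedes x)) (#-≺ ℕ.≤-refl))) ⟩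
        s₀ ⊕ # J ⊗ ε                    ∎

  seq-limit : ∀ {s} → IsCauchy s → ∀ n → seq (limit s) n ≡ s n
  seq-limit {s} c n with em {IsCauchy s}
  ... | yes _ = refl
  ... | no ¬c = ⊥-elim (¬c c)

  -- For a nonnegative upper bound the default value 0 is harmless. The quotient and the product in
  -- the level condition are bounded by this case distinction.
  seq-limit-or-0 : ∀ s n → seq (limit s) n ≡ s n ⊎ seq (limit s) n ≡ 0ℚ
  seq-limit-or-0 s n with em {IsCauchy s}
  ... | yes _ = inj₁ refl
  ... | no _  = inj₂ refl

  seq-+ : ∀ x y n → seq (x +ℝ y) n ≡ seq x n ⊕ seq y n
  seq-+ x y = seq-limit (cauchy-⊕ (seq x) (seq y) (cauchy x) (cauchy y))

  seq-- : ∀ x y n → seq (x -ℝ y) n ≡ seq x n ⊖ seq y n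
  seq-- x y = seq-limit (cauchy-⊖ (seq x) (seq y) (cauchy x) (cauchy y))

  seq-⊔ : ∀ x y n → seq (x ⊔ℝ y) n ≡ seq x n ℚ.⊔ seq y n
  seq-⊔ x y = seq-limit (cauchy-⊔ (seq x) (seq y) (cauchy x) (cauchy y))

  seq-∣∣ : ∀ x n → seq ∣ x ∣ℝ n ≡ ∥ seq x n ∥
  seq-∣∣ x = seq-limit (cauchy-∥∥ (seq x) (cauchy x))

  seq-sumℝ : ∀ {A : Set} (F : A → ℝ) xs n → seq (sumℝ (map F xs)) n ≡ ∑ₗ xs (λ x → seq (F x) n)
  seq-sumℝ F [] n = refl
  seq-sumℝ F (x ∷ xs) n = trans (seq-+ (F x) (sumℝ (map F xs)) n) (cong (seq (F x) n ⊕_) (seq-sumℝ F xs n))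

  seq-maxℝ-nonneg : ∀ xs n → 0ℚ ⩽ seq (maxℝ xs) n
  seq-maxℝ-nonneg [] n = ⩽-refl
  seq-maxℝ-nonneg (x ∷ xs) n = ⩽-trans (⩽-trans (seq-maxℝ-nonneg xs n) (ℚ.p≤q⊔p (seq x n) (seq (maxℝ xs) n))) (≡⇒⩽ (sym (seq-⊔ x (maxℝ xs) n)))

  seq-maxℝ-≥ : ∀ {A : Set} (F : A → ℝ) {xs x} → x ∈ xs → ∀ n → seq (F x) n ⩽ seq (maxℝ (map F xs)) n
  seq-maxℝ-≥ F {x ∷ xs} (here refl) n = ⩽-trans (ℚ.p≤p⊔q (seq (F x) n) (seq (maxℝ (map F xs)) n)) (≡⇒⩽ (sym (seq-⊔ (F x) (maxℝ (map F xs)) n)))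
  seq-maxℝ-≥ F {y ∷ xs} (there x∈) n = ⩽-trans (⩽-trans (seq-maxℝ-≥ F x∈ n) (ℚ.p≤q⊔p (seq (F y) n) (seq (maxℝ (map F xs)) n))) (≡⇒⩽ (sym (seq-⊔ (F y) (maxℝ (map F xs)) n)))

  seq-log : ∀ {p} → 0 < p → ∀ n → seq (log (ℕ→ℝ p)) n ≡ logo n (# p)
  seq-log {p} 0<p n = trans (seq-limit (cauchy-cong (λ n → sym (pointwise n)) (monotone-cauchy M)) n) (pointwise n)
    where
    pointwise : ∀ n → logPartial n (ℕ→ℚ p) ≡ logo n (# p)
    pointwise n = trans (logPartial≡ n (ℕ→ℚ p)) (cong (logo n) (sym (#-unfold p)))
    M : MonotoneBounded (λ n → logo n (# p))
    M .start = 0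
    M .monotone _ m≤n = logo-mono m≤n (1≤# 0<p) ⩽-refl
    M .bound = H p
    M .bounded {n} _ = logo≤H n p 0<p

  -- The exponent is represented by a constant sequence, so the argument of the exponential series
  -- increases with the index, and the power is the limit of a monotone bounded sequence.
  module _ {N : ℕ} (0<N : 0 < N) {c : ℚ} (0≤c : 0ℚ ⩽ c) {a : ℝ} (a≡c : ∀ n → seq a n ≡ c) where

    power-seq : ℕ → ℚ
    power-seq n = expo n (c ⊗ logo n (# N))

    private
      0≤c⊗ : ∀ n → 0ℚ ⩽ c ⊗ logo n (# N)
      0≤c⊗ n = ⊗-nonneg 0≤c (logo-nonneg n (1≤# 0<N))
      Y = proj₁ (archimedes (c ⊗ H N))
      mul : MonotoneBounded (λ n → c ⊗ logo n (# N))
      mul .start = 0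
      mul .monotone _ m≤n = ⊗-monoˡ c 0≤c (logo-mono m≤n (1≤# 0<N) ⩽-refl)
      mul .bound = c ⊗ H N
      mul .bounded {n} _ = ⊗-monoˡ c 0≤c (logo≤H n N 0<N)
      mul≡ : ∀ n → seq a n ⊗ seq (log (ℕ→ℝ N)) n ≡ c ⊗ logo n (# N)
      mul≡ n = cong₂ _⊗_ (a≡c n) (seq-log 0<N n)
      seq-mul : ∀ n → seq (a *ℝ log (ℕ→ℝ N)) n ≡ c ⊗ logo n (# N)
      seq-mul n = trans (seq-limit (cauchy-cong (λ n → sym (mul≡ n)) (monotone-cauchy mul)) n) (mul≡ n)
      exp≡ : ∀ n → expPartial n (seq (a *ℝ log (ℕ→ℝ N)) n) ≡ power-seq n
      exp≡ n = trans (expPartial≡ n (seq (a *ℝ log (ℕ→ℝ N)) n)) (cong (expo n) (seq-mul n))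

    power-monotone : MonotoneBounded power-seq
    power-monotone .start = 0
    power-monotone .monotone {m} {n} _ m≤n = expo-mono m≤n (0≤c⊗ m) (⊗-monoˡ c 0≤c (logo-mono m≤n (1≤# 0<N) ⩽-refl))
    power-monotone .bound = # (2 ℕ.^ (Y * 2))
    power-monotone .bounded {n} _ = expo-bounded Y (0≤c⊗ n) (⩽-trans (⊗-monoˡ c 0≤c (logo≤H n N 0<N)) (proj₂ (archimedes (c ⊗ H N)))) n

    seq-power : ∀ n → seq (ℕ→ℝ N ^ℝ a) n ≡ power-seq n
    seq-power n = trans (seq-limit (cauchy-cong (λ n → sym (exp≡ n)) (monotone-cauchy power-monotone)) n) (exp≡ n)

  -- The level condition speaks only of integers Q that are floors, so one must be produced. The
  -- search descends from K + 1, which exceeds x, to the first integer that is at most x.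
  floor : ∀ x → (∀ {m n} → m ≤ n → seq x m ⩽ seq x n) → 0ℚ ⩽ seq x 0 → ∃[ K ] (∀ n → seq x n ⩽ # K) → ∃[ Q ] IsFloor x Q
  floor x mono 0≤x (K , x≤K) = search (suc K) λ le → impossible le
    where
    ≤ℝ-0 : ℕ→ℝ 0 ≤ℝ x
    ≤ℝ-0 ε 0<ε = 0 , λ n _ → ⩽-trans (≡⇒⩽ (trans (sym (#-unfold 0)) #0)) (⊕-nonneg (⩽-trans 0≤x (mono z≤n)) (≺⇒⩽ 0<ε))
    impossible : ¬ (ℕ→ℝ (suc K) ≤ℝ x)
    impossible le with le (⅟ 2) (⅟-pos {2} (s≤s z≤n))
    ... | k , p = ≺⇒⋡ (ℚ.<-≤-trans (ℚ.+-mono-<-≤ 1/2<1 (⩽-refl {# K})) (≡⇒⩽ (sym (#-suc K)))) (⩽-trans (≡⇒⩽ (#-unfold (suc K))) (⩽-trans (p k ℕ.≤-refl) (⩽-trans (⊕-monoˡ (⅟ 2) (x≤K k)) (≡⇒⩽ (ℚ.+-comm (# K) (⅟ 2))))))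
      where
      1/2<1 : ⅟ 2 ≺ 1ℚ
      1/2<1 = ℚ.≰⇒> λ 1≤ → ≺⇒⋡ (#-≺ {1} {2} ℕ.≤-refl) (⩽-trans (≡⇒⩽ (sym (ℚ.*-identityʳ (# 2)))) (⩽-trans (⊗-monoˡ (# 2) (#-nonneg 2) 1≤) (≡⇒⩽ (trans (⅟-inverse {2} (s≤s z≤n)) (sym #1)))))
    -- The negation yields an ε for which the gap to Q + 1 recurs at arbitrarily late indices. As
    -- the sequence increases, a gap at a late index is a gap at every earlier one.
    below : ∀ Q → ¬ (ℕ→ℝ (suc Q) ≤ℝ x) → x <ℝ ℕ→ℝ (suc Q)
    below Q ¬le with em {∃[ ε ] (0ℚ ≺ ε × (∀ k → ∃[ n ] (k ≤ n × seq x n ⊕ ε ⩽ ℕ→ℚ (suc Q))))}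
    ... | yes (ε , 0<ε , p) = ε , 0<ε , 0 , λ n _ → ⩽-trans (⊕-monoˡ ε (mono (proj₁ (proj₂ (p n))))) (proj₂ (proj₂ (p n)))
    ... | no ¬p = ⊥-elim (¬le λ ε 0<ε → decide ε 0<ε)
      where
      decide : ∀ ε → 0ℚ ≺ ε → ∃[ k ] (∀ n → k ≤ n → ℕ→ℚ (suc Q) ⩽ seq x n ⊕ ε)
      decide ε 0<ε with em {∃[ k ] (∀ n → k ≤ n → ℕ→ℚ (suc Q) ⩽ seq x n ⊕ ε)}
      ... | yes q = q
      ... | no ¬q = ⊥-elim (¬p (ε , 0<ε , λ k → later k))
        where
        later : ∀ k → ∃[ n ] (k ≤ n × seq x n ⊕ ε ⩽ ℕ→ℚ (suc Q))
        later k with em {∃[ n ] (k ≤ n × seq x n ⊕ ε ⩽ ℕ→ℚ (suc Q))}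
        ... | yes r = r
        ... | no ¬r = ⊥-elim (¬q (k , λ n k≤n → ≺⇒⩽ (ℚ.≰⇒> λ le → ¬r (n , k≤n , le))))
    search : ∀ K → ¬ (ℕ→ℝ K ≤ℝ x) → ∃[ Q ] IsFloor x Q
    search zero ¬le = ⊥-elim (¬le ≤ℝ-0)
    search (suc K) ¬le with em {ℕ→ℝ K ≤ℝ x}
    ... | yes le = K , le , below K ¬le
    ... | no ¬le′ = search K ¬le′

-- From a level of distribution to rational bounds

∑ₗ-[1⋯] : ∀ n f → ∑ₗ [1⋯ n ] f ≡ ∑ n f
∑ₗ-[1⋯] zero f = refl
∑ₗ-[1⋯] (suc n) f = trans (cong (λ xs → ∑ₗ xs f) ([1⋯suc] n)) (trans (∑ₗ-++ [1⋯ n ] (suc n ∷ []) f) (cong₂ _⊕_ (∑ₗ-[1⋯] n f) (⊕-identityʳ (f (suc n)))))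

nat-floor : ∀ {x} → 0ℚ ⩽ x → ∃[ m ] (# m ⩽ x × x ⩽ # (suc m))
nat-floor {x} 0≤x = search (proj₁ (archimedes x)) (⩽-trans (proj₂ (archimedes x)) (#-mono (ℕ.n≤1+n (proj₁ (archimedes x)))))
  where
  search : ∀ M → x ⩽ # (suc M) → ∃[ m ] (# m ⩽ x × x ⩽ # (suc m))
  search zero    x≤ = 0 , ⩽-trans (≡⇒⩽ #0) 0≤x , x≤
  search (suc M) x≤ with ℚ.≤-total (# (suc M)) x
  ... | inj₁ ≤x = suc M , ≤x , x≤
  ... | inj₂ ≥x = search M ≥x

#2 : # 2 ≡ 1ℚ ⊕ 1ℚ
#2 = trans (#-suc 1) (cong (1ℚ ⊕_) #1)

module LevelBounds (em : ExcludedMiddle 0ℓ) where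

  open Classical em
  open Reals em
  open MonotoneBounded

  -- The denominator (log N)^A with A = 1 + 2 A₀, compared with (m + 1)^A₀ for m = ⌊H N - 2⌋.
  module Denominator (A₀ : ℕ) {N : ℕ} (67≤H : # 67 ⩽ H N) where

    private
      two = 1ℚ ⊕ 1ℚ
      0<N : 0 < N
      0<N = ℕ.≤-trans (s≤s z≤n) (#-cancel {67} (⩽-trans 67≤H (H≤# N)))
      -- The threshold 67 is 2 more than 65, which makes m at least 64 = 2^6. By the doubling bound
      -- this gives H m ≥ 4.
      65≤ : # 65 ⩽ H N ⊖ two
      65≤ = ⩽-trans (≡⇒⩽ (trans (solve 2 (λ a t → a := a :+ t :- t) refl (# 65) two) (cong (_⊖ two) (trans (cong (# 65 ⊕_) (sym #2)) (sym (#-+ 65 2)))))) (⊕-monoˡ (⊝ two) 67≤H)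
      fl = nat-floor (⩽-trans (#-nonneg 65) 65≤)

    m : ℕ
    m = proj₁ fl

    private
      m≤ : # m ⩽ H N ⊖ two
      m≤ = proj₁ (proj₂ fl)
      64≤m : 64 ≤ m
      64≤m = ℕ.s≤s⁻¹ (#-cancel {65} {suc m} (⩽-trans 65≤ (proj₂ (proj₂ fl))))
      0<m : 0 < m
      0<m = ℕ.≤-trans (s≤s z≤n) 64≤m
      4≤Hm : # 4 ⩽ H m
      4≤Hm = ⩽-trans (⊗-cancelˡ (# 2) (#-pos {2} (s≤s z≤n)) (⩽-trans (≡⇒⩽ (sym (#-* 2 4))) (H-2^ 6))) (H-mono 64≤m)
      k₀ = proj₁ (logo-eventually N 0<N)
      m≤log : ∀ {n} → k₀ ≤ n → # m ⩽ logo n (# N)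
      m≤log k₀≤n = ⩽-trans m≤ (proj₂ (logo-eventually N 0<N) _ k₀≤n)
      1≤log : ∀ {n} → k₀ ≤ n → 1ℚ ⩽ logo n (# N)
      1≤log k₀≤n = ⩽-trans (1≤# 0<m) (m≤log k₀≤n)

    -- The iterated logarithm is at least H m - 2, which is at least half of H m as H m ≥ 4. Twice
    -- A₀ is therefore enough to reach exp (A₀ H m) ≥ (m + 1)^A₀; adding 1 keeps the exponent
    -- positive when A₀ = 0.
    α : ℕ
    α = suc (2 * A₀)

    loglog D : ℕ → ℚ
    loglog n = logo n (logo n (# N))
    D n = expo n (# α ⊗ loglog n)

    private
      0≤loglog : ∀ {n} → k₀ ≤ n → 0ℚ ⩽ loglog n
      0≤loglog {n} k₀≤n = logo-nonneg n (1≤log k₀≤n)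
      loglog-monotone : MonotoneBounded loglog
      loglog-monotone .start = k₀
      loglog-monotone .monotone {m} {n} k₀≤m m≤n = logo-mono m≤n (1≤log k₀≤m) (logo-mono m≤n (1≤# 0<N) ⩽-refl)
      loglog-monotone .bound = H N
      loglog-monotone .bounded {n} k₀≤n = ⩽-trans (logo-mono {n} {n} ℕ.≤-refl (1≤log k₀≤n) (⩽-trans (logo≤H n N 0<N) (H≤# N))) (logo≤H n N 0<N)
      0≤arg : ∀ {n} → k₀ ≤ n → 0ℚ ⩽ # α ⊗ loglog n
      0≤arg k₀≤n = ⊗-nonneg (#-nonneg α) (0≤loglog k₀≤n)
      arg-monotone : MonotoneBounded (λ n → # α ⊗ loglog n)
      arg-monotone .start = k₀
      arg-monotone .monotone k₀≤m m≤n = ⊗-monoˡ (# α) (#-nonneg α) (monotone loglog-monotone k₀≤m m≤n)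
      arg-monotone .bound = # α ⊗ H N
      arg-monotone .bounded k₀≤n = ⊗-monoˡ (# α) (#-nonneg α) (bounded loglog-monotone k₀≤n)
      Y = proj₁ (archimedes (# α ⊗ H N))
      D-monotone : MonotoneBounded D
      D-monotone .start = k₀
      D-monotone .monotone k₀≤m m≤n = expo-mono m≤n (0≤arg k₀≤m) (monotone arg-monotone k₀≤m m≤n)
      D-monotone .bound = # (2 ℕ.^ (Y * 2))
      D-monotone .bounded {n} k₀≤n = expo-bounded Y (0≤arg k₀≤n) (⩽-trans (bounded arg-monotone k₀≤n) (proj₂ (archimedes (# α ⊗ H N)))) n
      L = log (ℕ→ℝ N)
      seq-loglog : ∀ n → seq (log L) n ≡ loglog n
      seq-loglog n = trans (seq-limit (cauchy-cong (λ n → sym (pointwise n)) (monotone-cauchy loglog-monotone)) n) (pointwise n)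
        where
        pointwise : ∀ n → logPartial n (seq L n) ≡ loglog n
        pointwise n = trans (logPartial≡ n (seq L n)) (cong (logo n) (seq-log 0<N n))
      seq-arg : ∀ n → seq (ℕ→ℝ α *ℝ log L) n ≡ # α ⊗ loglog n
      seq-arg n = trans (seq-limit (cauchy-cong (λ n → sym (pointwise n)) (monotone-cauchy arg-monotone)) n) (pointwise n)
        where
        pointwise : ∀ n → ℕ→ℚ α ⊗ seq (log L) n ≡ # α ⊗ loglog n
        pointwise n = cong₂ _⊗_ (sym (#-unfold α)) (seq-loglog n)

    seq-D : ∀ n → seq (L ^ℝ ℕ→ℝ α) n ≡ D n
    seq-D n = trans (seq-limit (cauchy-cong (λ n → sym (pointwise n)) (monotone-cauchy D-monotone)) n) (pointwise n)
      where
      pointwise : ∀ n → expPartial n (seq (ℕ→ℝ α *ℝ log L) n) ≡ D n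
      pointwise n = trans (expPartial≡ n (seq (ℕ→ℝ α *ℝ log L) n)) (cong (expo n) (seq-arg n))

    D-≥ : ∃[ k ] (∀ n → k ≤ n → (# (suc m)) ^ℚ A₀ ⩽ D n)
    D-≥ = k₀ + (k₁ + A₀ * m) , λ n k≤n → below n (ℕ.m+n≤o⇒m≤o k₀ k≤n) (ℕ.m+n≤o⇒m≤o k₁ (ℕ.m+n≤o⇒n≤o k₀ k≤n)) (ℕ.m+n≤o⇒n≤o k₁ (ℕ.m+n≤o⇒n≤o k₀ k≤n))
      where
      open ℚ.≤-Reasoning
      k₁ = proj₁ (logo-eventually m 0<m)
      h = H m
      4≡ : # 4 ≡ two ⊕ two
      4≡ = trans (#-+ 2 2) (cong₂ _⊕_ #2 #2)
      compare : ∀ n → k₀ ≤ n → k₁ ≤ n → # A₀ ⊗ h ⩽ # α ⊗ loglog n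
      compare n k₀≤n k₁≤n = begin
        # A₀ ⊗ h
          ≤⟨ by-excess (# A₀ ⊗ (h ⊖ # 4)) (⊗-nonneg (#-nonneg A₀) (x≤y⇒0≤y-x 4≤Hm)) (trans (cong (λ t → # A₀ ⊗ h ⊕ # A₀ ⊗ (h ⊖ t)) 4≡)
               (solve 2 (λ a h → a :* h :+ a :* (h :- (con 1ℚ :+ con 1ℚ :+ (con 1ℚ :+ con 1ℚ))) := (con 1ℚ :+ con 1ℚ) :* a :* (h :- (con 1ℚ :+ con 1ℚ))) refl (# A₀) h)) ⟩
        two ⊗ # A₀ ⊗ (h ⊖ two)
          ≡⟨ cong (λ t → t ⊗ # A₀ ⊗ (h ⊖ two)) (sym #2) ⟩
        # 2 ⊗ # A₀ ⊗ (h ⊖ two)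
          ≡⟨ cong (_⊗ (h ⊖ two)) (sym (#-* 2 A₀)) ⟩
        # (2 * A₀) ⊗ (h ⊖ two)
          ≤⟨ ⊗-mono (#-nonneg (2 * A₀)) (#-mono (ℕ.n≤1+n (2 * A₀))) (x≤y⇒0≤y-x (⩽-trans (⩽-trans (≡⇒⩽ (sym #2)) (#-mono (s≤s (s≤s z≤n)))) 4≤Hm))
               (⩽-trans (proj₂ (logo-eventually m 0<m) n k₁≤n) (logo-mono {n} {n} ℕ.≤-refl (1≤# 0<m) (m≤log k₀≤n))) ⟩
        # α ⊗ loglog n ∎
      below : ∀ n → k₀ ≤ n → k₁ ≤ n → A₀ * m ≤ n → (# (suc m)) ^ℚ A₀ ⩽ D n
      below n k₀≤n k₁≤n A₀m≤n = ⩽-trans (expo-power m A₀) (expo-mono A₀m≤n (⊗-nonneg (#-nonneg A₀) (H-nonneg m)) (compare n k₀≤n k₁≤n))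

    H-≤ : H N ^ℚ A₀ ⩽ (# 3) ^ℚ A₀ ⊗ (# (suc m)) ^ℚ A₀
    H-≤ = ⩽-trans (^ℚ-mono (H-nonneg N) H≤ A₀) (≡⇒⩽ (^ℚ-⊗ (# 3) (# (suc m)) A₀))
      where
      open ℚ.≤-Reasoning
      x = # (suc m)
      H≤ : H N ⩽ # 3 ⊗ x
      H≤ = begin
        H N                 ≡⟨ solve 2 (λ h t → h := h :- t :+ t) refl (H N) two ⟩
        H N ⊖ two ⊕ two     ≤⟨ ⊕-mono (proj₂ (proj₂ fl)) (⊕-mono (1≤# {suc m} (s≤s z≤n)) (1≤# {suc m} (s≤s z≤n))) ⟩
        x ⊕ (x ⊕ x)         ≡⟨ solve 1 (λ x → x :+ (x :+ x) := (con 1ℚ :+ (con 1ℚ :+ con 1ℚ)) :* x) refl x ⟩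
        (1ℚ ⊕ two) ⊗ x      ≡⟨ cong (_⊗ x) (sym (trans (#-suc 2) (cong (1ℚ ⊕_) #2))) ⟩
        # 3 ⊗ x             ∎

  -- Taking ε as the termwise difference of ϑ and c makes the exponent ϑ - ε equal to c at every
  -- index. The integer Q₀ lies below N^c, hence below its floor, and the sum up to the floor is
  -- bounded by hypothesis. The saving is expressed in powers of H N instead of the logarithm.
  level-bound : ∀ {E ϑ} → (∀ N q n → 0ℚ ⩽ seq (E N q) n) → HasLevel E ϑ → ∀ {c} → 0ℚ ⩽ c → ℚ→ℝ c <ℝ ϑ → ∀ A₀ →
    ∃[ C ] (0ℚ ⩽ C × (∀ N Q₀ → # 67 ⩽ H N → ∃[ k ] (∀ n → k ≤ n → # Q₀ ⩽ expo n (c ⊗ logo n (# N))) →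
      ∃[ k ] (∀ n → k ≤ n → H N ^ℚ A₀ ⊗ ∑ Q₀ (λ q → seq (E N q) n) ⩽ C ⊗ # N)))
  level-bound {E} {ϑ} E-nonneg level {c} 0≤c (δ , 0<δ , k₁ , c+δ≤) A₀ = # K ⊗ t ⊕ 1ℚ , ⊕-nonneg (⊗-nonneg (#-nonneg K) 0≤t) 0≤1 , at
    where
    ε : ℝ
    ε = mkℝ (λ n → seq ϑ n ⊖ c) (cauchy-⊖ (seq ϑ) (λ _ → c) (cauchy ϑ) (cauchy-const c))
    0<ε : 0ℝ <ℝ ε
    0<ε = δ , 0<δ , k₁ , λ n k₁≤n → ⩽-trans (≡⇒⩽ (solve 2 (λ c d → con 0ℚ :+ d := c :+ d :- c) refl c δ)) (⊕-monoˡ (⊝ c) (c+δ≤ n k₁≤n))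
    A : ℝ
    A = ℕ→ℝ (suc (2 * A₀))
    0<A : 0ℝ <ℝ A
    0<A = 1ℚ , 0<1 , 0 , λ n _ → ⩽-trans (≡⇒⩽ (⊕-identityˡ 1ℚ)) (⩽-trans (1≤# {suc (2 * A₀)} (s≤s z≤n)) (≡⇒⩽ (#-unfold (suc (2 * A₀)))))
    Cʳ = proj₁ (level ε A 0<ε 0<A)
    bounded-C = cauchy-bounded (cauchy Cʳ)
    K = proj₁ bounded-C
    t = (# 3) ^ℚ A₀
    0≤t : 0ℚ ⩽ t
    0≤t = ^ℚ-nonneg (#-nonneg 3) A₀
    a = ϑ -ℝ ε
    a≡c : ∀ n → seq a n ≡ c
    a≡c n = trans (seq-- ϑ ε n) (solve 2 (λ t c → t :- (t :- c) := c) refl (seq ϑ n) c)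
    at : ∀ N Q₀ → # 67 ⩽ H N → ∃[ k ] (∀ n → k ≤ n → # Q₀ ⩽ expo n (c ⊗ logo n (# N))) →
      ∃[ k ] (∀ n → k ≤ n → H N ^ℚ A₀ ⊗ ∑ Q₀ (λ q → seq (E N q) n) ⩽ (# K ⊗ t ⊕ 1ℚ) ⊗ # N)
    at N Q₀ 67≤H (k₂ , Q₀≤) = k₃ + (k₄ + k₅) , λ n k≤n → final n (ℕ.m+n≤o⇒m≤o k₃ k≤n) (ℕ.m+n≤o⇒m≤o k₄ (ℕ.m+n≤o⇒n≤o k₃ k≤n)) (ℕ.m+n≤o⇒n≤o k₄ (ℕ.m+n≤o⇒n≤o k₃ k≤n))
      where
      open Denominator A₀ {N} 67≤H
      67≤N : 67 ≤ N
      67≤N = #-cancel {67} (⩽-trans 67≤H (H≤# N))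
      0<N : 0 < N
      0<N = ℕ.≤-trans (s≤s z≤n) 67≤N
      X = ℕ→ℝ N ^ℝ a
      seq-X : ∀ n → seq X n ≡ power-seq 0<N 0≤c {a} a≡c n
      seq-X = seq-power 0<N 0≤c {a} a≡c
      M = power-monotone 0<N 0≤c {a} a≡c
      fl = floor X (λ {m} {n} m≤n → ⩽-trans (≡⇒⩽ (seq-X m)) (⩽-trans (monotone M {m} {n} z≤n m≤n) (≡⇒⩽ (sym (seq-X n)))))
             (⩽-trans (expo-nonneg 0 (⊗-nonneg 0≤c (logo-nonneg 0 (1≤# 0<N)))) (≡⇒⩽ (sym (seq-X 0))))
             (proj₁ (archimedes (bound M)) , λ n → ⩽-trans (≡⇒⩽ (seq-X n)) (⩽-trans (bounded M {n} z≤n) (proj₂ (archimedes (bound M)))))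
      Q = proj₁ fl
      Q₀≤Q : Q₀ ≤ Q
      Q₀≤Q = below-floor (proj₂ (proj₂ fl))
        where
        below-floor : X <ℝ ℕ→ℝ (suc Q) → Q₀ ≤ Q
        below-floor (e , 0<e , k , below) = ℕ.≮⇒≥ λ Q<Q₀ → ≺⇒⋡ strict (#-mono Q<Q₀)
          where
          j = k₂ + k
          strict : # Q₀ ≺ # (suc Q)
          strict = ℚ.≤-<-trans (⩽-trans (Q₀≤ j (ℕ.m≤m+n k₂ k)) (≡⇒⩽ (sym (seq-X j))))
            (ℚ.<-≤-trans (ℚ.≤-<-trans (≡⇒⩽ (sym (⊕-identityʳ (seq X j)))) (ℚ.+-monoʳ-< (seq X j) 0<e)) (⩽-trans (below j (ℕ.m≤n+m k k₂)) (≡⇒⩽ (sym (#-unfold (suc Q))))))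
      h = H N ^ℚ A₀
      0<h : 0ℚ ≺ h
      0<h = ^ℚ-pos (ℚ.<-≤-trans (#-pos {67} (s≤s z≤n)) 67≤H) A₀
      -- The tolerance in the order of reals is chosen so that it becomes 1 ≤ N after multiplication
      -- by h. This accounts for the summand 1 in the constant.
      e = invℚ h
      L = log (ℕ→ℝ N)
      q = ℕ→ℝ N /ℝ (L ^ℝ A)
      inequality : sumℝ (map (E N) [1⋯ Q ]) ≤ℝ Cʳ *ℝ q
      inequality = proj₂ (level ε A 0<ε 0<A) N Q (ℕ.≤-trans (s≤s (s≤s z≤n)) 67≤N) (proj₂ fl)
      k₃ = proj₁ (inequality e (invℚ-pos 0<h))
      k₄ = proj₁ D-≥
      k₅ = proj₁ (proj₂ bounded-C)
      P = (# (suc m)) ^ℚ A₀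
      0<P : 0ℚ ≺ P
      0<P = ^ℚ-pos (#-pos {suc m} (s≤s z≤n)) A₀
      y = # N ⊗ invℚ P
      0≤y : 0ℚ ⩽ y
      0≤y = ⊗-nonneg (#-nonneg N) (≺⇒⩽ (invℚ-pos 0<P))
      q-bounds : ∀ n → k₄ ≤ n → 0ℚ ⩽ seq q n × seq q n ⩽ y
      q-bounds n k₄≤n = Sum.[ nonzero , (λ q≡0 → ≡⇒⩽ (sym q≡0) , ⩽-trans (≡⇒⩽ q≡0) 0≤y) ]′ (seq-limit-or-0 (λ n → ℕ→ℚ N ⊗ invℚ (seq (L ^ℝ A) n)) n)
        where
        P≤ : P ⩽ D n
        P≤ = proj₂ D-≥ n k₄≤n
        nonzero : seq q n ≡ ℕ→ℚ N ⊗ invℚ (seq (L ^ℝ A) n) → 0ℚ ⩽ seq q n × seq q n ⩽ y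
        nonzero q≡ = ⩽-trans (⊗-nonneg (#-nonneg N) (≺⇒⩽ (invℚ-pos (ℚ.<-≤-trans 0<P P≤)))) (≡⇒⩽ (sym q≡′)) , ⩽-trans (≡⇒⩽ q≡′) (⊗-monoˡ (# N) (#-nonneg N) (invℚ-anti 0<P P≤))
          where
          q≡′ : seq q n ≡ # N ⊗ invℚ (D n)
          q≡′ = trans q≡ (cong₂ (λ x y → x ⊗ invℚ y) (sym (#-unfold N)) (seq-D n))
      rhs : ∀ n → k₄ ≤ n → k₅ ≤ n → seq (Cʳ *ℝ q) n ⩽ # K ⊗ y
      rhs n k₄≤n k₅≤n = Sum.[ nonzero , (λ ≡0 → ⩽-trans (≡⇒⩽ ≡0) (⊗-nonneg (#-nonneg K) 0≤y)) ]′ (seq-limit-or-0 (λ n → seq Cʳ n ⊗ seq q n) n)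
        where
        nonzero : seq (Cʳ *ℝ q) n ≡ seq Cʳ n ⊗ seq q n → seq (Cʳ *ℝ q) n ⩽ # K ⊗ y
        nonzero ≡C = ⩽-trans (≡⇒⩽ ≡C) (⩽-trans (⊗-monoʳ (seq q n) (proj₁ (q-bounds n k₄≤n)) (⩽-trans (x≤∥x∥ (seq Cʳ n)) (proj₂ (proj₂ bounded-C) n k₅≤n))) (⊗-monoˡ (# K) (#-nonneg K) (proj₂ (q-bounds n k₄≤n))))
      final : ∀ n → k₃ ≤ n → k₄ ≤ n → k₅ ≤ n → h ⊗ ∑ Q₀ (λ q → seq (E N q) n) ⩽ (# K ⊗ t ⊕ 1ℚ) ⊗ # N
      final n k₃≤n k₄≤n k₅≤n = begin
        h ⊗ ∑ Q₀ F                          ≤⟨ ⊗-monoˡ h (≺⇒⩽ 0<h) (∑-≤-ext Q₀≤Q λ q _ _ → E-nonneg N q n) ⟩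
        h ⊗ ∑ Q F                           ≡⟨ cong (h ⊗_) (trans (sym (∑ₗ-[1⋯] Q F)) (sym (seq-sumℝ (E N) [1⋯ Q ] n))) ⟩
        h ⊗ seq (sumℝ (map (E N) [1⋯ Q ])) n ≤⟨ ⊗-monoˡ h (≺⇒⩽ 0<h) (⩽-trans (proj₂ (inequality e (invℚ-pos 0<h)) n k₃≤n) (⊕-monoˡ e (rhs n k₄≤n k₅≤n))) ⟩
        h ⊗ (# K ⊗ y ⊕ e)                   ≡⟨ trans (ℚ.*-distribˡ-+ h (# K ⊗ y) e) (cong (h ⊗ (# K ⊗ y) ⊕_) (invℚ-inverseʳ 0<h)) ⟩
        h ⊗ (# K ⊗ y) ⊕ 1ℚ                  ≤⟨ ⊕-mono (⊗-monoʳ (# K ⊗ y) (⊗-nonneg (#-nonneg K) 0≤y) H-≤) (1≤# 0<N) ⟩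
        t ⊗ P ⊗ (# K ⊗ y) ⊕ # N             ≡⟨ cong (_⊕ # N) (solve 5 (λ t P K n i → t :* P :* (K :* (n :* i)) := K :* t :* n :* (P :* i)) refl t P (# K) (# N) (invℚ P)) ⟩
        # K ⊗ t ⊗ # N ⊗ (P ⊗ invℚ P) ⊕ # N  ≡⟨ cong (λ z → # K ⊗ t ⊗ # N ⊗ z ⊕ # N) (invℚ-inverseʳ 0<P) ⟩
        # K ⊗ t ⊗ # N ⊗ 1ℚ ⊕ # N            ≡⟨ solve 2 (λ x n → x :* n :* con 1ℚ :+ n := (x :+ con 1ℚ) :* n) refl (# K ⊗ t) (# N) ⟩
        (# K ⊗ t ⊕ 1ℚ) ⊗ # N                ∎
        where
        open ℚ.≤-Reasoning
        F : ℕ → ℚ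
        F q = seq (E N q) n

H-^-≥ : ∀ {T} → 0 < T → ∀ b → # b ⊗ (H T ⊖ 1ℚ) ⩽ H (T ℕ.^ b)
H-^-≥ {T} 0<T zero = ⩽-trans (≡⇒⩽ (trans (cong (_⊗ (H T ⊖ 1ℚ)) #0) (ℚ.*-zeroˡ (H T ⊖ 1ℚ)))) (H-nonneg 1)
H-^-≥ {T} 0<T (suc b) = begin
  # (suc b) ⊗ x                 ≡⟨ trans (cong (_⊗ x) (#-suc b)) (solve 2 (λ b h → (con 1ℚ :+ b) :* (h :- con 1ℚ) := h :+ (b :* (h :- con 1ℚ) :- con 1ℚ)) refl (# b) (H T)) ⟩
  H T ⊕ (# b ⊗ x ⊖ 1ℚ)          ≤⟨ ⊕-monoʳ (H T) (⊕-monoˡ (⊝ 1ℚ) (H-^-≥ 0<T b)) ⟩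
  H T ⊕ (H (T ℕ.^ b) ⊖ 1ℚ)      ≤⟨ H-*-≥ T 0<T (T ℕ.^ b) (^-pos 0<T b) ⟩
  H (T ℕ.^ suc b)               ∎
  where
  open ℚ.≤-Reasoning
  x = H T ⊖ 1ℚ

-- (T^b)^c = T^(j+1), and the factor T absorbs the distance between H and log.
power-reached : ∀ {T} → 0 < T → ∀ {b c j} → 0 < b → 0ℚ ⩽ c → # b ⊗ c ≡ # (suc j) → # (3 * suc j) ⩽ H T →
  ∃[ k ] (∀ n → k ≤ n → # (T ℕ.^ j) ⩽ expo n (c ⊗ logo n (# (T ℕ.^ b))))
power-reached {T} 0<T {b} {c} {j} 0<b 0≤c bc≡ large = k + j * T , λ n le → ⩽-trans T^j≤ (expo-mono (ℕ.m+n≤o⇒n≤o k le) (⊗-nonneg (#-nonneg j) (H-nonneg T)) (compare n (ℕ.m+n≤o⇒m≤o k le)))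
  where
  open ℚ.≤-Reasoning
  N = T ℕ.^ b
  ev = logo-eventually N (^-pos 0<T b)
  k = proj₁ ev
  h = H T
  J = # (suc j)
  two = 1ℚ ⊕ 1ℚ
  T^j≤ : # (T ℕ.^ j) ⩽ expo (j * T) (# j ⊗ H T)
  T^j≤ = ⩽-trans (≡⇒⩽ (#-^ T j)) (⩽-trans (^ℚ-mono (#-nonneg T) (#-mono (ℕ.n≤1+n T)) j) (expo-power T j))
  c≤J : c ⩽ J
  c≤J = ⩽-trans (≡⇒⩽ (sym (ℚ.*-identityˡ c))) (⩽-trans (⊗-monoʳ c 0≤c (1≤# 0<b)) (≡⇒⩽ bc≡))
  3J≤ : (two ⊕ 1ℚ) ⊗ J ⩽ h
  3J≤ = ⩽-trans (≡⇒⩽ (trans (cong (_⊗ J) (trans (ℚ.+-comm two 1ℚ) (sym (trans (#-suc 2) (cong (1ℚ ⊕_) #2))))) (sym (#-* 3 (suc j))))) large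
  compare : ∀ n → k ≤ n → # j ⊗ h ⩽ c ⊗ logo n (# N)
  compare n k≤n = begin
    # j ⊗ h
      ≤⟨ by-excess (h ⊖ (two ⊕ 1ℚ) ⊗ J) (x≤y⇒0≤y-x 3J≤) (trans (cong (λ t → # j ⊗ h ⊕ (h ⊖ (two ⊕ 1ℚ) ⊗ t)) (#-suc j)) (trans
           (solve 2 (λ j h → j :* h :+ (h :- (con 1ℚ :+ con 1ℚ :+ con 1ℚ) :* (con 1ℚ :+ j)) := (con 1ℚ :+ j) :* (h :- con 1ℚ) :- (con 1ℚ :+ j) :* (con 1ℚ :+ con 1ℚ)) refl (# j) h)
           (cong (λ t → t ⊗ (h ⊖ 1ℚ) ⊖ t ⊗ two) (sym (#-suc j))))) ⟩
    J ⊗ (h ⊖ 1ℚ) ⊖ J ⊗ two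
      ≤⟨ ⊕-monoʳ (J ⊗ (h ⊖ 1ℚ)) (ℚ.neg-antimono-≤ (⊗-monoʳ two (⊕-nonneg 0≤1 0≤1) c≤J)) ⟩
    J ⊗ (h ⊖ 1ℚ) ⊖ c ⊗ two
      ≡⟨ cong (λ t → t ⊗ (h ⊖ 1ℚ) ⊖ c ⊗ two) (sym bc≡) ⟩
    # b ⊗ c ⊗ (h ⊖ 1ℚ) ⊖ c ⊗ two
      ≡⟨ solve 4 (λ b c x t → b :* c :* x :- c :* t := c :* (b :* x :- t)) refl (# b) c (h ⊖ 1ℚ) two ⟩
    c ⊗ (# b ⊗ (h ⊖ 1ℚ) ⊖ two)
      ≤⟨ ⊗-monoˡ c 0≤c (⩽-trans (⊕-monoˡ (⊝ two) (H-^-≥ 0<T b)) (proj₂ ev n k≤n)) ⟩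
    c ⊗ logo n (# N) ∎

-- The Liouville function and exclusion of primes

fromℤ : ℤ → ℚ
fromℤ (ℤ.+ n)    = # n
fromℤ -[1+ n ] = ⊝ # (suc n)

fromℤ-⊖ : ∀ m n → fromℤ (m ℤ.⊖ n) ≡ # m ⊖ # n
fromℤ-⊖ m n with ℕ.≤-total n m
... | inj₁ n≤m = trans (cong fromℤ (ℤ.⊖-≥ n≤m)) (#-∸ n≤m)
... | inj₂ m≤n = trans (cong fromℤ (ℤ.⊖-≤ m≤n)) (trans (negate (n ℕ.∸ m)) (trans (cong ⊝_ (#-∸ m≤n)) (solve 2 (λ m n → :- (n :- m) := m :- n) refl (# m) (# n))))
  where
  negate : ∀ k → fromℤ (ℤ.- (ℤ.+ k)) ≡ ⊝ # k
  negate zero    = trans #0 (cong ⊝_ (sym #0))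
  negate (suc k) = refl

fromℤ-+ : ∀ i j → fromℤ (i ℤ.+ j) ≡ fromℤ i ⊕ fromℤ j
fromℤ-+ (ℤ.+ m)    (ℤ.+ n)    = #-+ m n
fromℤ-+ (ℤ.+ m)    -[1+ n ] = fromℤ-⊖ m (suc n)
fromℤ-+ -[1+ m ] (ℤ.+ n)    = trans (fromℤ-⊖ n (suc m)) (ℚ.+-comm (# n) (⊝ # (suc m)))
fromℤ-+ -[1+ m ] -[1+ n ] = trans (cong ⊝_ (trans (cong #_ (sym (ℕ.+-suc (suc m) n))) (#-+ (suc m) (suc n)))) (ℚ.neg-distrib-+ (# (suc m)) (# (suc n)))

∥fromℤ∥ : ∀ i → ∥ fromℤ i ∥ ≡ # ℤ.∣ i ∣
∥fromℤ∥ (ℤ.+ n)    = ℚ.0≤p⇒∣p∣≡p (#-nonneg n)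
∥fromℤ∥ -[1+ n ] = trans (ℚ.∣-p∣≡∣p∣ (# (suc n))) (ℚ.0≤p⇒∣p∣≡p (#-nonneg (suc n)))

fromℤ-sum : ∀ (f : ℕ → ℤ) xs → fromℤ (sumℤ (map f xs)) ≡ ∑ₗ xs (λ x → fromℤ (f x))
fromℤ-sum f []       = #0
fromℤ-sum f (x ∷ xs) = trans (fromℤ-+ (f x) (sumℤ (map f xs))) (cong (fromℤ (f x) ⊕_) (fromℤ-sum f xs))

sign : ∀ k → -1ℤ ℤ.^ k ≡ 1ℤ ⊎ -1ℤ ℤ.^ k ≡ -1ℤ
sign zero    = inj₁ refl
sign (suc k) = Sum.swap (Sum.map (cong (-1ℤ ℤ.*_)) (cong (-1ℤ ℤ.*_)) (sign k))

λ′-sign : ∀ n → λ′ n ≡ 1ℤ ⊎ λ′ n ≡ -1ℤ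
λ′-sign n = sign (Ω n)

λ′-prime : ∀ {p} → Prime p → λ′ p ≡ -1ℤ
λ′-prime {zero} pp = ⊥-elim (¬prime[0] pp)
λ′-prime {p@(suc _)} pp = cong (-1ℤ ℤ.^_) (↭-length (factorisationUnique (factorise p) (primeFactorisation[p] pp)))

lam : ℕ → ℚ
lam n = fromℤ (λ′ n)

lam-cases : ∀ n → lam n ≡ 1ℚ ⊎ lam n ≡ ⊝ 1ℚ
lam-cases n = Sum.map (λ e → trans (cong fromℤ e) #1) (λ e → trans (cong fromℤ e) (cong ⊝_ #1)) (λ′-sign n)

∥lam∥≤1 : ∀ n → ∥ lam n ∥ ⩽ 1ℚ
∥lam∥≤1 n = Sum.[ (λ e → ≡⇒⩽ (cong ∥_∥ e)) , (λ e → ≡⇒⩽ (cong ∥_∥ e)) ]′ (lam-cases n)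

0≤1+lam : ∀ n → 0ℚ ⩽ 1ℚ ⊕ lam n
0≤1+lam n = Sum.[ (λ e → ⩽-trans (⊕-nonneg 0≤1 0≤1) (≡⇒⩽ (cong (1ℚ ⊕_) (sym e)))) , (λ e → ≡⇒⩽ (cong (1ℚ ⊕_) (sym e))) ]′ (lam-cases n)

≤maxℕ : ∀ {x xs} → x ∈ xs → x ≤ maxℕ xs
≤maxℕ {x} {_ ∷ xs} (here refl) = ℕ.m≤m⊔n x (maxℕ xs)
≤maxℕ {x} {y ∷ xs} (there x∈) = ℕ.≤-trans (≤maxℕ x∈) (ℕ.m≤n⊔m y (maxℕ xs))

∑ₗ-mono : ∀ {A : Set} {xs : List A} {f g} → All (λ x → f x ⩽ g x) xs → ∑ₗ xs f ⩽ ∑ₗ xs g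
∑ₗ-mono []       = ⩽-refl
∑ₗ-mono (e ∷ es) = ⊕-mono e (∑ₗ-mono es)

NoSignChange : (h′ m : ℕ) → Set
NoSignChange h′ m = ∀ {d p} → 0 < d → 2 ∣ d → d ≤ h′ → m < p → Prime p → λ′ (p + d) ≢ -1ℤ

module _ {h′ m : ℕ} (none : NoSignChange h′ m) {hs : List ℕ} (unique : Unique hs) (evens : All (λ h → 2 ∣ h × h < h′) hs) (even : 2 ∣ h′) where

  private
    gap : ∀ {h g} → 2 ∣ h → 2 ∣ g → h < g → g ≤ h′ → ∀ n → m < n + h → Prime (n + h) → λ′ (n + g) ≢ -1ℤ
    gap {h} {g} 2∣h 2∣g h<g g≤h′ n m< pp = subst (λ t → λ′ t ≢ -1ℤ) (trans (ℕ.+-assoc n h (g ℕ.∸ h)) (cong (n +_) (ℕ.m+[n∸m]≡n (ℕ.<⇒≤ h<g))))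
      (none (ℕ.m<n⇒0<n∸m h<g) (∣m+n∣m⇒∣n (subst (2 ∣_) (sym (ℕ.m+[n∸m]≡n (ℕ.<⇒≤ h<g))) 2∣g) 2∣h) (ℕ.≤-trans (ℕ.m∸n≤m g h) g≤h′) m< pp)

  exclusive-primes : ∀ {B N η} {ℓ : ℕ → ℚ} → m ≤ B → 0ℚ ⩽ η → (∀ n → 0 < n → n ≤ N → ℓ n ⩽ η) → ∀ n →
    # 2 ⊗ ∑ₗ hs (λ h → 𝟙 (prime? (n + h) ×-dec (B ℕ.<? n + h ×-dec n + h ℕ.≤? N)) ⊗ ℓ (n + h)) ⩽ η ⊗ (1ℚ ⊕ lam (n + h′))
  exclusive-primes {B} {N} {η} {ℓ} m≤B 0≤η ℓ≤η n = begin
    # 2 ⊗ ∑ₗ hs (λ h → 𝟙 (P? h) ⊗ ℓ (n + h))   ≤⟨ ⊗-monoˡ (# 2) (#-nonneg 2) (∑ₗ-mono {xs = hs} (All.tabulate λ {h} _ → termwise h (P? h))) ⟩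
    # 2 ⊗ ∑ₗ hs (λ h → 𝟙 (P? h) ⊗ η)           ≡⟨ cong (# 2 ⊗_) (trans (∑ₗ-⊗ η hs (λ h → 𝟙 (P? h))) (cong (_⊗ η) (sym (any-sum P? unique same)))) ⟩
    # 2 ⊗ (𝟙 (any? P? hs) ⊗ η)                 ≡⟨ solve 3 (λ t x e → t :* (x :* e) := e :* (t :* x)) refl (# 2) (𝟙 (any? P? hs)) η ⟩
    η ⊗ (# 2 ⊗ 𝟙 (any? P? hs))                 ≤⟨ ⊗-monoˡ η 0≤η (decide (any? P? hs)) ⟩
    η ⊗ (1ℚ ⊕ lam (n + h′))                    ∎
    where
    open ℚ.≤-Reasoning
    P : ℕ → Set
    P h = Prime (n + h) × B < n + h × n + h ≤ N
    P? : ∀ h → Dec (P h)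
    P? h = prime? (n + h) ×-dec (B ℕ.<? n + h ×-dec n + h ℕ.≤? N)
    termwise : ∀ h (d : Dec (P h)) → 𝟙 d ⊗ ℓ (n + h) ⩽ 𝟙 d ⊗ η
    termwise h (yes (_ , B< , ≤N)) = ⊗-monoˡ 1ℚ 0≤1 (ℓ≤η (n + h) (ℕ.≤-<-trans z≤n B<) ≤N)
    termwise h (no _) = ≡⇒⩽ (trans (ℚ.*-zeroˡ (ℓ (n + h))) (sym (ℚ.*-zeroˡ η)))
    ordered : ∀ {h g} → h ∈ hs → g ∈ hs → P h → P g → ¬ (h < g)
    ordered h∈ g∈ (p , B< , _) (p′ , _) h<g = gap (proj₁ (All.lookup evens h∈)) (proj₁ (All.lookup evens g∈)) h<g (ℕ.<⇒≤ (proj₂ (All.lookup evens g∈))) n (ℕ.≤-<-trans m≤B B<) p (λ′-prime p′)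
    same : ∀ {h g} → h ∈ hs → g ∈ hs → P h → P g → h ≡ g
    same h∈ g∈ p q = ℕ.≤-antisym (ℕ.≮⇒≥ (ordered g∈ h∈ q p)) (ℕ.≮⇒≥ (ordered h∈ g∈ p q))
    decide : (d : Dec (Any P hs)) → # 2 ⊗ 𝟙 d ⩽ 1ℚ ⊕ lam (n + h′)
    decide (no _) = ⩽-trans (≡⇒⩽ (ℚ.*-zeroʳ (# 2))) (0≤1+lam (n + h′))
    decide (yes a) = witness (find a)
      where
      witness : ∃[ h ] (h ∈ hs × P h) → # 2 ⊗ 1ℚ ⩽ 1ℚ ⊕ lam (n + h′)
      witness (h , h∈ , pp , B< , _) = Sum.[ (λ e → ≡⇒⩽ (trans (ℚ.*-identityʳ (# 2)) (trans #2 (cong (1ℚ ⊕_) (sym (trans (cong fromℤ e) #1)))))) ,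
        (λ e → ⊥-elim (gap (proj₁ (All.lookup evens h∈)) even (proj₂ (All.lookup evens h∈)) ℕ.≤-refl n (ℕ.≤-<-trans m≤B B<) pp e)) ]′ (λ′-sign (n + h′))

-- Conditions (A) and (B) at one index, and the final assembly

module Distribution (em : ExcludedMiddle 0ℓ) where

  open Classical em
  open Reals em

  errorA-nonneg : ∀ N q n → 0ℚ ⩽ seq (errorA N q) n
  errorA-nonneg N q n = seq-maxℝ-nonneg (map (λ a → ∣ ϑ-sum N q a -ℝ ℕ→ℝ N /ℝ ℕ→ℝ (φ q) ∣ℝ) (filter (λ a → gcd a q ℕ.≟ 1) (upTo q))) n

  errorB-nonneg : ∀ N q n → 0ℚ ⩽ seq (errorB N q) n
  errorB-nonneg N q n = ⩽-trans (#-nonneg M) (≡⇒⩽ (#-unfold M))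
    where M = maxℕ (map (λ y → maxℕ (map (λ a → ℤ.∣ λ-sum y q a ∣) (upTo q))) [1⋯ N ])

  -- Maximum, sum and absolute value of reals act index by index, so the value of the error at index
  -- n dominates that of each reduced class at the same index.
  errorA-≥ : ∀ N q a n → a < q → gcd a q ≡ 1 →
    ∥ ∑ N (λ i → 𝟙 (prime? i ×-dec (i ≡? a [mod q ])) ⊗ logo n (# i)) ⊖ # N ⊗ ⅟ (φ q) ∥ ⩽ seq (errorA N q) n
  errorA-≥ N q a n a<q gcd≡1 = ⩽-trans (≡⇒⩽ (sym value)) (seq-maxℝ-≥ F (∈-filter⁺ (λ a → gcd a q ℕ.≟ 1) (∈-upTo⁺ a<q) gcd≡1) n)
    where
    P? : ∀ p → Dec (Prime p × p ≡ a [mod q ])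
    P? p = prime? p ×-dec (p ≡? a [mod q ])
    F : ℕ → ℝ
    F a = ∣ ϑ-sum N q a -ℝ ℕ→ℝ N /ℝ ℕ→ℝ (φ q) ∣ℝ
    main = ℕ→ℝ N /ℝ ℕ→ℝ (φ q)
    seq-main : seq main n ≡ # N ⊗ ⅟ (φ q)
    seq-main = trans (seq-limit (cauchy-const (ℕ→ℚ N ⊗ invℚ (ℕ→ℚ (φ q)))) n) (cong₂ _⊗_ (sym (#-unfold N)) (invℚ-ℕ (φ q)))
    seq-ϑ : seq (ϑ-sum N q a) n ≡ ∑ N (λ i → 𝟙 (P? i) ⊗ logo n (# i))
    seq-ϑ = trans (seq-sumℝ (λ p → log (ℕ→ℝ p)) (filter P? [1⋯ N ]) n) (trans (∑ₗ-filter P? N (λ p → seq (log (ℕ→ℝ p)) n)) (∑-cong N λ i 0<i _ → cong (𝟙 (P? i) ⊗_) (seq-log 0<i n)))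
    value : seq (F a) n ≡ ∥ ∑ N (λ i → 𝟙 (P? i) ⊗ logo n (# i)) ⊖ # N ⊗ ⅟ (φ q) ∥
    value = trans (seq-∣∣ (ϑ-sum N q a -ℝ main) n) (cong ∥_∥ (trans (seq-- (ϑ-sum N q a) main n) (cong₂ _⊖_ seq-ϑ seq-main)))

  errorB-≥ : ∀ N q a n → 0 < N → a < q → ∥ ∑ N (λ i → 𝟙 (i ≡? a [mod q ]) ⊗ lam i) ∥ ⩽ seq (errorB N q) n
  errorB-≥ N@(suc N-1) q a n _ a<q = begin
    ∥ ∑ N (λ i → 𝟙 (i ≡? a [mod q ]) ⊗ lam i) ∥      ≡⟨ cong ∥_∥ (trans (sym (∑ₗ-filter (λ i → i ≡? a [mod q ]) N lam)) (sym (fromℤ-sum λ′ (filter (λ i → i ≡? a [mod q ]) [1⋯ N ])))) ⟩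
    ∥ fromℤ (λ-sum N q a) ∥                          ≡⟨ ∥fromℤ∥ (λ-sum N q a) ⟩
    # ℤ.∣ λ-sum N q a ∣                              ≤⟨ #-mono (ℕ.≤-trans (≤maxℕ (∈-map⁺ (λ a → ℤ.∣ λ-sum N q a ∣) (∈-upTo⁺ a<q))) (≤maxℕ (∈-map⁺ M (∈-map⁺ suc (∈-upTo⁺ {N} {N-1} ℕ.≤-refl))))) ⟩
    # maxℕ (map M [1⋯ N ])                           ≡⟨ #-unfold (maxℕ (map M [1⋯ N ])) ⟩
    seq (errorB N q) n                               ∎
    where
    open ℚ.≤-Reasoning
    M : ℕ → ℕ
    M y = maxℕ (map (λ a → ℤ.∣ λ-sum y q a ∣) (upTo q))

  inputs-at : ∀ {W B N} → 0 < N → ℕ → Inputs W B N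
  inputs-at {N = N} 0<N n = record
    { ℓ = λ p → logo n (# p)
    ; e₁ = λ q → seq (errorA N q) n
    ; e₂ = λ q → seq (errorB N q) n
    ; lam = lam
    ; e₁-nonneg = λ q → errorA-nonneg N q n
    ; e₂-nonneg = λ q → errorB-nonneg N q n
    ; ℓ-nonneg = λ p 0<p _ → logo-nonneg n (1≤# 0<p)
    ; ℓ≤H = λ p 0<p p≤N → ⩽-trans (logo≤H n p 0<p) (H-mono p≤N)
    ; lam≤1 = ∥lam∥≤1
    ; primes-equidistributed = λ q a a<q cop → errorA-≥ N q a n a<q cop
    ; lam-equidistributed = λ q a a<q → errorB-≥ N q a n 0<N a<q
    }

module Assembly (em : ExcludedMiddle 0ℓ)
  {k₁ : ℕ} {hs : List ℕ} (tuple : Tuple k₁ hs) (h′ : ℕ) (h′≤16 : h′ ≤ 16) (evens : All (λ h → 2 ∣ h × h < h′) hs) (even : 2 ∣ h′)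
  (w : ℕ) (15≤w : 15 ≤ w) (2k≤w : suc k₁ + suc k₁ ≤ w) (w-large : 2 * (suc k₁ * suc k₁) * 4000 ≤ w)
  (i b : ℕ) (ds : List ℕ) (len : length ds ≡ suc i)
  (b-large : 50 * (suc k₁ * suc k₁) + (2 * suc k₁ + 2) + (2 * suc k₁ + 1) + 2 + (1 + (suc i + suc i)) ≤ b)
  (certificate : 1001 * (b * repeat (suc k₁) tails (squares (tails ds)) ‼ 0) ≤ 2000 * suc k₁ * repeat k₁ tails⁺ (squares (tails⁺ (tails ds))) ‼ 0)
  (nonzero : 0 < repeat (suc k₁) tails (squares (tails ds)) ‼ 0)
  (c : ℚ) (0≤c : 0ℚ ⩽ c) (bc≡ : # b ⊗ c ≡ # (2 + (suc i + suc i))) where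

  open Classical em
  open Distribution em
  open LevelBounds em
  open Contradiction tuple h′ h′≤16 w 15≤w 2k≤w w-large i b ds len b-large certificate nonzero

  private
    0<W : 0 < W
    0<W = ℕ.<-trans (s≤s z≤n) (1<modulus w)
    0<b : 0 < b
    0<b = ℕ.<-≤-trans (s≤s z≤n) (ℕ.≤-trans (ℕ.m≤n+m (1 + (suc i + suc i)) (A₀ + 2)) b-large)

  sign-change : ∀ ϑ → ℚ→ℝ c <ℝ ϑ → ConditionA ϑ → ConditionB ϑ → ∀ m → ¬ NoSignChange h′ m
  sign-change ϑ c<ϑ condA condB m none = impossible (⊕-nonneg 0≤Ca 0≤Cb) s₀ hyps
    where
    boundA = level-bound {errorA} {ϑ} errorA-nonneg condA 0≤c c<ϑ A₀
    boundB = level-bound {errorB} {ϑ} errorB-nonneg condB 0≤c c<ϑ A₀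
    Ca = proj₁ boundA
    Cb = proj₁ boundB
    0≤Ca = proj₁ (proj₂ boundA)
    0≤Cb = proj₁ (proj₂ boundB)
    -- The first summand meets the threshold of `Denominator`, the second the one of
    -- `power-reached`.
    L = 67 + 3 * (2 + (suc i + suc i))
    large = H-unbounded (# L)
    s₀ = m + proj₁ large
    hyps : ∀ s → s₀ ≤ s → 0 < s → Hypotheses (Ca ⊕ Cb) s
    hyps s s₀≤s 0<s = record
      { inputs = inputs-at 0<N n
      ; ∑e₁≤ = ⩽-trans (proj₂ (proj₂ (proj₂ boundA) N Q₀ 67≤H reached) n (ℕ.m≤m+n kA kB)) (⊗-monoʳ {Ca} {Ca ⊕ Cb} (# N) (#-nonneg N) (≤⊕ʳ 0≤Cb))
      ; ∑e₂≤ = ⩽-trans (proj₂ (proj₂ (proj₂ boundB) N Q₀ 67≤H reached) n (ℕ.m≤n+m kB kA)) (⊗-monoʳ {Cb} {Ca ⊕ Cb} (# N) (#-nonneg N) (≤⊕ˡ 0≤Ca))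
      ; exclusive = λ j _ _ → exclusive-primes none (Tuple.distinct tuple) evens even m≤B (H-nonneg N) (λ p 0<p p≤N → ⩽-trans (logo≤H n p 0<p) (H-mono p≤N)) j
      }
      where
      open At s
      0<T : 0 < T
      0<T = *-pos 0<W 0<s
      0<N : 0 < N
      0<N = ^-pos 0<T b
      s≤T : s ≤ T
      s≤T = m≤p*m s 0<W
      T≤^ : ∀ j → 0 < j → T ≤ T ℕ.^ j
      T≤^ (suc j) _ = ℕ.≤-trans (m≤p*m T (^-pos 0<T j)) (ℕ.≤-reflexive (ℕ.*-comm (T ℕ.^ j) T))
      m≤B : m ≤ R * R
      m≤B = ℕ.≤-trans (ℕ.m+n≤o⇒m≤o m s₀≤s) (ℕ.≤-trans s≤T (ℕ.≤-trans (T≤^ (suc i) (s≤s z≤n)) (m≤p*m R (^-pos 0<T (suc i)))))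
      L≤H : # L ⩽ H T
      L≤H = ⩽-trans (proj₂ (proj₂ large)) (H-mono (ℕ.≤-trans (ℕ.m+n≤o⇒n≤o m s₀≤s) s≤T))
      67≤H : # 67 ⩽ H N
      67≤H = ⩽-trans (⩽-trans (#-mono (ℕ.m≤m+n 67 (3 * (2 + (suc i + suc i))))) L≤H) (H-mono (T≤^ b 0<b))
      Q₀ = W * (R * R)
      Q₀≤ : Q₀ ≤ T ℕ.^ (1 + (suc i + suc i))
      Q₀≤ = ℕ.≤-trans (ℕ.*-monoˡ-≤ (R * R) (ℕ.≤-trans (m≤p*m W 0<s) (ℕ.≤-reflexive (ℕ.*-comm s W)))) (ℕ.≤-reflexive (cong (T *_) (sym (ℕ.^-distribˡ-+-* T (suc i) (suc i)))))
      reached₀ = power-reached 0<T {b} {c} {1 + (suc i + suc i)} 0<b 0≤c bc≡ (⩽-trans (#-mono (ℕ.m≤n+m (3 * (2 + (suc i + suc i))) 67)) L≤H)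
      reached : ∃[ k ] (∀ n → k ≤ n → # Q₀ ⩽ expo n (c ⊗ logo n (# N)))
      reached = proj₁ reached₀ , λ n k≤n → ⩽-trans (#-mono Q₀≤) (proj₂ reached₀ n k≤n)
      kA = proj₁ (proj₂ (proj₂ boundA) N Q₀ 67≤H reached)
      kB = proj₁ (proj₂ (proj₂ boundB) N Q₀ 67≤H reached)
      -- A common index at which the bounds from (A) and from (B) both hold; all rational data of
      -- the sieve are read off there. It may depend on N, while the constants do not.
      n = kA + kB

-- The tails of this list are the values of i² (10 + m x + q x²) at x = 1, 1 - 1/i, …, 0.  The coefficients
-- m and q below come from a numerical optimisation of the certificate.
differences : (i m q : ℕ) → List ℕ
differences i m q = go i
  module Differences where
  go : ℕ → List ℕ
  go zero    = 10 * i * i ∷ []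
  go (suc j) = m * i + q * (2 * j + 1) ∷ go j

length-differences : ∀ i m q → length (differences i m q) ≡ suc i
length-differences i m q = length-go i
  where
  open Differences i m q
  length-go : ∀ j → length (go j) ≡ suc j
  length-go zero    = refl
  length-go (suc j) = cong suc (length-go j)

Admissible? : ∀ h → Dec (AdmissibleShift h)
Admissible? h = h ℕ.≤? 199 ×-dec (gcd (199 ℕ.∸ h) 210 ℕ.≟ 1 ×-dec h + 2 ∣? 210 * (210 * 210))

tuple : ∀ k₁ hs → length hs ≡ suc k₁ → True (unique? hs) → True (All.all? (ℕ._≤? 14) hs) → True (All.all? Admissible? hs) →
  True (All.all? (λ h → length (others hs h) ℕ.≟ k₁) hs) → Tuple k₁ hs
tuple k₁ hs size distinct small admissible size-rest = record
  { size = size ; distinct = toWitness distinct ; small = toWitness small ; admissible = toWitness admissible ; size-rest = toWitness size-rest }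

SignChanges : (em : ExcludedMiddle 0ℓ) → ℚ → ℕ → Set
SignChanges em ϑ₀ h′ = ∀ ϑ → ℚ→ℝ ϑ₀ <ℝ ϑ → Classical.ConditionA em ϑ → Classical.ConditionB em ϑ → ∀ m → ¬ NoSignChange h′ m

-- The numbers in the certificates are huge, so the Boolean comparison is evaluated instead of
-- supplying an inductive proof of the inequality.
computed-≤ : ∀ {m n} → (m ℕ.≤ᵇ n) ≡ true → m ≤ n
computed-≤ {m} {n} e = ℕ.≤ᵇ⇒≤ m n (subst Bool.T (sym e) tt)

evens? : ∀ h′ hs → Dec (All (λ h → 2 ∣ h × h < h′) hs)
evens? h′ = All.all? (λ h → 2 ∣? h ×-dec h ℕ.<? h′)

module _ (em : ExcludedMiddle 0ℓ) where

  private
    certified : ∀ k₁ hs (size : length hs ≡ suc k₁) (distinct : True (unique? hs)) (small : True (All.all? (ℕ._≤? 14) hs)) (admissible : True (All.all? Admissible? hs))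
      (size-rest : True (All.all? (λ h → length (others hs h) ℕ.≟ k₁) hs))
      h′ → (h′ ℕ.≤ᵇ 16) ≡ true → True (evens? h′ hs) → ∀ g → h′ ≡ g * 2 → ∀ i m q →
      let ds = differences i m q ; k = suc k₁ in
      (50 * (k * k) + (2 * k + 2) + (2 * k + 1) + 2 + (1 + (suc i + suc i)) ℕ.≤ᵇ 20000) ≡ true →
      (1001 * (20000 * repeat k tails (squares (tails ds)) ‼ 0) ℕ.≤ᵇ 2000 * k * repeat k₁ tails⁺ (squares (tails⁺ (tails ds))) ‼ 0) ≡ true →
      (1 ℕ.≤ᵇ repeat k tails (squares (tails ds)) ‼ 0) ≡ true →
      ∀ c → 0ℚ ⩽ c → ℕ→ℚ 20000 ⊗ c ≡ ℕ→ℚ (2 + (suc i + suc i)) → (k ℕ.≤ᵇ 5) ≡ true → SignChanges em c h′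
    certified k₁ hs size distinct small admissible size-rest h′ h′≤16 evens g even i m q b-large certificate nonzero c 0≤c bc≡ k≤5 =
      Assembly.sign-change em (tuple k₁ hs size distinct small admissible size-rest) h′ (computed-≤ h′≤16) (toWitness evens) (divides g even)
        -- One w serves all four tuples: k ≤ 5 gives 2 k² 4000 ≤ 200000.
        200000 (computed-≤ refl) (ℕ.≤-trans (ℕ.+-mono-≤ k≤ k≤) (computed-≤ refl)) (ℕ.*-monoˡ-≤ 4000 (ℕ.*-monoʳ-≤ 2 (ℕ.*-mono-≤ k≤ k≤)))
        i 20000 (differences i m q) (length-differences i m q) (computed-≤ b-large) (computed-≤ certificate) (computed-≤ nonzero) c 0≤c
        (trans (cong (_⊗ c) (#-unfold 20000)) (trans bc≡ (sym (#-unfold (2 + (suc i + suc i))))))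
      where
      k≤ : suc k₁ ≤ 5
      k≤ = computed-≤ k≤5

  -- With b = 20000 the number of steps is fixed by 20000 ϑ₀ = 2 i + 4, which gives 7288 here. The
  -- final two numbers describe the polynomial 10 + 12 x; for the longer tuples a quadratic term is
  -- added.
  sign-changes-4 : SignChanges em (ℤ.+ 729 ℚ./ 1000) 4
  sign-changes-4 = certified 1 (0 ∷ 2 ∷ []) refl tt tt tt tt 4 refl tt 2 refl 7288 12 0 refl refl refl (ℤ.+ 729 ℚ./ 1000) (ℚ.nonNegative⁻¹ (ℤ.+ 729 ℚ./ 1000)) refl refl

  sign-changes-8 : SignChanges em (ℤ.+ 616 ℚ./ 1000) 8
  sign-changes-8 = certified 2 (0 ∷ 2 ∷ 6 ∷ []) refl tt tt tt tt 8 refl tt 4 refl 6158 24 4 refl refl refl (ℤ.+ 616 ℚ./ 1000) (ℚ.nonNegative⁻¹ (ℤ.+ 616 ℚ./ 1000)) refl refl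

  sign-changes-10 : SignChanges em (ℤ.+ 554 ℚ./ 1000) 10
  sign-changes-10 = certified 3 (0 ∷ 2 ∷ 6 ∷ 8 ∷ []) refl tt tt tt tt 10 refl tt 5 refl 5538 32 24 refl refl refl (ℤ.+ 554 ℚ./ 1000) (ℚ.nonNegative⁻¹ (ℤ.+ 554 ℚ./ 1000)) refl refl

  sign-changes-14 : SignChanges em (ℤ.+ 515 ℚ./ 1000) 14
  sign-changes-14 = certified 4 (0 ∷ 2 ∷ 6 ∷ 8 ∷ 12 ∷ []) refl tt tt tt tt 14 refl tt 7 refl 5148 44 44 refl refl refl (ℤ.+ 515 ℚ./ 1000) (ℚ.nonNegative⁻¹ (ℤ.+ 515 ℚ./ 1000)) refl refl

  sign-changes : ∀ {ϑ₀ D} → (ϑ₀ , D) ∈ admissiblePairs → SignChanges em ϑ₀ (D + 2)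
  sign-changes (here refl)                         = sign-changes-4
  sign-changes (there (here refl))                 = sign-changes-8
  sign-changes (there (there (here refl)))         = sign-changes-10
  sign-changes (there (there (there (here refl)))) = sign-changes-14

  finitely-many : ∀ {P : ℕ → Set} → ¬ InfinitelyMany P → ∃[ m ] (∀ n → m < n → ¬ P n)
  finitely-many {P} ¬inf with em {∃[ m ] (∀ n → m < n → ¬ P n)}
  ... | yes bound = bound
  ... | no ¬bound = ⊥-elim (¬inf λ m → later m)
    where
    later : ∀ m → ∃[ n ] (m < n × P n)
    later m with em {∃[ n ] (m < n × P n)}
    ... | yes found = found
    ... | no ¬found = ⊥-elim (¬bound (m , λ n m<n p → ¬found (n , m<n , p)))

theorem7 : (em : ExcludedMiddle 0ℓ) →
    ∀ (ϑ₀ : ℚ) (D : ℕ) → (ϑ₀ , D) ∈ admissiblePairs →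
    ∀ (ϑ : ℝ) → ℚ→ℝ ϑ₀ <ℝ ϑ →
    Classical.ConditionA em ϑ → Classical.ConditionB em ϑ →
    ∃[ d ] (0 < d × 2 ∣ d × d ≤ D + 2 ×
    InfinitelyMany (λ p → Prime p × λ′ (p + d) ≡ -1ℤ))
theorem7 em ϑ₀ D pair ϑ ϑ₀<ϑ condA condB = decide em
  where
  P : ℕ → ℕ → Set
  P d p = Prime p × λ′ (p + d) ≡ -1ℤ
  Goal : Set
  Goal = ∃[ d ] (0 < d × 2 ∣ d × d ≤ D + 2 × InfinitelyMany (P d))
  decide : Dec Goal → Goal
  decide (yes goal) = goal
  decide (no ¬goal) = ⊥-elim (sign-changes em pair ϑ ϑ₀<ϑ condA condB m none)
    where
    -- The conditions on d are part of the predicate, so that its solutions are not infinite in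
    -- number for any d, admissible or not. A threshold then exists for all d up to D + 2, and m is
    -- their maximum.
    Q : ℕ → ℕ → Set
    Q d p = 0 < d × 2 ∣ d × d ≤ D + 2 × P d p
    finite : ∀ d → ¬ InfinitelyMany (Q d)
    finite d inf with inf 0
    ... | _ , _ , 0<d , 2∣d , d≤ , _ = ¬goal (d , 0<d , 2∣d , d≤ , λ m → proj₁ (inf m) , proj₁ (proj₂ (inf m)) , proj₂ (proj₂ (proj₂ (proj₂ (proj₂ (inf m))))))
    threshold : ℕ → ℕ
    threshold d = proj₁ (finitely-many em (finite d))
    m = maxℕ (map threshold (upTo (suc (D + 2))))
    none : NoSignChange (D + 2) m
    none {d} {p} 0<d 2∣d d≤ m<p pp λ≡ = proj₂ (finitely-many em (finite d)) p (ℕ.≤-<-trans (≤maxℕ (∈-map⁺ threshold (∈-upTo⁺ (s≤s d≤)))) m<p) (0<d , 2∣d , d≤ , pp , λ≡)
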